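{- A finite simple graph $G$ is free-planar if and only if neither $K_5^-$ nor $K_{3,3}^-$ is a minor of $G$. In symbols, $Free(Planar) = N_{\circ}(K_5^-, K_{3,3}^-)$.
   Context: Graphs are finite and simple, considered up to isomorphism. $H$ is a minor of $G$, written $H \prec G$, if $H$ can be obtained from $G$ by vertex deletions, edge deletions and edge contractions (every graph is a minor of itself). For a set $B$ of graphs, $N_{\circ}(B) = \{G : H \not\prec G \text{ for all } H \in B\}$. $Planar$ is the class of planar graphs. A planar graph $G$ is called free-planar if for every pair $e$ of distinct non-adjacent vertices of $G$ the graph $G+e$, obtained by adding $e$ as an edge, is again planar; $Free(Planar)$ is the class of free-planar graphs. $K_5^-$ and $K_{3,3}^-$ are the graphs obtained from $K_5$ and $K_{3,3}$, respectively, by deleting one edge. -}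

module Defs where

open import Data.Bool.Base using (Bool; true; false)
import Data.Bool.Properties as Bool
open import Data.Fin.Base using (Fin; _<_; punchIn; splitAt)
open import Data.Fin using (#_)
import Data.Fin.Properties as Fin
open import Data.Nat.Base using (ℕ; suc; _+_)
open import Data.Product.Base using (∃-syntax; _×_; _,_)
open import Data.Rational.Base as ℚ using (ℚ; 0ℚ; 1ℚ)
open import Data.Sum.Base as Sum using (_⊎_; inj₁; inj₂; [_,_]′)
open import Function.Base using (_∘_; const)
open import Function.Bundles using (_↔_; _⇔_; Inverse)
open import Function.Definitions using (Injective)
open import Level using (Level; 0ℓ)
open import Relation.Binary.Core using (Rel)
open import Relation.Binary.Definitions using (Symmetric; Irreflexive; Decidable)
open import Relation.Binary.PropositionalEquality using (_≡_; _≢_; refl; sym; trans)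
open import Relation.Nullary.Decidable using (Dec; ¬?; _×-dec_; _⊎-dec_)
open import Relation.Nullary.Negation using (¬_)

record Graph (n : ℕ) : Set₁ where
  field
    Adj        : Rel (Fin n) 0ℓ
    adj?       : Decidable Adj
    adj-sym    : Symmetric Adj
    adj-irrefl : Irreflexive _≡_ Adj

open Graph public

GraphClass : (ℓ : Level) → Set _
GraphClass ℓ = ∀ {n} → Graph n → Set ℓ

infix 4 _≅_
record _≅_ {m n} (H : Graph m) (G : Graph n) : Set where
  field
    vertices  : Fin m ↔ Fin n
    adjacency : ∀ i j →
      Adj H i j ⇔ Adj G (Inverse.to vertices i) (Inverse.to vertices j)

-- Equality of the unordered pairs {x, y} and {u, v}.
SamePair : ∀ {n} (x y u v : Fin n) → Set
SamePair x y u v = (x ≡ u × y ≡ v) ⊎ (x ≡ v × y ≡ u)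

samePair? : ∀ {n} (x y u v : Fin n) → Dec (SamePair x y u v)
samePair? x y u v =
  (x Fin.≟ u ×-dec y Fin.≟ v) ⊎-dec (x Fin.≟ v ×-dec y Fin.≟ u)

samePair-swap : ∀ {n} {x y u v : Fin n} → SamePair x y u v → SamePair y x u v
samePair-swap (inj₁ (p , q)) = inj₂ (q , p)
samePair-swap (inj₂ (p , q)) = inj₁ (q , p)

samePair-diagonal : ∀ {n} {x u v : Fin n} → SamePair x x u v → u ≡ v
samePair-diagonal (inj₁ (p , q)) = trans (sym p) q
samePair-diagonal (inj₂ (p , q)) = trans (sym q) p

addEdge : ∀ {n} (G : Graph n) (u v : Fin n) → u ≢ v → Graph n
addEdge G u v u≢v = record
  { Adj        = λ x y → Adj G x y ⊎ SamePair x y u v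
  ; adj?       = λ x y → adj? G x y ⊎-dec samePair? x y u v
  ; adj-sym    = Sum.map (adj-sym G) samePair-swap
  ; adj-irrefl = λ { refl → [ adj-irrefl G refl , u≢v ∘ samePair-diagonal ]′ }
  }

deleteEdge : ∀ {n} (G : Graph n) (u v : Fin n) → Graph n
deleteEdge G u v = record
  { Adj        = λ x y → Adj G x y × ¬ SamePair x y u v
  ; adj?       = λ x y → adj? G x y ×-dec ¬? (samePair? x y u v)
  ; adj-sym    = λ (a , ¬p) → adj-sym G a , ¬p ∘ samePair-swap
  ; adj-irrefl = λ { refl (a , _) → adj-irrefl G refl a }
  }

-- punchIn v enumerates the vertices other than v.
deleteVertex : ∀ {n} (G : Graph (suc n)) (v : Fin (suc n)) → Graph n
deleteVertex G v = record
  { Adj        = λ i j → Adj G (punchIn v i) (punchIn v j)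
  ; adj?       = λ i j → adj? G (punchIn v i) (punchIn v j)
  ; adj-sym    = adj-sym G
  ; adj-irrefl = λ { refl → adj-irrefl G refl }
  }

-- Contraction of an edge uv: v disappears and u inherits its neighbours;
-- the loop and any parallel edges that arise are suppressed.
contractEdge : ∀ {n} (G : Graph (suc n)) (u v : Fin (suc n)) → Graph n
contractEdge {n} G u v = record
  { Adj        = λ i j → i ≢ j × Merged (punchIn v i) (punchIn v j)
  ; adj?       = λ i j → ¬? (i Fin.≟ j) ×-dec merged? (punchIn v i) (punchIn v j)
  ; adj-sym    = λ (i≢j , a) → i≢j ∘ sym , merged-sym a
  ; adj-irrefl = λ { refl (i≢i , _) → i≢i refl }
  }
  where
  Merged : Fin (suc n) → Fin (suc n) → Set
  Merged x y = Adj G x y ⊎ (x ≡ u × Adj G v y) ⊎ (y ≡ u × Adj G x v)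

  merged? : ∀ x y → Dec (Merged x y)
  merged? x y =
    adj? G x y ⊎-dec (x Fin.≟ u ×-dec adj? G v y) ⊎-dec (y Fin.≟ u ×-dec adj? G x v)

  merged-sym : ∀ {x y} → Merged x y → Merged y x
  merged-sym (inj₁ a)              = inj₁ (adj-sym G a)
  merged-sym (inj₂ (inj₁ (p , a))) = inj₂ (inj₂ (p , adj-sym G a))
  merged-sym (inj₂ (inj₂ (p , a))) = inj₂ (inj₁ (p , adj-sym G a))

infix 4 _≺_
data _≺_ {m} (H : Graph m) : GraphClass (Level.suc 0ℓ) where
  isomorphic : ∀ {n} {G : Graph n} → H ≅ G → H ≺ G
  delVertex  : ∀ {n} {G : Graph (suc n)} v → H ≺ deleteVertex G v → H ≺ G
  delEdge    : ∀ {n} {G : Graph n} u v → Adj G u v → H ≺ deleteEdge G u v → H ≺ G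
  contract   : ∀ {n} {G : Graph (suc n)} u v → Adj G u v → H ≺ contractEdge G u v → H ≺ G

-- The class whose members, up to isomorphism, are H₁ and H₂.
｛_,_｝ : ∀ {m n} → Graph m → Graph n → GraphClass 0ℓ
｛ H₁ , H₂ ｝ G = G ≅ H₁ ⊎ G ≅ H₂

N∘ : ∀ {ℓ} → GraphClass ℓ → GraphClass _
N∘ B G = ∀ {m} (H : Graph m) → B H → ¬ H ≺ G

Free : ∀ {ℓ} → GraphClass ℓ → GraphClass ℓ
Free C G = C G × (∀ u v (u≢v : u ≢ v) → ¬ Adj G u v → C (addEdge G u v u≢v))

complete : ∀ n → Graph n
complete n = record
  { Adj        = _≢_
  ; adj?       = λ i j → ¬? (i Fin.≟ j)
  ; adj-sym    = λ i≢j → i≢j ∘ sym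
  ; adj-irrefl = λ i≡i i≢i → i≢i i≡i
  }

completeBipartite : ∀ m n → Graph (m + n)
completeBipartite m n = record
  { Adj        = λ i j → side i ≢ side j
  ; adj?       = λ i j → ¬? (side i Bool.≟ side j)
  ; adj-sym    = λ s≢t → s≢t ∘ sym
  ; adj-irrefl = λ { refl s≢s → s≢s refl }
  }
  where
  side : Fin (m + n) → Bool
  side = [ const false , const true ]′ ∘ splitAt m

K₅⁻ : Graph 5
K₅⁻ = deleteEdge (complete 5) (# 0) (# 1)

K₃,₃⁻ : Graph 6
K₃,₃⁻ = deleteEdge (completeBipartite 3 3) (# 0) (# 3)

-- A graph is planar when it can be drawn in the plane without crossings, the
-- edges being drawn as polygonal arcs.  All corners have rational coordinates.
-- This loses no generality, since the corners of a polygonal drawing can be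
-- moved slightly; and segments with rational ends that meet have a common
-- rational point, so disjointness over ℚ is disjointness in the real plane.

record Point : Set where
  constructor ⟨_,_⟩
  field
    x-coord y-coord : ℚ

open Point public

infix 4 _∈[_,_]
_∈[_,_] : Point → Point → Point → Set
z ∈[ p , q ] = ∃[ t ] (0ℚ ℚ.≤ t) × (t ℚ.≤ 1ℚ)
  × (x-coord z ≡ (1ℚ ℚ.- t) ℚ.* x-coord p ℚ.+ t ℚ.* x-coord q)
  × (y-coord z ≡ (1ℚ ℚ.- t) ℚ.* y-coord p ℚ.+ t ℚ.* y-coord q)

data Polyline : Point → Point → Set where
  segment : ∀ p q → Polyline p q
  _∷_     : ∀ {q r} p → Polyline q r → Polyline p r

infix 4 _∈_
_∈_ : ∀ {p r} → Point → Polyline p r → Set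
z ∈ segment p q     = z ∈[ p , q ]
z ∈ (_∷_ {q} p π)   = z ∈[ p , q ] ⊎ z ∈ π

-- A simple polyline does not meet itself, so that it traces out an arc.
Simple : ∀ {p r} → Polyline p r → Set
Simple (segment p q)   = p ≢ q
Simple (_∷_ {q} p π)   = p ≢ q × Simple π × (∀ z → z ∈[ p , q ] → z ∈ π → z ≡ q)

-- Every edge is drawn once, from its smaller end to its larger one; the value
-- of arc at other pairs is irrelevant.
record Planar {n} (G : Graph n) : Set where
  Edge : Fin n → Fin n → Set
  Edge u v = u < v × Adj G u v

  field
    pos           : Fin n → Point
    pos-injective : Injective _≡_ _≡_ pos
    arc           : ∀ u v → Polyline (pos u) (pos v)
    arc-simple    : ∀ {u v} → Edge u v → Simple (arc u v)
    arc-vertex    : ∀ {u v} → Edge u v → ∀ w → pos w ∈ arc u v → w ≡ u ⊎ w ≡ v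
    arc-arc       : ∀ {u v u′ v′} → Edge u v → Edge u′ v′ → (u , v) ≢ (u′ , v′) →
                    ∀ z → z ∈ arc u v → z ∈ arc u′ v′ → z ≡ pos u ⊎ z ≡ pos v

-- Necessity.  A model of K₅⁻ or K₃,₃⁻ in G becomes one of K₅ or K₃,₃ when the
-- missing edge is restored, by an edge between two branch sets if G has none.
-- In a drawing, the parities of the crossings of the paths between branch sets
-- would then satisfy van Kampen's equations, which are contradictory; the
-- parities are read off from horizontal rays, so no Jordan curve theorem for
-- polygons is needed.
--
-- Sufficiency.  A drawing is represented by its sweep: a line moves from left
-- to right over the vertices and records the edges which it meets.  For any two
-- vertices s and t, G + st has a sweep from s to t, by induction on G.  A
-- separation by at most two vertices lets the sweep of one side be substituted
-- for a strand in the sweep of the other.  Otherwise G + st is 3-connected and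
-- has an edge xy other than st such that G + st - x - y stays connected when a
-- further vertex is deleted.  In a sweep of the contraction, either the
-- neighbours of x and those of y occupy complementary arcs around the contracted
-- vertex, so that it can be split, or four of them alternate or three are common.
-- Since closed curves cross an even number of times, the latter cases give a
-- K₃,₃ or a K₅ in G + st, hence a K₃,₃⁻ or a K₅⁻ in G.  Finally, a sweep becomes
-- a polygonal drawing when the position of a strand in a state is its height.
module Submission where

open import Defs renaming (_∷_ to _∷ᵖ_; _∈_ to _∈ᵖ_)
open import Data.Bool.Base using (Bool; true; false; not; _xor_)
open import Data.Empty using (⊥; ⊥-elim)
open import Data.Fin.Base using (Fin; zero; suc; punchIn; punchOut)
open import Data.Fin.Properties using (any?; all?; punchInᵢ≢i; punchIn-punchOut; punchIn-injective; suc-injective) renaming (_≟_ to _≟ᶠ_)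
open import Data.Fin.Subset using (Subset; ∣_∣; ∁; ⁅_⁆; _∪_; _-_; _─_; ⊤) renaming (_∈_ to _∈ˢ_; _∉_ to _∉ˢ_)
open import Data.Fin.Subset.Properties using (_∈?_; x∈⁅x⁆; x∈⁅y⁆⇒x≡y; x∈p∪q⁺; x∈p∪q⁻; p⊂q⇒∣p∣<∣q∣; x∈p⇒∣p-x∣<∣p∣; p⊂q⇒∁p⊃∁q; anySubset?; ∈⊤; x∈p∧x∉q⇒x∈p─q; p─q⊆p; x∈p∧x≢y⇒x∈p-y; ∣⊤∣≡n; x∉p⇒x∈∁p)
open import Data.Nat.Base using (ℕ; zero; suc; _≤_; z≤n; s≤s)
open import Data.Product.Base using (∃; ∃₂; ∃-syntax; _×_; _,_; proj₁; proj₂)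
open import Data.Sum.Base using (_⊎_; inj₁; inj₂; [_,_]′)
open import Data.Vec.Base using (tabulate; lookup) renaming (_∷_ to _∷ᵛ_; here to hereᵛ; there to thereᵛ)
open import Data.Vec.Properties using (lookup∘tabulate; []=⇒lookup; lookup⇒[]=)
open import Function.Base using (_∘_; id; const; case_of_)
open import Function.Bundles using (_⇔_; mk⇔; Inverse; Equivalence; mk↔ₛ′)
open import Relation.Binary.PropositionalEquality using (_≡_; _≢_; refl; sym; trans; cong; cong₂; subst; subst₂; module ≡-Reasoning)
open import Relation.Nullary using (¬_; Dec; yes; no; does; contradiction)
open import Relation.Nullary.Decidable using (¬?; _×-dec_; _⊎-dec_; _→-dec_; dec-true; dec-false; map′; from-yes; does-⇔)
open import Relation.Unary using (Decidable)
open import Data.Fin.Base using (splitAt; _↑ˡ_; _↑ʳ_)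
open import Data.Fin.Properties using (splitAt⁻¹-↑ˡ; splitAt⁻¹-↑ʳ; <-cmp)
open import Data.Fin.Patterns
open import Data.Fin.Permutation.Components using (transpose)
open import Data.List.Base using (List; []; _∷_; _++_; length; map; concatMap; reverse; cartesianProduct; allFin; [_])
open import Data.List.Relation.Unary.All using (All; []; _∷_)
open import Data.List.Relation.Unary.Any using (here; there)
open import Data.List.Relation.Unary.AllPairs using (AllPairs; []; _∷_)
open import Data.List.Membership.Propositional using () renaming (_∈_ to _∈ˡ_; _∉_ to _∉ˡ_)
open import Data.List.Membership.Propositional.Properties using (∈-cartesianProduct⁺; ∈-allFin; ∈-++⁺ˡ; ∈-++⁺ʳ; ∈-++⁻)
open import Relation.Binary.Definitions using (tri<; tri≈; tri>)

-- The induction speaks of `G + st` rather than of `G`. Excluding `K₅⁻` and `K₃,₃⁻` is inherited by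
-- minors of `G`, while `G + st` may well contain them; so cuts and contractions are carried out in
-- `G`, the edge is added afterwards, and the contracted edge must differ from `st`. A separation at
-- `p`, `q` asks for just such an extra edge, since both sides are drawn with `pq` present.
--
-- That `s` and `t` are the ends of the sweep is what makes this usable: the first and the last
-- vertex can be joined along the top of every state, and a sweep from `p` to `q` begins and ends in
-- single points, so that it can run where a strand `pq` ran.
--
-- The two graphs have to be excluded together. A `K₅` or `K₃,₃` of `G + st` loses one link with
-- `st`, unless `s` and `t` lie in one branch set. Then this set may break in two, and a `K₅` whose
-- broken vertex keeps two neighbours on each piece becomes a `K₃,₃⁻`.
--
-- All graphs of the induction share one vertex type; parts are subsets `U`, and a contraction
-- leaves the lost vertex in place, outside `U`.

-- Walks, components and minor models inside a set of vertices

module Models where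
  import Data.Nat.Properties as ℕₚ

  private variable
    m n : ℕ

  sub : {P : Fin n → Set} → Decidable P → Subset n
  sub P? = tabulate (does ∘ P?)

  sub⁺ : {P : Fin n → Set} (P? : Decidable P) {v : Fin n} → P v → v ∈ˢ sub P?
  sub⁺ P? {v} p = lookup⇒[]= v _ (trans (lookup∘tabulate _ v) (dec-true (P? v) p))

  sub⁻ : {P : Fin n → Set} (P? : Decidable P) {v : Fin n} → v ∈ˢ sub P? → P v
  sub⁻ P? {v} v∈ with P? v | trans (sym (lookup∘tabulate (does ∘ P?) v)) ([]=⇒lookup v∈)
  ... | yes p | _  = p
  ... | no  _ | ()

  ∉─ : {U C : Subset n} {v : Fin n} → v ∈ˢ U ─ C → v ∉ˢ C
  ∉─ {U = U} {C} v∈ v∈C = go U C v∈ v∈C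
    where
    go : ∀ {n} (U C : Subset n) {v} → v ∈ˢ U ─ C → v ∈ˢ C → ⊥
    go (_ ∷ᵛ U) (true ∷ᵛ C) () hereᵛ
    go (_ ∷ᵛ U) (_ ∷ᵛ C) (thereᵛ p) (thereᵛ q) = go U C p q

  ∈─ : {U C : Subset n} {v : Fin n} → v ∈ˢ U ─ C → v ∈ˢ U
  ∈─ {U = U} {C} = p─q⊆p U C

  ∉-minus : {U : Subset n} {v y : Fin n} → v ∈ˢ U - y → v ≢ y
  ∉-minus {y = y} v∈ refl = ∉─ v∈ (x∈⁅x⁆ y)

  ∣∣>0 : {p : Subset n} {x : Fin n} → x ∈ˢ p → 1 ≤ ∣ p ∣
  ∣∣>0 x∈p = ℕₚ.≤-trans (s≤s z≤n) (x∈p⇒∣p-x∣<∣p∣ x∈p)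

  ∣∁∣-grow : (Z : Subset n) {w : Fin n} → w ∉ˢ Z → suc ∣ ∁ (Z ∪ ⁅ w ⁆) ∣ ≤ ∣ ∁ Z ∣
  ∣∁∣-grow Z {w} w∉ = p⊂q⇒∣p∣<∣q∣ (p⊂q⇒∁p⊃∁q ((λ x∈ → x∈p∪q⁺ (inj₁ x∈)) , w , x∈p∪q⁺ (inj₂ (x∈⁅x⁆ w)) , w∉))

  data Walk (G : Graph n) (P : Fin n → Set) : Fin n → Fin n → Set where
    stay : ∀ {u} → P u → Walk G P u u
    step : ∀ {u v w} → P u → Adj G u v → Walk G P v w → Walk G P u w

  module _ {G : Graph n} where
    private variable
      P Q : Fin n → Set
      u v w : Fin n

    walk-start : Walk G P u v → P u
    walk-start (stay p)     = p
    walk-start (step p _ _) = p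

    walk-end : Walk G P u v → P v
    walk-end (stay p)     = p
    walk-end (step _ _ π) = walk-end π

    infixr 5 _++ʷ_
    _++ʷ_ : Walk G P u v → Walk G P v w → Walk G P u w
    stay _     ++ʷ ρ = ρ
    step p a π ++ʷ ρ = step p a (π ++ʷ ρ)

    walk-rev : Walk G P u v → Walk G P v u
    walk-rev (stay p)     = stay p
    walk-rev (step p a π) = walk-rev π ++ʷ step (walk-start π) (adj-sym G a) (stay p)

    walk-map : (∀ {x} → P x → Q x) → Walk G P u v → Walk G Q u v
    walk-map f (stay p)     = stay (f p)
    walk-map f (step p a π) = step (f p) a (walk-map f π)

    walk-exit : {Z : Fin n → Set} → Decidable Z → Walk G P u w → Z u → ¬ Z w →
                ∃₂ λ a b → Z a × ¬ Z b × P a × P b × Adj G a b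
    walk-exit Z? (stay p) z ¬z = contradiction z ¬z
    walk-exit Z? (step {v = v} p a π) z ¬z with Z? v
    ... | yes zv = walk-exit Z? π zv ¬z
    ... | no ¬zv = _ , _ , z , ¬zv , p , walk-start π , a

    walk-stays : {Z : Fin n → Set} → (∀ {a b} → Z a → P a → P b → Adj G a b → Z b) →
                 Walk G P u w → Z u → Walk G (λ x → P x × Z x) u w
    walk-stays cl (stay p) z = stay (p , z)
    walk-stays cl (step p a π) z = step (p , z) a (walk-stays cl π (cl z p (walk-start π) a))

  -- An edge may expand into a whole walk; this is how branch sets stay connected when a contracted
  -- or deleted edge has to be replaced by a detour.
  walk-graph : {G G′ : Graph n} {P Q : Fin n → Set} {u v : Fin n} →
               (∀ {a b} → P a → P b → Adj G a b → Walk G′ Q a b) → (∀ {a} → P a → Q a) →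
               Walk G P u v → Walk G′ Q u v
  walk-graph f g (stay p)     = stay (g p)
  walk-graph f g (step p a π) = f p (walk-start π) a ++ʷ walk-graph f g π

  record Component (G : Graph n) (S : Subset n) (c : Fin n) : Set where
    field
      Z      : Subset n
      root   : c ∈ˢ Z
      within : ∀ {z} → z ∈ˢ Z → z ∈ˢ S
      conn   : ∀ {z} → z ∈ˢ Z → Walk G (_∈ˢ Z) c z
      closed : ∀ {z w} → z ∈ˢ Z → w ∈ˢ S → Adj G z w → w ∈ˢ Z

  -- Grown from `c` by one frontier vertex at a time; the fuel `k` bounds the number of vertices
  -- outside `Z`, which drops at each step.
  component : (G : Graph n) (S : Subset n) {c : Fin n} → c ∈ˢ S → Component G S c
  component {n} G S {c} c∈S = grow _ ⁅ c ⁆ ℕₚ.≤-refl (x∈⁅x⁆ c) one-in one-conn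
    where
    one-in : ∀ {z} → z ∈ˢ ⁅ c ⁆ → z ∈ˢ S
    one-in z∈ = subst (_∈ˢ S) (sym (x∈⁅y⁆⇒x≡y c z∈)) c∈S
    one-conn : ∀ {z} → z ∈ˢ ⁅ c ⁆ → Walk G (_∈ˢ ⁅ c ⁆) c z
    one-conn z∈ = subst (Walk G _ c) (sym (x∈⁅y⁆⇒x≡y c z∈)) (stay (x∈⁅x⁆ c))

    Frontier : Subset n → Set
    Frontier Z = ∃₂ λ z w → z ∈ˢ Z × w ∈ˢ S × ¬ w ∈ˢ Z × Adj G z w

    frontier? : ∀ Z → Dec (Frontier Z)
    frontier? Z = any? λ z → any? λ w → z ∈? Z ×-dec w ∈? S ×-dec ¬? (w ∈? Z) ×-dec adj? G z w

    grow : ∀ k (Z : Subset n) → ∣ ∁ Z ∣ ≤ k → c ∈ˢ Z → (∀ {z} → z ∈ˢ Z → z ∈ˢ S) →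
           (∀ {z} → z ∈ˢ Z → Walk G (_∈ˢ Z) c z) → Component G S c
    grow k Z le c∈Z Z⊆S con with frontier? Z
    ... | no ¬f = record { Z = Z ; root = c∈Z ; within = Z⊆S ; conn = con ; closed = cl }
      where
      cl : ∀ {z w} → z ∈ˢ Z → w ∈ˢ S → Adj G z w → w ∈ˢ Z
      cl {z} {w} z∈ w∈ a with w ∈? Z
      ... | yes w∈Z = w∈Z
      ... | no  w∉Z = contradiction (z , w , z∈ , w∈ , w∉Z , a) ¬f
    grow zero Z le c∈Z Z⊆S con | yes (z , w , z∈ , w∈ , w∉ , a) =
      contradiction (ℕₚ.≤-trans (∣∣>0 (x∉p⇒x∈∁p w∉)) le) λ ()
    grow (suc k) Z le c∈Z Z⊆S con | yes (z , w , z∈ , w∈ , w∉ , a) =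
      grow k Z′ (ℕₚ.≤-pred (ℕₚ.≤-trans (∣∁∣-grow Z w∉) le)) (up c∈Z) in′ con′
      where
      Z′ = Z ∪ ⁅ w ⁆
      up : ∀ {x} → x ∈ˢ Z → x ∈ˢ Z′
      up x∈ = x∈p∪q⁺ (inj₁ x∈)
      in′ : ∀ {x} → x ∈ˢ Z′ → x ∈ˢ S
      in′ x∈ with x∈p∪q⁻ Z ⁅ w ⁆ x∈
      ... | inj₁ x∈Z = Z⊆S x∈Z
      ... | inj₂ x∈w = subst (_∈ˢ S) (sym (x∈⁅y⁆⇒x≡y w x∈w)) w∈
      con′ : ∀ {x} → x ∈ˢ Z′ → Walk G (_∈ˢ Z′) c x
      con′ x∈ with x∈p∪q⁻ Z ⁅ w ⁆ x∈
      ... | inj₁ x∈Z = walk-map up (con x∈Z)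
      ... | inj₂ x∈w rewrite x∈⁅y⁆⇒x≡y w x∈w =
        walk-map up (con z∈) ++ʷ step (up z∈) a (stay (x∈p∪q⁺ (inj₂ (x∈⁅x⁆ w))))

  -- Branch sets within `U`. Shrinking `U` instead of the vertex type lets the induction delete and
  -- contract without renumbering; vertices are renumbered only in the translation from and to
  -- `_≺_`.
  record Model (K : Graph m) (G : Graph n) (U : Subset n) : Set where
    field
      X      : Fin m → Subset n
      inside : ∀ {i v} → v ∈ˢ X i → v ∈ˢ U
      root   : Fin m → Fin n
      root∈  : ∀ i → root i ∈ˢ X i
      conn   : ∀ i {v} → v ∈ˢ X i → Walk G (_∈ˢ X i) (root i) v
      disj   : ∀ {i j v} → v ∈ˢ X i → v ∈ˢ X j → i ≡ j
      link   : ∀ {i j} → Adj K i j → ∃₂ λ u v → u ∈ˢ X i × v ∈ˢ X j × Adj G u v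

  _⊑_ : Graph n → Graph n → Set
  G ⊑ G′ = ∀ {a b} → Adj G a b → Adj G′ a b

  walk-⊑ : {G G′ : Graph n} {P : Fin n → Set} {u v : Fin n} → G ⊑ G′ → Walk G P u v → Walk G′ P u v
  walk-⊑ f = walk-graph (λ p q a → step p (f a) (stay q)) id

  model-mono : {K : Graph m} {G G′ : Graph n} {U U′ : Subset n} →
               (∀ {a b} → a ∈ˢ U → b ∈ˢ U → Adj G a b → Adj G′ a b) → (∀ {v} → v ∈ˢ U → v ∈ˢ U′) →
               Model K G U → Model K G′ U′
  model-mono f g M = record
    { X = X ; inside = g ∘ inside ; root = root ; root∈ = root∈
    ; conn = λ i v∈ → walk-graph (λ p q a → step p (f (inside p) (inside q) a) (stay q)) id (conn i v∈)
    ; disj = disj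
    ; link = λ a → let (u , v , u∈ , v∈ , b) = link a in u , v , u∈ , v∈ , f (inside u∈) (inside v∈) b }
    where open Model M

  model-perm : {k : ℕ} {K : Graph m} {K′ : Graph k} {G : Graph n} {U : Subset n}
               (π : Fin k → Fin m) → (∀ {i j} → π i ≡ π j → i ≡ j) →
               (∀ {i j} → Adj K′ i j → Adj K (π i) (π j)) → Model K G U → Model K′ G U
  model-perm π inj adj M = record
    { X = X ∘ π ; inside = inside ; root = root ∘ π ; root∈ = root∈ ∘ π ; conn = conn ∘ π
    ; disj = λ p q → inj (disj p q) ; link = link ∘ adj }
    where open Model M

  -- The vertices of Z outside the smaller graph are added to the branch set of p.
  module _ {K : Graph m} {G G′ : Graph n} {U U′ : Subset n} {p : Fin n} {Z : Subset n}
    (U′⊆U : ∀ {v} → v ∈ˢ U′ → v ∈ˢ U) (Z⊆U : ∀ {v} → v ∈ˢ Z → v ∈ˢ U)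
    (p∈Z : p ∈ˢ Z) (Z∩U′ : ∀ {v} → v ∈ˢ Z → v ∈ˢ U′ → v ≡ p)
    (Z-conn : ∀ {z} → z ∈ˢ Z → Walk G (_∈ˢ Z) p z)
    (adj : ∀ {a b} → Adj G′ a b → Adj G a b ⊎ (a ≡ p × ∃[ z ] (z ∈ˢ Z × Adj G z b))
                                             ⊎ (b ≡ p × ∃[ z ] (z ∈ˢ Z × Adj G a z))) where

    model-absorb : Model K G′ U′ → Model K G U
    model-absorb M = record
      { X = X′ ; inside = in′ ; root = root ; root∈ = λ i → up (root∈ i)
      ; conn = conn′ ; disj = disj′ ; link = link′ }
      where
      open Model M
      mem? : ∀ i v → Dec (v ∈ˢ X i ⊎ (v ∈ˢ Z × p ∈ˢ X i))
      mem? i v = v ∈? X i ⊎-dec (v ∈? Z ×-dec p ∈? X i)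
      X′ : Fin _ → Subset n
      X′ i = sub (mem? i)
      up : ∀ {i v} → v ∈ˢ X i → v ∈ˢ X′ i
      up {i} v∈ = sub⁺ (mem? i) (inj₁ v∈)
      upZ : ∀ {i v} → p ∈ˢ X i → v ∈ˢ Z → v ∈ˢ X′ i
      upZ {i} p∈ v∈ = sub⁺ (mem? i) (inj₂ (v∈ , p∈))
      in′ : ∀ {i v} → v ∈ˢ X′ i → v ∈ˢ U
      in′ {i} v∈ with sub⁻ (mem? i) v∈
      ... | inj₁ v∈X = U′⊆U (inside v∈X)
      ... | inj₂ (v∈Z , _) = Z⊆U v∈Z
      zwalk : ∀ {i z} → p ∈ˢ X i → z ∈ˢ Z → Walk G (_∈ˢ X′ i) p z
      zwalk p∈ z∈ = walk-map (upZ p∈) (Z-conn z∈)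
      edge : ∀ {i a b} → a ∈ˢ X i → b ∈ˢ X i → Adj G′ a b → Walk G (_∈ˢ X′ i) a b
      edge a∈ b∈ e with adj e
      ... | inj₁ e′ = step (up a∈) e′ (stay (up b∈))
      ... | inj₂ (inj₁ (refl , z , z∈ , e′)) = zwalk a∈ z∈ ++ʷ step (upZ a∈ z∈) e′ (stay (up b∈))
      ... | inj₂ (inj₂ (refl , z , z∈ , e′)) = step (up a∈) e′ (walk-rev (zwalk b∈ z∈))
      conn′ : ∀ i {v} → v ∈ˢ X′ i → Walk G (_∈ˢ X′ i) (root i) v
      conn′ i v∈ with sub⁻ (mem? i) v∈
      ... | inj₁ v∈X = walk-graph edge up (conn i v∈X)
      ... | inj₂ (v∈Z , p∈) = walk-graph edge up (conn i p∈) ++ʷ zwalk p∈ v∈Z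
      disj′ : ∀ {i j v} → v ∈ˢ X′ i → v ∈ˢ X′ j → i ≡ j
      disj′ {i} {j} v∈i v∈j with sub⁻ (mem? i) v∈i | sub⁻ (mem? j) v∈j
      ... | inj₁ a | inj₁ b = disj a b
      ... | inj₁ a | inj₂ (b , p∈) = disj (subst (_∈ˢ X i) (Z∩U′ b (inside a)) a) p∈
      ... | inj₂ (a , p∈) | inj₁ b = disj p∈ (subst (_∈ˢ X j) (Z∩U′ a (inside b)) b)
      ... | inj₂ (_ , p∈) | inj₂ (_ , q∈) = disj p∈ q∈
      link′ : ∀ {i j} → Adj K i j → ∃₂ λ u v → u ∈ˢ X′ i × v ∈ˢ X′ j × Adj G u v
      link′ k with link k
      ... | u , v , u∈ , v∈ , e with adj e
      ... | inj₁ e′ = u , v , up u∈ , up v∈ , e′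
      ... | inj₂ (inj₁ (refl , z , z∈ , e′)) = z , v , upZ u∈ z∈ , up v∈ , e′
      ... | inj₂ (inj₂ (refl , z , z∈ , e′)) = u , z , up u∈ , upZ v∈ z∈ , e′

  -- Contraction of `x y` onto `x` on the same vertex type. The vertex `y` keeps its edges and is
  -- discarded by restricting to `U - y`.
  merge : (G : Graph n) (x y : Fin n) → Graph n
  merge {n} G x y = record
    { Adj        = λ a b → a ≢ b × Merged a b
    ; adj?       = λ a b → ¬? (a ≟ᶠ b) ×-dec (adj? G a b ⊎-dec (a ≟ᶠ x ×-dec adj? G y b) ⊎-dec (b ≟ᶠ x ×-dec adj? G a y))
    ; adj-sym    = λ (a≢b , e) → a≢b ∘ sym , merged-sym e
    ; adj-irrefl = λ { refl (a≢a , _) → a≢a refl }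
    }
    where
    Merged : Fin n → Fin n → Set
    Merged a b = Adj G a b ⊎ (a ≡ x × Adj G y b) ⊎ (b ≡ x × Adj G a y)
    merged-sym : ∀ {a b} → Merged a b → Merged b a
    merged-sym (inj₁ e)              = inj₁ (adj-sym G e)
    merged-sym (inj₂ (inj₁ (p , e))) = inj₂ (inj₂ (p , adj-sym G e))
    merged-sym (inj₂ (inj₂ (p , e))) = inj₂ (inj₁ (p , adj-sym G e))

  model-merge : {K : Graph m} {G : Graph n} {U : Subset n} {x y : Fin n} → x ∈ˢ U → y ∈ˢ U → Adj G x y →
                Model K (merge G x y) (U - y) → Model K G U
  model-merge {n = n} {G = G} {U} {x} {y} x∈ y∈ e =
    model-absorb {p = x} {Z = Z} ∈─ Z⊆U (x∈p∪q⁺ (inj₁ (x∈⁅x⁆ x))) Z∩ Z-conn adj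
    where
    Z : Subset n
    Z = ⁅ x ⁆ ∪ ⁅ y ⁆
    y∈Z : y ∈ˢ Z
    y∈Z = x∈p∪q⁺ (inj₂ (x∈⁅x⁆ y))
    cases : ∀ {v} → v ∈ˢ Z → v ≡ x ⊎ v ≡ y
    cases v∈ with x∈p∪q⁻ ⁅ x ⁆ ⁅ y ⁆ v∈
    ... | inj₁ p = inj₁ (x∈⁅y⁆⇒x≡y x p)
    ... | inj₂ p = inj₂ (x∈⁅y⁆⇒x≡y y p)
    Z⊆U : ∀ {v} → v ∈ˢ Z → v ∈ˢ U
    Z⊆U v∈ with cases v∈
    ... | inj₁ refl = x∈
    ... | inj₂ refl = y∈
    Z∩ : ∀ {v} → v ∈ˢ Z → v ∈ˢ U - y → v ≡ x
    Z∩ v∈ v∈U with cases v∈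
    ... | inj₁ p = p
    ... | inj₂ p = contradiction p (∉-minus v∈U)
    Z-conn : ∀ {z} → z ∈ˢ Z → Walk G (_∈ˢ Z) x z
    Z-conn v∈ with cases v∈
    ... | inj₁ refl = stay v∈
    ... | inj₂ refl = step (x∈p∪q⁺ (inj₁ (x∈⁅x⁆ x))) e (stay v∈)
    adj : ∀ {a b} → Adj (merge G x y) a b → Adj G a b ⊎ (a ≡ x × ∃ λ z → z ∈ˢ Z × Adj G z b)
                                             ⊎ (b ≡ x × ∃ λ z → z ∈ˢ Z × Adj G a z)
    adj (_ , inj₁ e)              = inj₁ e
    adj (_ , inj₂ (inj₁ (p , e))) = inj₂ (inj₁ (p , y , y∈Z , e))
    adj (_ , inj₂ (inj₂ (p , e))) = inj₂ (inj₂ (p , y , y∈Z , e))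

-- What is left of a model when an edge is removed

module EdgeLoss where
  open Models
  import Data.List.Base as List
  import Data.Fin.Base as Fin

  private variable
    k m n : ℕ

  Touch : Graph n → Subset n → Subset n → Set
  Touch G S T = ∃₂ λ u v → u ∈ˢ S × v ∈ˢ T × Adj G u v

  touch-sym : {G : Graph n} {S T : Subset n} → Touch G S T → Touch G T S
  touch-sym {G = G} (u , v , u∈ , v∈ , a) = v , u , v∈ , u∈ , adj-sym G a

  Disjoint : Subset n → Subset n → Set
  Disjoint S T = ∀ {v} → v ∈ˢ S → v ∈ˢ T → ⊥

  record Rooted (G : Graph n) (U S : Subset n) : Set where
    constructor rooted
    field
      inside : ∀ {v} → v ∈ˢ S → v ∈ˢ U
      root   : Fin n
      root∈  : root ∈ˢ S
      conn   : ∀ {v} → v ∈ˢ S → Walk G (_∈ˢ S) root v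

  open Rooted

  rooted-⁅⁆ : {G : Graph n} {U : Subset n} {x : Fin n} → x ∈ˢ U → Rooted G U ⁅ x ⁆
  rooted-⁅⁆ {G = G} {U} {x} x∈ = rooted
    (λ v∈ → subst (_∈ˢ U) (sym (x∈⁅y⁆⇒x≡y x v∈)) x∈) x (x∈⁅x⁆ x)
    (λ v∈ → subst (Walk G _ x) (sym (x∈⁅y⁆⇒x≡y x v∈)) (stay (x∈⁅x⁆ x)))

  all-lookup : {A : Set} {P : A → Set} {xs : List A} → All P xs → ∀ i → P (List.lookup xs i)
  all-lookup (p ∷ ps) zero    = p
  all-lookup (p ∷ ps) (suc i) = all-lookup ps i

  allPairs-lookup : {A : Set} {R : A → A → Set} {xs : List A} → AllPairs R xs →
                    ∀ {i j} → i Fin.< j → R (List.lookup xs i) (List.lookup xs j)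
  allPairs-lookup (ps ∷ _)  {zero}  {suc j} _       = all-lookup ps j
  allPairs-lookup (_ ∷ pss) {suc i} {suc j} (s≤s p) = allPairs-lookup pss p

  model-from : {G : Graph n} {U : Subset n} (Ss : List (Subset n)) {K : Graph (length Ss)} →
               All (Rooted G U) Ss → AllPairs Disjoint Ss →
               (∀ {i j} → Adj K i j → Touch G (List.lookup Ss i) (List.lookup Ss j)) → Model K G U
  model-from {G = G} Ss rs ds ts = record
    { X = List.lookup Ss ; inside = λ {i} → inside (all-lookup rs i)
    ; root = λ i → root (all-lookup rs i) ; root∈ = λ i → root∈ (all-lookup rs i)
    ; conn = λ i → conn (all-lookup rs i) ; disj = dj ; link = ts }
    where
    dj : ∀ {i j v} → v ∈ˢ List.lookup Ss i → v ∈ˢ List.lookup Ss j → i ≡ j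
    dj {i} {j} p q with <-cmp i j
    ... | tri< i<j _ _ = ⊥-elim (allPairs-lookup ds i<j p q)
    ... | tri≈ _ eq _  = eq
    ... | tri> _ _ j<i = ⊥-elim (allPairs-lookup ds j<i q p)

  -- By symmetry the nine pairs directed from left to right suffice. `Q` carries the condition that
  -- a missing edge imposes, so that `K₃,₃` and `K₃,₃⁻` are treated alike.
  bipartite-link : {R : Fin 6 → Fin 6 → Set} → (∀ {i j} → R i j → R j i) →
                   {Q : Fin 6 → Fin 6 → Set} → (∀ {i j} → Q i j → Q j i) →
                   (∀ a b → Q (a ↑ˡ 3) (3 ↑ʳ b) → R (a ↑ˡ 3) (3 ↑ʳ b)) →
                   ∀ {i j} → Adj (completeBipartite 3 3) i j → Q i j → R i j
  bipartite-link R-sym Q-sym t {i} {j} k q with splitAt 3 i in p | splitAt 3 j in r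
  ... | inj₁ a | inj₁ b = ⊥-elim (k refl)
  ... | inj₂ a | inj₂ b = ⊥-elim (k refl)
  ... | inj₁ a | inj₂ b with refl ← splitAt⁻¹-↑ˡ {3} {3} {i} p | refl ← splitAt⁻¹-↑ʳ {3} {3} {j} r = t a b q
  ... | inj₂ a | inj₁ b with refl ← splitAt⁻¹-↑ʳ {3} {3} {i} p | refl ← splitAt⁻¹-↑ˡ {3} {3} {j} r = R-sym (t b a (Q-sym q))

  module Canonical where
    -- For `i ≢ j` a permutation that takes `0F` to `i` and `1F` to `j`: the inner transposition,
    -- which acts before the outer one, uses `j` pulled back along the outer one.
    π₅ : Fin 5 → Fin 5 → Fin 5 → Fin 5
    π₅ i j = transpose 0F i ∘ transpose 1F (transpose 0F i j)

    π₅-injective : ∀ i j → i ≢ j → ∀ a b → π₅ i j a ≡ π₅ i j b → a ≡ b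
    π₅-injective = from-yes (all? λ i → all? λ j → ¬? (i ≟ᶠ j) →-dec all? λ a → all? λ b →
      (π₅ i j a ≟ᶠ π₅ i j b) →-dec (a ≟ᶠ b))

    π₅-adj : ∀ i j → i ≢ j → ∀ a b → Adj K₅⁻ a b → Adj (deleteEdge (complete 5) i j) (π₅ i j a) (π₅ i j b)
    π₅-adj = from-yes (all? λ i → all? λ j → ¬? (i ≟ᶠ j) →-dec all? λ a → all? λ b →
      adj? K₅⁻ a b →-dec adj? (deleteEdge (complete 5) i j) (π₅ i j a) (π₅ i j b))

    π₆ : Fin 3 → Fin 3 → Fin 6 → Fin 6
    π₆ i j = transpose 0F (i ↑ˡ 3) ∘ transpose 3F (3 ↑ʳ j)

    π₆-injective : ∀ i j a b → π₆ i j a ≡ π₆ i j b → a ≡ b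
    π₆-injective = from-yes (all? λ i → all? λ j → all? λ a → all? λ b →
      (π₆ i j a ≟ᶠ π₆ i j b) →-dec (a ≟ᶠ b))

    π₆-adj : ∀ i j a b → Adj K₃,₃⁻ a b → Adj (deleteEdge (completeBipartite 3 3) (i ↑ˡ 3) (3 ↑ʳ j)) (π₆ i j a) (π₆ i j b)
    π₆-adj = from-yes (all? λ i → all? λ j → all? λ a → all? λ b →
      adj? K₃,₃⁻ a b →-dec adj? (deleteEdge (completeBipartite 3 3) (i ↑ˡ 3) (3 ↑ʳ j)) (π₆ i j a) (π₆ i j b))

  open Canonical

  module _ {G : Graph n} {U : Subset n} where

    model-K⊑ : {K K′ : Graph m} → K′ ⊑ K → Model K G U → Model K′ G U
    model-K⊑ f = model-perm id id f

    K₅-minus : ∀ {i j} → i ≢ j → Model (deleteEdge (complete 5) i j) G U → Model K₅⁻ G U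
    K₅-minus {i} {j} i≢j = model-perm (π₅ i j) (π₅-injective i j i≢j _ _) (π₅-adj i j i≢j _ _)

    K₃₃-minus : ∀ {i j} → Adj (completeBipartite 3 3) i j →
                Model (deleteEdge (completeBipartite 3 3) i j) G U → Model K₃,₃⁻ G U
    K₃₃-minus {i} {j} k with splitAt 3 i in p | splitAt 3 j in r
    ... | inj₁ a | inj₁ b = ⊥-elim (k refl)
    ... | inj₂ a | inj₂ b = ⊥-elim (k refl)
    ... | inj₁ a | inj₂ b with refl ← splitAt⁻¹-↑ˡ {3} {3} {i} p | refl ← splitAt⁻¹-↑ʳ {3} {3} {j} r =
      model-perm (π₆ a b) (π₆-injective a b _ _) (π₆-adj a b _ _)
    ... | inj₂ a | inj₁ b with refl ← splitAt⁻¹-↑ʳ {3} {3} {i} p | refl ← splitAt⁻¹-↑ˡ {3} {3} {j} r =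
      model-perm (π₆ b a) (π₆-injective b a _ _) (π₆-adj b a _ _)
      ∘ model-K⊑ {K = deleteEdge (completeBipartite 3 3) (3 ↑ʳ a) (b ↑ˡ 3)}
          {K′ = deleteEdge (completeBipartite 3 3) (b ↑ˡ 3) (3 ↑ʳ a)} λ (e , ¬p) → e , λ { (inj₁ (q , r)) → ¬p (inj₂ (q , r)) ; (inj₂ (q , r)) → ¬p (inj₁ (q , r)) }

  -- A model survives the removal of an edge s t unless s and t lie in one branch
  -- set; then the removal cuts this set into at most two connected pieces.
  module LoseEdge {G : Graph n} {U : Subset n} {s t : Fin n} {s≢t : s ≢ t}
                  {K : Graph m} (M : Model K (addEdge G s t s≢t) U) where
    open Model M renaming (inside to inside′; root to root′; root∈ to root∈′; conn to conn′)

    -- The branch set `X i` that contained both ends of the edge. Its pieces `Y true` and `Y false`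
    -- will be the components of `s` and of `t`; either can take over as a branch set, at the price
    -- of the links that belong to the other (`replace`).
    record Split : Set where
      field
        i     : Fin m
        Y     : Bool → Subset n
        Y⊆    : ∀ {b v} → v ∈ˢ Y b → v ∈ˢ X i
        Yr    : ∀ b → Rooted G U (Y b)
        Ydisj : Disjoint (Y true) (Y false)
        Xr    : ∀ {j} → j ≢ i → Rooted G U (X j)
        links : ∀ {j k} → j ≢ i → k ≢ i → Adj K j k → Touch G (X j) (X k)
        Ylink : ∀ {j} → Adj K i j → ∃ λ b → Touch G (Y b) (X j)

      replace : ∀ b {K′ : Graph m} → K′ ⊑ K → (∀ {j} → Adj K′ i j → Touch G (Y b) (X j)) → Model K′ G U
      replace b {K′} K′⊑K touch = record
        { X = X′ ; inside = λ {j} → inside (r j) ; root = λ j → root (r j) ; root∈ = λ j → root∈ (r j)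
        ; conn = λ j → conn (r j) ; disj = λ {j} {k} p q → disj (down {j} p) (down {k} q) ; link = lk }
        where
        X′ : Fin m → Subset n
        X′ j with j ≟ᶠ i
        ... | yes _ = Y b
        ... | no  _ = X j
        r : ∀ j → Rooted G U (X′ j)
        r j with j ≟ᶠ i
        ... | yes _  = Yr b
        ... | no j≢i = Xr j≢i
        down : ∀ {j v} → v ∈ˢ X′ j → v ∈ˢ X j
        down {j} v∈ with j ≟ᶠ i
        ... | yes refl = Y⊆ v∈
        ... | no _     = v∈
        lk : ∀ {j k} → Adj K′ j k → Touch G (X′ j) (X′ k)
        lk {j} {k} a with j ≟ᶠ i | k ≟ᶠ i
        ... | yes refl | yes refl = ⊥-elim (adj-irrefl K′ refl a)
        ... | yes refl | no _     = touch a
        ... | no _     | yes refl = touch-sym {G = G} (touch (adj-sym K′ a))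
        ... | no p     | no q     = links p q (K′⊑K a)

    data Outcome : Set where
      intact : Model K G U → Outcome
      lost   : ∀ {i j} → Adj K i j → Model (deleteEdge K i j) G U → Outcome
      split  : Split → Outcome

    private
      H : Graph n
      H = addEdge G s t s≢t

      conn-apart : ∀ i → (s ∈ˢ X i → t ∈ˢ X i → ⊥) → ∀ {v} → v ∈ˢ X i → Walk G (_∈ˢ X i) (root′ i) v
      conn-apart i ap v∈ = walk-graph edge id (conn′ i v∈)
        where
        edge : ∀ {a b} → a ∈ˢ X i → b ∈ˢ X i → Adj H a b → Walk G (_∈ˢ X i) a b
        edge p q (inj₁ a) = step p a (stay q)
        edge p q (inj₂ (inj₁ (refl , refl))) = ⊥-elim (ap p q)
        edge p q (inj₂ (inj₂ (refl , refl))) = ⊥-elim (ap q p)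

      link-apart : ∀ {i j} → Adj K i j → ¬ (s ∈ˢ X i × t ∈ˢ X j) → ¬ (s ∈ˢ X j × t ∈ˢ X i) → Touch G (X i) (X j)
      link-apart a ¬p ¬q with link a
      ... | u , v , u∈ , v∈ , inj₁ e = u , v , u∈ , v∈ , e
      ... | u , v , u∈ , v∈ , inj₂ (inj₁ (refl , refl)) = ⊥-elim (¬p (u∈ , v∈))
      ... | u , v , u∈ , v∈ , inj₂ (inj₂ (refl , refl)) = ⊥-elim (¬q (v∈ , u∈))

      build : {K′ : Graph m} → (∀ i → s ∈ˢ X i → t ∈ˢ X i → ⊥) →
              (∀ {i j} → Adj K′ i j → Touch G (X i) (X j)) → Model K′ G U
      build ap lk = record { X = X ; inside = inside′ ; root = root′ ; root∈ = root∈′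
        ; conn = λ i → conn-apart i (ap i) ; disj = disj ; link = lk }

      module Inner (i : Fin m) (s∈ : s ∈ˢ X i) (t∈ : t ∈ˢ X i) where
        module A = Component (component G (X i) s∈)
        module B = Component (component G (X i) t∈)

        apart : ∀ {j} → j ≢ i → s ∈ˢ X j → ⊥
        apart j≢i p = j≢i (disj p s∈)
        apart′ : ∀ {j} → j ≢ i → t ∈ˢ X j → ⊥
        apart′ j≢i p = j≢i (disj p t∈)

        Xr : ∀ {j} → j ≢ i → Rooted G U (X j)
        Xr {j} j≢i = rooted inside′ (root′ j) (root∈′ j) (conn-apart j (λ p _ → apart j≢i p))

        links : ∀ {j k} → j ≢ i → k ≢ i → Adj K j k → Touch G (X j) (X k)
        links j≢i k≢i a = link-apart a (λ (p , _) → apart j≢i p) (λ (p , _) → apart k≢i p)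

        linkᵢ : ∀ {j} → Adj K i j → Touch G (X i) (X j)
        linkᵢ {j} a = link-apart a (λ (_ , q) → apart′ j≢i q) (λ (p , _) → apart j≢i p)
          where
          j≢i : j ≢ i
          j≢i refl = adj-irrefl K refl a

        cover : ∀ {v} → v ∈ˢ X i → v ∈ˢ A.Z ⊎ v ∈ˢ B.Z
        -- Both components are closed under the edges of `G` in `X i`, and the one further edge of
        -- `H` joins `s` to `t`; so a walk in `X i` from `s` never leaves their union.
        cover v∈ = proj₂ (walk-end (walk-stays cl (walk-rev (conn′ i s∈) ++ʷ conn′ i v∈) (inj₁ A.root)))
          where
          cl : ∀ {a b} → a ∈ˢ A.Z ⊎ a ∈ˢ B.Z → a ∈ˢ X i → b ∈ˢ X i → Adj H a b → b ∈ˢ A.Z ⊎ b ∈ˢ B.Z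
          cl (inj₁ z) _ q (inj₁ e) = inj₁ (A.closed z q e)
          cl (inj₂ z) _ q (inj₁ e) = inj₂ (B.closed z q e)
          cl _ _ _ (inj₂ (inj₁ (refl , refl))) = inj₂ B.root
          cl _ _ _ (inj₂ (inj₂ (refl , refl))) = inj₁ A.root

        result : Outcome
        result with t ∈? A.Z
        ... | yes t∈A = intact (record
                { X = X ; inside = inside′ ; root = λ j → root (r j) ; root∈ = λ j → root∈ (r j)
                ; conn = λ j → conn (r j) ; disj = disj ; link = lk })
          where
          B⊆A : ∀ {v} → v ∈ˢ B.Z → v ∈ˢ A.Z
          B⊆A v∈ = proj₂ (walk-end (walk-stays (λ z _ q e → A.closed z (B.within q) e) (B.conn v∈) t∈A))
          whole : ∀ {v} → v ∈ˢ X i → v ∈ˢ A.Z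
          whole v∈ = [ id , B⊆A ]′ (cover v∈)
          r : ∀ j → Rooted G U (X j)
          r j with j ≟ᶠ i
          ... | no j≢i   = Xr j≢i
          ... | yes refl = rooted inside′ s s∈ (λ v∈ → walk-map A.within (A.conn (whole v∈)))
          lk : ∀ {j k} → Adj K j k → Touch G (X j) (X k)
          lk {j} {k} a with j ≟ᶠ i | k ≟ᶠ i
          ... | yes refl | _        = linkᵢ a
          ... | no _     | yes refl = touch-sym {G = G} (linkᵢ (adj-sym K a))
          ... | no p     | no q     = links p q a
        ... | no t∉A = split (record
                { i = i ; Y = Y ; Y⊆ = λ {b} → Y⊆ b ; Yr = Yr ; Ydisj = dj ; Xr = Xr ; links = links ; Ylink = yl })
          where
          Y : Bool → Subset n
          Y true  = A.Z
          Y false = B.Z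
          Y⊆ : ∀ b {v} → v ∈ˢ Y b → v ∈ˢ X i
          Y⊆ true  = A.within
          Y⊆ false = B.within
          Yr : ∀ b → Rooted G U (Y b)
          Yr true  = rooted (inside′ ∘ A.within) s A.root A.conn
          Yr false = rooted (inside′ ∘ B.within) t B.root B.conn
          dj : Disjoint A.Z B.Z
          dj p q = t∉A (proj₂ (walk-end (walk-stays (λ z _ r e → A.closed z (B.within r) e) (walk-rev (B.conn q)) p)))
          yl : ∀ {j} → Adj K i j → ∃ λ b → Touch G (Y b) (X j)
          yl a with linkᵢ a
          ... | u , v , u∈ , v∈ , e with cover u∈
          ... | inj₁ u∈A = true , u , v , u∈A , v∈ , e
          ... | inj₂ u∈B = false , u , v , u∈B , v∈ , e

    outcome : Outcome
    outcome with any? (λ i → s ∈? X i) | any? (λ j → t ∈? X j)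
    ... | no ¬s | _ = intact (build (λ i p _ → ¬s (i , p)) λ {i} {j} a →
            link-apart a (λ (p , _) → ¬s (i , p)) (λ (p , _) → ¬s (j , p)))
    ... | yes _ | no ¬t = intact (build (λ i _ p → ¬t (i , p)) λ {i} {j} a →
            link-apart a (λ (_ , p) → ¬t (j , p)) (λ (_ , p) → ¬t (i , p)))
    ... | yes (i , s∈) | yes (j , t∈) with i ≟ᶠ j
    ... | yes refl = Inner.result i s∈ t∈
    ... | no i≢j with adj? K i j
    ... | yes a = lost a (build (λ k p q → i≢j (trans (disj s∈ p) (disj q t∈))) λ (b , ¬p) →
            link-apart b (λ (p , q) → ¬p (inj₁ (disj p s∈ , disj q t∈)))
                         (λ (p , q) → ¬p (inj₂ (disj q t∈ , disj p s∈))))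
    ... | no ¬a = intact (build (λ k p q → i≢j (trans (disj s∈ p) (disj q t∈))) λ b →
            link-apart b (λ (p , q) → ¬a (subst₂ (Adj K) (disj p s∈) (disj q t∈) b))
                         (λ (p , q) → ¬a (subst₂ (Adj K) (disj p s∈) (disj q t∈) (adj-sym K b))))

  module _ {G : Graph n} {U : Subset n} {s t : Fin n} {s≢t : s ≢ t} where

    -- In the split case the broken branch set has three neighbours, and one of the two pieces
    -- touches at least two of them. With this piece alone, at most one link is lost.
    K₃₃-lose : Model (completeBipartite 3 3) (addEdge G s t s≢t) U → Model K₃,₃⁻ G U
    K₃₃-lose M with LoseEdge.outcome {s≢t = s≢t} M
    ... | LoseEdge.intact M′  = model-K⊑ {K = completeBipartite 3 3} {K′ = K₃,₃⁻} proj₁ M′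
    ... | LoseEdge.lost a M′  = K₃₃-minus a M′
    ... | LoseEdge.split S    = major (κ 0F) (κ 1F) (κ 2F)
      where
      open LoseEdge.Split S
      open Model M using (X)
      nb : Fin 6 → Fin 3 → Fin 6
      nb i a = [ const (3 ↑ʳ a) , const (a ↑ˡ 3) ]′ (splitAt 3 i)
      nb-adj : ∀ i a → Adj (completeBipartite 3 3) i (nb i a)
      nb-adj = from-yes (all? λ i → all? λ a → adj? (completeBipartite 3 3) i (nb i a))
      nb-all : ∀ i j → Adj (completeBipartite 3 3) i j → ∃ λ a → j ≡ nb i a
      nb-all = from-yes (all? λ i → all? λ j → adj? (completeBipartite 3 3) i j →-dec any? λ a → j ≟ᶠ nb i a)
      κ : ∀ a → ∃ λ b → Touch G (Y b) (X (nb i a))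
      κ a = Ylink (nb-adj i a)
      use : ∀ b a₀ → (∀ a → a ≢ a₀ → Touch G (Y b) (X (nb i a))) → Model K₃,₃⁻ G U
      use b a₀ f = K₃₃-minus (nb-adj i a₀) (replace b proj₁ λ {j} (e , ¬p) → lem j e ¬p (nb-all i j e))
        where
        lem : ∀ j → Adj (completeBipartite 3 3) i j → ¬ SamePair i j i (nb i a₀) → (∃ λ a → j ≡ nb i a) → Touch G (Y b) (X j)
        lem j e ¬p (a , refl) = f a λ { refl → ¬p (inj₁ (refl , refl)) }
      major : (∃ λ b → Touch G (Y b) (X (nb i 0F))) → (∃ λ b → Touch G (Y b) (X (nb i 1F))) →
              (∃ λ b → Touch G (Y b) (X (nb i 2F))) → Model K₃,₃⁻ G U
      major (true , p) (true , q) _ = use true 2F λ { 0F _ → p ; 1F _ → q ; 2F ne → ⊥-elim (ne refl) }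
      major (true , p) (false , _) (true , r) = use true 1F λ { 0F _ → p ; 2F _ → r ; 1F ne → ⊥-elim (ne refl) }
      major (true , _) (false , q) (false , r) = use false 0F λ { 1F _ → q ; 2F _ → r ; 0F ne → ⊥-elim (ne refl) }
      major (false , _) (true , q) (true , r) = use true 0F λ { 1F _ → q ; 2F _ → r ; 0F ne → ⊥-elim (ne refl) }
      major (false , p) (true , _) (false , r) = use false 1F λ { 0F _ → p ; 2F _ → r ; 1F ne → ⊥-elim (ne refl) }
      major (false , p) (false , q) _ = use false 2F λ { 0F _ → p ; 1F _ → q ; 2F ne → ⊥-elim (ne refl) }

    -- In the split case four neighbours are distributed over two pieces. Three neighbours on one
    -- piece yield `K₅⁻`; a distribution of two and two is a split vertex of `K₅`, which yields
    -- `K₃,₃⁻`.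
    K₅-lose : Model (complete 5) (addEdge G s t s≢t) U → Model K₅⁻ G U ⊎ Model K₃,₃⁻ G U
    K₅-lose M with LoseEdge.outcome {s≢t = s≢t} M
    ... | LoseEdge.intact M′         = inj₁ (model-K⊑ {K = complete 5} {K′ = K₅⁻} proj₁ M′)
    ... | LoseEdge.lost {i} {j} a M′ = inj₁ (K₅-minus a M′)
    ... | LoseEdge.split S           = cases (κ 0F) (κ 1F) (κ 2F) (κ 3F)
      where
      open LoseEdge.Split S
      open Model M using (X; disj)
      T : Bool → Fin 4 → Set
      T b a = Touch G (Y b) (X (punchIn i a))
      κ : ∀ a → ∃ λ b → T b a
      κ a = Ylink λ e → punchInᵢ≢i i a (sym e)
      use : ∀ b a₀ → (∀ a → a ≢ a₀ → T b a) → Model K₅⁻ G U ⊎ Model K₃,₃⁻ G U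
      use b a₀ f = inj₁ (K₅-minus (λ e → punchInᵢ≢i i a₀ (sym e)) (replace b proj₁ λ {j} (e , ¬p) →
        subst (λ j → Touch G (Y b) (X j)) (punchIn-punchOut e)
          (f (punchOut e) λ eq → ¬p (inj₁ (refl , trans (sym (punchIn-punchOut e)) (cong (punchIn i) eq))))))
      Xi : ∀ a → Rooted G U (X (punchIn i a))
      Xi a = Xr (punchInᵢ≢i i a)
      XX : ∀ {a b} → a ≢ b → Disjoint (X (punchIn i a)) (X (punchIn i b))
      XX ne p q = ne (punchIn-injective i _ _ (disj p q))
      YX : ∀ {b} a → Disjoint (Y b) (X (punchIn i a))
      YX a p q = punchInᵢ≢i i a (sym (disj (Y⊆ p) q))
      tt : ∀ a b → a ≢ b → Touch G (X (punchIn i a)) (X (punchIn i b))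
      tt a b ne = links (punchInᵢ≢i i a) (punchInᵢ≢i i b) (ne ∘ punchIn-injective i _ _)
      two : ∀ a b c d → a ≢ b → a ≢ c → a ≢ d → b ≢ c → b ≢ d → c ≢ d →
            T true a → T true b → T false c → T false d → Model K₅⁻ G U ⊎ Model K₃,₃⁻ G U
      -- Each piece stands on the side opposite to the neighbours that it touches. The two pieces
      -- take the places `0F` and `3F`, between which `K₃,₃⁻` lacks its edge; only the removed edge
      -- joined them.
      two a b c d ab ac ad bc bd cd ta tb tc td = inj₂ (model-from Ss
        (Yr true ∷ Xi c ∷ Xi d ∷ Yr false ∷ Xi a ∷ Xi b ∷ [])
        ((YX c ∷ YX d ∷ Ydisj ∷ YX a ∷ YX b ∷ []) ∷
         (XX cd ∷ (λ p q → YX c q p) ∷ XX (ac ∘ sym) ∷ XX (bc ∘ sym) ∷ []) ∷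
         ((λ p q → YX d q p) ∷ XX (ad ∘ sym) ∷ XX (bd ∘ sym) ∷ []) ∷
         (YX a ∷ YX b ∷ []) ∷ (XX ab ∷ []) ∷ [] ∷ [])
        λ (e , ¬p) → bipartite-link {R = λ i j → Touch G (List.lookup Ss i) (List.lookup Ss j)} (touch-sym {G = G})
          {Q = λ i j → ¬ SamePair i j 0F 3F} (λ q → q ∘ samePair-swap) lk e ¬p)
        where
        Ss : List (Subset n)
        Ss = Y true ∷ X (punchIn i c) ∷ X (punchIn i d) ∷ Y false ∷ X (punchIn i a) ∷ X (punchIn i b) ∷ []
        lk : ∀ p q → ¬ SamePair (p ↑ˡ 3) (3 ↑ʳ q) 0F 3F → Touch G (List.lookup Ss (p ↑ˡ 3)) (List.lookup Ss (3 ↑ʳ q))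
        lk 0F 0F ne = ⊥-elim (ne (inj₁ (refl , refl)))
        lk 0F 1F _ = ta
        lk 0F 2F _ = tb
        lk 1F 0F _ = touch-sym {G = G} tc
        lk 1F 1F _ = tt c a (ac ∘ sym)
        lk 1F 2F _ = tt c b (bc ∘ sym)
        lk 2F 0F _ = touch-sym {G = G} td
        lk 2F 1F _ = tt d a (ad ∘ sym)
        lk 2F 2F _ = tt d b (bd ∘ sym)
      three : ∀ {β} → T β 1F → T β 2F → T β 3F → Model K₅⁻ G U ⊎ Model K₃,₃⁻ G U
      three q r s = use _ 0F λ { 0F ne → ⊥-elim (ne refl) ; 1F _ → q ; 2F _ → r ; 3F _ → s }
      cases : ∃ (λ b → T b 0F) → ∃ (λ b → T b 1F) → ∃ (λ b → T b 2F) → ∃ (λ b → T b 3F) →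
              Model K₅⁻ G U ⊎ Model K₃,₃⁻ G U
      cases (_ , _) (true , q) (true , r) (true , s) = three q r s
      cases (_ , _) (false , q) (false , r) (false , s) = three q r s
      cases (true , p) (true , q) (true , r) (false , _) = use true 3F λ { 0F _ → p ; 1F _ → q ; 2F _ → r ; 3F ne → ⊥-elim (ne refl) }
      cases (true , p) (true , q) (false , _) (true , s) = use true 2F λ { 0F _ → p ; 1F _ → q ; 3F _ → s ; 2F ne → ⊥-elim (ne refl) }
      cases (true , p) (false , _) (true , r) (true , s) = use true 1F λ { 0F _ → p ; 2F _ → r ; 3F _ → s ; 1F ne → ⊥-elim (ne refl) }
      cases (false , p) (false , q) (false , r) (true , _) = use false 3F λ { 0F _ → p ; 1F _ → q ; 2F _ → r ; 3F ne → ⊥-elim (ne refl) }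
      cases (false , p) (false , q) (true , _) (false , s) = use false 2F λ { 0F _ → p ; 1F _ → q ; 3F _ → s ; 2F ne → ⊥-elim (ne refl) }
      cases (false , p) (true , _) (false , r) (false , s) = use false 1F λ { 0F _ → p ; 2F _ → r ; 3F _ → s ; 1F ne → ⊥-elim (ne refl) }
      cases (true , p) (true , q) (false , r) (false , s) = two 0F 1F 2F 3F (λ ()) (λ ()) (λ ()) (λ ()) (λ ()) (λ ()) p q r s
      cases (true , p) (false , q) (true , r) (false , s) = two 0F 2F 1F 3F (λ ()) (λ ()) (λ ()) (λ ()) (λ ()) (λ ()) p r q s
      cases (true , p) (false , q) (false , r) (true , s) = two 0F 3F 1F 2F (λ ()) (λ ()) (λ ()) (λ ()) (λ ()) (λ ()) p s q r
      cases (false , p) (true , q) (true , r) (false , s) = two 1F 2F 0F 3F (λ ()) (λ ()) (λ ()) (λ ()) (λ ()) (λ ()) q r p s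
      cases (false , p) (true , q) (false , r) (true , s) = two 1F 3F 0F 2F (λ ()) (λ ()) (λ ()) (λ ()) (λ ()) (λ ()) q s p r
      cases (false , p) (false , q) (true , r) (true , s) = two 2F 3F 0F 1F (λ ()) (λ ()) (λ ()) (λ ()) (λ ()) (λ ()) r s p q

-- Minors and models amount to the same

module Minors where
  open Models
  open EdgeLoss

  private variable
    m n n′ : ℕ

  image : (Fin n′ → Fin n) → Subset n′ → Subset n
  image f S = sub λ w → any? λ a → a ∈? S ×-dec f a ≟ᶠ w

  module _ {f : Fin n′ → Fin n} {S : Subset n′} where
    image⁺ : ∀ {a} → a ∈ˢ S → f a ∈ˢ image f S
    image⁺ {a} a∈ = sub⁺ (λ w → any? λ a → a ∈? S ×-dec f a ≟ᶠ w) (a , a∈ , refl)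

    image⁻ : ∀ {w} → w ∈ˢ image f S → ∃ λ a → a ∈ˢ S × f a ≡ w
    image⁻ = sub⁻ λ w → any? λ a → a ∈? S ×-dec f a ≟ᶠ w

  model-embed : {K : Graph m} {G′ : Graph n′} {G : Graph n} {U′ : Subset n′} {U : Subset n}
                (f : Fin n′ → Fin n) → (∀ {a b} → f a ≡ f b → a ≡ b) →
                (∀ {a b} → Adj G′ a b → Adj G (f a) (f b)) → (∀ {a} → a ∈ˢ U′ → f a ∈ˢ U) →
                Model K G′ U′ → Model K G U
  model-embed {G′ = G′} {G} {U = U} f inj adj sub-U M = record
    { X = image f ∘ X ; inside = λ {i} v∈ → in′ i (image⁻ v∈) ; root = f ∘ root ; root∈ = λ i → image⁺ (root∈ i)
    ; conn = λ i v∈ → con i (image⁻ v∈) ; disj = λ {i} {j} p q → dj i j (image⁻ p) (image⁻ q)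
    ; link = λ a → let (u , v , u∈ , v∈ , e) = link a in f u , f v , image⁺ u∈ , image⁺ v∈ , adj e }
    where
    open Model M
    in′ : ∀ i {w} → (∃ λ a → a ∈ˢ X i × f a ≡ w) → w ∈ˢ U
    in′ i (_ , a∈ , refl) = sub-U (inside a∈)
    walk : ∀ i {a b} → Walk G′ (_∈ˢ X i) a b → Walk G (_∈ˢ image f (X i)) (f a) (f b)
    walk i (stay p)     = stay (image⁺ p)
    walk i (step p e π) = step (image⁺ p) (adj e) (walk i π)
    con : ∀ i {w} → (∃ λ a → a ∈ˢ X i × f a ≡ w) → Walk G (_∈ˢ image f (X i)) (f (root i)) w
    con i (_ , a∈ , refl) = walk i (conn i a∈)
    dj : ∀ i j {w} → (∃ λ a → a ∈ˢ X i × f a ≡ w) → (∃ λ a → a ∈ˢ X j × f a ≡ w) → i ≡ j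
    dj i j (_ , p , refl) (_ , q , eq) = disj p (subst (_∈ˢ X j) (inj eq) q)

  ≺⇒model : {H : Graph m} {G : Graph n} → H ≺ G → Model H G ⊤
  ≺⇒model {H = H} {G} (isomorphic iso) = record
    { X = ⁅_⁆ ∘ to ; inside = λ _ → ∈⊤ ; root = to ; root∈ = λ i → x∈⁅x⁆ (to i)
    ; conn = λ i → conn (rooted-⁅⁆ {G = G} {U = ⊤} {x = to i} ∈⊤)
    ; disj = λ {i} {j} p q → to-injective (trans (sym (x∈⁅y⁆⇒x≡y (to i) p)) (x∈⁅y⁆⇒x≡y (to j) q))
    ; link = λ {i} {j} a → to i , to j , x∈⁅x⁆ _ , x∈⁅x⁆ _ , Equivalence.to (adjacency i j) a }
    where
    open _≅_ iso
    open Inverse vertices using (to; from; strictlyInverseʳ)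
    open Rooted
    to-injective : ∀ {i j} → to i ≡ to j → i ≡ j
    to-injective {i} {j} eq = trans (sym (strictlyInverseʳ i)) (trans (cong from eq) (strictlyInverseʳ j))
  ≺⇒model {G = G} (delVertex v p) =
    model-embed {G = G} (punchIn v) (punchIn-injective v _ _) id (λ _ → ∈⊤) (≺⇒model p)
  ≺⇒model {G = G} (delEdge u v a p) = model-mono (λ _ _ → proj₁) id (≺⇒model p)
  -- Read along `punchIn v`, adjacency in `contractEdge G u v` is adjacency in `merge G u v`, so
  -- only the numbering changes.
  ≺⇒model {G = G} (contract u v a p) = model-merge ∈⊤ ∈⊤ a
    (model-embed {G = merge G u v} (punchIn v) (punchIn-injective v _ _)
       (λ (i≢j , e) → i≢j ∘ punchIn-injective v _ _ , e)
       (λ {w} _ → x∈p∧x≢y⇒x∈p-y ∈⊤ (punchInᵢ≢i v w)) (≺⇒model p))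

  -- e picks representatives of the fibres of φ.
  module _ {K : Graph m} {G : Graph n} {G′ : Graph n′} (M : Model K G ⊤) (e : Fin n′ → Fin n) (φ : Fin n → Fin n′)
    (φ-mem : ∀ {i w} → w ∈ˢ Model.X M i → e (φ w) ∈ˢ Model.X M i) (φ∘e : ∀ a → φ (e a) ≡ a)
    (φ-adj : ∀ {i j a b} → a ∈ˢ Model.X M i → b ∈ˢ Model.X M j → Adj G a b → φ a ≡ φ b ⊎ Adj G′ (φ a) (φ b)) where

    open Model M

    model-quotient : Model K G′ ⊤
    model-quotient = record
      { X = X′ ; inside = λ _ → ∈⊤ ; root = φ ∘ root ; root∈ = λ i → in⁺ (φ-mem (root∈ i))
      ; conn = con ; disj = λ p q → disj (in⁻ p) (in⁻ q) ; link = lk }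
      where
      X′ : Fin m → Subset n′
      X′ i = sub λ a → e a ∈? X i
      in⁺ : ∀ {i a} → e a ∈ˢ X i → a ∈ˢ X′ i
      in⁺ {i} = sub⁺ λ a → e a ∈? X i
      in⁻ : ∀ {i a} → a ∈ˢ X′ i → e a ∈ˢ X i
      in⁻ {i} = sub⁻ λ a → e a ∈? X i
      walk : ∀ {i a b} → Walk G (_∈ˢ X i) a b → Walk G′ (_∈ˢ X′ i) (φ a) (φ b)
      walk (stay p) = stay (in⁺ (φ-mem p))
      walk {i} (step p a π) with φ-adj p (walk-start π) a
      ... | inj₁ eq = subst (λ x → Walk G′ (_∈ˢ X′ i) x (φ _)) (sym eq) (walk π)
      ... | inj₂ a′ = step (in⁺ (φ-mem p)) a′ (walk π)
      con : ∀ i {v} → v ∈ˢ X′ i → Walk G′ (_∈ˢ X′ i) (φ (root i)) v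
      con i {v} v∈ = subst (Walk G′ _ _) (φ∘e v) (walk (conn i (in⁻ v∈)))
      lk : ∀ {i j} → Adj K i j → Touch G′ (X′ i) (X′ j)
      lk {i} {j} k with link k
      ... | u , v , u∈ , v∈ , a with φ-adj u∈ v∈ a
      ... | inj₂ a′ = φ u , φ v , in⁺ (φ-mem u∈) , in⁺ (φ-mem v∈) , a′
      ... | inj₁ eq = ⊥-elim (adj-irrefl K (disj (φ-mem u∈) (subst (λ x → e x ∈ˢ X j) (sym eq) (φ-mem v∈))) k)

  module _ {H : Graph m} {root : Fin m → Fin n} {index : Fin n → Fin m}
    (index-root : ∀ i → index (root i) ≡ i) (root-index : ∀ v → root (index v) ≡ v) where

    private
      -- `ps` holds the pairs still to be examined. Each edge of `G` belongs to the copy of `H` or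
      -- is still listed, so an empty list leaves an isomorphism.
      delete-others : (ps : List (Fin n × Fin n)) (G : Graph n) →
        (∀ {u v} → Adj G u v → Adj H (index u) (index v) ⊎ (u , v) ∈ˡ ps) →
        (∀ {u v} → Adj H (index u) (index v) → Adj G u v) → H ≺ G
      delete-others [] G f g = isomorphic record
        { vertices = mk↔ₛ′ root index root-index index-root
        ; adjacency = λ i j → mk⇔ (λ a → g (subst₂ (Adj H) (sym (index-root i)) (sym (index-root j)) a))
                                 (λ a → subst₂ (Adj H) (index-root i) (index-root j) ([ id , (λ ()) ]′ (f a))) }
      delete-others ((u , v) ∷ ps) G f g with adj? G u v | adj? H (index u) (index v)
      ... | yes a | no ¬h = delEdge u v a (delete-others ps (deleteEdge G u v) f′ g′)
        where
        f′ : ∀ {x y} → Adj G x y × ¬ SamePair x y u v → Adj H (index x) (index y) ⊎ (x , y) ∈ˡ ps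
        f′ (b , ¬p) with f b
        ... | inj₁ h           = inj₁ h
        ... | inj₂ (here refl) = ⊥-elim (¬p (inj₁ (refl , refl)))
        ... | inj₂ (there p)   = inj₂ p
        g′ : ∀ {x y} → Adj H (index x) (index y) → Adj G x y × ¬ SamePair x y u v
        g′ h = g h , λ { (inj₁ (refl , refl)) → ¬h h ; (inj₂ (refl , refl)) → ¬h (adj-sym H h) }
      ... | no ¬a | _ = delete-others ps G f′ g
        where
        f′ : ∀ {x y} → Adj G x y → Adj H (index x) (index y) ⊎ (x , y) ∈ˡ ps
        f′ b with f b
        ... | inj₁ h           = inj₁ h
        ... | inj₂ (here refl) = ⊥-elim (¬a b)
        ... | inj₂ (there p)   = inj₂ p
      ... | yes _ | yes h₀ = delete-others ps G f′ g
        where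
        f′ : ∀ {x y} → Adj G x y → Adj H (index x) (index y) ⊎ (x , y) ∈ˡ ps
        f′ b with f b
        ... | inj₁ h           = inj₁ h
        ... | inj₂ (here refl) = inj₁ h₀
        ... | inj₂ (there p)   = inj₂ p

    spanning⇒≺ : (G : Graph n) → (∀ {u v} → Adj H (index u) (index v) → Adj G u v) → H ≺ G
    spanning⇒≺ G = delete-others (cartesianProduct (allFin n) (allFin n)) G
      (λ {u} {v} _ → inj₂ (∈-cartesianProduct⁺ (∈-allFin u) (∈-allFin v)))

  -- The default `d` is the value at `v` itself. In a contraction it is the vertex into which `v`
  -- disappears; in a deletion no branch set contains `v`, and any vertex will do.
  punchOut-total : Fin n → (v w : Fin (suc n)) → Fin n
  punchOut-total d v w with v ≟ᶠ w
  ... | yes _  = d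
  ... | no v≢w = punchOut v≢w

  punchIn-punchOut-total : (d : Fin n) {v w : Fin (suc n)} → v ≢ w → punchIn v (punchOut-total d v w) ≡ w
  punchIn-punchOut-total d {v} {w} v≢w with v ≟ᶠ w
  ... | yes eq = contradiction eq v≢w
  ... | no ne  = punchIn-punchOut ne

  punchOut-total-self : (d : Fin n) (v : Fin (suc n)) → punchOut-total d v v ≡ d
  punchOut-total-self d v with v ≟ᶠ v
  ... | yes _ = refl
  ... | no ne = contradiction refl ne

  punchOut-total-punchIn : (d : Fin n) (v : Fin (suc n)) (a : Fin n) → punchOut-total d v (punchIn v a) ≡ a
  punchOut-total-punchIn d v a = punchIn-injective v _ _ (punchIn-punchOut-total d (λ eq → punchInᵢ≢i v a (sym eq)))

  module _ {H : Graph m} where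

    private
      Covered : {G : Graph n} → Model H G ⊤ → Fin n → Set
      Covered M v = ∃ λ i → v ∈ˢ Model.X M i

      Inner : {G : Graph n} → Model H G ⊤ → Set
      Inner {G = G} M = ∃₂ λ u v → Adj G u v × ∃ λ i → u ∈ˢ Model.X M i × v ∈ˢ Model.X M i

      covered? : {G : Graph n} (M : Model H G ⊤) (v : Fin n) → Dec (Covered M v)
      covered? M v = any? λ i → v ∈? Model.X M i

      inner? : {G : Graph n} (M : Model H G ⊤) → Dec (Inner M)
      inner? {G = G} M = any? λ u → any? λ v → adj? G u v ×-dec any? λ i → u ∈? Model.X M i ×-dec v ∈? Model.X M i

      tight : {G : Graph n} (M : Model H G ⊤) → (∀ v → Covered M v) → ¬ Inner M → H ≺ G
      tight {n = n} {G} M cov ¬inner = spanning⇒≺ {root = root} {index = index} (λ i → disj (proj₂ (cov (root i))) (root∈ i))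
          (λ v → single (proj₂ (cov v))) G
          (λ {u} {v} a → let (x , y , x∈ , y∈ , b) = link a in
            subst₂ (Adj G) (trans (sym (single x∈)) (single (proj₂ (cov u))))
                           (trans (sym (single y∈)) (single (proj₂ (cov v)))) b)
        where
        open Model M
        index : Fin n → Fin m
        index v = proj₁ (cov v)
        stuck : ∀ {i u v} → Walk G (_∈ˢ X i) u v → u ≡ v
        stuck (stay _)     = refl
        stuck (step p a π) = ⊥-elim (¬inner (_ , _ , a , _ , p , walk-start π))
        single : ∀ {i v} → v ∈ˢ X i → root i ≡ v
        single v∈ = stuck (conn _ v∈)

    model⇒≺ : ∀ {n} {G : Graph n} → Model H G ⊤ → H ≺ G
    model⇒≺ {zero} M = tight M (λ ()) λ ()
    model⇒≺ {suc n} {G} M with all? (covered? M)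
    ... | no ¬cov = delVertex v (model⇒≺ (del n G M v λ i p → ¬c (i , p)))
      where
      open Model M using (X)
      find : ∃ λ v → ¬ Covered M v
      find with any? (λ v → ¬? (covered? M v))
      ... | yes p = p
      ... | no ¬p = ⊥-elim (¬cov λ v → case covered? M v of λ { (yes c) → c ; (no ¬c) → ⊥-elim (¬p (v , ¬c)) })
      v = proj₁ find
      ¬c = proj₂ find
      del : ∀ n (G : Graph (suc n)) (M : Model H G ⊤) (v : Fin (suc n)) → (∀ i → v ∈ˢ Model.X M i → ⊥) →
            Model H (deleteVertex G v) ⊤
      -- No vertex remains as a default for `punchOut-total`. But the root of a branch set could
      -- only be the deleted vertex, so `H` has no vertices either.
      del zero G M 0F none = record
        { X = λ _ → ⊤ ; inside = λ _ → ∈⊤ ; root = nope ; root∈ = λ i → ⊥-elim (no-root i)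
        ; conn = λ i → ⊥-elim (no-root i) ; disj = λ {i} → ⊥-elim (no-root i) ; link = λ {i} → ⊥-elim (no-root i) }
        where
        no-root : Fin m → ⊥
        no-root i with Model.root M i | Model.root∈ M i
        ... | 0F | p = none i p
        nope : Fin m → Fin 0
        nope i = ⊥-elim (no-root i)
      del (suc n) G M v none = model-quotient M (punchIn v) φ
        (λ {i} w∈ → subst (_∈ˢ Model.X M i) (sym (e∘φ w∈)) w∈) (punchOut-total-punchIn 0F v)
        (λ a∈ b∈ e → inj₂ (subst₂ (Adj G) (sym (e∘φ a∈)) (sym (e∘φ b∈)) e))
        where
        φ : Fin (suc (suc n)) → Fin (suc n)
        φ = punchOut-total 0F v
        e∘φ : ∀ {i w} → w ∈ˢ Model.X M i → punchIn v (φ w) ≡ w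
        e∘φ w∈ = punchIn-punchOut-total 0F λ { refl → none _ w∈ }
    ... | yes cov with inner? M
    ... | no ¬inner = tight M cov ¬inner
    ... | yes (u , v , a , i , u∈ , v∈) = contract u v a (model⇒≺ quot)
      where
      open Model M using (X; disj)
      v≢u : v ≢ u
      v≢u refl = adj-irrefl G refl a
      d : Fin n
      d = punchOut v≢u
      φ : Fin (suc n) → Fin n
      φ = punchOut-total d v
      φv : punchIn v (φ v) ≡ u
      φv = trans (cong (punchIn v) (punchOut-total-self d v)) (punchIn-punchOut v≢u)
      e∘φ : ∀ {w} → w ≢ v → punchIn v (φ w) ≡ w
      e∘φ w≢v = punchIn-punchOut-total d (w≢v ∘ sym)
      mem : ∀ {j w} → w ∈ˢ X j → punchIn v (φ w) ∈ˢ X j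
      mem {j} {w} w∈ with w ≟ᶠ v
      ... | no w≢v = subst (_∈ˢ X j) (sym (e∘φ w≢v)) w∈
      ... | yes refl rewrite disj w∈ v∈ = subst (_∈ˢ X i) (sym φv) u∈
      adj : ∀ {x y} → Adj G x y → φ x ≡ φ y ⊎ Adj (contractEdge G u v) (φ x) (φ y)
      adj {x} {y} b with φ x ≟ᶠ φ y
      ... | yes eq = inj₁ eq
      ... | no ne with x ≟ᶠ v | y ≟ᶠ v
      ... | yes refl | yes refl = ⊥-elim (ne refl)
      ... | yes refl | no y≢v   = inj₂ (ne , inj₂ (inj₁ (φv , subst (Adj G v) (sym (e∘φ y≢v)) b)))
      ... | no x≢v   | yes refl = inj₂ (ne , inj₂ (inj₂ (φv , subst (λ z → Adj G z v) (sym (e∘φ x≢v)) b)))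
      ... | no x≢v   | no y≢v   = inj₂ (ne , inj₁ (subst₂ (Adj G) (sym (e∘φ x≢v)) (sym (e∘φ y≢v)) b))
      quot : Model H (contractEdge G u v) ⊤
      quot = model-quotient M (punchIn v) φ mem (punchOut-total-punchIn d v) (λ _ _ → adj)

-- Van Kampen's obstruction modulo 2

module VanKampen where
  open Models
  import Data.Bool.Properties as Boolₚ
  open import Relation.Binary.Definitions using (DecidableEquality)
  open import Data.Fin.Properties using (_<?_)
  import Data.List.Relation.Unary.All as All

  private variable
    m n : ℕ

  xor-swap : ∀ a b c d → (a xor b) xor (c xor d) ≡ (a xor c) xor (b xor d)
  xor-swap false false c d = refl
  xor-swap false true  false d = refl
  xor-swap false true  true  d = refl
  xor-swap true  false false d = refl
  xor-swap true  false true  d = Boolₚ.not-involutive d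
  xor-swap true  true  false d = sym (Boolₚ.not-involutive d)
  xor-swap true  true  true  d = refl

  xor-cancel : ∀ a b c → (a xor b) xor (b xor c) ≡ a xor c
  xor-cancel false false c = refl
  xor-cancel false true  c = Boolₚ.not-involutive c
  xor-cancel true  false c = refl
  xor-cancel true  true  c = refl

  xor-move : ∀ {a b c d} → a xor b ≡ c xor d → b ≡ a xor (c xor d)
  xor-move {a} {b} eq = trans (sym (trans (sym (Boolₚ.xor-assoc a a b)) (cong (_xor b) (Boolₚ.xor-same a)))) (cong (a xor_) eq)

  -- Formal sums of variables over 𝔽₂.
  module Sum₂ {V : Set} (_≟_ : DecidableEquality V) (ρ : V → Bool) where

    eval : List V → Bool
    eval []       = false
    eval (v ∷ vs) = ρ v xor eval vs

    toggle : V → List V → List V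
    toggle v [] = v ∷ []
    toggle v (w ∷ ws) with v ≟ w
    ... | yes _ = ws
    ... | no  _ = w ∷ toggle v ws

    eval-toggle : ∀ v ws → eval (toggle v ws) ≡ ρ v xor eval ws
    eval-toggle v [] = refl
    eval-toggle v (w ∷ ws) with v ≟ w
    ... | yes refl = trans (cong (_xor eval ws) (sym (Boolₚ.xor-same (ρ v)))) (Boolₚ.xor-assoc (ρ v) (ρ v) (eval ws))
    ... | no _ = begin
      ρ w xor eval (toggle v ws)  ≡⟨ cong (ρ w xor_) (eval-toggle v ws) ⟩
      ρ w xor (ρ v xor eval ws)   ≡⟨ sym (Boolₚ.xor-assoc (ρ w) (ρ v) _) ⟩
      (ρ w xor ρ v) xor eval ws   ≡⟨ cong (_xor eval ws) (Boolₚ.xor-comm (ρ w) (ρ v)) ⟩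
      (ρ v xor ρ w) xor eval ws   ≡⟨ Boolₚ.xor-assoc (ρ v) (ρ w) _ ⟩
      ρ v xor (ρ w xor eval ws)   ∎
      where open ≡-Reasoning

    reduce : List V → List V
    reduce []       = []
    reduce (v ∷ vs) = toggle v (reduce vs)

    eval-reduce : ∀ vs → eval (reduce vs) ≡ eval vs
    eval-reduce []       = refl
    eval-reduce (v ∷ vs) = trans (eval-toggle v (reduce vs)) (cong (ρ v xor_) (eval-reduce vs))

    eval-++ : ∀ vs ws → eval (vs ++ ws) ≡ eval vs xor eval ws
    eval-++ []       ws = refl
    eval-++ (v ∷ vs) ws = trans (cong (ρ v xor_) (eval-++ vs ws)) (sym (Boolₚ.xor-assoc (ρ v) _ _))

    eval-concatMap : ∀ {A : Set} (f : A → List V) {xs} → All (λ x → eval (f x) ≡ false) xs → eval (concatMap f xs) ≡ false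
    eval-concatMap f [] = refl
    eval-concatMap f {x ∷ xs} (p ∷ ps) = trans (eval-++ (f x) (concatMap f xs)) (cong₂ _xor_ p (eval-concatMap f ps))

  -- What a drawing tells about crossings modulo 2: left u v w (right u v w)
  -- counts the points where a ray from w to the left (right) meets the edge u v,
  -- and below u w says that u precedes w in the vertical order.
  record Parity (G : Graph n) : Set where
    field
      left right : Fin n → Fin n → Fin n → Bool
      below      : Fin n → Fin n → Bool
      line       : ∀ {u v w} → Adj G u v → w ≢ u → w ≢ v → left u v w xor right u v w ≡ below u w xor below v w
      cross      : ∀ {u v u′ v′} → Adj G u v → Adj G u′ v′ → u ≢ u′ → u ≢ v′ → v ≢ u′ → v ≢ v′ →
                   (left u v u′ xor left u v v′) xor (right u′ v′ u xor right u′ v′ v) ≡ false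
      below-anti : ∀ {u w} → u ≢ w → below u w xor below w u ≡ true

  module _ {G : Graph n} (𝒫 : Parity G) where
    open Parity 𝒫
    private variable
      P Q : Fin n → Set
      a b c d w : Fin n

    along : (Fin n → Fin n → Fin n → Bool) → Walk G P a b → Fin n → Bool
    along f (stay _)                     w = false
    along f (step {u = u} {v = v} _ _ π) w = f u v w xor along f π w

    -- The sum of the equations `line` over the steps telescopes.
    line-walk : (π : Walk G P a b) → ¬ P w → along left π w xor along right π w ≡ below a w xor below b w
    line-walk {a = a} {w = w} (stay _) ¬p = sym (Boolₚ.xor-same (below a w))
    line-walk {w = w} (step {u = u} {v = v} {w = z} p e π) ¬p =
      trans (xor-swap (left u v w) _ (right u v w) _)
        (trans (cong₂ _xor_ (line e (λ { refl → ¬p p }) (λ { refl → ¬p (walk-start π) })) (line-walk π ¬p))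
               (xor-cancel (below u w) (below v w) (below z w)))

    cross-edge : ∀ {u v} → Adj G u v → ¬ Q u → ¬ Q v → (ρ : Walk G Q c d) →
                 (left u v c xor left u v d) xor (along right ρ u xor along right ρ v) ≡ false
    cross-edge {c = c} {u = u} {v} e ¬u ¬v (stay _) =
      trans (Boolₚ.xor-identityʳ _) (Boolₚ.xor-same (left u v c))
    cross-edge {u = u} {v} e ¬u ¬v (step {u = c} {v = c′} {w = d} q e′ ρ) = begin
      (left u v c xor left u v d) xor ((right c c′ u xor along right ρ u) xor (right c c′ v xor along right ρ v))
        ≡⟨ cong₂ _xor_ (sym (xor-cancel (left u v c) (left u v c′) (left u v d)))
             (xor-swap (right c c′ u) (along right ρ u) (right c c′ v) (along right ρ v)) ⟩
      ((left u v c xor left u v c′) xor (left u v c′ xor left u v d)) xor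
        ((right c c′ u xor right c c′ v) xor (along right ρ u xor along right ρ v))
        ≡⟨ xor-swap (left u v c xor left u v c′) _ (right c c′ u xor right c c′ v) _ ⟩
      ((left u v c xor left u v c′) xor (right c c′ u xor right c c′ v)) xor
        ((left u v c′ xor left u v d) xor (along right ρ u xor along right ρ v))
        ≡⟨ cong₂ _xor_ (cross e e′ (λ { refl → ¬u q }) (λ { refl → ¬u (walk-start ρ) })
             (λ { refl → ¬v q }) (λ { refl → ¬v (walk-start ρ) })) (cross-edge e ¬u ¬v ρ) ⟩
      false ∎
      where open ≡-Reasoning

    -- The crossing equation is additive in either walk: the counts taken at an inner vertex enter
    -- twice and cancel. So it passes from edges to paths between branch sets.
    cross-walk : (∀ {v} → P v → Q v → ⊥) → (π : Walk G P a b) (ρ : Walk G Q c d) →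
                 (along left π c xor along left π d) xor (along right ρ a xor along right ρ b) ≡ false
    cross-walk {a = a} dj (stay p) ρ = Boolₚ.xor-same (along right ρ a)
    cross-walk {b = b} {c = c} {d = d} dj (step {u = u} {v = v} p e π) ρ = begin
      ((left u v c xor along left π c) xor (left u v d xor along left π d)) xor (along right ρ u xor along right ρ b)
        ≡⟨ cong₂ _xor_ (xor-swap (left u v c) (along left π c) (left u v d) (along left π d))
             (sym (xor-cancel (along right ρ u) (along right ρ v) (along right ρ b))) ⟩
      ((left u v c xor left u v d) xor (along left π c xor along left π d)) xor
        ((along right ρ u xor along right ρ v) xor (along right ρ v xor along right ρ b))
        ≡⟨ xor-swap (left u v c xor left u v d) _ (along right ρ u xor along right ρ v) _ ⟩
      ((left u v c xor left u v d) xor (along right ρ u xor along right ρ v)) xor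
        ((along left π c xor along left π d) xor (along right ρ v xor along right ρ b))
        ≡⟨ cong₂ _xor_ (cross-edge e (dj p) (dj (walk-start π)) ρ) (cross-walk dj π ρ) ⟩
      false ∎
      where open ≡-Reasoning

  data Var (m : ℕ) : Set where
    one  : Var m
    side : Fin m → Fin m → Fin m → Var m
    over : Fin m → Fin m → Var m

  _≟ᵛ_ : DecidableEquality (Var m)
  one ≟ᵛ one = yes refl
  one ≟ᵛ side _ _ _ = no λ ()
  one ≟ᵛ over _ _ = no λ ()
  side _ _ _ ≟ᵛ one = no λ ()
  side i j k ≟ᵛ side i′ j′ k′ = map′ (λ { (refl , refl , refl) → refl }) (λ { refl → refl , refl , refl })
    (i ≟ᶠ i′ ×-dec j ≟ᶠ j′ ×-dec k ≟ᶠ k′)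
  side _ _ _ ≟ᵛ over _ _ = no λ ()
  over _ _ ≟ᵛ one = no λ ()
  over _ _ ≟ᵛ side _ _ _ = no λ ()
  over i j ≟ᵛ over i′ j′ = map′ (λ { (refl , refl) → refl }) (λ { refl → refl , refl }) (i ≟ᶠ i′ ×-dec j ≟ᶠ j′)

  Quad : ℕ → Set
  Quad m = Fin m × Fin m × Fin m × Fin m

  -- By antisymmetry of `below`, a comparison is a variable in one order and one plus this variable
  -- in the other. The ones arising here are what survives in the contradiction.
  over± : Fin m → Fin m → List (Var m)
  over± i j with i <? j
  ... | yes _ = over i j ∷ []
  ... | no _  = one ∷ over j i ∷ []

  -- The crossing equation of the independent edges `i j` and `k l`, with the right counts of `k l`
  -- eliminated by means of `line`.
  terms : Quad m → List (Var m)
  terms (i , j , k , l) = side i j k ∷ side i j l ∷ side k l i ∷ side k l j ∷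
    over± k i ++ over± l i ++ over± k j ++ over± l j

  Independent : Graph m → Quad m → Set
  Independent K (i , j , k , l) = Adj K i j × Adj K k l × i ≢ k × i ≢ l × j ≢ k × j ≢ l

  independent? : (K : Graph m) → Decidable (Independent K)
  independent? K (i , j , k , l) =
    adj? K i j ×-dec adj? K k l ×-dec ¬? (i ≟ᶠ k) ×-dec ¬? (i ≟ᶠ l) ×-dec ¬? (j ≟ᶠ k) ×-dec ¬? (j ≟ᶠ l)

  -- Van Kampen's argument: the crossing equations of all pairs of independent
  -- edges of K add up to 1 = 0.
  module VanKampen {K : Graph m} (qs : List (Quad m)) (ind : All (Independent K) qs)
    (odd : Sum₂.reduce _≟ᵛ_ (const false) (concatMap terms qs) ≡ one ∷ []) where

    nonplanar : {G : Graph n} {U : Subset n} → Parity G → Model K G U → ⊥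
    nonplanar {G = G} 𝒫 M = contradiction (trans (sym total) (eval-concatMap terms (all-eqs qs ind))) λ ()
      where
      open Parity 𝒫
      open Model M
      Pair : Fin m → Fin m → Fin _ → Set
      Pair i j v = v ∈ˢ X i ⊎ v ∈ˢ X j
      path : ∀ {i j} → Adj K i j → Walk G (Pair i j) (root i) (root j)
      path {i} {j} a with link a
      ... | u , v , u∈ , v∈ , e = walk-map inj₁ (conn i u∈) ++ʷ step (inj₁ u∈) e (walk-map inj₂ (walk-rev (conn j v∈)))
      L : Fin m → Fin m → Fin m → Bool
      L i j k with adj? K i j
      ... | yes a = along 𝒫 left (path a) (root k)
      ... | no _  = false
      R : Fin m → Fin m → Fin m → Bool
      R i j k with adj? K i j
      ... | yes a = along 𝒫 right (path a) (root k)
      ... | no _  = false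
      H : Fin m → Fin m → Bool
      H i j = below (root i) (root j)
      ρ : Var m → Bool
      ρ one          = true
      ρ (side i j k) = L i j k
      ρ (over i j)   = H i j
      open Sum₂ _≟ᵛ_ ρ
      -- Cancellation is symbolic, so the closed computation `odd`, made with a constant valuation,
      -- serves the valuation by counts too.
      reduce-any : ∀ {σ : Var m → Bool} vs → Sum₂.reduce _≟ᵛ_ σ vs ≡ reduce vs
      reduce-any [] = refl
      reduce-any {σ} (v ∷ vs) = trans (toggle-any v (Sum₂.reduce _≟ᵛ_ σ vs)) (cong (toggle v) (reduce-any {σ} vs))
        where
        toggle-any : ∀ v ws → Sum₂.toggle _≟ᵛ_ σ v ws ≡ toggle v ws
        toggle-any v [] = refl
        toggle-any v (w ∷ ws) with v ≟ᵛ w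
        ... | yes _ = refl
        ... | no _  = cong (w ∷_) (toggle-any v ws)
      total : eval (concatMap terms qs) ≡ true
      total = trans (sym (eval-reduce (concatMap terms qs)))
        (cong eval (trans (sym (reduce-any {const false} (concatMap terms qs))) odd))
      root≢ : ∀ {i j} → i ≢ j → root i ≢ root j
      root≢ {i} {j} ne eq = ne (disj (root∈ i) (subst (_∈ˢ X j) (sym eq) (root∈ j)))
      out : ∀ {i j k} → i ≢ k → j ≢ k → ¬ Pair i j (root k)
      out {k = k} ne _ (inj₁ p) = ne (disj p (root∈ k))
      out {k = k} _ ne (inj₂ p) = ne (disj p (root∈ k))
      eval-over± : ∀ {i j} → i ≢ j → eval (over± i j) ≡ H i j
      eval-over± {i} {j} ne with i <? j
      ... | yes _ = Boolₚ.xor-identityʳ _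
      ... | no _ = trans (cong not (Boolₚ.xor-identityʳ (H j i)))
        (trans (cong (_xor H j i) (sym (below-anti (root≢ ne))))
          (trans (Boolₚ.xor-assoc (H i j) (H j i) (H j i)) (trans (cong (H i j xor_) (Boolₚ.xor-same (H j i))) (Boolₚ.xor-identityʳ _))))
      LR : ∀ {i j k} → Adj K i j → i ≢ k → j ≢ k → R i j k ≡ L i j k xor (H i k xor H j k)
      LR {i} {j} {k} a ik jk with adj? K i j
      ... | yes a′ = xor-move {along 𝒫 left (path a′) (root k)} {c = H i k} {H j k} (line-walk 𝒫 (path a′) (out ik jk))
      ... | no ¬a  = contradiction a ¬a
      LR-cross : ∀ {i j k l} → Independent K (i , j , k , l) → (L i j k xor L i j l) xor (R k l i xor R k l j) ≡ false
      LR-cross {i} {j} {k} {l} (a , b , ik , il , jk , jl) with adj? K i j | adj? K k l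
      ... | yes a′ | yes b′ = cross-walk 𝒫 dj (path a′) (path b′)
        where
        dj : ∀ {v} → Pair i j v → Pair k l v → ⊥
        dj (inj₁ p) (inj₁ q) = ik (disj p q)
        dj (inj₁ p) (inj₂ q) = il (disj p q)
        dj (inj₂ p) (inj₁ q) = jk (disj p q)
        dj (inj₂ p) (inj₂ q) = jl (disj p q)
      ... | no ¬a | _     = contradiction a ¬a
      ... | _     | no ¬b = contradiction b ¬b
      eq : ∀ {q} → Independent K q → eval (terms q) ≡ false
      eq {i , j , k , l} h@(a , b , ik , il , jk , jl) = begin
        L i j k xor (L i j l xor (L k l i xor (L k l j xor eval (over± k i ++ over± l i ++ over± k j ++ over± l j))))
          ≡⟨ cong (λ z → L i j k xor (L i j l xor (L k l i xor (L k l j xor z)))) overs ⟩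
        L i j k xor (L i j l xor (L k l i xor (L k l j xor ((H k i xor H l i) xor (H k j xor H l j)))))
          ≡⟨ shuffle (L i j k) (L i j l) (L k l i) (L k l j) (H k i xor H l i) (H k j xor H l j) ⟩
        (L i j k xor L i j l) xor ((L k l i xor (H k i xor H l i)) xor (L k l j xor (H k j xor H l j)))
          ≡⟨ cong ((L i j k xor L i j l) xor_) (cong₂ _xor_ (sym (LR b (ik ∘ sym) (il ∘ sym))) (sym (LR b (jk ∘ sym) (jl ∘ sym)))) ⟩
        (L i j k xor L i j l) xor (R k l i xor R k l j)
          ≡⟨ LR-cross h ⟩
        false ∎
        where
        open ≡-Reasoning
        overs : eval (over± k i ++ over± l i ++ over± k j ++ over± l j) ≡ (H k i xor H l i) xor (H k j xor H l j)
        overs = trans (eval-++ (over± k i) _) (trans (cong₂ _xor_ (eval-over± (ik ∘ sym))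
          (trans (eval-++ (over± l i) _) (cong₂ _xor_ (eval-over± (il ∘ sym))
          (trans (eval-++ (over± k j) _) (cong₂ _xor_ (eval-over± (jk ∘ sym)) (eval-over± (jl ∘ sym)))))))
          (sym (Boolₚ.xor-assoc (H k i) (H l i) _)))
        shuffle : ∀ a b c d e f → a xor (b xor (c xor (d xor (e xor f)))) ≡ (a xor b) xor ((c xor e) xor (d xor f))
        shuffle a b c d e f = trans (sym (Boolₚ.xor-assoc a b _)) (cong ((a xor b) xor_)
          (trans (sym (Boolₚ.xor-assoc c d _)) (xor-swap c d e f)))
      all-eqs : ∀ qs → All (Independent K) qs → All (λ q → eval (terms q) ≡ false) qs
      all-eqs [] [] = []
      all-eqs (q ∷ qs) (p ∷ ps) = eq p ∷ all-eqs qs ps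

  -- All fifteen pairs of disjoint edges. An edge and a vertex off it occur together in two of the
  -- pairs, and two given vertices lie on different edges of six pairs; so every variable cancels in
  -- the sum. For the eighteen pairs of `K₃,₃` these numbers are two, and six or four.
  K₅-pairs : List (Quad 5)
  K₅-pairs =
    (0F , 1F , 2F , 3F) ∷ (0F , 1F , 2F , 4F) ∷ (0F , 1F , 3F , 4F) ∷
    (0F , 2F , 1F , 3F) ∷ (0F , 2F , 1F , 4F) ∷ (0F , 2F , 3F , 4F) ∷
    (0F , 3F , 1F , 2F) ∷ (0F , 3F , 1F , 4F) ∷ (0F , 3F , 2F , 4F) ∷
    (0F , 4F , 1F , 2F) ∷ (0F , 4F , 1F , 3F) ∷ (0F , 4F , 2F , 3F) ∷
    (1F , 2F , 3F , 4F) ∷ (1F , 3F , 2F , 4F) ∷ (1F , 4F , 2F , 3F) ∷ []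

  K₃₃-pairs : List (Quad 6)
  K₃₃-pairs =
    (0F , 3F , 1F , 4F) ∷ (0F , 3F , 1F , 5F) ∷ (0F , 3F , 2F , 4F) ∷ (0F , 3F , 2F , 5F) ∷
    (0F , 4F , 1F , 3F) ∷ (0F , 4F , 1F , 5F) ∷ (0F , 4F , 2F , 3F) ∷ (0F , 4F , 2F , 5F) ∷
    (0F , 5F , 1F , 3F) ∷ (0F , 5F , 1F , 4F) ∷ (0F , 5F , 2F , 3F) ∷ (0F , 5F , 2F , 4F) ∷
    (1F , 3F , 2F , 4F) ∷ (1F , 3F , 2F , 5F) ∷ (1F , 4F , 2F , 3F) ∷ (1F , 4F , 2F , 5F) ∷
    (1F , 5F , 2F , 3F) ∷ (1F , 5F , 2F , 4F) ∷ []

  K₅-nonplanar : {G : Graph n} {U : Subset n} → Parity G → Model (complete 5) G U → ⊥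
  K₅-nonplanar = VanKampen.nonplanar {K = complete 5} K₅-pairs (from-yes (All.all? (independent? (complete 5)) K₅-pairs)) refl

  K₃₃-nonplanar : {G : Graph n} {U : Subset n} → Parity G → Model (completeBipartite 3 3) G U → ⊥
  K₃₃-nonplanar = VanKampen.nonplanar {K = completeBipartite 3 3} K₃₃-pairs
    (from-yes (All.all? (independent? (completeBipartite 3 3)) K₃₃-pairs)) refl

-- Crossings of segments counted along horizontal rays

module SegmentParity where
  import Data.Bool.Properties as Boolₚ
  open import Data.Bool.Base using (_∧_)
  open import Data.Rational.Base using (ℚ; 0ℚ; 1ℚ; _+_; _*_; -_; 1/_) renaming (_-_ to _⊖_; _<_ to _<ᵣ_; _≤_ to _≤ᵣ_)
  import Data.Rational.Base as ℚ
  import Data.Rational.Properties as ℚₚ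
  open import Tactic.RingSolver.Core.AlmostCommutativeRing using (AlmostCommutativeRing; fromCommutativeRing)
  open import Tactic.RingSolver using (solve-∀)
  open import Data.Maybe.Base using (Maybe; just; nothing)
  open import Level using (0ℓ)

  private variable
    n : ℕ

  ℚ-ring : AlmostCommutativeRing 0ℓ 0ℓ
  ℚ-ring = fromCommutativeRing ℚₚ.+-*-commutativeRing zero?
    where
    zero? : ∀ x → Maybe (0ℚ ≡ x)
    zero? x with 0ℚ ℚₚ.≟ x
    ... | yes p = just p
    ... | no _  = nothing

  0<* : ∀ {a b} → 0ℚ <ᵣ a → 0ℚ <ᵣ b → 0ℚ <ᵣ a * b
  0<* {a} {b} p q = subst (_<ᵣ a * b) (ℚₚ.*-zeroʳ a) (ℚₚ.*-monoʳ-<-pos a {{ℚ.positive p}} q)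

  0<+ : ∀ {a b} → 0ℚ <ᵣ a → 0ℚ <ᵣ b → 0ℚ <ᵣ a + b
  0<+ p q = ℚₚ.+-mono-< p q

  0≤* : ∀ {a b} → 0ℚ ≤ᵣ a → 0ℚ ≤ᵣ b → 0ℚ ≤ᵣ a * b
  0≤* {a} {b} p q = subst (_≤ᵣ a * b) (ℚₚ.*-zeroʳ a) (ℚₚ.*-monoˡ-≤-nonNeg a {{ℚ.nonNegative p}} q)

  neg-< : ∀ {a} → a <ᵣ 0ℚ → 0ℚ <ᵣ - a
  neg-< p = ℚₚ.neg-antimono-< p

  neg-neg : ∀ a → a ≡ - (- a)
  neg-neg = solve-∀ ℚ-ring

  0<⊖ : ∀ {a b} → a <ᵣ b → 0ℚ <ᵣ b ⊖ a
  0<⊖ {a} {b} p = subst (_<ᵣ b ⊖ a) (ℚₚ.+-inverseʳ a) (ℚₚ.+-monoˡ-< (- a) p)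

  0≤⊖ : ∀ {a b} → a ≤ᵣ b → 0ℚ ≤ᵣ b ⊖ a
  0≤⊖ {a} {b} p = subst (_≤ᵣ b ⊖ a) (ℚₚ.+-inverseʳ a) (ℚₚ.+-monoˡ-≤ (- a) p)

  ≡⇒⊖ : ∀ {a b} → a ≡ b → 0ℚ ≡ b ⊖ a
  ≡⇒⊖ {a} refl = sym (ℚₚ.+-inverseʳ a)

  ≤-cases : ∀ {a} → 0ℚ ≤ᵣ a → 0ℚ ≡ a ⊎ 0ℚ <ᵣ a
  ≤-cases {a} p with ℚₚ.<-cmp 0ℚ a
  ... | tri< l _ _ = inj₂ l
  ... | tri≈ _ e _ = inj₁ e
  ... | tri> _ _ g = ⊥-elim (ℚₚ.<-irrefl refl (ℚₚ.≤-<-trans p g))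

  -- The order of the plane by height, ties being broken from left to right; it
  -- is the order of heights after an infinitesimal rotation.
  infix 4 _⊏_
  _⊏_ : Point → Point → Set
  p ⊏ q = y-coord p <ᵣ y-coord q ⊎ (y-coord p ≡ y-coord q × x-coord p <ᵣ x-coord q)

  record Pos (x y : ℚ) : Set where
    constructor pos⁺
    field isPos : 0ℚ <ᵣ y ⊎ (0ℚ ≡ y × 0ℚ <ᵣ x)

  Nonneg : ℚ → ℚ → Set
  Nonneg x y = (0ℚ ≡ x × 0ℚ ≡ y) ⊎ Pos x y

  ⊏⇒Pos : ∀ {p q} → p ⊏ q → Pos (x-coord q ⊖ x-coord p) (y-coord q ⊖ y-coord p)
  ⊏⇒Pos (inj₁ l)       = pos⁺ (inj₁ (0<⊖ l))
  ⊏⇒Pos (inj₂ (e , l)) = pos⁺ (inj₂ (≡⇒⊖ e , 0<⊖ l))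

  Pos-+ : ∀ {x y x′ y′} → Pos x y → Nonneg x′ y′ → Pos (x + x′) (y + y′)
  Pos-+ {x} {y} p (inj₁ (refl , refl)) = subst₂ Pos (sym (ℚₚ.+-identityʳ x)) (sym (ℚₚ.+-identityʳ y)) p
  Pos-+ (pos⁺ (inj₁ l)) (inj₂ (pos⁺ (inj₁ l′))) = pos⁺ (inj₁ (0<+ l l′))
  Pos-+ {y = y} (pos⁺ (inj₁ l)) (inj₂ (pos⁺ (inj₂ (refl , _)))) = pos⁺ (inj₁ (subst (0ℚ <ᵣ_) (sym (ℚₚ.+-identityʳ y)) l))
  Pos-+ {y′ = y′} (pos⁺ (inj₂ (refl , _))) (inj₂ (pos⁺ (inj₁ l′))) = pos⁺ (inj₁ (subst (0ℚ <ᵣ_) (sym (ℚₚ.+-identityˡ y′)) l′))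
  Pos-+ (pos⁺ (inj₂ (refl , l))) (inj₂ (pos⁺ (inj₂ (refl , l′)))) = pos⁺ (inj₂ (refl , 0<+ l l′))

  Pos-* : ∀ {a x y} → 0ℚ <ᵣ a → Pos x y → Pos (a * x) (a * y)
  Pos-* p (pos⁺ (inj₁ l)) = pos⁺ (inj₁ (0<* p l))
  Pos-* {a} p (pos⁺ (inj₂ (refl , l))) = pos⁺ (inj₂ (sym (ℚₚ.*-zeroʳ a) , 0<* p l))

  Nonneg-* : ∀ {a x y} → 0ℚ ≤ᵣ a → Pos x y → Nonneg (a * x) (a * y)
  Nonneg-* {a} {x} {y} p v with ≤-cases p
  ... | inj₁ refl = inj₁ (sym (ℚₚ.*-zeroˡ x) , sym (ℚₚ.*-zeroˡ y))
  ... | inj₂ l    = inj₂ (Pos-* l v)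

  ¬Pos-0 : ¬ Pos 0ℚ 0ℚ
  ¬Pos-0 (pos⁺ (inj₁ l))       = ℚₚ.<-irrefl refl l
  ¬Pos-0 (pos⁺ (inj₂ (_ , l))) = ℚₚ.<-irrefl refl l

  -- The vectors that point upwards in the order `_⊏_` form a convex cone without the origin. The
  -- sign lemmas for four ordered points are reduced to this.
  combination : ∀ {a b c ux uy vx vy wx wy} → 0ℚ <ᵣ a → 0ℚ ≤ᵣ b → 0ℚ ≤ᵣ c → Pos ux uy → Pos vx vy → Pos wx wy →
                a * ux + b * vx + c * wx ≡ 0ℚ → a * uy + b * vy + c * wy ≡ 0ℚ → ⊥
  combination p q r u v w ex ey =
    ¬Pos-0 (subst₂ Pos ex ey (Pos-+ (Pos-+ (Pos-* p u) (Nonneg-* q v)) (Nonneg-* r w)))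

  ⊏-trans : ∀ {p q r} → p ⊏ q → q ⊏ r → p ⊏ r
  ⊏-trans (inj₁ l) (inj₁ l′) = inj₁ (ℚₚ.<-trans l l′)
  ⊏-trans (inj₁ l) (inj₂ (e , _)) = inj₁ (subst (_ <ᵣ_) e l)
  ⊏-trans (inj₂ (e , _)) (inj₁ l′) = inj₁ (subst (_<ᵣ _) (sym e) l′)
  ⊏-trans (inj₂ (e , l)) (inj₂ (e′ , l′)) = inj₂ (trans e e′ , ℚₚ.<-trans l l′)

  ⊏-asym : ∀ {p q} → p ⊏ q → q ⊏ p → ⊥
  ⊏-asym (inj₁ l) (inj₁ l′) = ℚₚ.<-asym l l′
  ⊏-asym (inj₁ l) (inj₂ (e , _)) = ℚₚ.<-irrefl (sym e) l
  ⊏-asym (inj₂ (e , _)) (inj₁ l′) = ℚₚ.<-irrefl (sym e) l′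
  ⊏-asym (inj₂ (e , l)) (inj₂ (e′ , l′)) = ℚₚ.<-asym l l′

  data Cmp (p q : Point) : Set where
    lt : p ⊏ q → Cmp p q
    eq : p ≡ q → Cmp p q
    gt : q ⊏ p → Cmp p q

  abstract
    cmp : ∀ p q → Cmp p q
    cmp ⟨ a , b ⟩ ⟨ c , d ⟩ with ℚₚ.<-cmp b d
    ... | tri< l _ _ = lt (inj₁ l)
    ... | tri> _ _ g = gt (inj₁ g)
    ... | tri≈ _ e _ with ℚₚ.<-cmp a c
    ... | tri< l _ _ = lt (inj₂ (e , l))
    ... | tri> _ _ g = gt (inj₂ (sym e , g))
    ... | tri≈ _ f _ = eq (cong₂ ⟨_,_⟩ f e)

  abstract
    _⊏ᵇ_ : Point → Point → Bool
    p ⊏ᵇ q with cmp p q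
    ... | lt _ = true
    ... | eq _ = false
    ... | gt _ = false

    ⊏ᵇ-true : ∀ {p q} → p ⊏ q → p ⊏ᵇ q ≡ true
    ⊏ᵇ-true {p} {q} l with cmp p q
    ... | lt _    = refl
    ... | eq refl = ⊥-elim (⊏-asym l l)
    ... | gt g    = ⊥-elim (⊏-asym l g)

    ⊏ᵇ-false : ∀ {p q} → q ⊏ p → p ⊏ᵇ q ≡ false
    ⊏ᵇ-false {p} {q} g with cmp p q
    ... | lt l = ⊥-elim (⊏-asym l g)
    ... | eq _ = refl
    ... | gt _ = refl

  abstract
    -- Twice the signed area of the triangle. If the second point lies above the first, a negative
    -- value means that the third is to the right of the line through them.
    det : Point → Point → Point → ℚ
    det ⟨ ax , ay ⟩ ⟨ bx , by ⟩ ⟨ cx , cy ⟩ = (bx ⊖ ax) * (cy ⊖ ay) ⊖ (by ⊖ ay) * (cx ⊖ ax)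

  end₀ : ∀ p q → p ∈[ p , q ]
  end₀ ⟨ px , py ⟩ ⟨ qx , qy ⟩ = 0ℚ , ℚₚ.≤-refl , ℚₚ.<⇒≤ (from-yes (0ℚ ℚₚ.<? 1ℚ)) , eqn px qx , eqn py qy
    where
    eqn : ∀ a b → a ≡ (1ℚ ⊖ 0ℚ) * a + 0ℚ * b
    eqn = solve-∀ ℚ-ring

  end₁ : ∀ p q → q ∈[ p , q ]
  end₁ ⟨ px , py ⟩ ⟨ qx , qy ⟩ = 1ℚ , ℚₚ.<⇒≤ (from-yes (0ℚ ℚₚ.<? 1ℚ)) , ℚₚ.≤-refl , eqn px qx , eqn py qy
    where
    eqn : ∀ a b → b ≡ (1ℚ ⊖ 1ℚ) * a + 1ℚ * b
    eqn = solve-∀ ℚ-ring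

  ∈[]-swap : ∀ {z p q} → z ∈[ p , q ] → z ∈[ q , p ]
  ∈[]-swap {⟨ zx , zy ⟩} {⟨ px , py ⟩} {⟨ qx , qy ⟩} (t , 0≤t , t≤1 , ex , ey) =
    1ℚ ⊖ t , 0≤⊖ t≤1 , le , trans ex (eqn t px qx) , trans ey (eqn t py qy)
    where
    eqn : ∀ t a b → (1ℚ ⊖ t) * a + t * b ≡ (1ℚ ⊖ (1ℚ ⊖ t)) * b + (1ℚ ⊖ t) * a
    eqn = solve-∀ ℚ-ring
    le : 1ℚ ⊖ t ≤ᵣ 1ℚ
    le = subst (1ℚ ⊖ t ≤ᵣ_) (ℚₚ.+-identityʳ 1ℚ) (ℚₚ.+-monoʳ-≤ 1ℚ (ℚₚ.neg-antimono-≤ 0≤t))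

  -- A point of weight a at p and b at q, for total weight a + b = s > 0.
  weighted : ∀ {a b s} → 0ℚ ≤ᵣ a → 0ℚ ≤ᵣ b → a + b ≡ s → (s>0 : 0ℚ <ᵣ s) → ∀ p q z →
             s * x-coord z ≡ a * x-coord p + b * x-coord q → s * y-coord z ≡ a * y-coord p + b * y-coord q → z ∈[ p , q ]
  weighted {a} {b} {s} 0≤a 0≤b refl s>0 ⟨ px , py ⟩ ⟨ qx , qy ⟩ ⟨ zx , zy ⟩ ex ey =
    b * i , 0≤* 0≤b 0≤i , le , coord px qx zx ex , coord py qy zy ey
    where
    instance
      s-pos : ℚ.Positive s
      s-pos = ℚ.positive s>0
      s-nz : ℚ.NonZero s
      s-nz = ℚₚ.pos⇒nonZero s
    i : ℚ
    i = 1/ s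
    si : s * i ≡ 1ℚ
    si = ℚₚ.*-inverseʳ s
    0≤i : 0ℚ ≤ᵣ i
    0≤i = ℚₚ.<⇒≤ (ℚₚ.positive⁻¹ i {{ℚₚ.1/pos⇒pos s}})
    le : b * i ≤ᵣ 1ℚ
    le = subst (b * i ≤ᵣ_) si (ℚₚ.*-monoʳ-≤-nonNeg i {{ℚ.nonNegative 0≤i}}
      (subst (_≤ᵣ s) (ℚₚ.+-identityˡ b) (ℚₚ.+-monoˡ-≤ b 0≤a)))
    r₁ : ∀ s i z → (s * i) * z ≡ i * (s * z)
    r₁ = solve-∀ ℚ-ring
    r₂ : ∀ a b i p q → i * (a * p + b * q) ≡ ((a + b) * i ⊖ b * i) * p + b * i * q
    r₂ = solve-∀ ℚ-ring
    coord : ∀ p q z → s * z ≡ a * p + b * q → z ≡ (1ℚ ⊖ b * i) * p + b * i * q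
    coord p q z e = begin
      z                                    ≡⟨ sym (ℚₚ.*-identityˡ z) ⟩
      1ℚ * z                               ≡⟨ cong (_* z) (sym si) ⟩
      (s * i) * z                          ≡⟨ r₁ s i z ⟩
      i * (s * z)                          ≡⟨ cong (i *_) e ⟩
      i * (a * p + b * q)                  ≡⟨ r₂ a b i p q ⟩
      (s * i ⊖ b * i) * p + b * i * q      ≡⟨ cong (λ u → (u ⊖ b * i) * p + b * i * q) si ⟩
      (1ℚ ⊖ b * i) * p + b * i * q         ∎
      where open ≡-Reasoning

  Meet : Point → Point → Point → Point → Set
  Meet p q z w = ∃ λ u → u ∈[ p , q ] × u ∈[ z , w ]

  meet : ∀ {a b c d} p q z w → 0ℚ ≤ᵣ a → 0ℚ ≤ᵣ c → 0ℚ ≤ᵣ b → 0ℚ ≤ᵣ d → a + c ≡ b + d → 0ℚ <ᵣ a + c →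
         a * x-coord p + c * x-coord q ≡ b * x-coord z + d * x-coord w →
         a * y-coord p + c * y-coord q ≡ b * y-coord z + d * y-coord w → Meet p q z w
  meet {a} {b} {c} {d} p q z w 0≤a 0≤c 0≤b 0≤d e s>0 ex ey =
    ⟨ i * X , i * Y ⟩ , weighted 0≤a 0≤c refl s>0 p q _ (r X) (r Y) ,
    weighted 0≤b 0≤d (sym e) s>0 z w _ (trans (r X) ex) (trans (r Y) ey)
    where
    X Y i : ℚ
    X = a * x-coord p + c * x-coord q
    Y = a * y-coord p + c * y-coord q
    instance
      s-nz : ℚ.NonZero (a + c)
      s-nz = ℚₚ.pos⇒nonZero (a + c) {{ℚ.positive s>0}}
    i = 1/ (a + c)
    r : ∀ Z → (a + c) * (i * Z) ≡ Z
    r Z = trans (sym (ℚₚ.*-assoc (a + c) i Z)) (trans (cong (_* Z) (ℚₚ.*-inverseʳ (a + c))) (ℚₚ.*-identityˡ Z))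

  -- An affine dependence of a ⊏ b ⊏ c ⊏ d.
  record Dep (A B C D : ℚ) (a b c d : Point) : Set where
    constructor dep
    field
      sums   : A + C ≡ B + D
      x-eqn  : A * x-coord a + C * x-coord c ≡ B * x-coord b + D * x-coord d
      y-eqn  : A * y-coord a + C * y-coord c ≡ B * y-coord b + D * y-coord d

  ≥-by : ∀ {a} → ¬ a <ᵣ 0ℚ → 0ℚ ≤ᵣ a
  ≥-by ¬p = ℚₚ.≮⇒≥ ¬p

  -- With one of the four points as origin, a negative `B` or `C` would express zero as a
  -- combination, of the kind excluded by `combination`, of differences that point upwards. The
  -- origins are `a`, `b` and `d` in `r₁`, `r₂` and `r₃`.
  interlaced-dep : ∀ {A B C D a b c d} → a ⊏ b → b ⊏ c → c ⊏ d → Dep A B C D a b c d →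
                   0ℚ <ᵣ A → 0ℚ <ᵣ D → 0ℚ ≤ᵣ B × 0ℚ ≤ᵣ C
  interlaced-dep {A} {B} {C} {D} {a} {b} {c} {d} ab bc cd (dep e ex ey) A>0 D>0 = ≥-by ¬B<0 , ≥-by ¬C<0
    where
    P : ∀ {p q} → p ⊏ q → Pos (x-coord q ⊖ x-coord p) (y-coord q ⊖ y-coord p)
    P = ⊏⇒Pos
    ac = ⊏-trans ab bc
    bd = ⊏-trans bc cd
    ad = ⊏-trans ab bd
    r₁ : ∀ A B C D a b c d → A + C ≡ B + D → A * a + C * c ≡ B * b + D * d →
         D * (d ⊖ a) + B * (b ⊖ a) + (- C) * (c ⊖ a) ≡ 0ℚ
    r₁ A B C D a b c d e f = trans (i₁ B C D a b c d) (trans (cong₂ (λ u v → u ⊖ C * c ⊖ (v ⊖ C) * a) (sym f) (sym e)) (i₂ A C a c))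
      where
      i₁ : ∀ B C D a b c d → D * (d ⊖ a) + B * (b ⊖ a) + (- C) * (c ⊖ a) ≡ (B * b + D * d) ⊖ C * c ⊖ ((B + D) ⊖ C) * a
      i₁ = solve-∀ ℚ-ring
      i₂ : ∀ A C a c → (A * a + C * c) ⊖ C * c ⊖ ((A + C) ⊖ C) * a ≡ 0ℚ
      i₂ = solve-∀ ℚ-ring
    r₂ : ∀ A B C D a b c d → A + C ≡ B + D → A * a + C * c ≡ B * b + D * d →
         A * (b ⊖ a) + (- C) * (c ⊖ b) + D * (d ⊖ b) ≡ 0ℚ
    r₂ A B C D a b c d e f = trans (i₁ A C D a b c d) (trans (cong₂ (λ u v → D * d ⊖ u + (v ⊖ D) * b) f e) (i₂ B D b d))
      where
      i₁ : ∀ A C D a b c d → A * (b ⊖ a) + (- C) * (c ⊖ b) + D * (d ⊖ b) ≡ D * d ⊖ (A * a + C * c) + ((A + C) ⊖ D) * b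
      i₁ = solve-∀ ℚ-ring
      i₂ : ∀ B D b d → D * d ⊖ (B * b + D * d) + ((B + D) ⊖ D) * b ≡ 0ℚ
      i₂ = solve-∀ ℚ-ring
    r₃ : ∀ A B C D a b c d → A + C ≡ B + D → A * a + C * c ≡ B * b + D * d →
         A * (d ⊖ a) + (- B) * (d ⊖ b) + C * (d ⊖ c) ≡ 0ℚ
    r₃ A B C D a b c d e f = trans (i₁ A B C a b c d) (trans (cong₂ (λ u v → (v ⊖ B) * d ⊖ u + B * b) f e) (i₂ B D b d))
      where
      i₁ : ∀ A B C a b c d → A * (d ⊖ a) + (- B) * (d ⊖ b) + C * (d ⊖ c) ≡ ((A + C) ⊖ B) * d ⊖ (A * a + C * c) + B * b
      i₁ = solve-∀ ℚ-ring
      i₂ : ∀ B D b d → ((B + D) ⊖ B) * d ⊖ (B * b + D * d) + B * b ≡ 0ℚ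
      i₂ = solve-∀ ℚ-ring
    ¬C<0 : ¬ C <ᵣ 0ℚ
    ¬C<0 C<0 with B ℚₚ.<? 0ℚ
    ... | no B≮0 = combination D>0 (≥-by B≮0) (ℚₚ.<⇒≤ (neg-< C<0)) (P ad) (P ab) (P ac)
                     (r₁ A B C D _ _ _ _ e ex) (r₁ A B C D _ _ _ _ e ey)
    ... | yes _  = combination A>0 (ℚₚ.<⇒≤ (neg-< C<0)) (ℚₚ.<⇒≤ D>0) (P ab) (P bc) (P bd)
                     (r₂ A B C D _ _ _ _ e ex) (r₂ A B C D _ _ _ _ e ey)
    ¬B<0 : ¬ B <ᵣ 0ℚ
    ¬B<0 B<0 = combination A>0 (ℚₚ.<⇒≤ (neg-< B<0)) (≥-by ¬C<0) (P ad) (P bd) (P cd)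
                 (r₃ A B C D _ _ _ _ e ex) (r₃ A B C D _ _ _ _ e ey)

  nested-dep : ∀ {A B C D a b c d} → a ⊏ b → b ⊏ c → c ⊏ d → Dep A B D C a b d c →
               0ℚ <ᵣ B → 0ℚ <ᵣ C → 0ℚ ≤ᵣ A × 0ℚ ≤ᵣ D
  nested-dep {A} {B} {C} {D} {a} {b} {c} {d} ab bc cd (dep e ex ey) B>0 C>0 = ≥-by ¬A<0 , ≥-by ¬D<0
    where
    P : ∀ {p q} → p ⊏ q → Pos (x-coord q ⊖ x-coord p) (y-coord q ⊖ y-coord p)
    P = ⊏⇒Pos
    ac = ⊏-trans ab bc
    bd = ⊏-trans bc cd
    ad = ⊏-trans ab bd
    r₁ : ∀ A B C D a b c d → A + D ≡ B + C → A * a + D * d ≡ B * b + C * c →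
         B * (b ⊖ a) + C * (c ⊖ a) + (- D) * (d ⊖ a) ≡ 0ℚ
    r₁ A B C D a b c d e f = trans (i₁ B C D a b c d) (trans (cong₂ (λ u v → u ⊖ D * d ⊖ (v ⊖ D) * a) (sym f) (sym e)) (i₂ A D a d))
      where
      i₁ : ∀ B C D a b c d → B * (b ⊖ a) + C * (c ⊖ a) + (- D) * (d ⊖ a) ≡ (B * b + C * c) ⊖ D * d ⊖ ((B + C) ⊖ D) * a
      i₁ = solve-∀ ℚ-ring
      i₂ : ∀ A D a d → (A * a + D * d) ⊖ D * d ⊖ ((A + D) ⊖ D) * a ≡ 0ℚ
      i₂ = solve-∀ ℚ-ring
    r₂ : ∀ A B C D a b c d → A + D ≡ B + C → A * a + D * d ≡ B * b + C * c →
         B * (d ⊖ b) + C * (d ⊖ c) + (- A) * (d ⊖ a) ≡ 0ℚ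
    r₂ A B C D a b c d e f = trans (i₁ A B C a b c d) (trans (cong₂ (λ u v → (v ⊖ A) * d ⊖ u + A * a) (sym f) (sym e)) (i₂ A D a d))
      where
      i₁ : ∀ A B C a b c d → B * (d ⊖ b) + C * (d ⊖ c) + (- A) * (d ⊖ a) ≡ ((B + C) ⊖ A) * d ⊖ (B * b + C * c) + A * a
      i₁ = solve-∀ ℚ-ring
      i₂ : ∀ A D a d → ((A + D) ⊖ A) * d ⊖ (A * a + D * d) + A * a ≡ 0ℚ
      i₂ = solve-∀ ℚ-ring
    ¬D<0 : ¬ D <ᵣ 0ℚ
    ¬D<0 D<0 = combination B>0 (ℚₚ.<⇒≤ C>0) (ℚₚ.<⇒≤ (neg-< D<0)) (P ab) (P ac) (P ad)
                 (r₁ A B C D _ _ _ _ e ex) (r₁ A B C D _ _ _ _ e ey)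
    ¬A<0 : ¬ A <ᵣ 0ℚ
    ¬A<0 A<0 = combination B>0 (ℚₚ.<⇒≤ C>0) (ℚₚ.<⇒≤ (neg-< A<0)) (P bd) (P cd) (P ad)
                 (r₂ A B C D _ _ _ _ e ex) (r₂ A B C D _ _ _ _ e ey)

  dep-neg : ∀ {A B C D a b c d} → Dep A B C D a b c d → Dep (- A) (- B) (- C) (- D) a b c d
  dep-neg {A} {B} {C} {D} (dep e ex ey) = dep
    (trans (n₀ A C) (trans (cong -_ e) (sym (n₀ B D))))
    (trans (n₁ A _ C _) (trans (cong -_ ex) (sym (n₁ B _ D _))))
    (trans (n₁ A _ C _) (trans (cong -_ ey) (sym (n₁ B _ D _))))
    where
    n₀ : ∀ a b → - a + - b ≡ - (a + b)
    n₀ = solve-∀ ℚ-ring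
    n₁ : ∀ a u b v → (- a) * u + (- b) * v ≡ - (a * u + b * v)
    n₁ = solve-∀ ℚ-ring

  dep-sym : ∀ {A B C D a b c d} → Dep A B C D a b c d → Dep B A D C b a d c
  dep-sym (dep e ex ey) = dep (sym e) (sym ex) (sym ey)

  abstract
    -- Cramer's rule: the coefficients are the signed areas of the triangles that omit one of the
    -- points. If none is negative and not all vanish, the dependence exhibits a common point of
    -- `p q` and `z w`.
    four-points : ∀ p q z w → Dep (det z q w) (det p q w) (det p z w) (det p z q) p z q w
    four-points ⟨ px , py ⟩ ⟨ qx , qy ⟩ ⟨ zx , zy ⟩ ⟨ wx , wy ⟩ =
      dep (s px py qx qy zx zy wx wy) (xe px py qx qy zx zy wx wy) (ye px py qx qy zx zy wx wy)
      where
      s : ∀ px py qx qy zx zy wx wy →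
        ((qx ⊖ zx) * (wy ⊖ zy) ⊖ (qy ⊖ zy) * (wx ⊖ zx)) + ((zx ⊖ px) * (wy ⊖ py) ⊖ (zy ⊖ py) * (wx ⊖ px))
        ≡ ((qx ⊖ px) * (wy ⊖ py) ⊖ (qy ⊖ py) * (wx ⊖ px)) + ((zx ⊖ px) * (qy ⊖ py) ⊖ (zy ⊖ py) * (qx ⊖ px))
      s = solve-∀ ℚ-ring
      xe : ∀ px py qx qy zx zy wx wy →
        ((qx ⊖ zx) * (wy ⊖ zy) ⊖ (qy ⊖ zy) * (wx ⊖ zx)) * px + ((zx ⊖ px) * (wy ⊖ py) ⊖ (zy ⊖ py) * (wx ⊖ px)) * qx
        ≡ ((qx ⊖ px) * (wy ⊖ py) ⊖ (qy ⊖ py) * (wx ⊖ px)) * zx + ((zx ⊖ px) * (qy ⊖ py) ⊖ (zy ⊖ py) * (qx ⊖ px)) * wx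
      xe = solve-∀ ℚ-ring
      ye : ∀ px py qx qy zx zy wx wy →
        ((qx ⊖ zx) * (wy ⊖ zy) ⊖ (qy ⊖ zy) * (wx ⊖ zx)) * py + ((zx ⊖ px) * (wy ⊖ py) ⊖ (zy ⊖ py) * (wx ⊖ px)) * qy
        ≡ ((qx ⊖ px) * (wy ⊖ py) ⊖ (qy ⊖ py) * (wx ⊖ px)) * zy + ((zx ⊖ px) * (qy ⊖ py) ⊖ (zy ⊖ py) * (qx ⊖ px)) * wy
      ye = solve-∀ ℚ-ring

    det-swap : ∀ p q z → det p z q ≡ - det p q z
    det-swap ⟨ px , py ⟩ ⟨ qx , qy ⟩ ⟨ zx , zy ⟩ = s px py qx qy zx zy
      where
      s : ∀ px py qx qy zx zy → (zx ⊖ px) * (qy ⊖ py) ⊖ (zy ⊖ py) * (qx ⊖ px) ≡ - ((qx ⊖ px) * (zy ⊖ py) ⊖ (qy ⊖ py) * (zx ⊖ px))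
      s = solve-∀ ℚ-ring

    det-cycle : ∀ p q z → det p q z ≡ det q z p
    det-cycle ⟨ px , py ⟩ ⟨ qx , qy ⟩ ⟨ zx , zy ⟩ = s px py qx qy zx zy
      where
      s : ∀ px py qx qy zx zy → (qx ⊖ px) * (zy ⊖ py) ⊖ (qy ⊖ py) * (zx ⊖ px) ≡ (zx ⊖ qx) * (py ⊖ qy) ⊖ (zy ⊖ qy) * (px ⊖ qx)
      s = solve-∀ ℚ-ring

    -- The position on the segment is read off from the heights or, on a horizontal segment, from
    -- the abscissae.
    collinear : ∀ {p z q} → p ⊏ z → z ⊏ q → det p q z ≡ 0ℚ → z ∈[ p , q ]
    collinear {p} {z} {q} pz zq e with ⊏-trans pz zq
    ... | inj₁ l = weighted (y-le zq) (y-le pz) (r₀ (y-coord p) (y-coord q) (y-coord z)) (0<⊖ l) p q z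
        (trans (r₁ (x-coord p) (y-coord p) (x-coord q) (y-coord q) (x-coord z) (y-coord z))
          (trans (cong (((y-coord q ⊖ y-coord z) * x-coord p + (y-coord z ⊖ y-coord p) * x-coord q) ⊖_) e) (r₃ _)))
        (r₂ (y-coord p) (y-coord q) (y-coord z))
      where
      y-le : ∀ {a b} → a ⊏ b → 0ℚ ≤ᵣ y-coord b ⊖ y-coord a
      y-le (inj₁ l)       = ℚₚ.<⇒≤ (0<⊖ l)
      y-le (inj₂ (e , _)) = ℚₚ.≤-reflexive (≡⇒⊖ e)
      r₀ : ∀ p q z → (q ⊖ z) + (z ⊖ p) ≡ q ⊖ p
      r₀ = solve-∀ ℚ-ring
      r₁ : ∀ px py qx qy zx zy → (qy ⊖ py) * zx ≡ ((qy ⊖ zy) * px + (zy ⊖ py) * qx) ⊖ ((qx ⊖ px) * (zy ⊖ py) ⊖ (qy ⊖ py) * (zx ⊖ px))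
      r₁ = solve-∀ ℚ-ring
      r₂ : ∀ p q z → (q ⊖ p) * z ≡ (q ⊖ z) * p + (z ⊖ p) * q
      r₂ = solve-∀ ℚ-ring
      r₃ : ∀ a → a ⊖ 0ℚ ≡ a
      r₃ = solve-∀ ℚ-ring
    ... | inj₂ (f , l) = weighted (ℚₚ.<⇒≤ (0<⊖ (proj₂ zq′))) (ℚₚ.<⇒≤ (0<⊖ (proj₂ pz′))) (r₀ (x-coord p) (x-coord q) (x-coord z)) (0<⊖ l) p q z
        (r₂ (x-coord p) (x-coord q) (x-coord z))
        (trans (cong ((x-coord q ⊖ x-coord p) *_) (sym (proj₁ pz′)))
          (trans (r₄ (y-coord p) (x-coord p) (x-coord q) (x-coord z)) (cong (λ u → (x-coord q ⊖ x-coord z) * y-coord p + (x-coord z ⊖ x-coord p) * u) f)))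
      where
      level₁ : p ⊏ z → z ⊏ q → y-coord p ≡ y-coord z × x-coord p <ᵣ x-coord z
      level₁ (inj₂ r) _               = r
      level₁ (inj₁ l) (inj₁ l′)       = ⊥-elim (ℚₚ.<-irrefl f (ℚₚ.<-trans l l′))
      level₁ (inj₁ l) (inj₂ (e′ , _)) = ⊥-elim (ℚₚ.<-irrefl (trans f (sym e′)) l)
      pz′ : y-coord p ≡ y-coord z × x-coord p <ᵣ x-coord z
      pz′ = level₁ pz zq
      level₂ : z ⊏ q → y-coord z ≡ y-coord q × x-coord z <ᵣ x-coord q
      level₂ (inj₂ r)  = r
      level₂ (inj₁ l′) = ⊥-elim (ℚₚ.<-irrefl (trans (sym (proj₁ pz′)) f) l′)
      zq′ : y-coord z ≡ y-coord q × x-coord z <ᵣ x-coord q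
      zq′ = level₂ zq
      r₀ : ∀ p q z → (q ⊖ z) + (z ⊖ p) ≡ q ⊖ p
      r₀ = solve-∀ ℚ-ring
      r₂ : ∀ p q z → (q ⊖ p) * z ≡ (q ⊖ z) * p + (z ⊖ p) * q
      r₂ = solve-∀ ℚ-ring
      r₄ : ∀ y p q z → (q ⊖ p) * y ≡ (q ⊖ z) * y + (z ⊖ p) * y
      r₄ = solve-∀ ℚ-ring

  abstract
    negᵇ posᵇ : ℚ → Bool
    negᵇ a = does (a ℚₚ.<? 0ℚ)
    posᵇ a = does (0ℚ ℚₚ.<? a)

    sign-xor : ∀ {a} → a ≢ 0ℚ → negᵇ a xor posᵇ a ≡ true
    sign-xor {a} a≢0 with ℚₚ.<-cmp a 0ℚ
    ... | tri< l _ ¬g = cong₂ _xor_ (dec-true (a ℚₚ.<? 0ℚ) l) (dec-false (0ℚ ℚₚ.<? a) ¬g)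
    ... | tri≈ _ e _  = ⊥-elim (a≢0 e)
    ... | tri> ¬l _ g = cong₂ _xor_ (dec-false (a ℚₚ.<? 0ℚ) ¬l) (dec-true (0ℚ ℚₚ.<? a) g)

  -- The point `z` lies at a height strictly between the ends and on the side selected by `s`. With
  -- `negᵇ` it is to the right of the upward segment, so its left ray meets the segment; with `posᵇ`
  -- its right ray does.
  rising falling : (ℚ → Bool) → Point → Point → Point → Bool
  rising s p q z = (p ⊏ᵇ z) ∧ (z ⊏ᵇ q) ∧ s (det p q z)
  falling s p q z = rising s q p z

  ray : (ℚ → Bool) → Point → Point → Point → Bool
  ray s p q z with cmp p q
  ... | lt _ = rising s p q z
  ... | eq _ = false
  ... | gt _ = falling s p q z

  ray-rising : ∀ s {p q} z → p ⊏ q → ray s p q z ≡ rising s p q z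
  ray-rising s {p} {q} z l with cmp p q
  ... | lt _    = refl
  ... | eq refl = ⊥-elim (⊏-asym l l)
  ... | gt g    = ⊥-elim (⊏-asym l g)

  ray-falling : ∀ s {p q} z → q ⊏ p → ray s p q z ≡ rising s q p z
  ray-falling s {p} {q} z l with cmp p q
  ... | gt _    = refl
  ... | eq refl = ⊥-elim (⊏-asym l l)
  ... | lt g    = ⊥-elim (⊏-asym l g)

  module _ {p q z : Point} (pq : p ⊏ q) (z∉ : ¬ z ∈[ p , q ]) where
    line-rising : rising negᵇ p q z xor rising posᵇ p q z ≡ (p ⊏ᵇ z) xor (q ⊏ᵇ z)
    line-rising with cmp p z | cmp z q
    ... | eq refl | _ = ⊥-elim (z∉ (end₀ p q))
    ... | _ | eq refl = ⊥-elim (z∉ (end₁ p q))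
    ... | lt pz | lt zq rewrite ⊏ᵇ-true pz | ⊏ᵇ-true zq | ⊏ᵇ-false zq = sign-xor (z∉ ∘ collinear pz zq)
    ... | lt pz | gt qz rewrite ⊏ᵇ-true pz | ⊏ᵇ-false qz | ⊏ᵇ-true qz = refl
    ... | gt zp | lt zq rewrite ⊏ᵇ-false zp | ⊏ᵇ-false zq = refl
    ... | gt zp | gt qz = ⊥-elim (⊏-asym pq (⊏-trans qz zp))

  line-segment : ∀ p q z → ¬ z ∈[ p , q ] → ray negᵇ p q z xor ray posᵇ p q z ≡ (p ⊏ᵇ z) xor (q ⊏ᵇ z)
  line-segment p q z z∉ with cmp p q
  ... | lt l    = line-rising l z∉
  ... | eq refl = sym (Boolₚ.xor-same (p ⊏ᵇ z))
  ... | gt g    = trans (line-rising g (z∉ ∘ ∈[]-swap)) (Boolₚ.xor-comm (q ⊏ᵇ z) (p ⊏ᵇ z))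

  data Sign (a : ℚ) : Set where
    neg  : a <ᵣ 0ℚ → negᵇ a ≡ true → posᵇ a ≡ false → Sign a
    zero : a ≡ 0ℚ → Sign a
    plus : 0ℚ <ᵣ a → negᵇ a ≡ false → posᵇ a ≡ true → Sign a

  abstract
    sign : ∀ a → Sign a
    sign a with ℚₚ.<-cmp a 0ℚ
    ... | tri< l _ ¬g = neg l (dec-true (a ℚₚ.<? 0ℚ) l) (dec-false (0ℚ ℚₚ.<? a) ¬g)
    ... | tri≈ _ e _  = zero e
    ... | tri> ¬l _ g = plus g (dec-false (a ℚₚ.<? 0ℚ) ¬l) (dec-true (0ℚ ℚₚ.<? a) g)

  -- While a point moves from `z` to `w`, its left ray gains or loses the segment `p q` when it
  -- sweeps over an end of `p q`, that is, where the right ray of this end meets `z w`; otherwise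
  -- only at a crossing. This is verified by signs: in each order of the heights, a violation gives
  -- two coefficients of `four-points` the same strict sign, the other two cannot have the opposite
  -- sign, and the segments meet.
  module CrossRising {p q z w : Point} (pq : p ⊏ q) (zw : z ⊏ w) (apart : ¬ Meet p q z w) where

    private
      α β γ δ : ℚ
      α = det z q w
      β = det p q w
      γ = det p z w
      δ = det p z q
      D : Dep α β γ δ p z q w
      D = four-points p q z w

      meets : ∀ {a b c d} → Dep a b c d p z q w → 0ℚ ≤ᵣ a → 0ℚ ≤ᵣ b → 0ℚ ≤ᵣ c → 0ℚ ≤ᵣ d → 0ℚ <ᵣ a + c → ⊥
      meets (dep e ex ey) a b c d s = apart (meet p q z w a c b d e s ex ey)

      +pos : ∀ {a c} → 0ℚ <ᵣ a → 0ℚ ≤ᵣ c → 0ℚ <ᵣ a + c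
      +pos p q = ℚₚ.+-mono-<-≤ p q
      pos+ : ∀ {a c} → 0ℚ ≤ᵣ a → 0ℚ <ᵣ c → 0ℚ <ᵣ a + c
      pos+ p q = ℚₚ.+-mono-≤-< p q

      αq : α ≡ - det z w q
      αq = det-swap z w q
      δz : δ ≡ - det p q z
      δz = det-swap p q z
      γp : γ ≡ det z w p
      γp = det-cycle p z w

      flip-neg : ∀ {a b} → a ≡ - b → b <ᵣ 0ℚ → 0ℚ <ᵣ a
      flip-neg refl l = neg-< l
      flip-pos : ∀ {a b} → a ≡ - b → 0ℚ <ᵣ b → 0ℚ <ᵣ - a
      flip-pos {b = b} refl l = subst (0ℚ <ᵣ_) (neg-neg b) l
      same-neg : ∀ {a b} → a ≡ b → b <ᵣ 0ℚ → 0ℚ <ᵣ - a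
      same-neg refl = neg-<
      same-pos : ∀ {a b} → a ≡ b → 0ℚ <ᵣ b → 0ℚ <ᵣ a
      same-pos refl l = l
      ge : ∀ {a} → 0ℚ <ᵣ a → 0ℚ ≤ᵣ a
      ge = ℚₚ.<⇒≤

      nz-z : p ⊏ z → z ⊏ q → det p q z ≢ 0ℚ
      nz-z a b e = apart (z , collinear a b e , end₀ z w)
      nz-w : p ⊏ w → w ⊏ q → det p q w ≢ 0ℚ
      nz-w a b e = apart (w , collinear a b e , end₁ z w)
      nz-p : z ⊏ p → p ⊏ w → det z w p ≢ 0ℚ
      nz-p a b e = apart (p , end₀ p q , collinear a b e)
      nz-q : z ⊏ q → q ⊏ w → det z w q ≢ 0ℚ
      nz-q a b e = apart (q , end₁ p q , collinear a b e)

      Dᵃ : ∀ {a b c d} → Dep a b c d p z q w → p ⊏ z → z ⊏ q → q ⊏ w → 0ℚ <ᵣ a → 0ℚ <ᵣ d → ⊥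
      Dᵃ {a} {b} {c} {d} E pz zq qw a>0 d>0 = meets E (ge a>0) (proj₁ bc) (proj₂ bc) (ge d>0) (+pos {a} {c} a>0 (proj₂ bc))
        where
        bc : 0ℚ ≤ᵣ b × 0ℚ ≤ᵣ c
        bc = interlaced-dep pz zq qw E a>0 d>0
      Dᵇ : ∀ {a b c d} → Dep a b c d p z q w → z ⊏ p → p ⊏ w → w ⊏ q → 0ℚ <ᵣ b → 0ℚ <ᵣ c → ⊥
      Dᵇ {a} {b} {c} {d} E zp pw wq b>0 c>0 = meets E (proj₁ ad) (ge b>0) (ge c>0) (proj₂ ad) (pos+ {a} {c} (proj₁ ad) c>0)
        where
        ad : 0ℚ ≤ᵣ a × 0ℚ ≤ᵣ d
        ad = interlaced-dep zp pw wq (dep-sym E) b>0 c>0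
      Dᶜ : ∀ {a b c d} → Dep a b c d p z q w → p ⊏ z → w ⊏ q → 0ℚ <ᵣ b → 0ℚ <ᵣ d → ⊥
      Dᶜ {a} {b} {c} {d} E pz wq b>0 d>0 =
        meets E (proj₁ ac) (ge b>0) (proj₂ ac) (ge d>0) (subst (0ℚ <ᵣ_) (sym (Dep.sums E)) (0<+ {b} {d} b>0 d>0))
        where
        ac : 0ℚ ≤ᵣ a × 0ℚ ≤ᵣ c
        ac = nested-dep pz zw wq E b>0 d>0
      Dᵈ : ∀ {a b c d} → Dep a b c d p z q w → z ⊏ p → q ⊏ w → 0ℚ <ᵣ a → 0ℚ <ᵣ c → ⊥
      Dᵈ {a} {b} {c} {d} E zp qw a>0 c>0 = meets E (ge a>0) (proj₁ bd) (ge c>0) (proj₂ bd) (0<+ {a} {c} a>0 c>0)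
        where
        bd : 0ℚ ≤ᵣ b × 0ℚ ≤ᵣ d
        bd = nested-dep zp pq qw (dep-sym E) a>0 c>0

      caseA : p ⊏ z → z ⊏ q → q ⊏ w → negᵇ (det p q z) xor posᵇ (det z w q) ≡ false
      caseA pz zq qw with sign (det p q z) | sign (det z w q)
      ... | zero e | _ = ⊥-elim (nz-z pz zq e)
      ... | _ | zero e = ⊥-elim (nz-q zq qw e)
      ... | neg l _ _ | neg l′ _ _ = ⊥-elim (Dᵃ D pz zq qw (flip-neg αq l′) (flip-neg δz l))
      ... | plus l _ _ | plus l′ _ _ = ⊥-elim (Dᵃ (dep-neg D) pz zq qw (flip-pos αq l′) (flip-pos δz l))
      ... | neg _ e _ | plus _ _ e′ = cong₂ _xor_ e e′
      ... | plus _ e _ | neg _ _ e′ = cong₂ _xor_ e e′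

      caseB : z ⊏ p → p ⊏ w → w ⊏ q → negᵇ (det p q w) xor posᵇ (det z w p) ≡ false
      caseB zp pw wq with sign (det p q w) | sign (det z w p)
      ... | zero e | _ = ⊥-elim (nz-w pw wq e)
      ... | _ | zero e = ⊥-elim (nz-p zp pw e)
      ... | neg l _ _ | neg l′ _ _ = ⊥-elim (Dᵇ (dep-neg D) zp pw wq (neg-< l) (same-neg γp l′))
      ... | plus l _ _ | plus l′ _ _ = ⊥-elim (Dᵇ D zp pw wq l (same-pos γp l′))
      ... | neg _ e _ | plus _ _ e′ = cong₂ _xor_ e e′
      ... | plus _ e _ | neg _ _ e′ = cong₂ _xor_ e e′

      caseC : p ⊏ z → w ⊏ q → negᵇ (det p q z) xor negᵇ (det p q w) ≡ false
      caseC pz wq with sign (det p q z) | sign (det p q w)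
      ... | zero e | _ = ⊥-elim (nz-z pz (⊏-trans zw wq) e)
      ... | _ | zero e = ⊥-elim (nz-w (⊏-trans pz zw) wq e)
      ... | neg l _ _ | plus l′ _ _ = ⊥-elim (Dᶜ D pz wq l′ (flip-neg δz l))
      ... | plus l _ _ | neg l′ _ _ = ⊥-elim (Dᶜ (dep-neg D) pz wq (neg-< l′) (flip-pos δz l))
      ... | neg _ e _ | neg _ e′ _ = cong₂ _xor_ e e′
      ... | plus _ e _ | plus _ e′ _ = cong₂ _xor_ e e′

      caseD : z ⊏ p → q ⊏ w → posᵇ (det z w p) xor posᵇ (det z w q) ≡ false
      caseD zp qw with sign (det z w p) | sign (det z w q)
      ... | zero e | _ = ⊥-elim (nz-p zp (⊏-trans pq qw) e)
      ... | _ | zero e = ⊥-elim (nz-q (⊏-trans zp pq) qw e)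
      ... | plus l _ _ | neg l′ _ _ = ⊥-elim (Dᵈ D zp qw (flip-neg αq l′) (same-pos γp l))
      ... | neg l _ _ | plus l′ _ _ = ⊥-elim (Dᵈ (dep-neg D) zp qw (flip-pos αq l′) (same-neg γp l))
      ... | neg _ _ e | neg _ _ e′ = cong₂ _xor_ e e′
      ... | plus _ _ e | plus _ _ e′ = cong₂ _xor_ e e′

    private
      Total : (a b c d e f : Bool) → Bool
      Total a b c d e f = ((a ∧ b ∧ negᵇ (det p q z)) xor (c ∧ d ∧ negᵇ (det p q w))) xor
                          ((e ∧ c ∧ posᵇ (det z w p)) xor (b ∧ f ∧ posᵇ (det z w q)))

      values : ∀ {a b c d e f} → p ⊏ᵇ z ≡ a → z ⊏ᵇ q ≡ b → p ⊏ᵇ w ≡ c → w ⊏ᵇ q ≡ d → z ⊏ᵇ p ≡ e → q ⊏ᵇ w ≡ f →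
               Total a b c d e f ≡ false →
               (rising negᵇ p q z xor rising negᵇ p q w) xor (rising posᵇ z w p xor rising posᵇ z w q) ≡ false
      values refl refl refl refl refl refl h = h

      order : Cmp p z → Cmp q z → Cmp p w → Cmp q w →
              (rising negᵇ p q z xor rising negᵇ p q w) xor (rising posᵇ z w p xor rising posᵇ z w q) ≡ false
      order (eq refl) _ _ _ = ⊥-elim (apart (p , end₀ p q , end₀ z w))
      order _ (eq refl) _ _ = ⊥-elim (apart (q , end₁ p q , end₀ z w))
      order _ _ (eq refl) _ = ⊥-elim (apart (p , end₀ p q , end₁ z w))
      order _ _ _ (eq refl) = ⊥-elim (apart (q , end₁ p q , end₁ z w))
      order (gt zp) (lt qz) _ _ = ⊥-elim (⊏-asym pq (⊏-trans qz zp))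
      order (lt pz) _ (gt wp) _ = ⊥-elim (⊏-asym zw (⊏-trans wp pz))
      order _ _ (gt wp) (lt qw) = ⊥-elim (⊏-asym pq (⊏-trans qw wp))
      order _ (lt qz) _ (gt wq) = ⊥-elim (⊏-asym zw (⊏-trans wq qz))
      order (gt zp) (gt zq) (gt wp) (gt wq) =
        values (⊏ᵇ-false zp) (⊏ᵇ-true zq) (⊏ᵇ-false wp) (⊏ᵇ-true wq) (⊏ᵇ-true zp) (⊏ᵇ-false wq) refl
      order (gt zp) (gt zq) (lt pw) (gt wq) =
        values (⊏ᵇ-false zp) (⊏ᵇ-true zq) (⊏ᵇ-true pw) (⊏ᵇ-true wq) (⊏ᵇ-true zp) (⊏ᵇ-false wq)
          (trans (cong (negᵇ (det p q w) xor_) (Boolₚ.xor-identityʳ _)) (caseB zp pw wq))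
      order (gt zp) (gt zq) (lt pw) (lt qw) =
        values (⊏ᵇ-false zp) (⊏ᵇ-true zq) (⊏ᵇ-true pw) (⊏ᵇ-false qw) (⊏ᵇ-true zp) (⊏ᵇ-true qw) (caseD zp qw)
      order (lt pz) (gt zq) (lt pw) (gt wq) =
        values (⊏ᵇ-true pz) (⊏ᵇ-true zq) (⊏ᵇ-true pw) (⊏ᵇ-true wq) (⊏ᵇ-false pz) (⊏ᵇ-false wq)
          (trans (Boolₚ.xor-identityʳ _) (caseC pz wq))
      order (lt pz) (gt zq) (lt pw) (lt qw) =
        values (⊏ᵇ-true pz) (⊏ᵇ-true zq) (⊏ᵇ-true pw) (⊏ᵇ-false qw) (⊏ᵇ-false pz) (⊏ᵇ-true qw)
          (trans (cong (_xor posᵇ (det z w q)) (Boolₚ.xor-identityʳ (negᵇ (det p q z)))) (caseA pz zq qw))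
      order (lt pz) (lt qz) (lt pw) (lt qw) =
        values (⊏ᵇ-true pz) (⊏ᵇ-false qz) (⊏ᵇ-true pw) (⊏ᵇ-false qw) (⊏ᵇ-false pz) (⊏ᵇ-true qw) refl

    cross-rising : (rising negᵇ p q z xor rising negᵇ p q w) xor (rising posᵇ z w p xor rising posᵇ z w q) ≡ false
    cross-rising = order (cmp p z) (cmp q z) (cmp p w) (cmp q w)

  ray-degenerate : ∀ s p z → ray s p p z ≡ false
  ray-degenerate s p z with cmp p p
  ... | lt l = ⊥-elim (⊏-asym l l)
  ... | eq _ = refl
  ... | gt g = ⊥-elim (⊏-asym g g)

  -- Reversing a segment merely exchanges two summands, so rising segments suffice; for a degenerate
  -- segment equal terms cancel.
  cross-segment : ∀ p q z w → ¬ Meet p q z w →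
    (ray negᵇ p q z xor ray negᵇ p q w) xor (ray posᵇ z w p xor ray posᵇ z w q) ≡ false
  cross-segment p q z w apart = order (cmp p q) (cmp z w)
    where
    values : ∀ {a b c d} → ray negᵇ p q z ≡ a → ray negᵇ p q w ≡ b → ray posᵇ z w p ≡ c → ray posᵇ z w q ≡ d →
             (a xor b) xor (c xor d) ≡ false →
             (ray negᵇ p q z xor ray negᵇ p q w) xor (ray posᵇ z w p xor ray posᵇ z w q) ≡ false
    values refl refl refl refl h = h
    order : Cmp p q → Cmp z w →
            (ray negᵇ p q z xor ray negᵇ p q w) xor (ray posᵇ z w p xor ray posᵇ z w q) ≡ false
    order (eq refl) _ = values (ray-degenerate negᵇ p z) (ray-degenerate negᵇ p w) refl refl (Boolₚ.xor-same (ray posᵇ z w p))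
    order _ (eq refl) = values refl refl (ray-degenerate posᵇ z p) (ray-degenerate posᵇ z q)
      (trans (Boolₚ.xor-identityʳ _) (Boolₚ.xor-same (ray negᵇ p q z)))
    order (lt pq) (lt zw) = values (ray-rising negᵇ z pq) (ray-rising negᵇ w pq) (ray-rising posᵇ p zw) (ray-rising posᵇ q zw)
      (CrossRising.cross-rising pq zw apart)
    order (lt pq) (gt wz) = values (ray-rising negᵇ z pq) (ray-rising negᵇ w pq) (ray-falling posᵇ p wz) (ray-falling posᵇ q wz)
      (trans (cong (_xor (rising posᵇ w z p xor rising posᵇ w z q)) (Boolₚ.xor-comm (rising negᵇ p q z) _))
        (CrossRising.cross-rising pq wz λ (u , a , b) → apart (u , a , ∈[]-swap b)))
    order (gt qp) (lt zw) = values (ray-falling negᵇ z qp) (ray-falling negᵇ w qp) (ray-rising posᵇ p zw) (ray-rising posᵇ q zw)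
      (trans (cong ((rising negᵇ q p z xor rising negᵇ q p w) xor_) (Boolₚ.xor-comm (rising posᵇ z w p) _))
        (CrossRising.cross-rising qp zw λ (u , a , b) → apart (u , ∈[]-swap a , b)))
    order (gt qp) (gt wz) = values (ray-falling negᵇ z qp) (ray-falling negᵇ w qp) (ray-falling posᵇ p wz) (ray-falling posᵇ q wz)
      (trans (cong₂ _xor_ (Boolₚ.xor-comm (rising negᵇ q p z) _) (Boolₚ.xor-comm (rising posᵇ w z p) _))
        (CrossRising.cross-rising qp wz λ (u , a , b) → apart (u , ∈[]-swap a , ∈[]-swap b)))

  end∈ : ∀ {p r} (π : Polyline p r) → r ∈ᵖ π
  end∈ (segment p q) = end₁ p q
  end∈ (p ∷ᵖ π)      = inj₂ (end∈ π)

-- Necessity: parities of a drawing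

module Necessity where
  open Models
  open Minors
  open VanKampen
  open SegmentParity
  import Data.Bool.Properties as Boolₚ
  open import Data.Rational.Base using (ℚ)

  private variable
    m n : ℕ
    p q r z w : Point

  crossings : (ℚ → Bool) → Polyline p r → Point → Bool
  crossings s (segment p q)     z = ray s p q z
  crossings s (_∷ᵖ_ {q} p π) z = ray s p q z xor crossings s π z

  start∈ : (π : Polyline p r) → p ∈ᵖ π
  start∈ (segment p q) = end₀ p q
  start∈ (p ∷ᵖ π)      = inj₁ (end₀ p _)

  line-polyline : (π : Polyline p r) → ¬ z ∈ᵖ π →
                  crossings negᵇ π z xor crossings posᵇ π z ≡ (p ⊏ᵇ z) xor (r ⊏ᵇ z)
  line-polyline {z = z} (segment p q) z∉ = line-segment p q z z∉
  line-polyline {r = r} {z = z} (_∷ᵖ_ {q} p π) z∉ =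
    trans (xor-swap (ray negᵇ p q z) _ (ray posᵇ p q z) _)
      (trans (cong₂ _xor_ (line-segment p q z (z∉ ∘ inj₁)) (line-polyline π (z∉ ∘ inj₂)))
             (xor-cancel (p ⊏ᵇ z) (q ⊏ᵇ z) (r ⊏ᵇ z)))

  cross-segment-polyline : ∀ p q (ρ : Polyline z w) → (∀ u → u ∈[ p , q ] → u ∈ᵖ ρ → ⊥) →
    (ray negᵇ p q z xor ray negᵇ p q w) xor (crossings posᵇ ρ p xor crossings posᵇ ρ q) ≡ false
  cross-segment-polyline p q (segment z w) dj = cross-segment p q z w λ (u , a , b) → dj u a b
  cross-segment-polyline {w = w} p q (_∷ᵖ_ {z′} z ρ) dj = begin
    (ray negᵇ p q z xor ray negᵇ p q w) xor ((ray posᵇ z z′ p xor crossings posᵇ ρ p) xor (ray posᵇ z z′ q xor crossings posᵇ ρ q))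
      ≡⟨ cong₂ _xor_ (sym (xor-cancel (ray negᵇ p q z) (ray negᵇ p q z′) (ray negᵇ p q w)))
           (xor-swap (ray posᵇ z z′ p) (crossings posᵇ ρ p) (ray posᵇ z z′ q) (crossings posᵇ ρ q)) ⟩
    ((ray negᵇ p q z xor ray negᵇ p q z′) xor (ray negᵇ p q z′ xor ray negᵇ p q w)) xor
      ((ray posᵇ z z′ p xor ray posᵇ z z′ q) xor (crossings posᵇ ρ p xor crossings posᵇ ρ q))
      ≡⟨ xor-swap (ray negᵇ p q z xor ray negᵇ p q z′) _ (ray posᵇ z z′ p xor ray posᵇ z z′ q) _ ⟩
    ((ray negᵇ p q z xor ray negᵇ p q z′) xor (ray posᵇ z z′ p xor ray posᵇ z z′ q)) xor
      ((ray negᵇ p q z′ xor ray negᵇ p q w) xor (crossings posᵇ ρ p xor crossings posᵇ ρ q))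
      ≡⟨ cong₂ _xor_ (cross-segment p q z z′ λ (u , a , b) → dj u a (inj₁ b))
           (cross-segment-polyline p q ρ λ u a b → dj u a (inj₂ b)) ⟩
    false ∎
    where open ≡-Reasoning

  cross-polyline : (π : Polyline p r) (ρ : Polyline z w) → (∀ u → u ∈ᵖ π → u ∈ᵖ ρ → ⊥) →
    (crossings negᵇ π z xor crossings negᵇ π w) xor (crossings posᵇ ρ p xor crossings posᵇ ρ r) ≡ false
  cross-polyline (segment p q) ρ dj = cross-segment-polyline p q ρ dj
  cross-polyline {r = r} {z = z} {w = w} (_∷ᵖ_ {q} p π) ρ dj = begin
    ((ray negᵇ p q z xor crossings negᵇ π z) xor (ray negᵇ p q w xor crossings negᵇ π w)) xor
      (crossings posᵇ ρ p xor crossings posᵇ ρ r)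
      ≡⟨ cong₂ _xor_ (xor-swap (ray negᵇ p q z) (crossings negᵇ π z) (ray negᵇ p q w) (crossings negᵇ π w))
           (sym (xor-cancel (crossings posᵇ ρ p) (crossings posᵇ ρ q) (crossings posᵇ ρ r))) ⟩
    ((ray negᵇ p q z xor ray negᵇ p q w) xor (crossings negᵇ π z xor crossings negᵇ π w)) xor
      ((crossings posᵇ ρ p xor crossings posᵇ ρ q) xor (crossings posᵇ ρ q xor crossings posᵇ ρ r))
      ≡⟨ xor-swap (ray negᵇ p q z xor ray negᵇ p q w) _ (crossings posᵇ ρ p xor crossings posᵇ ρ q) _ ⟩
    ((ray negᵇ p q z xor ray negᵇ p q w) xor (crossings posᵇ ρ p xor crossings posᵇ ρ q)) xor
      ((crossings negᵇ π z xor crossings negᵇ π w) xor (crossings posᵇ ρ q xor crossings posᵇ ρ r))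
      ≡⟨ cong₂ _xor_ (cross-segment-polyline p q ρ λ u a b → dj u (inj₁ a) b)
           (cross-polyline π ρ λ u a b → dj u (inj₂ a) b) ⟩
    false ∎
    where open ≡-Reasoning

  module _ {G : Graph n} (D : Planar G) where
    open Planar D

    private
      -- Only the arc from the smaller to the larger end is part of the drawing; an edge named in
      -- the other direction shares its count.
      arc-crossings : (ℚ → Bool) → Fin n → Fin n → Fin n → Bool
      arc-crossings s u v w with <-cmp u v
      ... | tri< _ _ _ = crossings s (arc u v) (pos w)
      ... | tri≈ _ _ _ = false
      ... | tri> _ _ _ = crossings s (arc v u) (pos w)

      line-edge : ∀ {u v w} → Edge u v → w ≢ u → w ≢ v →
                  crossings negᵇ (arc u v) (pos w) xor crossings posᵇ (arc u v) (pos w) ≡ (pos u ⊏ᵇ pos w) xor (pos v ⊏ᵇ pos w)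
      line-edge {u} {v} {w} e w≢u w≢v = line-polyline (arc u v) λ w∈ → [ w≢u , w≢v ]′ (arc-vertex e w w∈)

      line′ : ∀ {u v w} → Adj G u v → w ≢ u → w ≢ v →
              arc-crossings negᵇ u v w xor arc-crossings posᵇ u v w ≡ (pos u ⊏ᵇ pos w) xor (pos v ⊏ᵇ pos w)
      line′ {u} {v} {w} a w≢u w≢v with <-cmp u v
      ... | tri< l _ _    = line-edge (l , a) w≢u w≢v
      ... | tri≈ _ refl _ = ⊥-elim (adj-irrefl G refl a)
      ... | tri> _ _ g    = trans (line-edge (g , adj-sym G a) w≢v w≢u) (Boolₚ.xor-comm (pos v ⊏ᵇ pos w) _)

      cross-arcs : ∀ {u v u′ v′} → Edge u v → Edge u′ v′ → u ≢ u′ → u ≢ v′ → v ≢ u′ → v ≢ v′ →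
        (crossings negᵇ (arc u v) (pos u′) xor crossings negᵇ (arc u v) (pos v′)) xor
        (crossings posᵇ (arc u′ v′) (pos u) xor crossings posᵇ (arc u′ v′) (pos v)) ≡ false
      cross-arcs {u} {v} {u′} {v′} e e′ a b c d = cross-polyline (arc u v) (arc u′ v′) apart
        where
        apart : ∀ z → z ∈ᵖ arc u v → z ∈ᵖ arc u′ v′ → ⊥
        apart z z∈ z∈′ with arc-arc e e′ (λ { refl → a refl }) z z∈ z∈′
        ... | inj₁ refl = [ a , b ]′ (arc-vertex e′ u z∈′)
        ... | inj₂ refl = [ c , d ]′ (arc-vertex e′ v z∈′)

      cross′ : ∀ {u v u′ v′} → Adj G u v → Adj G u′ v′ → u ≢ u′ → u ≢ v′ → v ≢ u′ → v ≢ v′ →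
        (arc-crossings negᵇ u v u′ xor arc-crossings negᵇ u v v′) xor
        (arc-crossings posᵇ u′ v′ u xor arc-crossings posᵇ u′ v′ v) ≡ false
      cross′ {u} {v} {u′} {v′} e e′ a b c d with <-cmp u v | <-cmp u′ v′
      ... | tri≈ _ refl _ | _ = ⊥-elim (adj-irrefl G refl e)
      ... | _ | tri≈ _ refl _ = ⊥-elim (adj-irrefl G refl e′)
      ... | tri< l _ _ | tri< l′ _ _ = cross-arcs (l , e) (l′ , e′) a b c d
      ... | tri< l _ _ | tri> _ _ g′ =
        trans (cong (_xor (crossings posᵇ (arc v′ u′) (pos u) xor crossings posᵇ (arc v′ u′) (pos v))) (Boolₚ.xor-comm (crossings negᵇ (arc u v) (pos u′)) _))
          (cross-arcs (l , e) (g′ , adj-sym G e′) b a d c)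
      ... | tri> _ _ g | tri< l′ _ _ =
        trans (cong ((crossings negᵇ (arc v u) (pos u′) xor crossings negᵇ (arc v u) (pos v′)) xor_) (Boolₚ.xor-comm (crossings posᵇ (arc u′ v′) (pos u)) _))
          (cross-arcs (g , adj-sym G e) (l′ , e′) c d a b)
      ... | tri> _ _ g | tri> _ _ g′ =
        trans (cong₂ _xor_ (Boolₚ.xor-comm (crossings negᵇ (arc v u) (pos u′)) _) (Boolₚ.xor-comm (crossings posᵇ (arc v′ u′) (pos u)) _))
          (cross-arcs (g , adj-sym G e) (g′ , adj-sym G e′) d c b a)

      anti : ∀ {u w} → u ≢ w → (pos u ⊏ᵇ pos w) xor (pos w ⊏ᵇ pos u) ≡ true
      anti {u} {w} ne with cmp (pos u) (pos w)
      ... | lt l = cong₂ _xor_ (⊏ᵇ-true l) (⊏ᵇ-false l)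
      ... | eq e = ⊥-elim (ne (pos-injective e))
      ... | gt g = cong₂ _xor_ (⊏ᵇ-false g) (⊏ᵇ-true g)

    planar⇒parity : Parity G
    planar⇒parity = record
      { left = arc-crossings negᵇ ; right = arc-crossings posᵇ ; below = λ u w → pos u ⊏ᵇ pos w
      ; line = line′ ; cross = cross′ ; below-anti = anti }

  restore-edge : {K : Graph m} {G G′ : Graph n} {a b : Fin m} (M : Model (deleteEdge K a b) G ⊤) → G ⊑ G′ →
                 Adj G′ (Model.root M a) (Model.root M b) → Model K G′ ⊤
  restore-edge {K = K} {G} {G′} {a} {b} M inc e = record
    { X = X ; inside = inside ; root = root ; root∈ = root∈ ; conn = λ i v∈ → walk-⊑ inc (conn i v∈)
    ; disj = disj ; link = lk }
    where
    open Model M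
    lk : ∀ {i j} → Adj K i j → ∃₂ λ u v → u ∈ˢ X i × v ∈ˢ X j × Adj G′ u v
    lk {i} {j} k with samePair? i j a b
    ... | no ¬p = let (u , v , u∈ , v∈ , g) = link (k , ¬p) in u , v , u∈ , v∈ , inc g
    ... | yes (inj₁ (refl , refl)) = root a , root b , root∈ a , root∈ b , e
    ... | yes (inj₂ (refl , refl)) = root b , root a , root∈ b , root∈ a , adj-sym G′ e

  -- Freeness is applied to a single pair of vertices, the roots of the two branch sets that lack an
  -- edge.
  free⇒¬minus : {K : Graph m} {G : Graph n} {a b : Fin m} → a ≢ b → (∀ {G : Graph n} → Parity G → Model K G ⊤ → ⊥) →
                Free Planar G → Model (deleteEdge K a b) G ⊤ → ⊥
  free⇒¬minus {K = K} {G} {a} {b} a≢b nonplanar (D , add) M with adj? G (root a) (root b)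
    where open Model M
  ... | yes e = nonplanar (planar⇒parity D) (restore-edge {K = K} M id e)
  ... | no ¬e = nonplanar (planar⇒parity (add (root a) (root b) ne ¬e)) (restore-edge {K = K} M inj₁ (inj₂ (inj₁ (refl , refl))))
    where
    open Model M
    ne : root a ≢ root b
    ne e = a≢b (disj (root∈ a) (subst (_∈ˢ X b) (sym e) (root∈ b)))

  model-≅ : {H : Graph m} {k : ℕ} {K : Graph k} {G : Graph n} {U : Subset n} → H ≅ K → Model H G U → Model K G U
  model-≅ {H = H} {K = K} iso = model-perm from
    (λ {i} {j} e → trans (sym (strictlyInverseˡ i)) (trans (cong to e) (strictlyInverseˡ j)))
    (λ {i} {j} a → Equivalence.from (adjacency (from i) (from j))
      (subst₂ (Adj K) (sym (strictlyInverseˡ i)) (sym (strictlyInverseˡ j)) a))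
    where
    open _≅_ iso
    open Inverse vertices using (to; from; strictlyInverseˡ)

  free⇒excluded : (G : Graph n) → Free Planar G → N∘ ｛ K₅⁻ , K₃,₃⁻ ｝ G
  free⇒excluded G free H (inj₁ iso) H≺G =
    free⇒¬minus {K = complete 5} (λ ()) K₅-nonplanar free (model-≅ iso (≺⇒model H≺G))
  free⇒excluded G free H (inj₂ iso) H≺G =
    free⇒¬minus {K = completeBipartite 3 3} (λ ()) K₃₃-nonplanar free (model-≅ iso (≺⇒model H≺G))

-- Two-connected parts, separations and contractible edges

module Connectivity where
  open Models
  open EdgeLoss
  import Data.Nat.Properties as ℕₚ
  import Data.List.Base as List

  private variable
    n : ℕ

  -- Two-connectedness of the part of G on W, as connectedness after the removal
  -- of any vertex.
  Conn₂ : Graph n → Subset n → Set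
  Conn₂ {n} G W = ∀ c {u v : Fin n} → u ∈ˢ W → v ∈ˢ W → u ≢ c → v ≢ c → Walk G (λ x → x ∈ˢ W × x ≢ c) u v

  -- `B` is enlarged until it touches both `a` and `c` and can serve as a branch set. The path,
  -- which must survive each enlargement, keeps `a` and `c` connected outside `B`; it is what the
  -- second branch set between them is built from.
  record Arm (G : Graph n) (W : Subset n) (a b c : Fin n) : Set where
    field
      B    : Subset n
      b∈   : b ∈ˢ B
      B⊆   : ∀ {v} → v ∈ˢ B → v ∈ˢ W
      conn : ∀ {v} → v ∈ˢ B → Walk G (_∈ˢ B) b v
      a∉   : a ∉ˢ B
      c∉   : c ∉ˢ B
      path : Walk G (λ x → x ∈ˢ W × x ∉ˢ B) a c

    flip : Arm G W c b a
    flip = record { B = B ; b∈ = b∈ ; B⊆ = B⊆ ; conn = conn ; a∉ = c∉ ; c∉ = a∉ ; path = walk-rev path }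

    Near : Fin n → Set
    Near v = ∃ λ u → u ∈ˢ B × Adj G u v

    near? : ∀ v → Dec (Near v)
    near? v = any? λ u → u ∈? B ×-dec adj? G u v

  module _ {G : Graph n} {W : Subset n} (conn₂ : Conn₂ G W) where

    -- If c is not adjacent to the arm, the component Z of c among the vertices
    -- away from the arm has two boundary vertices, and the arm can absorb one of them.
    module Improve {a b c : Fin n} (M : Arm G W a b c) (b∈W : b ∈ˢ W) (a≢b : a ≢ b) (a≢c : a ≢ c) (¬near : ¬ Arm.Near M c) where
      open Arm M

      private
        S? : Decidable (λ x → x ∈ˢ W × x ∉ˢ B × ¬ Near x)
        S? x = x ∈? W ×-dec ¬? (x ∈? B) ×-dec ¬? (near? x)
        c∈W : c ∈ˢ W
        c∈W = proj₁ (walk-end path)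
        open Component (component G (sub S?) (sub⁺ S? (c∈W , c∉ , ¬near))) using (Z; within; closed) renaming (root to c∈Z; conn to Z-conn)
        Z⊆ : ∀ {z} → z ∈ˢ Z → z ∈ˢ W × z ∉ˢ B × ¬ Near z
        Z⊆ z∈ = sub⁻ S? (within z∈)

        Bd : Fin n → Set
        Bd q = (q ∈ˢ W × q ∉ˢ B) × Near q × (∃ λ p → p ∈ˢ Z × Adj G p q) × q ∉ˢ Z
        bd? : Decidable Bd
        bd? q = (q ∈? W ×-dec ¬? (q ∈? B)) ×-dec near? q ×-dec any? (λ p → p ∈? Z ×-dec adj? G p q) ×-dec ¬? (q ∈? Z)

        boundary : ∀ {p q} → p ∈ˢ Z → q ∈ˢ W → q ∉ˢ Z → Adj G p q → Bd q
        boundary {p} {q} p∈ q∈W q∉Z e = (q∈W , q∉B) , near , (p , p∈ , e) , q∉Z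
          where
          q∉B : q ∉ˢ B
          q∉B q∈B = proj₂ (proj₂ (Z⊆ p∈)) (q , q∈B , adj-sym G e)
          near : Near q
          near with near? q
          ... | yes nq = nq
          ... | no ¬nq = ⊥-elim (q∉Z (closed p∈ (sub⁺ S? (q∈W , q∉B , ¬nq)) e))

        -- Two-connectedness provides a walk from `c` to `b` around `x`; it leaves `Z` through a
        -- boundary vertex.
        exit : ∀ x → x ≢ c → x ≢ b → ∃ λ q → Bd q × q ≢ x
        exit x x≢c x≢b with walk-exit (_∈? Z) (conn₂ x c∈W b∈W (x≢c ∘ sym) (x≢b ∘ sym)) c∈Z (λ b∈Z → proj₁ (proj₂ (Z⊆ b∈Z)) b∈)
        ... | p , q , p∈ , q∉ , _ , (q∈W , q≢x) , e = q , boundary p∈ q∈W q∉ e , q≢x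

        e₁ = exit a a≢c a≢b
        v₁ = proj₁ e₁
        bd₁ : Bd v₁
        bd₁ = proj₁ (proj₂ e₁)
        v₁≢a : v₁ ≢ a
        v₁≢a = proj₂ (proj₂ e₁)
        bd≢c : ∀ {v} → Bd v → v ≢ c
        bd≢c (_ , _ , _ , v∉Z) refl = v∉Z c∈Z
        bd≢b : ∀ {v} → Bd v → v ≢ b
        bd≢b ((_ , v∉B) , _) refl = v∉B b∈
        e₂ = exit v₁ (bd≢c bd₁) (bd≢b bd₁)
        v₂ = proj₁ e₂
        bd₂ : Bd v₂
        bd₂ = proj₁ (proj₂ e₂)
        v₂≢v₁ : v₂ ≢ v₁
        v₂≢v₁ = proj₂ (proj₂ e₂)

        Off : Fin n → Fin n → Set
        Off v x = (x ∈ˢ W × x ∉ˢ B) × x ≢ v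

        -- Cuts the path off at its first boundary vertex, so that it avoids all other boundary
        -- vertices.
        first : ∀ {u} → u ∉ˢ Z → Walk G (λ x → x ∈ˢ W × x ∉ˢ B) u c →
                ∃ λ v → Bd v × Walk G (λ x → (x ∈ˢ W × x ∉ˢ B) × (Bd x → x ≡ v)) u v
        first u∉ (stay _) = ⊥-elim (u∉ c∈Z)
        first {u} u∉ (step p e π) with bd? u
        ... | yes bu = u , bu , stay (p , λ _ → refl)
        ... | no ¬bu with first (λ w∈ → ¬bu (boundary w∈ (proj₁ p) u∉ (adj-sym G e))) π
        ... | v , bv , θ = v , bv , step (p , λ bu → ⊥-elim (¬bu bu)) e θ

        in-Z : ∀ {v u} → Bd v → u ∈ˢ Z → Walk G (Off v) u c
        in-Z bv u∈ = walk-map (λ z∈ → (proj₁ (Z⊆ z∈) , proj₁ (proj₂ (Z⊆ z∈))) , λ { refl → proj₂ (proj₂ (proj₂ bv)) z∈ }) (walk-rev (Z-conn u∈))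

        via : ∀ {v w} → Bd w → w ≢ v → Bd v → Walk G (λ x → (x ∈ˢ W × x ∉ˢ B) × (Bd x → x ≡ w)) a w → Walk G (Off v) a c
        via {v} bw@(_ , _ , (p , p∈ , e) , _) w≢v bv θ =
          walk-map (λ { (s , f) → s , λ { refl → w≢v (sym (f bv)) } }) θ
          ++ʷ step (proj₁ bw , w≢v) (adj-sym G e) (in-Z bv p∈)

      -- The vertex to be absorbed must leave a path from `a` to `c`. Inside `Z` no boundary vertex
      -- is met; from outside, the path runs to its first boundary vertex and then through `Z`. So
      -- all boundary vertices but that one are eligible, and of two at least one is.
      found : ∃ λ v → (v ∈ˢ W × v ∉ˢ B) × Near v × v ≢ a × v ≢ c × Walk G (Off v) a c
      found with a ∈? Z
      ... | yes a∈Z = v₁ , proj₁ bd₁ , proj₁ (proj₂ bd₁) , v₁≢a , bd≢c bd₁ , in-Z bd₁ a∈Z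
      ... | no a∉Z with first a∉Z path
      ... | v , bv , θ with v ≟ᶠ v₁
      ... | no v≢v₁ = v₁ , proj₁ bd₁ , proj₁ (proj₂ bd₁) , v₁≢a , bd≢c bd₁ , via bv v≢v₁ bd₁ θ
      ... | yes refl = v₂ , proj₁ bd₂ , proj₁ (proj₂ bd₂) , v₂≢a , bd≢c bd₂ , via bv (v₂≢v₁ ∘ sym) bd₂ θ
        where
        v₂≢a : v₂ ≢ a
        -- Were `a` a boundary vertex, the path would have been cut off there, and `a` would be
        -- `v₁`.
        v₂≢a e = v₂≢v₁ (trans e (proj₂ (walk-start θ) (subst Bd e bd₂)))

      bigger : ∃ λ M′ → suc ∣ ∁ (Arm.B M′) ∣ ≤ ∣ ∁ B ∣
      bigger with found
      ... | v , (v∈W , v∉B) , (u , u∈ , e) , v≢a , v≢c , θ = record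
        { B = B ∪ ⁅ v ⁆ ; b∈ = up b∈ ; B⊆ = in′ ; conn = con ; a∉ = out a∉ (v≢a ∘ sym) ; c∉ = out c∉ (v≢c ∘ sym)
        ; path = walk-map (λ { ((w , b) , ne) → w , out b ne }) θ } , ∣∁∣-grow B v∉B
        where
        up : ∀ {x} → x ∈ˢ B → x ∈ˢ B ∪ ⁅ v ⁆
        up x∈ = x∈p∪q⁺ (inj₁ x∈)
        out : ∀ {x} → x ∉ˢ B → x ≢ v → x ∉ˢ B ∪ ⁅ v ⁆
        out x∉ x≢v x∈ with x∈p∪q⁻ B ⁅ v ⁆ x∈
        ... | inj₁ p = x∉ p
        ... | inj₂ p = x≢v (x∈⁅y⁆⇒x≡y v p)
        in′ : ∀ {x} → x ∈ˢ B ∪ ⁅ v ⁆ → x ∈ˢ W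
        in′ x∈ with x∈p∪q⁻ B ⁅ v ⁆ x∈
        ... | inj₁ p = B⊆ p
        ... | inj₂ p = subst (_∈ˢ W) (sym (x∈⁅y⁆⇒x≡y v p)) v∈W
        con : ∀ {x} → x ∈ˢ B ∪ ⁅ v ⁆ → Walk G (_∈ˢ B ∪ ⁅ v ⁆) b x
        con x∈ with x∈p∪q⁻ B ⁅ v ⁆ x∈
        ... | inj₁ p = walk-map up (conn p)
        ... | inj₂ p rewrite x∈⁅y⁆⇒x≡y v p = walk-map up (conn u∈) ++ʷ step (up u∈) e (stay (x∈p∪q⁺ (inj₂ (x∈⁅x⁆ v))))

    arm : ∀ {a b c} → a ∈ˢ W → b ∈ˢ W → c ∈ˢ W → a ≢ b → b ≢ c → a ≢ c →
          ∃ λ (M : Arm G W a b c) → Arm.Near M a × Arm.Near M c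
    arm {a} {b} {c} a∈ b∈ c∈ a≢b b≢c a≢c = grow _ start ℕₚ.≤-refl
      where
      start : Arm G W a b c
      start = record { B = ⁅ b ⁆ ; b∈ = x∈⁅x⁆ b ; B⊆ = λ p → subst (_∈ˢ W) (sym (x∈⁅y⁆⇒x≡y b p)) b∈
        ; conn = λ p → subst (Walk G _ b) (sym (x∈⁅y⁆⇒x≡y b p)) (stay (x∈⁅x⁆ b))
        ; a∉ = a≢b ∘ x∈⁅y⁆⇒x≡y b ; c∉ = b≢c ∘ sym ∘ x∈⁅y⁆⇒x≡y b
        ; path = walk-map (λ { (w , ne) → w , ne ∘ x∈⁅y⁆⇒x≡y b }) (conn₂ b a∈ c∈ a≢b (b≢c ∘ sym)) }
      grow : ∀ k (M : Arm G W a b c) → ∣ ∁ (Arm.B M) ∣ ≤ k → ∃ λ (M : Arm G W a b c) → Arm.Near M a × Arm.Near M c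
      grow k M le with Arm.near? M c | Arm.near? M a
      ... | yes nc | yes na = M , na , nc
      grow zero M le | no _ | _ = ⊥-elim (ℕₚ.<⇒≱ (∣∣>0 (x∉p⇒x∈∁p (Arm.c∉ M))) le)
      grow zero M le | _ | no _ = ⊥-elim (ℕₚ.<⇒≱ (∣∣>0 (x∉p⇒x∈∁p (Arm.c∉ M))) le)
      grow (suc k) M le | no ¬nc | _ with Improve.bigger M b∈ a≢b a≢c ¬nc
      ... | M′ , lt = grow k M′ (ℕₚ.≤-pred (ℕₚ.≤-trans lt le))
      grow (suc k) M le | _ | no ¬na with Improve.bigger (Arm.flip M) b∈ (b≢c ∘ sym) (a≢c ∘ sym) ¬na
      ... | M′ , lt = grow k (Arm.flip M′) (ℕₚ.≤-pred (ℕₚ.≤-trans lt le))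

    -- This is all that a drawing of the contraction contributes; `no-crossing` supplies it for
    -- vertices in this order around the contracted vertex.
    Uncrossed : (a b c d : Fin n) → Set₁
    Uncrossed a b c d = ∀ {P Q : Fin n → Set} → (∀ {v} → P v → v ∈ˢ W) → (∀ {v} → Q v → v ∈ˢ W) → (∀ {v} → P v → Q v → ⊥) →
                        Walk G P a c → Walk G Q b d → ⊥

    -- The component `D` of `d` away from the arm and from `a`, `c` is to become the counterpart of
    -- the arm: it, too, touches both `a` and `c`.
    module Opposite {a b c d : Fin n} (M : Arm G W a b c) (d∈W : d ∈ˢ W) (a≢c : a ≢ c) (a≢d : a ≢ d) (c≢d : c ≢ d)
      (uncrossed : Uncrossed a b c d) where
      open Arm M

      d∉B : d ∉ˢ B
      d∉B d∈ = uncrossed proj₁ B⊆ (λ (_ , v∉) v∈ → v∉ v∈) path (conn d∈)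

      private
        S? : Decidable (λ x → x ∈ˢ W × x ∉ˢ B × x ≢ a × x ≢ c)
        S? x = x ∈? W ×-dec ¬? (x ∈? B) ×-dec ¬? (x ≟ᶠ a) ×-dec ¬? (x ≟ᶠ c)
        open Component (component G (sub S?) (sub⁺ S? (d∈W , d∉B , a≢d ∘ sym , c≢d ∘ sym))) using (within; closed)
      open Component (component G (sub S?) (sub⁺ S? (d∈W , d∉B , a≢d ∘ sym , c≢d ∘ sym))) public using () renaming (Z to D; root to d∈; conn to D-conn)

      D⊆ : ∀ {z} → z ∈ˢ D → z ∈ˢ W × z ∉ˢ B × z ≢ a × z ≢ c
      D⊆ z∈ = sub⁻ S? (within z∈)

      private
        module End {u v : Fin n} (v≢u : v ≢ u) (d≢u : d ≢ u) (v∈W : v ∈ˢ W) (v∉D : v ∉ˢ D)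
          (other : ∀ {x} → x ∈ˢ W → x ∉ˢ B → x ≢ u → x ≢ v → x ∈ˢ sub S?)
          (along : Walk G (λ x → x ∈ˢ W × x ∉ˢ B) v u)
          (orient : Walk G (λ x → (x ∈ˢ W × x ∉ˢ B) × x ∉ˢ D) v u → Walk G (λ x → (x ∈ˢ W × x ∉ˢ B) × x ∉ˢ D) a c) where

          -- If `D` did not touch `v`, the path from `v`, stopped at `u`, could not enter `D`. An
          -- edge between `D` and the arm would then complete a walk from `b` to `d` disjoint from
          -- this path; without such an edge, `u` alone would separate `D` from `v`.
          near : ∃ λ z → z ∈ˢ D × Adj G z v
          near with any? (λ z → z ∈? D ×-dec adj? G z v)
          ... | yes p = p
          ... | no ¬p = ⊥-elim (case any? (λ z → any? λ w → z ∈? D ×-dec w ∈? B ×-dec adj? G z w) of λ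
              { (yes (z , w , z∈ , w∈ , e)) → crossing (walk-map inj₁ (conn w∈) ++ʷ step (inj₁ w∈) (adj-sym G e) (walk-map inj₂ (walk-rev (D-conn z∈))))
              ; (no ¬q) → isolated ¬q })
            where
            detour : ∀ {w} → w ∉ˢ D → Walk G (λ x → x ∈ˢ W × x ∉ˢ B) w u → Walk G (λ x → (x ∈ˢ W × x ∉ˢ B) × x ∉ˢ D) w u
            detour w∉ (stay p) = stay (p , w∉)
            detour {w} w∉ (step {v = w′} p e π) with w ≟ᶠ u
            ... | yes refl = stay (p , w∉)
            ... | no w≢u = step (p , w∉) e (detour w′∉ π)
              where
              w′∉ : w′ ∉ˢ D
              w′∉ w′∈ with w ≟ᶠ v
              ... | yes refl = ¬p (w′ , w′∈ , adj-sym G e)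
              ... | no w≢v   = w∉ (closed w′∈ (other (proj₁ p) (proj₂ p) w≢u w≢v) (adj-sym G e))
            crossing : Walk G (λ x → x ∈ˢ B ⊎ x ∈ˢ D) b d → ⊥
            crossing = uncrossed (proj₁ ∘ proj₁) [ B⊆ , proj₁ ∘ D⊆ ]′
              (λ { ((_ , x∉B) , _) (inj₁ x∈) → x∉B x∈ ; (_ , x∉D) (inj₂ x∈) → x∉D x∈ }) (orient (detour v∉D along))
            isolated : ¬ (∃₂ λ z w → z ∈ˢ D × w ∈ˢ B × Adj G z w) → ⊥
            isolated ¬q with walk-exit (_∈? D) (conn₂ u d∈W v∈W d≢u v≢u) d∈ v∉D
            ... | z , w , z∈ , w∉ , _ , (w∈W , w≢u) , e with w ≟ᶠ v | w ∈? B
            ... | yes refl | _      = ¬p (z , z∈ , e)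
            ... | no _ | yes w∈B    = ¬q (z , w , z∈ , w∈B , e)
            ... | no w≢v | no w∉B   = w∉ (closed z∈ (other w∈W w∉B w≢u w≢v) e)

      near-a : ∃ λ z → z ∈ˢ D × Adj G z a
      near-a = End.near a≢c (c≢d ∘ sym) (proj₁ (walk-start path)) (λ z∈ → proj₁ (proj₂ (proj₂ (D⊆ z∈))) refl)
        (λ x∈ x∉ xc xa → sub⁺ S? (x∈ , x∉ , xa , xc)) path id

      near-c : ∃ λ z → z ∈ˢ D × Adj G z c
      near-c = End.near (a≢c ∘ sym) (a≢d ∘ sym) (proj₁ (walk-end path)) (λ z∈ → proj₂ (proj₂ (proj₂ (D⊆ z∈))) refl)
        (λ x∈ x∉ xa xc → sub⁺ S? (x∈ , x∉ , xa , xc)) (walk-rev path) walk-rev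

    module _ {U : Subset n} {x y : Fin n} (W⊆U : ∀ {v} → v ∈ˢ W → v ∈ˢ U) (x∈ : x ∈ˢ U) (y∈ : y ∈ˢ U)
      (x∉W : x ∉ˢ W) (y∉W : y ∉ˢ W) (xy : Adj G x y) where

      private
        x≢y : x ≢ y
        x≢y refl = adj-irrefl G refl xy
        apart : ∀ {v w : Fin n} {S : Subset n} → (∀ {z} → z ∈ˢ S → z ∈ˢ W) → v ∉ˢ W → w ∈ˢ ⁅ v ⁆ → w ∈ˢ S → ⊥
        apart {v} f v∉ p q = v∉ (subst (_∈ˢ W) (x∈⁅y⁆⇒x≡y v p) (f q))
        single : ∀ {v w : Fin n} → v ≢ w → Disjoint ⁅ v ⁆ ⁅ w ⁆
        single {v} {w} ne p q = ne (trans (sym (x∈⁅y⁆⇒x≡y v p)) (x∈⁅y⁆⇒x≡y w q))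
        avoid : ∀ {v : Fin n} {S : Subset n} → v ∉ˢ S → Disjoint ⁅ v ⁆ S
        avoid {v} {S} v∉ p q = v∉ (subst (_∈ˢ S) (x∈⁅y⁆⇒x≡y v p) q)
        one-W : ∀ {v} → v ∈ˢ W → ∀ {z} → z ∈ˢ ⁅ v ⁆ → z ∈ˢ W
        one-W {v} v∈ p = subst (_∈ˢ W) (sym (x∈⁅y⁆⇒x≡y v p)) v∈

      -- One side consists of `x`, the arm of `b` and the component `D` of `d`, the other one of
      -- `y`, `a` and `c`.
      interlaced⇒K₃₃ : ∀ {a b c d} → a ∈ˢ W → b ∈ˢ W → c ∈ˢ W → d ∈ˢ W →
        a ≢ b → a ≢ c → a ≢ d → b ≢ c → c ≢ d → Adj G x a → Adj G y b → Adj G x c → Adj G y d →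
        Uncrossed a b c d → Model (completeBipartite 3 3) G U
      interlaced⇒K₃₃ {a} {b} {c} {d} a∈ b∈W c∈ d∈W ab ac ad bc cd xa yb xc yd uncrossed
        with arm a∈ b∈W c∈ ab bc ac
      ... | M , (ua , ua∈ , ua-adj) , (uc , uc∈ , uc-adj) = model-from Ss
        (rooted-⁅⁆ x∈ ∷ rooted (W⊆U ∘ B⊆) b b∈ conn ∷ rooted (W⊆U ∘ proj₁ ∘ D⊆) d d∈ D-conn ∷
         rooted-⁅⁆ y∈ ∷ rooted-⁅⁆ (W⊆U a∈) ∷ rooted-⁅⁆ (W⊆U c∈) ∷ [])
        ((apart B⊆ x∉W ∷ apart (proj₁ ∘ D⊆) x∉W ∷ single x≢y ∷ apart (one-W a∈) x∉W ∷ apart (one-W c∈) x∉W ∷ []) ∷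
         ((λ p q → proj₁ (proj₂ (D⊆ q)) p) ∷ (λ p q → apart B⊆ y∉W q p) ∷ (λ p q → avoid a∉ q p) ∷ (λ p q → avoid c∉ q p) ∷ []) ∷
         ((λ p q → apart (proj₁ ∘ D⊆) y∉W q p) ∷ (λ p q → avoid (λ r → proj₁ (proj₂ (proj₂ (D⊆ r))) refl) q p) ∷
           (λ p q → avoid (λ r → proj₂ (proj₂ (proj₂ (D⊆ r))) refl) q p) ∷ []) ∷
         (apart (one-W a∈) y∉W ∷ apart (one-W c∈) y∉W ∷ []) ∷ (single ac ∷ []) ∷ [] ∷ [])
        λ {i} {j} e → bipartite-link {R = λ i j → Touch G (List.lookup Ss i) (List.lookup Ss j)} (touch-sym {G = G})
          {Q = λ _ _ → Fin 1} id lk {i} {j} e 0F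
        where
        open Arm M
        open Opposite M d∈W ac ad cd uncrossed
        Ss : List (Subset n)
        Ss = ⁅ x ⁆ ∷ B ∷ D ∷ ⁅ y ⁆ ∷ ⁅ a ⁆ ∷ ⁅ c ⁆ ∷ []
        lk : ∀ p q → Fin 1 → Touch G (List.lookup Ss (p ↑ˡ 3)) (List.lookup Ss (3 ↑ʳ q))
        lk 0F 0F _ = x , y , x∈⁅x⁆ x , x∈⁅x⁆ y , xy
        lk 0F 1F _ = x , a , x∈⁅x⁆ x , x∈⁅x⁆ a , xa
        lk 0F 2F _ = x , c , x∈⁅x⁆ x , x∈⁅x⁆ c , xc
        lk 1F 0F _ = b , y , b∈ , x∈⁅x⁆ y , adj-sym G yb
        lk 1F 1F _ = ua , a , ua∈ , x∈⁅x⁆ a , ua-adj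
        lk 1F 2F _ = uc , c , uc∈ , x∈⁅x⁆ c , uc-adj
        lk 2F 0F _ = d , y , d∈ , x∈⁅x⁆ y , adj-sym G yd
        lk 2F 1F _ = let (z , z∈ , e) = near-a in z , a , z∈ , x∈⁅x⁆ a , e
        lk 2F 2F _ = let (z , z∈ , e) = near-c in z , c , z∈ , x∈⁅x⁆ c , e

      -- The branch sets are `x`, `y`, `a`, the arm of `b` and the component of `c` away from the
      -- arm and from `a`; the path that the arm leaves intact joins the last one to `a`.
      common⇒K₅ : ∀ {a b c} → a ∈ˢ W → b ∈ˢ W → c ∈ˢ W → a ≢ b → a ≢ c → b ≢ c →
        Adj G x a → Adj G y a → Adj G x b → Adj G y b → Adj G x c → Adj G y c → Model (complete 5) G U
      common⇒K₅ {a} {b} {c} a∈ b∈W c∈ ab ac bc xa ya xb yb xc yc with arm a∈ b∈W c∈ ab bc ac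
      ... | M , (ua , ua∈ , ua-adj) , (uc , uc∈ , uc-adj) = model-from Ss
        (rooted-⁅⁆ x∈ ∷ rooted-⁅⁆ y∈ ∷ rooted-⁅⁆ (W⊆U a∈) ∷ rooted (W⊆U ∘ B⊆) b b∈ conn ∷ rooted (W⊆U ∘ proj₁ ∘ C⊆) c C.root C.conn ∷ [])
        ((single x≢y ∷ apart (one-W a∈) x∉W ∷ apart B⊆ x∉W ∷ apart (proj₁ ∘ C⊆) x∉W ∷ []) ∷
         (apart (one-W a∈) y∉W ∷ apart B⊆ y∉W ∷ apart (proj₁ ∘ C⊆) y∉W ∷ []) ∷
         (avoid a∉ ∷ avoid (λ r → proj₂ (proj₂ (C⊆ r)) refl) ∷ []) ∷ ((λ p q → proj₁ (proj₂ (C⊆ q)) p) ∷ []) ∷ [] ∷ [])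
        λ {i} {j} → lk i j
        where
        open Arm M
        S? : Decidable (λ v → v ∈ˢ W × v ∉ˢ B × v ≢ a)
        S? v = v ∈? W ×-dec ¬? (v ∈? B) ×-dec ¬? (v ≟ᶠ a)
        module C = Component (component G (sub S?) (sub⁺ S? (c∈ , c∉ , ac ∘ sym)))
        C⊆ : ∀ {z} → z ∈ˢ C.Z → z ∈ˢ W × z ∉ˢ B × z ≢ a
        C⊆ z∈ = sub⁻ S? (C.within z∈)
        Ss : List (Subset n)
        Ss = ⁅ x ⁆ ∷ ⁅ y ⁆ ∷ ⁅ a ⁆ ∷ B ∷ C.Z ∷ []
        to-a : Touch G C.Z ⁅ a ⁆
        to-a with walk-exit (_∈? C.Z) (walk-rev path) C.root (λ r → proj₂ (proj₂ (C⊆ r)) refl)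
        ... | p , q , p∈ , q∉ , _ , (q∈W , q∉B) , e with q ≟ᶠ a
        ... | yes refl = p , q , p∈ , x∈⁅x⁆ q , e
        ... | no q≢a   = ⊥-elim (q∉ (C.closed p∈ (sub⁺ S? (q∈W , q∉B , q≢a)) e))
        t₀₁ : Touch G ⁅ x ⁆ ⁅ y ⁆
        t₀₁ = x , y , x∈⁅x⁆ x , x∈⁅x⁆ y , xy
        t₀₂ : Touch G ⁅ x ⁆ ⁅ a ⁆
        t₀₂ = x , a , x∈⁅x⁆ x , x∈⁅x⁆ a , xa
        t₀₃ : Touch G ⁅ x ⁆ B
        t₀₃ = x , b , x∈⁅x⁆ x , b∈ , xb
        t₀₄ : Touch G ⁅ x ⁆ C.Z
        t₀₄ = x , c , x∈⁅x⁆ x , C.root , xc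
        t₁₂ : Touch G ⁅ y ⁆ ⁅ a ⁆
        t₁₂ = y , a , x∈⁅x⁆ y , x∈⁅x⁆ a , ya
        t₁₃ : Touch G ⁅ y ⁆ B
        t₁₃ = y , b , x∈⁅x⁆ y , b∈ , yb
        t₁₄ : Touch G ⁅ y ⁆ C.Z
        t₁₄ = y , c , x∈⁅x⁆ y , C.root , yc
        t₂₃ : Touch G B ⁅ a ⁆
        t₂₃ = ua , a , ua∈ , x∈⁅x⁆ a , ua-adj
        t₃₄ : Touch G B C.Z
        t₃₄ = uc , c , uc∈ , C.root , uc-adj
        back : {S T : Subset n} → Touch G S T → Touch G T S
        back = touch-sym {G = G}
        lk : ∀ i j → i ≢ j → Touch G (List.lookup Ss i) (List.lookup Ss j)
        lk 0F 1F _ = t₀₁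
        lk 0F 2F _ = t₀₂
        lk 0F 3F _ = t₀₃
        lk 0F 4F _ = t₀₄
        lk 1F 0F _ = back t₀₁
        lk 1F 2F _ = t₁₂
        lk 1F 3F _ = t₁₃
        lk 1F 4F _ = t₁₄
        lk 2F 0F _ = back t₀₂
        lk 2F 1F _ = back t₁₂
        lk 2F 3F _ = back t₂₃
        lk 2F 4F _ = back to-a
        lk 3F 0F _ = back t₀₃
        lk 3F 1F _ = back t₁₃
        lk 3F 2F _ = t₂₃
        lk 3F 4F _ = t₃₄
        lk 4F 0F _ = back t₀₄
        lk 4F 1F _ = back t₁₄
        lk 4F 2F _ = to-a
        lk 4F 3F _ = back t₃₄
        lk 0F 0F ne = ⊥-elim (ne refl)
        lk 1F 1F ne = ⊥-elim (ne refl)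
        lk 2F 2F ne = ⊥-elim (ne refl)
        lk 3F 3F ne = ⊥-elim (ne refl)
        lk 4F 4F ne = ⊥-elim (ne refl)

  -- K separates C from the rest of U.
  record Sep (G : Graph n) (U K C : Subset n) : Set where
    constructor sep
    field
      C⊆     : ∀ v → v ∈ˢ C → v ∈ˢ U × v ∉ˢ K
      inner  : ∃ λ v → v ∈ˢ C
      outer  : ∃ λ v → v ∈ˢ U × v ∉ˢ C × v ∉ˢ K
      closed : ∀ u v → u ∈ˢ C → v ∈ˢ U → Adj G u v → v ∈ˢ C ⊎ v ∈ˢ K

  sep? : (G : Graph n) (U K : Subset n) → Dec (∃ (Sep G U K))
  sep? G U K = anySubset? λ C → map′ (λ (a , b , c , d) → sep a b c d) (λ (sep a b c d) → a , b , c , d)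
    ((all? λ v → v ∈? C →-dec (v ∈? U ×-dec ¬? (v ∈? K))) ×-dec (any? λ v → v ∈? C) ×-dec
     (any? λ v → v ∈? U ×-dec ¬? (v ∈? C) ×-dec ¬? (v ∈? K)) ×-dec
     (all? λ u → all? λ v → u ∈? C →-dec (v ∈? U →-dec (adj? G u v →-dec (v ∈? C ⊎-dec v ∈? K)))))

  module _ {G : Graph n} {U : Subset n} where

    other-side? : ∀ K C → Decidable (λ v → v ∈ˢ U × v ∉ˢ C × v ∉ˢ K)
    other-side? K C v = v ∈? U ×-dec ¬? (v ∈? C) ×-dec ¬? (v ∈? K)

    sep-other : ∀ {K C} → Sep G U K C → Sep G U K (sub (other-side? K C))
    sep-other {K} {C} (sep C⊆ (i , i∈) (o , o∈) cl) = sep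
      (λ v v∈ → let (a , _ , c) = sub⁻ O? v∈ in a , c) (o , sub⁺ O? o∈)
      (i , proj₁ (C⊆ i i∈) , (λ i∈′ → proj₁ (proj₂ (sub⁻ O? i∈′)) i∈) , proj₂ (C⊆ i i∈)) closed′
      where
      O? = other-side? K C
      closed′ : ∀ u v → u ∈ˢ sub O? → v ∈ˢ U → Adj G u v → v ∈ˢ sub O? ⊎ v ∈ˢ K
      closed′ u v u∈ v∈ e with v ∈? K | v ∈? C | sub⁻ O? u∈
      ... | yes v∈K | _ | _ = inj₂ v∈K
      ... | no v∉K | no v∉C | _ = inj₁ (sub⁺ O? (v∈ , v∉C , v∉K))
      ... | no v∉K | yes v∈C | u∈U , u∉C , u∉K with cl v u v∈C u∈U (adj-sym G e)
      ... | inj₁ u∈C = ⊥-elim (u∉C u∈C)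
      ... | inj₂ u∈K = ⊥-elim (u∉K u∈K)

    -- Two adjacent vertices cannot be separated, so one side avoids both.
    avoiding : ∀ {K C s t} → Sep G U K C → s ∈ˢ U → t ∈ˢ U → Adj G s t → ∃ λ C → Sep G U K C × s ∉ˢ C × t ∉ˢ C
    avoiding {K} {C} {s} {t} S s∈ t∈ st with s ∈? C | t ∈? C
    ... | no s∉ | no t∉ = C , S , s∉ , t∉
    ... | yes s∈C | _ = _ , sep-other S , (λ p → proj₁ (proj₂ (sub⁻ (other-side? K C) p)) s∈C) , λ p →
        let (_ , t∉C , t∉K) = sub⁻ (other-side? K C) p in [ t∉C , t∉K ]′ (Sep.closed S s t s∈C t∈ st)
    ... | no _ | yes t∈C = _ , sep-other S , (λ p →
        let (_ , s∉C , s∉K) = sub⁻ (other-side? K C) p in [ s∉C , s∉K ]′ (Sep.closed S t s t∈C s∈ (adj-sym G st))) ,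
        λ p → proj₁ (proj₂ (sub⁻ (other-side? K C) p)) t∈C

    connected : ∀ {K} → ¬ ∃ (Sep G U K) → ∀ {u v} → u ∈ˢ U → v ∈ˢ U → u ∉ˢ K → v ∉ˢ K → Walk G (λ x → x ∈ˢ U × x ∉ˢ K) u v
    connected {K} ¬sep {u} {v} u∈ v∈ u∉ v∉ with v ∈? Z
      where
      S? : Decidable (λ x → x ∈ˢ U × x ∉ˢ K)
      S? x = x ∈? U ×-dec ¬? (x ∈? K)
      open Component (component G (sub S?) (sub⁺ S? (u∈ , u∉)))
    ... | yes v∈Z = walk-map (sub⁻ S? ∘ within) (conn v∈Z)
      where
      S? : Decidable (λ x → x ∈ˢ U × x ∉ˢ K)
      S? x = x ∈? U ×-dec ¬? (x ∈? K)
      open Component (component G (sub S?) (sub⁺ S? (u∈ , u∉)))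
    ... | no v∉Z = ⊥-elim (¬sep (Z , sep (λ w w∈ → sub⁻ S? (within w∈)) (u , root) (v , v∈ , v∉Z , v∉) cl))
      where
      S? : Decidable (λ x → x ∈ˢ U × x ∉ˢ K)
      S? x = x ∈? U ×-dec ¬? (x ∈? K)
      open Component (component G (sub S?) (sub⁺ S? (u∈ , u∉)))
      cl : ∀ a b → a ∈ˢ Z → b ∈ˢ U → Adj G a b → b ∈ˢ Z ⊎ b ∈ˢ K
      cl a b a∈ b∈ e with b ∈? K
      ... | yes b∈K = inj₂ b∈K
      ... | no b∉K  = inj₁ (closed a∈ (sub⁺ S? (b∈ , b∉K)) e)

  duo? : (p q : Fin n) → Decidable (λ v → v ≡ p ⊎ v ≡ q)
  duo? p q v = v ≟ᶠ p ⊎-dec v ≟ᶠ q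

  -- The two vertices may coincide or lie outside `U`, so separations by fewer than two vertices are
  -- included.
  duo : (p q : Fin n) → Subset n
  duo p q = sub (duo? p q)

  trio? : (p q r : Fin n) → Decidable (λ v → v ≡ p ⊎ v ≡ q ⊎ v ≡ r)
  trio? p q r v = v ≟ᶠ p ⊎-dec v ≟ᶠ q ⊎-dec v ≟ᶠ r

  trio : (p q r : Fin n) → Subset n
  trio p q r = sub (trio? p q r)

  Contractible : Graph n → Subset n → Fin n → Fin n → Set
  Contractible G U x y = ∀ c → ¬ ∃ (Sep G U (trio x y c))

  contractible? : (G : Graph n) (U : Subset n) (x y : Fin n) → Dec (Contractible G U x y)
  contractible? G U x y = all? λ c → ¬? (sep? G U (trio x y c))

  module ContractibleEdge {G : Graph n} {U : Subset n} (conn₃ : ∀ p q → ¬ ∃ (Sep G U (duo p q)))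
    {s t : Fin n} (s∈ : s ∈ˢ U) (t∈ : t ∈ˢ U) (st : Adj G s t) where

    Found : Set
    Found = ∃₂ λ x y → x ∈ˢ U × y ∈ˢ U × Adj G x y × ¬ SamePair x y s t × Contractible G U x y

    private
      not-contractible : ∀ {x y} → ¬ Contractible G U x y → ∃ λ c → ∃ (Sep G U (trio x y c))
      not-contractible {x} {y} ¬c with any? (λ c → sep? G U (trio x y c))
      ... | yes p = p
      ... | no ¬p = ⊥-elim (¬c λ c q → ¬p (c , q))

      -- The classical descent. `c` has a neighbour `w` in `C`, or else `x` and `y` alone would
      -- separate. If some `c`, `w`, `w′` separate, the adjacent vertices `x`, `y` miss one side
      -- `D`. An edge from `C` to `D` stays in `C`, so `C ∩ D` is a side of the new separation, and
      -- it lacks `w`. The edge `c w` is never `s t`, because `w` lies in `C` and `s`, `t` do not.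
      descend : ∀ k {x y c C} → ∣ C ∣ ≤ k → x ∈ˢ U → y ∈ˢ U → Adj G x y → Sep G U (trio x y c) C → s ∉ˢ C → t ∉ˢ C → Found
      descend zero le _ _ _ S _ _ = ⊥-elim (ℕₚ.<⇒≱ (∣∣>0 (proj₂ (Sep.inner S))) le)
      descend (suc k) {x} {y} {c} {C} le x∈ y∈ xy S s∉ t∉
        with any? (λ w → w ∈? C ×-dec adj? G c w ×-dec c ∈? U)
      ... | no ¬w = ⊥-elim (conn₃ x y (C , sep
          (λ v v∈ → let (a , b) = Sep.C⊆ S v v∈ in a , λ q → b (widen (sub⁻ (duo? x y) q)))
          (Sep.inner S)
          (let (o , a , b , q) = Sep.outer S in o , a , b , λ r → q (widen (sub⁻ (duo? x y) r)))
          cl))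
        where
        widen : ∀ {v} → v ≡ x ⊎ v ≡ y → v ∈ˢ trio x y c
        widen (inj₁ e) = sub⁺ (trio? x y c) (inj₁ e)
        widen (inj₂ e) = sub⁺ (trio? x y c) (inj₂ (inj₁ e))
        cl : ∀ u v → u ∈ˢ C → v ∈ˢ U → Adj G u v → v ∈ˢ C ⊎ v ∈ˢ duo x y
        cl u v u∈ v∈ e with Sep.closed S u v u∈ v∈ e
        ... | inj₁ r = inj₁ r
        ... | inj₂ r with sub⁻ (trio? x y c) r
        ... | inj₁ p = inj₂ (sub⁺ (duo? x y) (inj₁ p))
        ... | inj₂ (inj₁ p) = inj₂ (sub⁺ (duo? x y) (inj₂ p))
        ... | inj₂ (inj₂ refl) = ⊥-elim (¬w (u , u∈ , adj-sym G e , v∈))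
      ... | yes (w , w∈C , cw , c∈) with contractible? G U c w
      ... | yes con = c , w , c∈ , proj₁ (Sep.C⊆ S w w∈C) , cw ,
          (λ { (inj₁ (_ , refl)) → t∉ w∈C ; (inj₂ (_ , refl)) → s∉ w∈C }) , con
      ... | no ¬con with not-contractible ¬con
      ... | w′ , D₀ , S₀ with avoiding S₀ x∈ y∈ xy
      ... | D , T , x∉ , y∉ = descend k smaller c∈ w∈U cw S′ (s∉ ∘ left) (t∉ ∘ left)
        where
        w∈U : w ∈ˢ U
        w∈U = proj₁ (Sep.C⊆ S w w∈C)
        both? : Decidable (λ v → v ∈ˢ C × v ∈ˢ D)
        both? v = v ∈? C ×-dec v ∈? D
        C′ : Subset n
        C′ = sub both?
        left : ∀ {v} → v ∈ˢ C′ → v ∈ˢ C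
        left v∈ = proj₁ (sub⁻ both? v∈)
        w∉D : w ∉ˢ D
        w∉D w∈ = proj₂ (Sep.C⊆ T w w∈) (sub⁺ (trio? c w w′) (inj₂ (inj₁ refl)))
        c∉D : c ∉ˢ D
        c∉D c∈ = proj₂ (Sep.C⊆ T c c∈) (sub⁺ (trio? c w w′) (inj₁ refl))
        smaller : ∣ C′ ∣ ≤ k
        smaller = ℕₚ.≤-pred (ℕₚ.≤-trans (p⊂q⇒∣p∣<∣q∣ (left , w , w∈C , λ w∈ → w∉D (proj₂ (sub⁻ both? w∈)))) le)
        meet : ∀ {u v} → u ∈ˢ C → v ∈ˢ U → v ∈ˢ D → Adj G u v → v ∈ˢ C
        meet {u} {v} u∈ v∈ v∈D e with Sep.closed S u v u∈ v∈ e
        ... | inj₁ r = r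
        ... | inj₂ r with sub⁻ (trio? x y c) r
        ... | inj₁ refl        = ⊥-elim (x∉ v∈D)
        ... | inj₂ (inj₁ refl) = ⊥-elim (y∉ v∈D)
        ... | inj₂ (inj₂ refl) = ⊥-elim (c∉D v∈D)
        inner′ : ∃ λ v → v ∈ˢ C′
        inner′ with any? (λ u → u ∈? D ×-dec adj? G w u)
        ... | yes (u , u∈D , e) = u , sub⁺ both? (meet w∈C (proj₁ (Sep.C⊆ T u u∈D)) u∈D e , u∈D)
        ... | no ¬u = ⊥-elim (conn₃ c w′ (D , sep
            (λ v v∈ → let (a , b) = Sep.C⊆ T v v∈ in a , λ q → b (widen (sub⁻ (duo? c w′) q))) (Sep.inner T)
            (let (o , a , b , q) = Sep.outer T in o , a , b , λ r → q (widen (sub⁻ (duo? c w′) r))) cl))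
          where
          widen : ∀ {v} → v ≡ c ⊎ v ≡ w′ → v ∈ˢ trio c w w′
          widen (inj₁ e) = sub⁺ (trio? c w w′) (inj₁ e)
          widen (inj₂ e) = sub⁺ (trio? c w w′) (inj₂ (inj₂ e))
          cl : ∀ u v → u ∈ˢ D → v ∈ˢ U → Adj G u v → v ∈ˢ D ⊎ v ∈ˢ duo c w′
          cl u v u∈ v∈ e with Sep.closed T u v u∈ v∈ e
          ... | inj₁ r = inj₁ r
          ... | inj₂ r with sub⁻ (trio? c w w′) r
          ... | inj₁ p = inj₂ (sub⁺ (duo? c w′) (inj₁ p))
          ... | inj₂ (inj₁ refl) = ⊥-elim (¬u (u , u∈ , adj-sym G e))
          ... | inj₂ (inj₂ p) = inj₂ (sub⁺ (duo? c w′) (inj₂ p))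
        S′ : Sep G U (trio c w w′) C′
        S′ = sep (λ v v∈ → Sep.C⊆ T v (proj₂ (sub⁻ both? v∈))) inner′
          (let (o , a , b , q) = Sep.outer T in o , a , (λ r → b (proj₂ (sub⁻ both? r))) , q) cl
          where
          cl : ∀ u v → u ∈ˢ C′ → v ∈ˢ U → Adj G u v → v ∈ˢ C′ ⊎ v ∈ˢ trio c w w′
          cl u v u∈ v∈ e with Sep.closed T u v (proj₂ (sub⁻ both? u∈)) v∈ e
          ... | inj₂ r = inj₂ r
          ... | inj₁ v∈D = inj₁ (sub⁺ both? (meet (left u∈) v∈ v∈D e , v∈D))

    contractible-edge : ∀ {w} → w ∈ˢ U → w ≢ s → w ≢ t → Found
    contractible-edge {w} w∈ w≢s w≢t with any? (λ x → x ∈? U ×-dec adj? G w x)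
    -- Without a neighbour, `w` would be separated from `t` by the degenerate pair `s`, `s`.
    ... | no ¬x = ⊥-elim (conn₃ s s (⁅ w ⁆ , sep
        (λ v v∈ → subst (_∈ˢ U) (sym (x∈⁅y⁆⇒x≡y w v∈)) w∈ , λ q → w≢s (trans (sym (x∈⁅y⁆⇒x≡y w v∈)) ([ id , id ]′ (sub⁻ (duo? s s) q))))
        (w , x∈⁅x⁆ w)
        (t , t∈ , (λ q → w≢t (sym (x∈⁅y⁆⇒x≡y w q))) , λ q → adj-irrefl G (sym ([ id , id ]′ (sub⁻ (duo? s s) q))) st)
        λ u v u∈ v∈ e → ⊥-elim (¬x (v , v∈ , subst (λ z → Adj G z v) (x∈⁅y⁆⇒x≡y w u∈) e))))
    ... | yes (x , x∈ , wx) with contractible? G U w x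
    ... | yes con = w , x , w∈ , x∈ , wx , (λ { (inj₁ (e , _)) → w≢s e ; (inj₂ (e , _)) → w≢t e }) , con
    ... | no ¬con with not-contractible ¬con
    ... | c , C₀ , S₀ with avoiding S₀ s∈ t∈ st
    ... | C , S , s∉ , t∉ = descend _ ℕₚ.≤-refl w∈ x∈ wx S s∉ t∉

-- Sweeps as runs over a list of vertices

module Runs where
  import Data.List.Properties as Listₚ
  import Data.List.Relation.Unary.All as All
  import Data.List.Relation.Unary.All.Properties as Allₚ
  import Data.List.Membership.Propositional.Properties as ∈ₚ
  import Data.List.Relation.Unary.Any.Properties as Anyₚ
  import Data.List.Membership.DecPropositional as Mem
  open import Data.Product.Base using (swap)
  open import Data.Product.Properties using (≡-dec)

  private variable
    n : ℕ
    A B : Set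

  Unique : List A → Set
  Unique = AllPairs _≢_

  all-∈ : {P : A → Set} {xs : List A} {x : A} → All P xs → x ∈ˡ xs → P x
  all-∈ ps x∈ = All.lookup ps x∈

  ∈-all : {P : A → Set} (xs : List A) → (∀ {x} → x ∈ˡ xs → P x) → All P xs
  ∈-all []       f = []
  ∈-all (x ∷ xs) f = f (here refl) ∷ ∈-all xs (f ∘ there)

  ∉-all : {x : A} {xs : List A} → All (x ≢_) xs → x ∉ˡ xs
  ∉-all ps x∈ = all-∈ ps x∈ refl

  uniq-++⁻ : (xs : List A) {ys : List A} → Unique (xs ++ ys) → Unique xs × Unique ys × (∀ {w} → w ∈ˡ xs → w ∈ˡ ys → ⊥)
  uniq-++⁻ [] u = [] , u , λ ()
  uniq-++⁻ (x ∷ xs) (p ∷ u) with uniq-++⁻ xs u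
  ... | ux , uy , dj = Allₚ.++⁻ˡ xs p ∷ ux , uy , λ { (here refl) q → all-∈ (Allₚ.++⁻ʳ xs p) q refl ; (there r) q → dj r q }

  uniq-++⁺ : {xs ys : List A} → Unique xs → Unique ys → (∀ {w} → w ∈ˡ xs → w ∈ˡ ys → ⊥) → Unique (xs ++ ys)
  uniq-++⁺ [] uy dj = uy
  uniq-++⁺ {xs = x ∷ xs} (p ∷ ux) uy dj =
    Allₚ.++⁺ p (∈-all _ λ q e → dj (here refl) (subst (_∈ˡ _) (sym e) q)) ∷ uniq-++⁺ ux uy (dj ∘ there)

  uniq-mid : (xs : List A) {z : A} {ys : List A} → Unique (xs ++ z ∷ ys) → z ∉ˡ xs × z ∉ˡ ys × (∀ {w} → w ∈ˡ xs → w ∈ˡ ys → ⊥)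
  uniq-mid xs u with uniq-++⁻ xs u
  ... | _ , p ∷ _ , dj = (λ z∈ → dj z∈ (here refl)) , ∉-all p , λ a b → dj a (there b)

  uniq-reverse : {xs : List A} → Unique xs → Unique (reverse xs)
  uniq-reverse [] = []
  uniq-reverse {xs = x ∷ xs} (p ∷ u) = subst Unique (sym (Listₚ.unfold-reverse x xs))
    (uniq-++⁺ (uniq-reverse u) ([] ∷ []) λ { q (here refl) → all-∈ p (Anyₚ.reverse⁻ q) refl })

  uniq-map : {f : A → B} {xs : List A} → (∀ {x y} → x ∈ˡ xs → y ∈ˡ xs → f x ≡ f y → x ≡ y) → Unique xs → Unique (map f xs)
  uniq-map inj [] = []
  uniq-map {f = f} {x ∷ xs} inj (p ∷ u) =
    ∈-all _ (λ q e → let (y , y∈ , e′) = ∈ₚ.∈-map⁻ f q in all-∈ p y∈ (inj (here refl) (there y∈) (trans e e′)))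
    ∷ uniq-map (λ a b → inj (there a) (there b)) u

  ++-compare : (as cs : List A) {bs ds : List A} → as ++ bs ≡ cs ++ ds →
               (∃ λ m → as ≡ cs ++ m × ds ≡ m ++ bs) ⊎ (∃ λ m → cs ≡ as ++ m × bs ≡ m ++ ds)
  ++-compare [] cs e = inj₂ (cs , refl , e)
  ++-compare (a ∷ as) [] e = inj₁ (a ∷ as , refl , sym e)
  ++-compare (a ∷ as) (c ∷ cs) e with Listₚ.∷-injective e
  ... | refl , e′ with ++-compare as cs e′
  ... | inj₁ (m , p , q) = inj₁ (m , cong (a ∷_) p , q)
  ... | inj₂ (m , p , q) = inj₂ (m , cong (a ∷_) p , q)

  data Last {A : Set} (t : A) : List A → Set where
    one  : Last t (t ∷ [])
    more : ∀ {x xs} → Last t xs → Last t (x ∷ xs)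

  last-++ : {t : A} (xs : List A) {ys : List A} → Last t ys → Last t (xs ++ ys)
  last-++ []       l = l
  last-++ (x ∷ xs) l = more (last-++ xs l)

  last-suffix : {t : A} (xs : List A) {y : A} {ys : List A} → Last t (xs ++ y ∷ ys) → Last t (y ∷ ys)
  last-suffix []           l        = l
  last-suffix (x ∷ [])     (more l) = l
  last-suffix (x ∷ z ∷ xs) (more l) = last-suffix (z ∷ xs) l

  last-∈ : {t : A} {xs : List A} → Last t xs → t ∈ˡ xs
  last-∈ one      = here refl
  last-∈ (more l) = there (last-∈ l)

  -- A strand is an edge directed from the earlier to the later end.  A state lists the
  -- strands met by a vertical line from top to bottom.
  Strand : ℕ → Set
  Strand n = Fin n × Fin n

  State : ℕ → Set
  State n = List (Strand n)

  From To : Fin n → Strand n → Set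
  From v e = proj₁ e ≡ v
  To   v e = proj₂ e ≡ v

  Rule : ℕ → Set₁
  Rule n = Fin n → List (Fin n) → State n → Set

  -- Run Q ρ σ vs τ is a sweep, from left to right, over the vertices vs between
  -- the states σ and τ; the vertices ρ come later.
  data Run (Q : Rule n) (ρ : List (Fin n)) : State n → List (Fin n) → State n → Set where
    done  : ∀ {σ} → Run Q ρ σ [] σ
    event : ∀ {v vs σ τ} pre ins outs post → σ ≡ pre ++ ins ++ post → All (To v) ins → All (From v) outs →
            Q v (vs ++ ρ) outs → Run Q ρ (pre ++ outs ++ post) vs τ → Run Q ρ σ (v ∷ vs) τ

  Complete Exact : Graph n → Rule n
  Complete G v vs outs = ∀ {w} → w ∈ˡ vs → Adj G v w → (v , w) ∈ˡ outs
  Exact G v vs outs = Unique outs × (∀ {a w} → (a , w) ∈ˡ outs → w ∈ˡ vs × Adj G v w) × Complete G v vs outs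

  private variable
    Q Q′ : Rule n
    ρ ρ′ vs us : List (Fin n)
    σ σ′ τ υ : State n
    v x z : Fin n

  run-map : (∀ {v us outs} → v ∈ˡ vs → (∀ {w} → w ∈ˡ us → w ∈ˡ vs) → Q v (us ++ ρ) outs → Q′ v (us ++ ρ′) outs) →
            Run Q ρ σ vs τ → Run Q′ ρ′ σ vs τ
  run-map f done = done
  run-map {vs = v ∷ vs} {Q = Q} {Q′ = Q′} f (event pre ins outs post e i o q R) =
    event pre ins outs post e i o (f (here refl) there q)
      (run-map {Q = Q} {Q′ = Q′} (λ v∈ us⊆ → f (there v∈) (there ∘ us⊆)) R)

  infixr 5 _⊕_
  _⊕_ : ∀ {β} → Run Q (β ++ ρ) σ vs τ → Run Q ρ τ β υ → Run Q ρ σ (vs ++ β) υ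
  done ⊕ S = S
  _⊕_ {Q = Q} {ρ = ρ} {β = β} (event {v} {vs} pre ins outs post e i o q R) S =
    event pre ins outs post e i o (subst (λ l → Q v l outs) (sym (Listₚ.++-assoc vs β ρ)) q) (R ⊕ S)

  frame-eq : (a pre ins post b : List A) → a ++ (pre ++ ins ++ post) ++ b ≡ (a ++ pre) ++ ins ++ post ++ b
  frame-eq a pre ins post b = begin
    a ++ (pre ++ ins ++ post) ++ b   ≡⟨ cong (a ++_) (Listₚ.++-assoc pre (ins ++ post) b) ⟩
    a ++ pre ++ (ins ++ post) ++ b   ≡⟨ cong (λ l → a ++ pre ++ l) (Listₚ.++-assoc ins post b) ⟩
    a ++ pre ++ ins ++ post ++ b     ≡⟨ sym (Listₚ.++-assoc a pre _) ⟩
    (a ++ pre) ++ ins ++ post ++ b   ∎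
    where open ≡-Reasoning

  frame : (a b : State n) → Run Q ρ σ vs τ → Run Q ρ (a ++ σ ++ b) vs (a ++ τ ++ b)
  frame a b done = done
  frame {Q = Q} {ρ = ρ} a b (event {v} {vs} {τ = τ} pre ins outs post refl i o q R) =
    event (a ++ pre) ins outs (post ++ b) (frame-eq a pre ins post b) i o q
      (subst (λ l → Run Q ρ l vs (a ++ τ ++ b)) (frame-eq a pre outs post b) (frame a b R))

  targets : Run Q ρ σ vs [] → ∀ {e} → e ∈ˡ σ → proj₂ e ∈ˡ vs
  targets (event pre ins outs post refl i o q R) e∈ with ∈-++⁻ pre e∈
  ... | inj₁ p = there (targets R (∈-++⁺ˡ p))
  ... | inj₂ p with ∈-++⁻ ins p
  ... | inj₁ r = here (all-∈ i r)
  ... | inj₂ r = there (targets R (∈-++⁺ʳ pre (∈-++⁺ʳ outs r)))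

  record At (Q : Rule n) (ρ : List (Fin n)) (σ : State n) (z : Fin n) (vs : List (Fin n)) (τ : State n) : Set where
    field
      before after : List (Fin n)
      split-vs     : vs ≡ before ++ z ∷ after
      pre ins outs post : State n
      prefix       : Run Q (z ∷ after ++ ρ) σ before (pre ++ ins ++ post)
      ins-to       : All (To z) ins
      outs-from    : All (From z) outs
      rule         : Q z (after ++ ρ) outs
      suffix       : Run Q ρ (pre ++ outs ++ post) after τ

  locate : z ∈ˡ vs → Run Q ρ σ vs τ → At Q ρ σ z vs τ
  locate (here refl) (event pre ins outs post refl i o q R) = record
    { before = [] ; after = _ ; split-vs = refl ; pre = pre ; ins = ins ; outs = outs ; post = post
    ; prefix = done ; ins-to = i ; outs-from = o ; rule = q ; suffix = R }
  locate {Q = Q} {ρ = ρ} (there z∈) (event {v} {vs} pre ins outs post e i o q R) = record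
    { before = v ∷ before ; after = after ; split-vs = cong (v ∷_) split-vs
    ; pre = A.pre ; ins = A.ins ; outs = A.outs ; post = A.post
    ; prefix = event pre ins outs post e i o (subst (λ l → Q v l outs) eq q) prefix
    ; ins-to = ins-to ; outs-from = outs-from ; rule = rule ; suffix = suffix }
    where
    module A = At (locate z∈ R)
    open A using (before; after; split-vs; prefix; ins-to; outs-from; rule; suffix)
    eq : vs ++ ρ ≡ before ++ _ ∷ after ++ ρ
    eq = trans (cong (_++ ρ) split-vs) (Listₚ.++-assoc before _ ρ)

  -- Exp σ τ: every strand of σ is replaced by some strands with the same target.
  data Exp {n : ℕ} : State n → State n → Set where
    []  : Exp [] []
    _∷_ : ∀ {d ds σ τ} → All (To (proj₂ d)) ds → Exp σ τ → Exp (d ∷ σ) (ds ++ τ)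

  exp-refl : (σ : State n) → Exp σ σ
  exp-refl []      = []
  exp-refl (d ∷ σ) = (refl ∷ []) ∷ exp-refl σ

  exp-++ : Exp σ τ → Exp σ′ υ → Exp (σ ++ σ′) (τ ++ υ)
  exp-++ [] E′ = E′
  exp-++ {σ′ = σ′} {υ = υ} (_∷_ {ds = ds} {σ} {τ} p E) E′ =
    subst (Exp _) (sym (Listₚ.++-assoc ds τ υ)) (p ∷ exp-++ E E′)

  exp-++⁻ : (a : State n) {b τ : State n} → Exp (a ++ b) τ → ∃₂ λ a′ b′ → τ ≡ a′ ++ b′ × Exp a a′ × Exp b b′
  exp-++⁻ [] E = [] , _ , refl , [] , E
  exp-++⁻ (d ∷ a) (_∷_ {ds = ds} p E) with exp-++⁻ a E
  ... | a′ , b′ , refl , Ea , Eb = ds ++ a′ , b′ , sym (Listₚ.++-assoc ds a′ b′) , p ∷ Ea , Eb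

  exp-To : All (To v) σ → Exp σ τ → All (To v) τ
  exp-To [] [] = []
  exp-To (refl ∷ i) (p ∷ E) = Allₚ.++⁺ p (exp-To i E)

  -- Neighbouring strands with one target end in the same event. So a strand may be multiplied,
  -- dropped or given another source from its first state on, without disturbing the rest.
  reroute : (∀ {v us outs} → v ∈ˡ vs → (∀ {w} → w ∈ˡ us → w ∈ˡ vs) → All (From v) outs → Q v (us ++ ρ) outs →
               ∃ λ outs′ → Exp outs outs′ × All (From v) outs′ × Q′ v (us ++ ρ′) outs′) →
            Run Q ρ σ vs [] → Exp σ σ′ → Run Q′ ρ′ σ′ vs []
  reroute f done [] = done
  reroute {vs = v ∷ vs} {Q = Q} {Q′ = Q′} f (event pre ins outs post refl i o q R) E with exp-++⁻ pre E
  ... | pre′ , _ , refl , Epre , E′ with exp-++⁻ ins E′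
  ... | ins′ , post′ , refl , Eins , Epost with f (here refl) there o q
  ... | outs′ , Eouts , o′ , q′ = event pre′ ins′ outs′ post′ refl (exp-To i Eins) o′ q′
    (reroute {Q = Q} {Q′ = Q′} (λ v∈ us⊆ → f (there v∈) (there ∘ us⊆)) R (exp-++ Epre (exp-++ Eouts Epost)))

  strand-≟ : (e f : Strand n) → Dec (e ≡ f)
  strand-≟ = ≡-dec _≟ᶠ_ _≟ᶠ_

  _∈ˡ?_ : (v : Fin n) (vs : List (Fin n)) → Dec (v ∈ˡ vs)
  _∈ˡ?_ = Mem._∈?_ _≟ᶠ_

  dedupe : {P : Strand n → Set} → Decidable P → (outs : State n) →
           ∃ λ outs′ → Exp outs outs′ × Unique outs′ × (∀ {e} → e ∈ˡ outs′ → e ∈ˡ outs × P e) × (∀ {e} → e ∈ˡ outs → P e → e ∈ˡ outs′)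
  dedupe P? [] = [] , [] , [] , (λ ()) , λ ()
  dedupe P? (d ∷ outs) with dedupe P? outs
  ... | outs′ , E , u , s , c with P? d ×-dec ¬? (Mem._∈?_ strand-≟ d outs′)
  ... | yes (p , d∉) = d ∷ outs′ , (refl ∷ []) ∷ E , ∈-all outs′ (λ { q refl → d∉ q }) ∷ u ,
    (λ { (here refl) → here refl , p ; (there q) → let (a , b) = s q in there a , b }) ,
    (λ { (here refl) _ → here refl ; (there q) r → there (c q r) })
  ... | no ¬p = outs′ , [] ∷ E , u , (λ q → let (a , b) = s q in there a , b) , comp
    where
    comp : ∀ {e} → e ∈ˡ d ∷ outs → _ → e ∈ˡ outs′
    comp (there q) r = c q r
    comp (here refl) r with Mem._∈?_ strand-≟ d outs′
    ... | yes d∈ = d∈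
    ... | no d∉  = ⊥-elim (¬p (r , d∉))

  normalise : {G : Graph n} → Run (Complete G) ρ σ vs [] → Exp σ σ′ → Run (Exact G) ρ σ′ vs []
  normalise {ρ = ρ} {G = G} = reroute {Q = Complete G} {Q′ = Exact G} λ {v} {us} {outs} _ _ o q →
    let (outs′ , E , u , s , c) = dedupe (λ e → (proj₂ e ∈ˡ? (us ++ ρ)) ×-dec adj? G v (proj₂ e)) outs
    in outs′ , E , ∈-all outs′ (λ e∈ → all-∈ o (proj₁ (s e∈))) , u , (λ e∈ → proj₂ (s e∈)) , λ w∈ a → c (q w∈ a) (w∈ , a)

  -- The event at the last vertex absorbs the whole state, so strands to it can run along the top
  -- and the bottom throughout.
  add-ends : ∀ {t} (top bot : State n) → All (To t) top → All (To t) bot → Last t vs →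
             Run Q ρ σ vs [] → Run Q ρ (top ++ σ ++ bot) vs []
  add-ends top bot p r one (event [] ins [] [] refl i o q done) =
    event [] (top ++ (ins ++ []) ++ bot) [] [] (sym (Listₚ.++-identityʳ _)) (Allₚ.++⁺ p (Allₚ.++⁺ (Allₚ.++⁺ i []) r)) o q done
  add-ends {Q = Q} {ρ = ρ} top bot p r (more {xs = vs} l) (event pre ins outs post refl i o q R) =
    event (top ++ pre) ins outs (post ++ bot) (frame-eq top pre ins post bot) i o q
      (subst (λ s → Run Q ρ s vs []) (frame-eq top pre outs post bot) (add-ends top bot p r l R))

  -- In state σ, exactly the edges from the visited vertices us to the remaining
  -- vertices vs occur.
  record Cut (G : Graph n) (us : List (Fin n)) (σ : State n) (vs : List (Fin n)) : Set where
    field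
      uniq  : Unique σ
      sound : ∀ {a b} → (a , b) ∈ˡ σ → a ∈ˡ us × Adj G a b
      compl : ∀ {a b} → a ∈ˡ us → b ∈ˡ vs → Adj G a b → (a , b) ∈ˡ σ

  no-target : {v : Fin n} {vs : List (Fin n)} (pre outs post : State n) → v ∉ˡ vs → Run Q ρ (pre ++ outs ++ post) vs [] →
              ∀ {e} → To v e → e ∈ˡ pre ⊎ e ∈ˡ post → ⊥
  no-target pre outs post v∉ R refl (inj₁ e∈) = v∉ (targets R (∈-++⁺ˡ e∈))
  no-target pre outs post v∉ R refl (inj₂ e∈) = v∉ (targets R (∈-++⁺ʳ pre (∈-++⁺ʳ outs e∈)))

  cut-next : {G : Graph n} {us vs : List (Fin n)} {v : Fin n} (pre ins outs post : State n) →
             Cut G us (pre ++ ins ++ post) (v ∷ vs) → All (To v) ins → All (From v) outs → Exact G v vs outs →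
             v ∉ˡ us → v ∉ˡ vs → Cut G (v ∷ us) (pre ++ outs ++ post) vs
  cut-next {G = G} {us} {vs} {v} pre ins outs post C i o (u , s , c) v∉us v∉vs = record
    { uniq = uniq-++⁺ upre (uniq-++⁺ u upost λ p q → old q (all-∈ o p)) dj ; sound = sd ; compl = cp }
    where
    open Cut C
    parts = uniq-++⁻ pre uniq
    upre = proj₁ parts
    parts′ = uniq-++⁻ ins (proj₁ (proj₂ parts))
    upost = proj₁ (proj₂ parts′)
    old : ∀ {e} → e ∈ˡ post → From v e → ⊥
    old p refl = v∉us (proj₁ (sound (∈-++⁺ʳ pre (∈-++⁺ʳ ins p))))
    dj : ∀ {e} → e ∈ˡ pre → e ∈ˡ outs ++ post → ⊥
    dj p q with ∈-++⁻ outs q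
    ... | inj₁ r = v∉us (subst (_∈ˡ us) (all-∈ o r) (proj₁ (sound (∈-++⁺ˡ p))))
    ... | inj₂ r = proj₂ (proj₂ parts) p (∈-++⁺ʳ ins r)
    sd : ∀ {a b} → (a , b) ∈ˡ pre ++ outs ++ post → a ∈ˡ v ∷ us × Adj G a b
    sd p with ∈-++⁻ pre p
    ... | inj₁ r = let (x , y) = sound (∈-++⁺ˡ r) in there x , y
    ... | inj₂ r with ∈-++⁻ outs r
    ... | inj₁ r′ = here (all-∈ o r′) , subst (λ a → Adj G a _) (sym (all-∈ o r′)) (proj₂ (s r′))
    ... | inj₂ r′ = let (x , y) = sound (∈-++⁺ʳ pre (∈-++⁺ʳ ins r′)) in there x , y
    cp : ∀ {a b} → a ∈ˡ v ∷ us → b ∈ˡ vs → Adj G a b → (a , b) ∈ˡ pre ++ outs ++ post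
    cp (here refl) b∈ ab = ∈-++⁺ʳ pre (∈-++⁺ˡ (c b∈ ab))
    cp (there a∈) b∈ ab with ∈-++⁻ pre (compl a∈ (there b∈) ab)
    ... | inj₁ r = ∈-++⁺ˡ r
    ... | inj₂ r with ∈-++⁻ ins r
    ... | inj₁ r′ = ⊥-elim (v∉vs (subst (_∈ˡ vs) (all-∈ i r′) b∈))
    ... | inj₂ r′ = ∈-++⁺ʳ pre (∈-++⁺ʳ outs r′)

  -- The neighbours of a vertex in the order in which the edges leave it.
  Rotation : State n → State n → List (Fin n)
  Rotation ins outs = map proj₂ outs ++ reverse (map proj₁ ins)

  record Enum (G : Graph n) (all : Fin n → Set) (v : Fin n) (L : List (Fin n)) : Set where
    field
      uniq  : Unique L
      sound : ∀ {w} → w ∈ˡ L → Adj G v w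
      compl : ∀ {w} → Adj G v w → all w → w ∈ˡ L

  -- Every edge from an earlier vertex arrives among `ins`: a strand to `v` that passed the event by
  -- would never end.
  rotation-enum : {G : Graph n} {us vs : List (Fin n)} {v : Fin n} (pre ins outs post : State n) →
    Cut G us (pre ++ ins ++ post) (v ∷ vs) → All (To v) ins → All (From v) outs → Exact G v vs outs →
    (∀ {w} → w ∈ˡ us → w ∉ˡ vs) → v ∉ˡ vs → Run Q ρ (pre ++ outs ++ post) vs [] →
    Enum G (λ w → w ∈ˡ us ⊎ w ∈ˡ v ∷ vs) v (Rotation ins outs)
  rotation-enum {G = G} {us} {vs} {v} pre ins outs post C i o (u , s , c) us∉vs v∉vs R = record
    { uniq = uniq-++⁺ (uniq-map injO u) (uniq-reverse (uniq-map injI uins)) dj ; sound = sd ; compl = cp }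
    where
    open Cut C
    uins : Unique ins
    uins = proj₁ (uniq-++⁻ ins (proj₁ (proj₂ (uniq-++⁻ pre uniq))))
    injO : ∀ {x y} → x ∈ˡ outs → y ∈ˡ outs → proj₂ x ≡ proj₂ y → x ≡ y
    injO p q e = cong₂ _,_ (trans (all-∈ o p) (sym (all-∈ o q))) e
    injI : ∀ {x y} → x ∈ˡ ins → y ∈ˡ ins → proj₁ x ≡ proj₁ y → x ≡ y
    injI p q e = cong₂ _,_ e (trans (all-∈ i p) (sym (all-∈ i q)))
    fromO : ∀ {w} → w ∈ˡ map proj₂ outs → w ∈ˡ vs × Adj G v w
    fromO p with ∈ₚ.∈-map⁻ proj₂ p
    ... | (a , w) , e∈ , refl = s e∈
    fromI : ∀ {w} → w ∈ˡ reverse (map proj₁ ins) → w ∈ˡ us × Adj G w v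
    fromI p with ∈ₚ.∈-map⁻ proj₁ (Anyₚ.reverse⁻ p)
    ... | (w , b) , e∈ , refl with all-∈ i e∈
    ... | refl = sound (∈-++⁺ʳ pre (∈-++⁺ˡ e∈))
    dj : ∀ {w} → w ∈ˡ map proj₂ outs → w ∈ˡ reverse (map proj₁ ins) → ⊥
    dj p q = us∉vs (proj₁ (fromI q)) (proj₁ (fromO p))
    sd : ∀ {w} → w ∈ˡ Rotation ins outs → Adj G v w
    sd p with ∈-++⁻ (map proj₂ outs) p
    ... | inj₁ q = proj₂ (fromO q)
    ... | inj₂ q = adj-sym G (proj₂ (fromI q))
    cp : ∀ {w} → Adj G v w → w ∈ˡ us ⊎ w ∈ˡ v ∷ vs → w ∈ˡ Rotation ins outs
    cp a (inj₂ (here refl)) = ⊥-elim (adj-irrefl G refl a)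
    cp a (inj₂ (there w∈)) = ∈-++⁺ˡ (∈ₚ.∈-map⁺ proj₂ (c w∈ a))
    cp a (inj₁ w∈) with ∈-++⁻ pre (compl w∈ (here refl) (adj-sym G a))
    ... | inj₁ r = ⊥-elim (no-target pre outs post v∉vs R refl (inj₁ r))
    ... | inj₂ r with ∈-++⁻ ins r
    ... | inj₁ r′ = ∈-++⁺ʳ (map proj₂ outs) (Anyₚ.reverse⁺ (∈ₚ.∈-map⁺ proj₁ r′))
    ... | inj₂ r′ = ⊥-elim (no-target pre outs post v∉vs R refl (inj₂ r′))

  -- In the mirror image the incoming strands are the outgoing ones, and completeness concerns the
  -- earlier vertices. The hypothesis on `σ` keeps track of the edges that come from them.
  reverse-run : {G : Graph n} (us : List (Fin n)) {σ : State n} {vs : List (Fin n)} → Unique vs →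
                (∀ {a b} → a ∈ˡ us → b ∈ˡ vs → Adj G a b → (a , b) ∈ˡ σ) →
                Run (Complete G) [] σ vs [] → Run (Complete G) us [] (reverse vs) (map swap σ)
  reverse-run us _ _ done = done
  reverse-run {G = G} us (p ∷ u) inv (event {v} {vs} pre ins outs post refl i o q R) =
    subst (λ l → Run (Complete G) us [] l (map swap (pre ++ ins ++ post))) (sym (Listₚ.unfold-reverse v vs))
      (reverse-run {G = G} (v ∷ us) u inv′ R ⊕ event (map swap pre) (map swap outs) (map swap ins) (map swap post)
        (eq outs) (to-from outs o) (to-from′ ins i) compl
        (subst (λ l → Run (Complete G) us l [] (map swap (pre ++ ins ++ post))) (eq ins) done))
    where
    v∉vs = ∉-all p
    eq : ∀ m → map swap (pre ++ m ++ post) ≡ map swap pre ++ map swap m ++ map swap post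
    eq m = trans (Listₚ.map-++ swap pre (m ++ post)) (cong (map swap pre ++_) (Listₚ.map-++ swap m post))
    to-from : ∀ l → All (From v) l → All (To v) (map swap l)
    to-from l a = Allₚ.map⁺ a
    to-from′ : ∀ l → All (To v) l → All (From v) (map swap l)
    to-from′ l a = Allₚ.map⁺ a
    in-ins : ∀ {a} → a ∈ˡ us → Adj G a v → (a , v) ∈ˡ ins
    in-ins a∈ e with ∈-++⁻ pre (inv a∈ (here refl) e)
    ... | inj₁ r = ⊥-elim (no-target pre outs post v∉vs R refl (inj₁ r))
    ... | inj₂ r with ∈-++⁻ ins r
    ... | inj₁ r′ = r′
    ... | inj₂ r′ = ⊥-elim (no-target pre outs post v∉vs R refl (inj₂ r′))
    compl : Complete G v us (map swap ins)
    compl w∈ e = ∈ₚ.∈-map⁺ swap (in-ins w∈ (adj-sym G e))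
    inv′ : ∀ {a b} → a ∈ˡ v ∷ us → b ∈ˡ vs → Adj G a b → (a , b) ∈ˡ pre ++ outs ++ post
    inv′ (here refl) b∈ e = ∈-++⁺ʳ pre (∈-++⁺ˡ (q (∈-++⁺ˡ b∈) e))
    inv′ (there a∈) b∈ e with ∈-++⁻ pre (inv a∈ (there b∈) e)
    ... | inj₁ r = ∈-++⁺ˡ r
    ... | inj₂ r with ∈-++⁻ ins r
    ... | inj₁ r′ = ⊥-elim (v∉vs (subst (_∈ˡ vs) (all-∈ i r′) b∈))
    ... | inj₂ r′ = ∈-++⁺ʳ pre (∈-++⁺ʳ outs r′)

-- A Jordan curve argument modulo 2 for sweeps

module Crossings where
  open Models
  open VanKampen using (xor-swap; xor-cancel)
  open Runs
  import Data.Bool.Properties as Boolₚ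
  open import Data.Bool.Base using (_∧_)
  import Data.List.Properties as Listₚ
  import Data.List.Relation.Unary.All as All
  open import Data.List.Relation.Binary.Sublist.Propositional using ([]; _∷_; _∷ʳ_) renaming (_⊆_ to _⊆ˡ_; lookup to ⊆ˡ-lookup)

  private variable
    n : ℕ
    A B : Set

  -- Lets identities between Boolean expressions be settled by truth tables.
  ∀-bool? : {P : Bool → Set} → (∀ b → Dec (P b)) → Dec (∀ b → P b)
  ∀-bool? P? with P? false | P? true
  ... | yes p | yes q = yes λ { false → p ; true → q }
  ... | no ¬p | _     = no λ f → ¬p (f false)
  ... | _     | no ¬q = no λ f → ¬q (f true)

  ⨁ : (A → Bool) → List A → Bool
  ⨁ f []       = false
  ⨁ f (x ∷ xs) = f x xor ⨁ f xs

  -- The parity of the number of pairs x before y with f x and g y.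
  Φ : (f g : A → Bool) → List A → Bool
  Φ f g []       = false
  Φ f g (x ∷ xs) = (f x ∧ ⨁ g xs) xor Φ f g xs

  module _ (f : A → Bool) where
    ⨁-++ : ∀ xs ys → ⨁ f (xs ++ ys) ≡ ⨁ f xs xor ⨁ f ys
    ⨁-++ []       ys = refl
    ⨁-++ (x ∷ xs) ys = trans (cong (f x xor_) (⨁-++ xs ys)) (sym (Boolₚ.xor-assoc (f x) _ _))

    ⨁-reverse : ∀ xs → ⨁ f (reverse xs) ≡ ⨁ f xs
    ⨁-reverse [] = refl
    ⨁-reverse (x ∷ xs) = begin
      ⨁ f (reverse (x ∷ xs))               ≡⟨ cong (⨁ f) (Listₚ.unfold-reverse x xs) ⟩
      ⨁ f (reverse xs ++ x ∷ [])           ≡⟨ ⨁-++ (reverse xs) (x ∷ []) ⟩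
      ⨁ f (reverse xs) xor (f x xor false) ≡⟨ cong₂ _xor_ (⨁-reverse xs) (Boolₚ.xor-identityʳ (f x)) ⟩
      ⨁ f xs xor f x                       ≡⟨ Boolₚ.xor-comm (⨁ f xs) (f x) ⟩
      f x xor ⨁ f xs                       ∎
      where open ≡-Reasoning

    ⨁-zero : ∀ {xs} → All (λ x → f x ≡ false) xs → ⨁ f xs ≡ false
    ⨁-zero []       = refl
    ⨁-zero (p ∷ ps) = cong₂ _xor_ p (⨁-zero ps)

  ⨁-map : (f : B → Bool) (h : A → B) {g : A → Bool} {xs : List A} → All (λ x → g x ≡ f (h x)) xs → ⨁ g xs ≡ ⨁ f (map h xs)
  ⨁-map f h []       = refl
  ⨁-map f h (p ∷ ps) = cong₂ _xor_ p (⨁-map f h ps)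

  Φ-map : (f f′ : B → Bool) (h : A → B) {g g′ : A → Bool} {xs : List A} →
          All (λ x → g x ≡ f (h x)) xs → All (λ x → g′ x ≡ f′ (h x)) xs → Φ g g′ xs ≡ Φ f f′ (map h xs)
  Φ-map f f′ h []       []       = refl
  Φ-map f f′ h (p ∷ ps) (q ∷ qs) = cong₂ _xor_ (cong₂ _∧_ p (⨁-map f′ h qs)) (Φ-map f f′ h ps qs)

  module _ (f g : A → Bool) where
    Φ-zeroˡ : ∀ {xs} → All (λ x → f x ≡ false) xs → Φ f g xs ≡ false
    Φ-zeroˡ []               = refl
    Φ-zeroˡ (_∷_ {xs = xs} p ps) = cong₂ _xor_ (cong (_∧ ⨁ g xs) p) (Φ-zeroˡ ps)

    Φ-zeroʳ : ∀ {xs} → All (λ x → g x ≡ false) xs → Φ f g xs ≡ false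
    Φ-zeroʳ []               = refl
    Φ-zeroʳ (_∷_ {x = x} p ps) = cong₂ _xor_ (trans (cong (f x ∧_) (⨁-zero g ps)) (Boolₚ.∧-zeroʳ (f x))) (Φ-zeroʳ ps)

    Φ-++ : ∀ xs ys → Φ f g (xs ++ ys) ≡ (Φ f g xs xor Φ f g ys) xor (⨁ f xs ∧ ⨁ g ys)
    Φ-++ [] ys = sym (Boolₚ.xor-identityʳ (Φ f g ys))
    Φ-++ (x ∷ xs) ys = trans (cong₂ (λ u v → (f x ∧ u) xor v) (⨁-++ g xs ys) (Φ-++ xs ys))
      (law (f x) (⨁ g xs) (⨁ g ys) (Φ f g xs) (Φ f g ys) (⨁ f xs))
      where
      law : ∀ a b c d e h → (a ∧ (b xor c)) xor ((d xor e) xor (h ∧ c)) ≡ (((a ∧ b) xor d) xor e) xor ((a xor h) ∧ c)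
      law = from-yes (∀-bool? λ a → ∀-bool? λ b → ∀-bool? λ c → ∀-bool? λ d → ∀-bool? λ e → ∀-bool? λ h →
        ((a ∧ (b xor c)) xor ((d xor e) xor (h ∧ c))) Boolₚ.≟ ((((a ∧ b) xor d) xor e) xor ((a xor h) ∧ c)))

    -- Reversal counts the pairs in the opposite order; as no element satisfies both `f` and `g`,
    -- the two orders together count all pairs.
    Φ-reverse : (∀ x → f x ∧ g x ≡ false) → ∀ xs → Φ f g (reverse xs) ≡ Φ f g xs xor (⨁ f xs ∧ ⨁ g xs)
    Φ-reverse dj [] = refl
    Φ-reverse dj (x ∷ xs) = begin
      Φ f g (reverse (x ∷ xs))
        ≡⟨ cong (Φ f g) (Listₚ.unfold-reverse x xs) ⟩
      Φ f g (reverse xs ++ x ∷ [])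
        ≡⟨ Φ-++ (reverse xs) (x ∷ []) ⟩
      (Φ f g (reverse xs) xor ((f x ∧ false) xor false)) xor (⨁ f (reverse xs) ∧ (g x xor false))
        ≡⟨ cong₂ (λ u v → (u xor ((f x ∧ false) xor false)) xor (v ∧ (g x xor false))) (Φ-reverse dj xs) (⨁-reverse f xs) ⟩
      ((Φ f g xs xor (⨁ f xs ∧ ⨁ g xs)) xor ((f x ∧ false) xor false)) xor (⨁ f xs ∧ (g x xor false))
        ≡⟨ law (f x) (g x) (⨁ f xs) (⨁ g xs) (Φ f g xs) (dj x) ⟩
      ((f x ∧ ⨁ g xs) xor Φ f g xs) xor ((f x xor ⨁ f xs) ∧ (g x xor ⨁ g xs)) ∎
      where
      open ≡-Reasoning
      law : ∀ a b c d e → a ∧ b ≡ false → ((e xor (c ∧ d)) xor ((a ∧ false) xor false)) xor (c ∧ (b xor false)) ≡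
                          ((a ∧ d) xor e) xor ((a xor c) ∧ (b xor d))
      law = from-yes (∀-bool? λ a → ∀-bool? λ b → ∀-bool? λ c → ∀-bool? λ d → ∀-bool? λ e → ((a ∧ b) Boolₚ.≟ false) →-dec
        ((((e xor (c ∧ d)) xor ((a ∧ false) xor false)) xor (c ∧ (b xor false))) Boolₚ.≟ (((a ∧ d) xor e) xor ((a xor c) ∧ (b xor d)))))

    -- A block interacts with its surroundings only through its two parities.
    Φ-replace : ∀ pre ins outs post → ⨁ f ins ≡ ⨁ f outs → ⨁ g ins ≡ ⨁ g outs →
                Φ f g (pre ++ ins ++ post) ≡ (Φ f g ins xor Φ f g outs) xor Φ f g (pre ++ outs ++ post)
    Φ-replace pre ins outs post ef eg = begin
      Φ f g (pre ++ ins ++ post)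
        ≡⟨ expand ins ⟩
      (Φ f g pre xor ((Φ f g ins xor Φ f g post) xor (⨁ f ins ∧ ⨁ g post))) xor (⨁ f pre ∧ (⨁ g ins xor ⨁ g post))
        ≡⟨ cong₂ (λ u v → (Φ f g pre xor ((Φ f g ins xor Φ f g post) xor (u ∧ ⨁ g post))) xor (⨁ f pre ∧ (v xor ⨁ g post))) ef eg ⟩
      (Φ f g pre xor ((Φ f g ins xor Φ f g post) xor (⨁ f outs ∧ ⨁ g post))) xor (⨁ f pre ∧ (⨁ g outs xor ⨁ g post))
        ≡⟨ law (Φ f g pre) (Φ f g ins) (Φ f g outs) (Φ f g post) (⨁ f outs ∧ ⨁ g post) (⨁ f pre ∧ (⨁ g outs xor ⨁ g post)) ⟩
      (Φ f g ins xor Φ f g outs) xor ((Φ f g pre xor ((Φ f g outs xor Φ f g post) xor (⨁ f outs ∧ ⨁ g post))) xor (⨁ f pre ∧ (⨁ g outs xor ⨁ g post)))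
        ≡⟨ cong ((Φ f g ins xor Φ f g outs) xor_) (sym (expand outs)) ⟩
      (Φ f g ins xor Φ f g outs) xor Φ f g (pre ++ outs ++ post) ∎
      where
      open ≡-Reasoning
      expand : ∀ m → Φ f g (pre ++ m ++ post) ≡
        (Φ f g pre xor ((Φ f g m xor Φ f g post) xor (⨁ f m ∧ ⨁ g post))) xor (⨁ f pre ∧ (⨁ g m xor ⨁ g post))
      expand m = trans (Φ-++ pre (m ++ post)) (cong₂ (λ u v → (Φ f g pre xor u) xor (⨁ f pre ∧ v)) (Φ-++ m post) (⨁-++ g m post))
      law : ∀ p x y q c d → (p xor ((x xor q) xor c)) xor d ≡ (x xor y) xor ((p xor ((y xor q) xor c)) xor d)
      law = from-yes (∀-bool? λ p → ∀-bool? λ x → ∀-bool? λ y → ∀-bool? λ q → ∀-bool? λ c → ∀-bool? λ d →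
        ((p xor ((x xor q) xor c)) xor d) Boolₚ.≟ ((x xor y) xor ((p xor ((y xor q) xor c)) xor d)))

    ⨁-sub : {S L : List A} → S ⊆ˡ L → Unique L → (∀ {w} → w ∈ˡ L → w ∉ˡ S → g w ≡ false) → ⨁ g L ≡ ⨁ g S
    ⨁-sub [] _ _ = refl
    ⨁-sub {L = y ∷ L} (y ∷ʳ s) (p ∷ u) v = trans (cong (_xor ⨁ g L) (v (here refl) λ y∈ → ∉-all p (⊆ˡ-lookup s y∈))) (⨁-sub s u (v ∘ there))
    ⨁-sub (refl ∷ s) (p ∷ u) v = cong (g _ xor_) (⨁-sub s u λ w∈ w∉ → v (there w∈) λ { (here refl) → ∉-all p w∈ ; (there q) → w∉ q })

  Φ-sub : (f g : A → Bool) {S L : List A} → S ⊆ˡ L → Unique L → (∀ {w} → w ∈ˡ L → w ∉ˡ S → f w ≡ false × g w ≡ false) → Φ f g L ≡ Φ f g S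
  Φ-sub f g [] _ _ = refl
  Φ-sub f g {S} {y ∷ L} (y ∷ʳ s) (p ∷ u) v =
    trans (cong (λ b → (b ∧ ⨁ g L) xor Φ f g L) (proj₁ (v (here refl) λ y∈ → ∉-all p (⊆ˡ-lookup s y∈)))) (Φ-sub f g s u (v ∘ there))
  Φ-sub f g {x ∷ S} {.x ∷ L} (refl ∷ s) (p ∷ u) v = cong₂ _xor_ (cong (f x ∧_) (⨁-sub f g s u (λ a b → proj₂ (v′ a b)))) (Φ-sub f g s u v′)
    where
    v′ : ∀ {w} → w ∈ˡ L → w ∉ˡ S → f w ≡ false × g w ≡ false
    v′ w∈ w∉ = v (there w∈) λ { (here refl) → ∉-all p w∈ ; (there q) → w∉ q }

  sub-unique : {S L : List A} → S ⊆ˡ L → Unique L → Unique S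
  sub-unique [] _ = []
  sub-unique (y ∷ʳ s) (_ ∷ u) = sub-unique s u
  sub-unique (refl ∷ s) (p ∷ u) = ∈-all _ (λ w∈ → all-∈ p (⊆ˡ-lookup s w∈)) ∷ sub-unique s u

  abstract
    is : Fin n → Fin n → Bool
    is x y = does (x ≟ᶠ y)

    is-refl : (x : Fin n) → is x x ≡ true
    is-refl x = dec-true (x ≟ᶠ x) refl

    is-≢ : {x y : Fin n} → x ≢ y → is x y ≡ false
    is-≢ {x = x} {y} = dec-false (x ≟ᶠ y)

    is-⇔ : {P : Set} {x y : Fin n} (P? : Dec P) → (P → x ≡ y) → (x ≡ y → P) → does P? ≡ is x y
    is-⇔ {x = x} {y} P? f g = does-⇔ (mk⇔ f g) P? (x ≟ᶠ y)

  -- A mod 2 cycle, as a symmetric function on the edges.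
  record Cycle (G : Graph n) (all : Fin n → Set) : Set where
    field
      val  : Fin n → Fin n → Bool
      symm : ∀ a b → val a b ≡ val b a
      even : ∀ {v L} → Enum G all v L → ⨁ (val v) L ≡ false

  module _ {G : Graph n} where
    private variable
      P : Fin n → Set
      a b v w : Fin n

    -- The formal sum modulo 2 of the edges of the walk; an edge that is traversed twice cancels.
    chain : Walk G P a b → Fin n → Fin n → Bool
    chain (stay _)                     x y = false
    chain (step {u = u} {v = v} _ _ π) x y = does (samePair? x y u v) xor chain π x y

    chain-++ : (π : Walk G P a b) (ρ : Walk G P b w) → ∀ x y → chain (π ++ʷ ρ) x y ≡ chain π x y xor chain ρ x y
    chain-++ (stay _) ρ x y = refl
    chain-++ (step {u = u} {v = v} _ _ π) ρ x y = trans (cong (does (samePair? x y u v) xor_) (chain-++ π ρ x y)) (sym (Boolₚ.xor-assoc (does (samePair? x y u v)) _ _))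

    chain-map : {Q : Fin n → Set} (f : ∀ {x} → P x → Q x) (π : Walk G P a b) → ∀ x y → chain (walk-map f π) x y ≡ chain π x y
    chain-map f (stay _) x y = refl
    chain-map f (step {u = u} {v = v} _ _ π) x y = cong (does (samePair? x y u v) xor_) (chain-map f π x y)

    samePair-flip : ∀ (x y u v : Fin n) → does (samePair? x y u v) ≡ does (samePair? y x u v)
    samePair-flip x y u v = does-⇔ (mk⇔ samePair-swap samePair-swap) (samePair? x y u v) (samePair? y x u v)

    chain-sym : (π : Walk G P a b) → ∀ x y → chain π x y ≡ chain π y x
    chain-sym (stay _) x y = refl
    chain-sym (step {u = u} {v = v} _ _ π) x y = cong₂ _xor_ (samePair-flip x y u v) (chain-sym π x y)

    chain-support : (π : Walk G P a b) → ∀ x y → ¬ P x → chain π x y ≡ false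
    chain-support (stay _) x y ¬p = refl
    chain-support (step {u = u} {v = v} p _ π) x y ¬p = cong₂ _xor_
      (dec-false (samePair? x y u v) λ { (inj₁ (refl , _)) → ¬p p ; (inj₂ (refl , _)) → ¬p (walk-start π) }) (chain-support π x y ¬p)

    ⨁-is : ∀ {q : Fin n} {L} → Unique L → q ∈ˡ L → ⨁ (λ w → is w q) L ≡ true
    ⨁-is {q} {_ ∷ L} (p ∷ u) (here refl) = cong₂ _xor_ (is-refl q) (⨁-zero (λ w → is w q) (∈-all L λ w∈ → is-≢ λ { refl → ∉-all p w∈ }))
    ⨁-is {q} {x ∷ L} (p ∷ u) (there q∈) = cong₂ _xor_ (is-≢ {x = x} {q} λ { refl → ∉-all p q∈ }) (⨁-is u q∈)

    ⨁-cong : {f g : Fin n → Bool} → (∀ w → f w ≡ g w) → ∀ L → ⨁ f L ≡ ⨁ g L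
    ⨁-cong e []      = refl
    ⨁-cong e (x ∷ L) = cong₂ _xor_ (e x) (⨁-cong e L)

    edge-sum : {all : Fin n → Set} {v p q : Fin n} {L : List (Fin n)} → Enum G all v L → Adj G p q → all p → all q →
               ⨁ (λ w → does (samePair? v w p q)) L ≡ is v p xor is v q
    edge-sum {v = v} {p} {q} {L} E e ap aq = order (v ≟ᶠ p) (v ≟ᶠ q)
     where
     order : Dec (v ≡ p) → Dec (v ≡ q) → ⨁ (λ w → does (samePair? v w p q)) L ≡ is v p xor is v q
     order (yes refl) (yes refl) = ⊥-elim (adj-irrefl G refl e)
     order (yes refl) (no v≢q) = trans (trans (⨁-cong same L) (⨁-is (Enum.uniq E) (Enum.compl E e aq)))
                                       (sym (cong₂ _xor_ (is-refl v) (is-≢ v≢q)))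
      where
      same : ∀ w → does (samePair? v w v q) ≡ is w q
      same w = is-⇔ (samePair? v w v q) (λ { (inj₁ (_ , e)) → e ; (inj₂ (e , _)) → ⊥-elim (v≢q e) }) (λ e → inj₁ (refl , e))
     order (no v≢p) (yes refl) = trans (trans (⨁-cong same L) (⨁-is (Enum.uniq E) (Enum.compl E (adj-sym G e) ap)))
                                       (sym (cong₂ _xor_ (is-≢ v≢p) (is-refl v)))
      where
      same : ∀ w → does (samePair? v w p v) ≡ is w p
      same w = is-⇔ (samePair? v w p v) (λ { (inj₁ (e , _)) → ⊥-elim (v≢p e) ; (inj₂ (_ , e)) → e }) (λ e → inj₂ (refl , e))
     order (no v≢p) (no v≢q) = trans (⨁-zero _ (∈-all L λ {w} _ → dec-false (samePair? v w p q) λ { (inj₁ (e , _)) → v≢p e ; (inj₂ (e , _)) → v≢q e }))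
                                     (sym (cong₂ _xor_ (is-≢ v≢p) (is-≢ v≢q)))

    ⨁-xor : (f g : Fin n → Bool) → ∀ L → ⨁ (λ w → f w xor g w) L ≡ ⨁ f L xor ⨁ g L
    ⨁-xor f g []      = refl
    ⨁-xor f g (x ∷ L) = trans (cong ((f x xor g x) xor_) (⨁-xor f g L)) (xor-swap (f x) (g x) (⨁ f L) (⨁ g L))

    chain-boundary : {all : Fin n → Set} {v : Fin n} {L : List (Fin n)} → Enum G all v L → (∀ {x} → P x → all x) →
                     (π : Walk G P a b) → ⨁ (chain π v) L ≡ is v a xor is v b
    chain-boundary {a = a} {v = v} {L} E P⊆ (stay _) = trans (⨁-zero _ (∈-all L λ _ → refl)) (sym (Boolₚ.xor-same (is v a)))
    chain-boundary {b = b} {v = v} {L} E P⊆ (step {u = p} {v = q} pp e π) =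
      trans (⨁-xor (λ w → does (samePair? v w p q)) (chain π v) L)
        (trans (cong₂ _xor_ (edge-sum E e (P⊆ pp) (P⊆ (walk-start π))) (chain-boundary E P⊆ π)) (xor-cancel (is v p) (is v q) (is v b)))

    closed-chain : {all : Fin n → Set} → (∀ {x} → P x → all x) → Walk G P a a → Cycle G all
    closed-chain {a = a} P⊆ π = record { val = chain π ; symm = chain-sym π
      ; even = λ {v} E → trans (chain-boundary E P⊆ π) (Boolₚ.xor-same (is v a)) }

    loop : {z a c : Fin n} → Adj G z a → Adj G z c → Walk G P a c → Walk G (λ v → v ≡ z ⊎ P v) z z
    loop za zc π = step (inj₁ refl) za (walk-map inj₂ π ++ʷ step (inj₂ (walk-end π)) (adj-sym G zc) (stay (inj₁ refl)))

    loop-at : {z a c : Fin n} (za : Adj G z a) (zc : Adj G z c) (π : Walk G P a c) → ¬ P z →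
              ∀ w → chain (loop za zc π) z w ≡ is w a xor is w c
    loop-at {z = z} {a} {c} za zc π ¬p w = cong₂ _xor_ first
      (trans (chain-++ (walk-map inj₂ π) (step (inj₂ (walk-end π)) (adj-sym G zc) (stay (inj₁ refl))) z w)
        (cong₂ _xor_ (trans (chain-map inj₂ π z w) (chain-support π z w ¬p)) (trans (Boolₚ.xor-identityʳ _) second)))
      where
      first : does (samePair? z w z a) ≡ is w a
      first = is-⇔ (samePair? z w z a) (λ { (inj₁ (_ , e)) → e ; (inj₂ (refl , _)) → ⊥-elim (adj-irrefl G refl za) }) (λ e → inj₁ (refl , e))
      second : does (samePair? z w c z) ≡ is w c
      second = is-⇔ (samePair? z w c z) (λ { (inj₁ (refl , _)) → ⊥-elim (adj-irrefl G refl zc) ; (inj₂ (_ , e)) → e }) (λ e → inj₂ (refl , e))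

  module _ {G : Graph n} where

    rotation-at : {us vs : List (Fin n)} {σ : State n} {z : Fin n} → Cut G us σ vs → Unique vs → (∀ {w} → w ∈ˡ us → w ∉ˡ vs) →
      (z∈ : z ∈ˡ vs) (R : Run (Exact G) [] σ vs []) →
      Enum G (λ w → w ∈ˡ us ⊎ w ∈ˡ vs) z (Rotation (At.ins (locate z∈ R)) (At.outs (locate z∈ R)))
    rotation-at C (p ∷ u) dj (here refl) (event {v} {vs} pre ins outs post refl i o q R) =
      rotation-enum pre ins outs post C i o (subst (λ l → Exact G v l outs) (Listₚ.++-identityʳ vs) q) (λ a b → dj a (there b)) (∉-all p) R
    rotation-at {us = us} C (p ∷ u) dj (there z∈) (event {v} {vs} pre ins outs post refl i o q R) = record
      { uniq = uniq ; sound = sound ; compl = λ a w∈ → compl a (move w∈) }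
      where
      moved : ∀ {w} → w ∈ˡ v ∷ us → w ∉ˡ vs
      moved (here refl) b = ∉-all p b
      moved (there a)   b = dj a (there b)
      open Enum (rotation-at (cut-next pre ins outs post C i o (subst (λ l → Exact G v l outs) (Listₚ.++-identityʳ vs) q)
        (λ v∈ → dj v∈ (here refl)) (∉-all p)) u moved z∈ R)
      move : ∀ {w} → w ∈ˡ us ⊎ w ∈ˡ v ∷ vs → w ∈ˡ v ∷ us ⊎ w ∈ˡ vs
      move (inj₁ a)           = inj₁ (there a)
      move (inj₂ (here refl)) = inj₁ (here refl)
      move (inj₂ (there b))   = inj₂ b

    -- The invariant of a state is the parity of the pairs in which a strand of `ρ` lies above a
    -- strand of `β`. At a vertex other than `z` one of the cycles is absent, and evenness of both
    -- keeps the invariant fixed. It is zero in the empty state at either end, so the change at `z`,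
    -- which the rotation determines, is zero as well.
    module _ {all : Fin n → Set} (ρ β : Cycle G all) (z : Fin n)
      (clean : ∀ v → v ≢ z → (∀ w → Cycle.val ρ v w ≡ false) ⊎ (∀ w → Cycle.val β v w ≡ false)) where

      private
        r b : Fin n → Fin n → Bool
        r = Cycle.val ρ
        b = Cycle.val β
        f g : Strand n → Bool
        f (x , y) = r x y
        g (x , y) = b x y

        module AtEvent {us vs : List (Fin n)} {v : Fin n} (pre ins outs post : State n)
          (C : Cut G us (pre ++ ins ++ post) (v ∷ vs)) (i : All (To v) ins) (o : All (From v) outs) (q : Exact G v vs outs)
          (us∉ : ∀ {w} → w ∈ˡ us → w ∉ˡ vs) (v∉ : v ∉ˡ vs) (R : Run (Exact G) [] (pre ++ outs ++ post) vs [])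
          (cover : ∀ {w} → all w → w ∈ˡ us ⊎ w ∈ˡ v ∷ vs) where

          E : Enum G all v (Rotation ins outs)
          E = record { uniq = uniq ; sound = sound ; compl = λ a w∈ → compl a (cover w∈) }
            where open Enum (rotation-enum pre ins outs post C i o q us∉ v∉ R)

          as-ins : (κ : Cycle G all) → All (λ e → Cycle.val κ (proj₁ e) (proj₂ e) ≡ Cycle.val κ v (proj₁ e)) ins
          as-ins κ = ∈-all ins λ {e} e∈ → trans (cong (Cycle.val κ (proj₁ e)) (all-∈ i e∈)) (Cycle.symm κ (proj₁ e) v)
          as-outs : (κ : Cycle G all) → All (λ e → Cycle.val κ (proj₁ e) (proj₂ e) ≡ Cycle.val κ v (proj₂ e)) outs
          as-outs κ = ∈-all outs λ {e} e∈ → cong (λ x → Cycle.val κ x (proj₂ e)) (all-∈ o e∈)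

          -- Evenness at `v`, with the rotation divided into its outgoing and its incoming half.
          balance : (κ : Cycle G all) → ⨁ (λ e → Cycle.val κ (proj₁ e) (proj₂ e)) ins ≡ ⨁ (λ e → Cycle.val κ (proj₁ e) (proj₂ e)) outs
          balance κ = begin
            ⨁ (λ e → Cycle.val κ (proj₁ e) (proj₂ e)) ins   ≡⟨ ⨁-map (Cycle.val κ v) proj₁ (as-ins κ) ⟩
            ⨁ (Cycle.val κ v) (map proj₁ ins)                ≡⟨ sym (⨁-reverse (Cycle.val κ v) (map proj₁ ins)) ⟩
            ⨁ (Cycle.val κ v) (reverse (map proj₁ ins))      ≡⟨ cancel _ _ (trans (sym (⨁-++ _ (map proj₂ outs) _)) (Cycle.even κ E)) ⟩
            ⨁ (Cycle.val κ v) (map proj₂ outs)               ≡⟨ sym (⨁-map (Cycle.val κ v) proj₂ (as-outs κ)) ⟩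
            ⨁ (λ e → Cycle.val κ (proj₁ e) (proj₂ e)) outs   ∎
            where
            open ≡-Reasoning
            cancel : ∀ x y → x xor y ≡ false → y ≡ x
            cancel false false _ = refl
            cancel true  true  _ = refl

          replaced : Φ f g (pre ++ ins ++ post) ≡ (Φ f g ins xor Φ f g outs) xor Φ f g (pre ++ outs ++ post)
          replaced = Φ-replace f g pre ins outs post (balance ρ) (balance β)

          quiet : v ≢ z → Φ f g ins xor Φ f g outs ≡ false
          quiet v≢z with clean v v≢z
          ... | inj₁ h = cong₂ _xor_ (Φ-zeroˡ f g (All.map (λ {e} p → trans p (h (proj₁ e))) (as-ins ρ)))
                                     (Φ-zeroˡ f g (All.map (λ {e} p → trans p (h (proj₂ e))) (as-outs ρ)))
          ... | inj₂ h = cong₂ _xor_ (Φ-zeroʳ f g (All.map (λ {e} p → trans p (h (proj₁ e))) (as-ins β)))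
                                     (Φ-zeroʳ f g (All.map (λ {e} p → trans p (h (proj₂ e))) (as-outs β)))

          -- The rotation lists the incoming strands upwards. Turning them round costs the product
          -- of their parities, which by `balance` is cancelled by the pairs of an outgoing before
          -- an incoming strand.
          rotate : (∀ w → r v w ∧ b v w ≡ false) → Φ (r v) (b v) (Rotation ins outs) ≡ Φ f g ins xor Φ f g outs
          rotate dj = begin
            Φ (r v) (b v) (O ++ reverse I)
              ≡⟨ Φ-++ (r v) (b v) O (reverse I) ⟩
            (Φ (r v) (b v) O xor Φ (r v) (b v) (reverse I)) xor (⨁ (r v) O ∧ ⨁ (b v) (reverse I))
              ≡⟨ cong₂ (λ x y → (Φ (r v) (b v) O xor x) xor (⨁ (r v) O ∧ y)) (Φ-reverse (r v) (b v) dj I) (⨁-reverse (b v) I) ⟩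
            (Φ (r v) (b v) O xor (Φ (r v) (b v) I xor (⨁ (r v) I ∧ ⨁ (b v) I))) xor (⨁ (r v) O ∧ ⨁ (b v) I)
              ≡⟨ cong (λ x → (Φ (r v) (b v) O xor (Φ (r v) (b v) I xor (⨁ (r v) I ∧ ⨁ (b v) I))) xor (x ∧ ⨁ (b v) I)) same ⟩
            (Φ (r v) (b v) O xor (Φ (r v) (b v) I xor (⨁ (r v) I ∧ ⨁ (b v) I))) xor (⨁ (r v) I ∧ ⨁ (b v) I)
              ≡⟨ law (Φ (r v) (b v) O) (Φ (r v) (b v) I) (⨁ (r v) I ∧ ⨁ (b v) I) ⟩
            Φ (r v) (b v) I xor Φ (r v) (b v) O
              ≡⟨ cong₂ _xor_ (sym (Φ-map (r v) (b v) proj₁ (as-ins ρ) (as-ins β))) (sym (Φ-map (r v) (b v) proj₂ (as-outs ρ) (as-outs β))) ⟩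
            Φ f g ins xor Φ f g outs ∎
            where
            open ≡-Reasoning
            O = map proj₂ outs
            I = map proj₁ ins
            same : ⨁ (r v) O ≡ ⨁ (r v) I
            same = trans (sym (⨁-map (r v) proj₂ (as-outs ρ))) (trans (sym (balance ρ)) (⨁-map (r v) proj₁ (as-ins ρ)))
            law : ∀ x y c → (x xor (y xor c)) xor c ≡ y xor x
            law = from-yes (∀-bool? λ x → ∀-bool? λ y → ∀-bool? λ c → ((x xor (y xor c)) xor c) Boolₚ.≟ (y xor x))

      even-beyond : {us vs : List (Fin n)} {σ : State n} → Cut G us σ vs → Unique vs → (∀ {w} → w ∈ˡ us → w ∉ˡ vs) →
        (∀ {w} → all w → w ∈ˡ us ⊎ w ∈ˡ vs) → z ∉ˡ vs → Run (Exact G) [] σ vs [] → Φ f g σ ≡ false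
      even-beyond C _ dj cover z∉ done = refl
      even-beyond {us} C (p ∷ u) dj cover z∉ (event {v} {vs} pre ins outs post refl i o q R) =
        trans replaced (cong₂ _xor_ (quiet λ { refl → z∉ (here refl) })
          (even-beyond (cut-next pre ins outs post C i o q′ (λ v∈ → dj v∈ (here refl)) (∉-all p)) u
            (λ { (here refl) b → ∉-all p b ; (there a) b → dj a (there b) }) move (z∉ ∘ there) R))
        where
        q′ = subst (λ l → Exact G v l outs) (Listₚ.++-identityʳ vs) q
        open AtEvent pre ins outs post C i o q′ (λ a b → dj a (there b)) (∉-all p) R cover
        move : ∀ {w} → all w → w ∈ˡ v ∷ us ⊎ w ∈ˡ vs
        move w∈ with cover w∈
        ... | inj₁ a           = inj₁ (there a)
        ... | inj₂ (here refl) = inj₁ (here refl)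
        ... | inj₂ (there b)   = inj₂ b

      odd-before : {us vs : List (Fin n)} {σ : State n} → Cut G us σ vs → Unique vs → (∀ {w} → w ∈ˡ us → w ∉ˡ vs) →
        (∀ {w} → all w → w ∈ˡ us ⊎ w ∈ˡ vs) → (∀ w → r z w ∧ b z w ≡ false) → (z∈ : z ∈ˡ vs) (R : Run (Exact G) [] σ vs []) →
        Φ (r z) (b z) (Rotation (At.ins (locate z∈ R)) (At.outs (locate z∈ R))) ≡ true → Φ f g σ ≡ true
      odd-before {us} C (p ∷ u) dj cover rb (here refl) (event {v} {vs} pre ins outs post refl i o q R) odd =
        trans replaced (cong₂ _xor_ (trans (sym (rotate rb)) odd)
          (even-beyond (cut-next pre ins outs post C i o q′ (λ v∈ → dj v∈ (here refl)) (∉-all p)) u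
            (λ { (here refl) b → ∉-all p b ; (there a) b → dj a (there b) }) move (∉-all p) R))
        where
        q′ = subst (λ l → Exact G v l outs) (Listₚ.++-identityʳ vs) q
        open AtEvent pre ins outs post C i o q′ (λ a b → dj a (there b)) (∉-all p) R cover
        move : ∀ {w} → all w → w ∈ˡ v ∷ us ⊎ w ∈ˡ vs
        move w∈ with cover w∈
        ... | inj₁ a           = inj₁ (there a)
        ... | inj₂ (here refl) = inj₁ (here refl)
        ... | inj₂ (there b)   = inj₂ b
      odd-before {us} C (p ∷ u) dj cover rb (there z∈) (event {v} {vs} pre ins outs post refl i o q R) odd =
        trans replaced (cong₂ _xor_ (quiet λ { refl → ∉-all p z∈ })
          (odd-before (cut-next pre ins outs post C i o q′ (λ v∈ → dj v∈ (here refl)) (∉-all p)) u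
            (λ { (here refl) b → ∉-all p b ; (there a) b → dj a (there b) }) move rb z∈ R odd))
        where
        q′ = subst (λ l → Exact G v l outs) (Listₚ.++-identityʳ vs) q
        open AtEvent pre ins outs post C i o q′ (λ a b → dj a (there b)) (∉-all p) R cover
        move : ∀ {w} → all w → w ∈ˡ v ∷ us ⊎ w ∈ˡ vs
        move w∈ with cover w∈
        ... | inj₁ a           = inj₁ (there a)
        ... | inj₂ (here refl) = inj₁ (here refl)
        ... | inj₂ (there b)   = inj₂ b

    no-cut : {vs : List (Fin n)} → Cut G [] [] vs
    no-cut = record { uniq = [] ; sound = λ () ; compl = λ () }

    -- A mod 2 Jordan curve theorem: two closed curves that meet only in z do
    -- not cross there.
    no-crossing : {vs : List (Fin n)} {z a b c d : Fin n} {P Q : Fin n → Set} → Unique vs → (z∈ : z ∈ˡ vs)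
      (R : Run (Exact G) [] [] vs []) → (∀ {v} → P v → v ∈ˡ vs) → (∀ {v} → Q v → v ∈ˡ vs) → ¬ P z → ¬ Q z →
      (∀ {v} → P v → Q v → ⊥) →
      (a ∷ b ∷ c ∷ d ∷ []) ⊆ˡ Rotation (At.ins (locate z∈ R)) (At.outs (locate z∈ R)) →
      Walk G P a c → Walk G Q b d → ⊥
    no-crossing {vs} {z} {a} {b} {c} {d} {P} {Q} u z∈ R P⊆ Q⊆ ¬Pz ¬Qz dj sub π θ =
      contradiction (odd-before ρ β z clean no-cut u (λ ()) inj₂ rb z∈ R odd) λ ()
      where
      L = Rotation (At.ins (locate z∈ R)) (At.outs (locate z∈ R))
      E : Enum G (λ w → w ∈ˡ [] ⊎ w ∈ˡ vs) z L
      E = rotation-at no-cut u (λ ()) z∈ R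
      adj : ∀ {w} → w ∈ˡ (a ∷ b ∷ c ∷ d ∷ []) → Adj G z w
      adj w∈ = Enum.sound E (⊆ˡ-lookup sub w∈)
      za = adj (here refl)
      zb = adj (there (here refl))
      zc = adj (there (there (here refl)))
      zd = adj (there (there (there (here refl))))
      in-vs : {S : Fin n → Set} → (∀ {v} → S v → v ∈ˡ vs) → ∀ {v} → v ≡ z ⊎ S v → v ∈ˡ vs
      in-vs f (inj₁ refl) = z∈
      in-vs f (inj₂ s)    = f s
      ρ β : Cycle G (_∈ˡ vs)
      ρ = closed-chain (in-vs P⊆) (loop za zc π)
      β = closed-chain (in-vs Q⊆) (loop zb zd θ)
      distinct : Unique (a ∷ b ∷ c ∷ d ∷ [])
      distinct = sub-unique sub (Enum.uniq E)
      ac : a ≢ c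
      ac with (_ ∷ ne ∷ _) ∷ _ ← distinct = ne
      bd : b ≢ d
      bd with _ ∷ (_ ∷ ne ∷ _) ∷ _ ← distinct = ne
      clean : ∀ v → v ≢ z → (∀ w → Cycle.val ρ v w ≡ false) ⊎ (∀ w → Cycle.val β v w ≡ false)
      clean v v≢z with all? (λ w → Cycle.val ρ v w Boolₚ.≟ false)
      ... | yes h = inj₁ h
      ... | no ¬h = inj₂ λ w → chain-support (loop zb zd θ) v w λ
        { (inj₁ e) → v≢z e ; (inj₂ qv) → ¬h λ w → chain-support (loop za zc π) v w λ { (inj₁ e) → v≢z e ; (inj₂ pv) → dj pv qv } }
      rz : ∀ w → Cycle.val ρ z w ≡ is w a xor is w c
      rz = loop-at za zc π ¬Pz
      bz : ∀ w → Cycle.val β z w ≡ is w b xor is w d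
      bz = loop-at zb zd θ ¬Qz
      Pa = walk-start π
      Pc = walk-end π
      Qb = walk-start θ
      Qd = walk-end θ
      rb : ∀ w → Cycle.val ρ z w ∧ Cycle.val β z w ≡ false
      rb w = order (w ≟ᶠ z)
        where
        order : Dec (w ≡ z) → Cycle.val ρ z w ∧ Cycle.val β z w ≡ false
        order (yes refl) = cong (_∧ Cycle.val β z z) (trans (rz z)
          (cong₂ _xor_ (is-≢ λ { refl → adj-irrefl G refl za }) (is-≢ λ { refl → adj-irrefl G refl zc })))
        order (no w≢z) = [ (λ h → cong (_∧ Cycle.val β z w) (trans (Cycle.symm ρ z w) (h z)))
          , (λ h → trans (cong (Cycle.val ρ z w ∧_) (trans (Cycle.symm β z w) (h z))) (Boolₚ.∧-zeroʳ _)) ]′ (clean w w≢z)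
      value : ∀ {x y p q} → x ≡ p → y ≡ q → x xor y ≡ p xor q
      value = cong₂ _xor_
      isn : {x y : Fin n} → x ≢ y → is x y ≡ false
      isn = is-≢
      odd : Φ (Cycle.val ρ z) (Cycle.val β z) L ≡ true
      -- Three pairs are counted: `a` before `b`, `a` before `d` and `c` before `d`.
      odd = trans (Φ-sub (Cycle.val ρ z) (Cycle.val β z) sub (Enum.uniq E) vanish)
        (compute {Cycle.val ρ z} {Cycle.val β z} (trans (rz a) (value (is-refl a) (isn ac)))
                 (trans (rz b) (value (isn λ { refl → dj Pa Qb }) (isn λ { refl → dj Pc Qb })))
                 (trans (rz c) (value (isn (ac ∘ sym)) (is-refl c)))
                 (trans (bz b) (value (is-refl b) (isn bd)))
                 (trans (bz c) (value (isn λ { refl → dj Pc Qb }) (isn λ { refl → dj Pc Qd })))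
                 (trans (bz d) (value (isn (bd ∘ sym)) (is-refl d))))
        where
        vanish : ∀ {w} → w ∈ˡ L → w ∉ˡ (a ∷ b ∷ c ∷ d ∷ []) → Cycle.val ρ z w ≡ false × Cycle.val β z w ≡ false
        vanish {w} _ w∉ =
          trans (rz w) (value (isn λ { refl → w∉ (here refl) }) (isn λ { refl → w∉ (there (there (here refl))) })) ,
          trans (bz w) (value (isn λ { refl → w∉ (there (here refl)) }) (isn λ { refl → w∉ (there (there (there (here refl)))) }))
        compute : ∀ {r s : Fin n → Bool} → r a ≡ true → r b ≡ false → r c ≡ true → s b ≡ true → s c ≡ false → s d ≡ true →
                  Φ r s (a ∷ b ∷ c ∷ d ∷ []) ≡ true
        compute {r} {s} ra rb rc sb sc sd rewrite ra | rb | rc | sb | sc | sd with r d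
        ... | false = refl
        ... | true  = refl

-- Distributing the edges at a contracted vertex

module Labellings where
  open Runs
  import Data.List.Properties as Listₚ
  import Data.List.Relation.Unary.All.Properties as Allₚ
  open import Data.List.Relation.Binary.Sublist.Propositional using ([]; _∷_; _∷ʳ_; minimum) renaming (_⊆_ to _⊆ˡ_)
  import Data.List.Relation.Binary.Sublist.Propositional.Properties as Subₚ

  private variable
    n : ℕ
    A : Set

  from∈ : {x : A} {xs : List A} → x ∈ˡ xs → (x ∷ []) ⊆ˡ xs
  from∈ (here refl) = refl ∷ minimum _
  from∈ (there p)   = _ ∷ʳ from∈ p

  pair-order : {a b : A} {M : List A} → a ∈ˡ M → b ∈ˡ M → a ≡ b ⊎ (a ∷ b ∷ []) ⊆ˡ M ⊎ (b ∷ a ∷ []) ⊆ˡ M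
  pair-order (here refl) (here refl) = inj₁ refl
  pair-order (here refl) (there q)   = inj₂ (inj₁ (refl ∷ from∈ q))
  pair-order (there p)   (here refl) = inj₂ (inj₂ (refl ∷ from∈ p))
  pair-order (there p)   (there q) with pair-order p q
  ... | inj₁ e        = inj₁ e
  ... | inj₂ (inj₁ s) = inj₂ (inj₁ (_ ∷ʳ s))
  ... | inj₂ (inj₂ s) = inj₂ (inj₂ (_ ∷ʳ s))

  two-splits : {m n : A} (P P′ : List A) {R R′ : List A} → P ++ m ∷ R ≡ P′ ++ n ∷ R′ →
               (n ∈ˡ P × m ∈ˡ R′) ⊎ (m ∈ˡ P′ × n ∈ˡ R) ⊎ (m ≡ n × R ≡ R′)
  two-splits P P′ e with ++-compare P P′ e
  ... | inj₁ ([] , refl , refl)    = inj₂ (inj₂ (refl , refl))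
  ... | inj₁ (_ ∷ k , refl , refl) = inj₁ (∈-++⁺ʳ P′ (here refl) , ∈-++⁺ʳ k (here refl))
  ... | inj₂ ([] , refl , refl)    = inj₂ (inj₂ (refl , refl))
  ... | inj₂ (_ ∷ k , refl , refl) = inj₂ (inj₁ (∈-++⁺ʳ P (here refl) , ∈-++⁺ʳ k (here refl)))

  data Hull {A : Set} (P : A → Set) : List A → Set where
    none   : ∀ {L} → All (¬_ ∘ P) L → Hull P L
    single : ∀ L m R → All (¬_ ∘ P) L → P m → All (¬_ ∘ P) R → Hull P (L ++ m ∷ R)
    double : ∀ L m M m′ R → All (¬_ ∘ P) L → P m → P m′ → All (¬_ ∘ P) R → Hull P (L ++ m ∷ M ++ m′ ∷ R)

  hull : {P : A → Set} → Decidable P → ∀ L → Hull P L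
  hull P? [] = none []
  hull {P = P} P? (x ∷ L) with P? x | hull P? L
  ... | no ¬p | none q                     = none (¬p ∷ q)
  ... | no ¬p | single L m R l p r         = single (x ∷ L) m R (¬p ∷ l) p r
  ... | no ¬p | double L m M m′ R l p p′ r = double (x ∷ L) m M m′ R (¬p ∷ l) p p′ r
  ... | yes p | none q                     = single [] x L [] p q
  ... | yes p | single L m R l q r         = double [] x L m R [] p q r
  ... | yes p | double L m M m′ R l q q′ r =
    subst (Hull P) (cong (x ∷_) (Listₚ.++-assoc L (m ∷ M) (m′ ∷ R))) (double [] x (L ++ m ∷ M) m′ R [] p q′ r)

  Shape : List Bool → Set
  Shape bs = bs ≡ true ∷ [] ⊎ bs ≡ false ∷ [] ⊎ bs ≡ true ∷ false ∷ [] ⊎ bs ≡ false ∷ true ∷ []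

  Letters : ℕ → Set
  Letters n = List (Bool × Fin n)

  word : (Fin n → List Bool) → Fin n → Letters n
  word c w = map (_, w) (c w)

  Colour : Bool → Letters n → Set
  Colour b W = All (λ e → proj₁ e ≡ b) W

  -- A distribution of the edges at a contracted vertex to its two preimages, in
  -- which the colours occupy complementary arcs of the rotation L.
  record Labelling (A B : Fin n → Set) (L : List (Fin n)) : Set where
    field
      c         : Fin n → List Bool
      shape     : ∀ w → Shape (c w)
      coverA    : ∀ {w} → A w → true ∈ˡ c w
      coverB    : ∀ {w} → B w → false ∈ˡ c w
      b         : Bool
      W₁ W₂ W₃  : Letters n
      arcs      : concatMap (word c) L ≡ W₁ ++ W₂ ++ W₃
      col₁      : Colour b W₁
      col₂      : Colour (not b) W₂
      col₃      : Colour b W₃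

  -- Around the vertex `abab` and `baba` are the same alternation; they differ because the rotation
  -- is cut open into a list.
  data Obstruction {n : ℕ} (A B : Fin n → Set) (L : List (Fin n)) : Set where
    abab : ∀ {p q r s} → (p ∷ q ∷ r ∷ s ∷ []) ⊆ˡ L → A p → B q → A r → B s → Obstruction A B L
    baba : ∀ {p q r s} → (p ∷ q ∷ r ∷ s ∷ []) ⊆ˡ L → B p → A q → B r → A s → Obstruction A B L
    both : ∀ {p q r} → (p ∷ q ∷ r ∷ []) ⊆ˡ L → A p → B p → A q → B q → A r → B r → Obstruction A B L

  -- The stretch from the first to the last element of `A` gets the colour `β`, the rest the other
  -- colour; this works if `B` does not occur strictly inside. The two ends may belong to `B` as
  -- well. There the letter of the other colour must face outwards: it comes second at the last end,
  -- as in `c₀`, and first at the first end, which `c₁` provides by means of `tie`.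
  module HullLabelling {A B : Fin n → Set} (A? : Decidable A) (B? : Decidable B) (β : Bool) where

    c₀ : Fin n → List Bool
    c₀ w with A? w | B? w
    ... | yes _ | yes _ = β ∷ not β ∷ []
    ... | yes _ | no _  = β ∷ []
    ... | no _  | _     = not β ∷ []

    shape-two : ∀ b → Shape (b ∷ not b ∷ [])
    shape-two true  = inj₂ (inj₂ (inj₁ refl))
    shape-two false = inj₂ (inj₂ (inj₂ refl))
    shape-two′ : ∀ b → Shape (not b ∷ b ∷ [])
    shape-two′ true  = inj₂ (inj₂ (inj₂ refl))
    shape-two′ false = inj₂ (inj₂ (inj₁ refl))
    shape-one : ∀ b → Shape (b ∷ [])
    shape-one true  = inj₁ refl
    shape-one false = inj₂ (inj₁ refl)

    shape₀ : ∀ w → Shape (c₀ w)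
    shape₀ w with A? w | B? w
    ... | yes _ | yes _ = shape-two β
    ... | yes _ | no _  = shape-one β
    ... | no _  | _     = shape-one (not β)

    coverA₀ : ∀ {w} → A w → β ∈ˡ c₀ w
    coverA₀ {w} a with A? w | B? w
    ... | yes _ | yes _ = here refl
    ... | yes _ | no _  = here refl
    ... | no ¬a | _     = ⊥-elim (¬a a)

    coverB₀ : ∀ {w} → B w → not β ∈ˡ c₀ w
    coverB₀ {w} b with A? w | B? w
    ... | yes _ | yes _ = there (here refl)
    ... | yes _ | no ¬b = ⊥-elim (¬b b)
    ... | no _  | _     = here refl

    words-¬A : ∀ {P} → All (¬_ ∘ A) P → (c : Fin n → List Bool) → (∀ {w} → w ∈ˡ P → c w ≡ c₀ w) → Colour (not β) (concatMap (word c) P)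
    words-¬A [] c e = []
    words-¬A {w ∷ P} (¬a ∷ r) c e = Allₚ.++⁺ (first (c w) (e (here refl))) (words-¬A r c (e ∘ there))
      where
      first : ∀ bs → bs ≡ c₀ w → Colour (not β) (map (_, w) bs)
      first bs e with A? w | B? w
      ... | yes a | _ = ⊥-elim (¬a a)
      first _ refl | no _ | _ = refl ∷ []

    words-¬B : ∀ {P} → All (¬_ ∘ B) P → (∀ {w} → w ∈ˡ P → A w) → (c : Fin n → List Bool) → (∀ {w} → w ∈ˡ P → c w ≡ c₀ w) → Colour β (concatMap (word c) P)
    words-¬B [] _ c e = []
    words-¬B {w ∷ P} (¬b ∷ r) f c e = Allₚ.++⁺ (first (c w) (e (here refl))) (words-¬B r (f ∘ there) c (e ∘ there))
      where
      first : ∀ bs → bs ≡ c₀ w → Colour β (map (_, w) bs)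
      first bs e with A? w | B? w
      ... | no ¬a | _ = ⊥-elim (¬a (f (here refl)))
      ... | _ | yes b = ⊥-elim (¬b b)
      first _ refl | yes _ | no _ = refl ∷ []

    -- At the last element of the hull, β comes first, and at the first one, last.
    last-word : ∀ m → A m → (c : Fin n → List Bool) → c m ≡ c₀ m → ∃₂ λ X Y → word c m ≡ X ++ Y × Colour β X × Colour (not β) Y
    last-word m a c e with c m | e
    ... | _ | refl with A? m | B? m
    ... | yes _ | yes _ = (β , m) ∷ [] , (not β , m) ∷ [] , refl , refl ∷ [] , refl ∷ []
    ... | yes _ | no _  = (β , m) ∷ [] , [] , refl , refl ∷ [] , []
    ... | no ¬a | _     = ⊥-elim (¬a a)

    tie : Fin n → List Bool
    tie w with B? w
    ... | yes _ = not β ∷ β ∷ []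
    ... | no _  = β ∷ []

    c₁ : Fin n → Fin n → List Bool
    c₁ m w with w ≟ᶠ m
    ... | yes _ = tie w
    ... | no _  = c₀ w

    c₁-other : ∀ {m w} → w ≢ m → c₁ m w ≡ c₀ w
    c₁-other {m} {w} ne with w ≟ᶠ m
    ... | yes e = ⊥-elim (ne e)
    ... | no _  = refl

    first-word : ∀ m → ∃₂ λ X Y → word (c₁ m) m ≡ X ++ Y × Colour (not β) X × Colour β Y
    first-word m with m ≟ᶠ m
    ... | no ne = ⊥-elim (ne refl)
    ... | yes _ with B? m
    ... | yes _ = (not β , m) ∷ [] , (β , m) ∷ [] , refl , refl ∷ [] , refl ∷ []
    ... | no _  = [] , (β , m) ∷ [] , refl , [] , refl ∷ []

    shape₁ : ∀ m w → Shape (c₁ m w)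
    shape₁ m w with w ≟ᶠ m
    ... | no _ = shape₀ w
    ... | yes _ with B? w
    ... | yes _ = shape-two′ β
    ... | no _  = shape-one β

    coverA₁ : ∀ {m w} → A w → β ∈ˡ c₁ m w
    coverA₁ {m} {w} a with w ≟ᶠ m
    ... | no _ = coverA₀ a
    ... | yes _ with B? w
    ... | yes _ = there (here refl)
    ... | no _  = here refl

    coverB₁ : ∀ {m w} → B w → not β ∈ˡ c₁ m w
    coverB₁ {m} {w} b with w ≟ᶠ m
    ... | no _ = coverB₀ b
    ... | yes _ with B? w
    ... | yes _ = here refl
    ... | no ¬b = ⊥-elim (¬b b)

    record Arcs (L : List (Fin n)) : Set where
      field
        c        : Fin n → List Bool
        shape    : ∀ w → Shape (c w)
        coverA   : ∀ {w} → A w → β ∈ˡ c w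
        coverB   : ∀ {w} → B w → not β ∈ˡ c w
        W₁ W₂ W₃ : Letters n
        arcs     : concatMap (word c) L ≡ W₁ ++ W₂ ++ W₃
        col₁     : Colour (not β) W₁
        col₂     : Colour β W₂
        col₃     : Colour (not β) W₃

    words-++ : ∀ c xs ys → concatMap (word c) (xs ++ ys) ≡ concatMap (word {n} c) xs ++ concatMap (word c) ys
    words-++ c = Listₚ.concatMap-++ (word c)

    arcs-none : ∀ {L} → All (¬_ ∘ A) L → Arcs L
    arcs-none {L} p = record { c = c₀ ; shape = shape₀ ; coverA = coverA₀ ; coverB = coverB₀
      ; W₁ = concatMap (word c₀) L ; W₂ = [] ; W₃ = [] ; arcs = sym (Listₚ.++-identityʳ _)
      ; col₁ = words-¬A p c₀ (λ _ → refl) ; col₂ = [] ; col₃ = [] }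

    arcs-single : ∀ P m Q → All (¬_ ∘ A) P → A m → All (¬_ ∘ A) Q → Arcs (P ++ m ∷ Q)
    arcs-single P m Q p a q with last-word m a c₀ refl
    ... | X , Y , e , cX , cY = record { c = c₀ ; shape = shape₀ ; coverA = coverA₀ ; coverB = coverB₀
      ; W₁ = concatMap (word c₀) P ; W₂ = X ; W₃ = Y ++ concatMap (word c₀) Q
      ; arcs = trans (words-++ c₀ P (m ∷ Q)) (cong (concatMap (word c₀) P ++_)
          (trans (cong (_++ concatMap (word c₀) Q) e) (Listₚ.++-assoc X Y _)))
      ; col₁ = words-¬A p c₀ (λ _ → refl) ; col₂ = cX ; col₃ = Allₚ.++⁺ cY (words-¬A q c₀ (λ _ → refl)) }

    arcs-double : ∀ P m M m′ Q → Unique (P ++ m ∷ M ++ m′ ∷ Q) → All (¬_ ∘ A) P → A m → A m′ → All (¬_ ∘ A) Q →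
                  All (¬_ ∘ B) M → (∀ {w} → w ∈ˡ M → A w) → Arcs (P ++ m ∷ M ++ m′ ∷ Q)
    arcs-double P m M m′ Q u p a a′ q ¬b inA with first-word m | last-word m′ a′ (c₁ m) (c₁-other m′≢m)
      where
      m′≢m : m′ ≢ m
      m′≢m refl = proj₁ (proj₂ (uniq-mid P u)) (∈-++⁺ʳ M (here refl))
    ... | X , Y , e , cX , cY | X′ , Y′ , e′ , cX′ , cY′ = record
      { c = c₁ m ; shape = shape₁ m ; coverA = coverA₁ ; coverB = coverB₁
      ; W₁ = cm P ++ X ; W₂ = Y ++ cm M ++ X′ ; W₃ = Y′ ++ cm Q ; arcs = eqn
      ; col₁ = Allₚ.++⁺ (words-¬A p (c₁ m) λ w∈ → c₁-other λ { refl → proj₁ mid w∈ }) cX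
      ; col₂ = Allₚ.++⁺ cY (Allₚ.++⁺ (words-¬B ¬b inA (c₁ m) λ w∈ → c₁-other λ { refl → proj₁ (proj₂ mid) (∈-++⁺ˡ w∈) }) cX′)
      ; col₃ = Allₚ.++⁺ cY′ (words-¬A q (c₁ m) λ w∈ → c₁-other λ { refl → proj₁ (proj₂ mid) (∈-++⁺ʳ M (there w∈)) }) }
      where
      mid = uniq-mid P u
      cm : List (Fin n) → Letters n
      cm = concatMap (word (c₁ m))
      eqn : cm (P ++ m ∷ M ++ m′ ∷ Q) ≡ (cm P ++ X) ++ (Y ++ cm M ++ X′) ++ Y′ ++ cm Q
      eqn = begin
        cm (P ++ m ∷ M ++ m′ ∷ Q)                              ≡⟨ words-++ (c₁ m) P (m ∷ M ++ m′ ∷ Q) ⟩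
        cm P ++ word (c₁ m) m ++ cm (M ++ m′ ∷ Q)              ≡⟨ cong (λ l → cm P ++ word (c₁ m) m ++ l) (words-++ (c₁ m) M (m′ ∷ Q)) ⟩
        cm P ++ word (c₁ m) m ++ cm M ++ word (c₁ m) m′ ++ cm Q ≡⟨ cong₂ (λ k l → cm P ++ k ++ cm M ++ l ++ cm Q) e e′ ⟩
        cm P ++ (X ++ Y) ++ cm M ++ (X′ ++ Y′) ++ cm Q         ≡⟨ cong (λ l → cm P ++ (X ++ Y) ++ cm M ++ l) (Listₚ.++-assoc X′ Y′ (cm Q)) ⟩
        cm P ++ (X ++ Y) ++ cm M ++ X′ ++ Y′ ++ cm Q           ≡⟨ cong (cm P ++_) (Listₚ.++-assoc X Y _) ⟩
        cm P ++ X ++ Y ++ cm M ++ X′ ++ Y′ ++ cm Q             ≡⟨ sym (Listₚ.++-assoc (cm P) X _) ⟩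
        (cm P ++ X) ++ Y ++ cm M ++ X′ ++ Y′ ++ cm Q           ≡⟨ cong (λ l → (cm P ++ X) ++ Y ++ l) (sym (Listₚ.++-assoc (cm M) X′ _)) ⟩
        (cm P ++ X) ++ Y ++ (cm M ++ X′) ++ Y′ ++ cm Q         ≡⟨ cong ((cm P ++ X) ++_) (sym (Listₚ.++-assoc Y (cm M ++ X′) _)) ⟩
        (cm P ++ X) ++ (Y ++ cm M ++ X′) ++ Y′ ++ cm Q         ∎
        where open ≡-Reasoning

  module _ {A B : Fin n → Set} (A? : Decidable A) (B? : Decidable B) where

    private
      fromA : ∀ {L} → HullLabelling.Arcs A? B? true L → Labelling A B L
      fromA K = record { c = c ; shape = shape ; coverA = coverA ; coverB = coverB ; b = false ; W₁ = W₁ ; W₂ = W₂ ; W₃ = W₃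
        ; arcs = arcs ; col₁ = col₁ ; col₂ = col₂ ; col₃ = col₃ }
        where open HullLabelling.Arcs K
      fromB : ∀ {L} → HullLabelling.Arcs B? A? false L → Labelling A B L
      fromB K = record { c = c ; shape = shape ; coverA = coverB ; coverB = coverA ; b = true ; W₁ = W₁ ; W₂ = W₂ ; W₃ = W₃
        ; arcs = arcs ; col₁ = col₁ ; col₂ = col₂ ; col₃ = col₃ }
        where open HullLabelling.Arcs K

      some : {P : Fin n → Set} → Decidable P → ∀ M → All (¬_ ∘ P) M ⊎ ∃ λ b → b ∈ˡ M × P b
      some P? [] = inj₁ []
      some P? (x ∷ M) with P? x | some P? M
      ... | yes p | _ = inj₂ (x , here refl , p)
      ... | no ¬p | inj₁ q = inj₁ (¬p ∷ q)
      ... | no ¬p | inj₂ (b , b∈ , p) = inj₂ (b , there b∈ , p)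

      in-three : ∀ {a b c : Fin n} P M Q → b ∈ˡ M → (a ∷ b ∷ c ∷ []) ⊆ˡ (P ++ a ∷ M ++ c ∷ Q)
      in-three P M Q b∈ = Subₚ.++⁺ˡ P (refl ∷ Subₚ.++⁺ (from∈ b∈) (refl ∷ minimum _))

      -- The hull of each kind has an element of the other kind strictly inside. If the hulls start
      -- differently, the two starts, the inner element of the later hull and its end alternate; if
      -- they only end differently, the mirror image holds. If they coincide, their ends and the two
      -- inner elements alternate, or there is one inner element of both kinds, and with the ends
      -- three common ones.
      clash : ∀ {P m M m′ Q P′ k M′ k′ Q′ a b} → P ++ m ∷ M ++ m′ ∷ Q ≡ P′ ++ k ∷ M′ ++ k′ ∷ Q′ →
              A m → A m′ → B k → B k′ → b ∈ˡ M → B b → a ∈ˡ M′ → A a → Obstruction A B (P ++ m ∷ M ++ m′ ∷ Q)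
      clash {P} {m} {M} {m′} {Q} {P′} {k} {M′} {k′} {Q′} {a} {b} e Am Am′ Bk Bk′ b∈ Bb a∈ Aa with two-splits P P′ e
      ... | inj₁ (k∈P , _) = baba (Subₚ.++⁺ (from∈ k∈P) (refl ∷ Subₚ.++⁺ (from∈ b∈) (refl ∷ minimum _))) Bk Am Bb Am′
      ... | inj₂ (inj₁ (m∈P′ , _)) = subst (Obstruction A B) (sym e)
            (abab (Subₚ.++⁺ (from∈ m∈P′) (refl ∷ Subₚ.++⁺ (from∈ a∈) (refl ∷ minimum _))) Am Bk Aa Bk′)
      ... | inj₂ (inj₂ (refl , e′)) with two-splits M M′ e′
      ... | inj₁ (k′∈M , m′∈Q′) = subst (Obstruction A B) (sym e)
            (baba (Subₚ.++⁺ˡ P′ (refl ∷ Subₚ.++⁺ (from∈ a∈) (refl ∷ from∈ m′∈Q′))) Bk Aa Bk′ Am′)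
      ... | inj₂ (inj₁ (m′∈M′ , k′∈Q)) =
            abab (Subₚ.++⁺ˡ P (refl ∷ Subₚ.++⁺ (from∈ b∈) (refl ∷ from∈ k′∈Q))) Am Bb Am′ Bk′
      ... | inj₂ (inj₂ (refl , refl)) with pair-order a∈ (subst (b ∈ˡ_) (Listₚ.++-cancelʳ (m′ ∷ Q) M M′ e′) b∈)
      ... | inj₁ refl = both (in-three P M Q b∈) Am Bk Aa Bb Am′ Bk′
      ... | inj₂ (inj₁ s) = subst (Obstruction A B) (sym e)
            (baba (Subₚ.++⁺ˡ P′ (refl ∷ Subₚ.++⁺ s (refl ∷ minimum _))) Bk Aa Bb Am′)
      ... | inj₂ (inj₂ s) = subst (Obstruction A B) (sym e)
            (abab (Subₚ.++⁺ˡ P′ (refl ∷ Subₚ.++⁺ s (refl ∷ minimum _))) Am Bb Aa Bk′)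

    labelling-or-obstruction : ∀ L → Unique L → (∀ {w} → w ∈ˡ L → A w ⊎ B w) → Labelling A B L ⊎ Obstruction A B L
    labelling-or-obstruction L u AB = go (hull A? L) refl
      where
      go : ∀ {L′} → Hull A L′ → L′ ≡ L → Labelling A B L ⊎ Obstruction A B L
      go (none p) refl = inj₁ (fromA (HullLabelling.arcs-none A? B? true p))
      go (single P m Q p a q) refl = inj₁ (fromA (HullLabelling.arcs-single A? B? true P m Q p a q))
      go (double P m M m′ Q p a a′ q) refl with some B? M
      ... | inj₁ ¬b = inj₁ (fromA (HullLabelling.arcs-double A? B? true P m M m′ Q u p a a′ q ¬b
            λ w∈ → [ id , ⊥-elim ∘ all-∈ ¬b w∈ ]′ (AB (∈-++⁺ʳ P (there (∈-++⁺ˡ w∈))))))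
      ... | inj₂ (b , b∈ , Bb) = go′ (hull B? L) refl
        where
        go′ : ∀ {L′} → Hull B L′ → L′ ≡ L → Labelling A B L ⊎ Obstruction A B L
        go′ (none p) e = inj₁ (subst (Labelling A B) e (fromB (HullLabelling.arcs-none B? A? false p)))
        go′ (single P′ k Q′ p b q) e = inj₁ (subst (Labelling A B) e (fromB (HullLabelling.arcs-single B? A? false P′ k Q′ p b q)))
        go′ (double P′ k M′ k′ Q′ p′ Bk Bk′ q′) e with some A? M′
        ... | inj₁ ¬a = inj₁ (subst (Labelling A B) e (fromB (HullLabelling.arcs-double B? A? false P′ k M′ k′ Q′ (subst Unique (sym e) u) p′ Bk Bk′ q′ ¬a
              λ w∈ → [ ⊥-elim ∘ all-∈ ¬a w∈ , id ]′ (AB (subst (_ ∈ˡ_) e (∈-++⁺ʳ P′ (there (∈-++⁺ˡ w∈))))))))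
        ... | inj₂ (x , x∈ , Ax) = inj₂ (clash (sym e) a a′ Bk Bk′ b∈ Bb x∈ Ax)

-- Splitting a contracted vertex in a sweep

module Splitting where
  open Models
  open Runs
  open Labellings
  import Data.List.Properties as Listₚ
  import Data.List.Relation.Unary.All as All
  import Data.List.Relation.Unary.All.Properties as Allₚ
  import Data.List.Membership.Propositional.Properties as ∈ₚ
  import Data.List.Relation.Unary.Any.Properties as Anyₚ

  private variable
    n : ℕ
    A : Set

  ∈-concatMap : {B : Set} {f : A → List B} {x : A} {y : B} {xs : List A} → x ∈ˡ xs → y ∈ˡ f x → y ∈ˡ concatMap f xs
  ∈-concatMap {f = f} (here refl) q = ∈-++⁺ˡ q
  ∈-concatMap {f = f} {xs = x ∷ xs} (there p) q = ∈-++⁺ʳ (f x) (∈-concatMap p q)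

  concatMap-id : {f : A → List A} (xs : List A) → (∀ {x} → x ∈ˡ xs → f x ≡ x ∷ []) → concatMap f xs ≡ xs
  concatMap-id [] e = refl
  concatMap-id (x ∷ xs) e = cong₂ _++_ (e (here refl)) (concatMap-id xs (e ∘ there))

  concatMap-++₃ : {B : Set} (f : A → List B) (xs ys zs : List A) →
                  concatMap f (xs ++ ys ++ zs) ≡ concatMap f xs ++ concatMap f ys ++ concatMap f zs
  concatMap-++₃ f xs ys zs = trans (Listₚ.concatMap-++ f xs (ys ++ zs)) (cong (concatMap f xs ++_) (Listₚ.concatMap-++ f ys zs))

  focus : (p w m q : List A) (e : A) → p ++ (w ++ e ∷ m) ++ q ≡ (p ++ w) ++ (e ∷ []) ++ m ++ q
  focus p w m q e = trans (cong (p ++_) (Listₚ.++-assoc w (e ∷ m) q)) (sym (Listₚ.++-assoc p w _))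

  focus₂ : (p w x m q : List A) → p ++ (w ++ x ++ m) ++ q ≡ (p ++ w) ++ x ++ m ++ q
  focus₂ p w x m q = trans (cong (p ++_) (trans (Listₚ.++-assoc w (x ++ m) q) (cong (w ++_) (Listₚ.++-assoc x m q)))) (sym (Listₚ.++-assoc p w _))

  module _ {Q Q′ : Rule n} {f : Strand n → State n} {x : Fin n} {ρ ρ′ : List (Fin n)}
    (f-id : ∀ {e} → proj₂ e ≢ x → f e ≡ e ∷ []) (f-from : ∀ e → All (From (proj₁ e)) (f e)) where

    private
      from-all : ∀ {v outs} → All (From v) outs → All (From v) (concatMap f outs)
      from-all [] = []
      from-all {outs = e ∷ _} (refl ∷ o) = Allₚ.++⁺ (f-from e) (from-all o)

    -- As long as `x` is not swept, no event takes in a strand to `x`; so such a strand can be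
    -- exchanged for any strands from the same source.
    relabel : ∀ {σ vs τ} → x ∉ˡ vs →
      (∀ {v us outs} → v ∈ˡ vs → (∀ {w} → w ∈ˡ us → w ∈ˡ vs) → Q v (us ++ ρ) outs → Q′ v (us ++ ρ′) (concatMap f outs)) →
      Run Q ρ σ vs τ → Run Q′ ρ′ (concatMap f σ) vs (concatMap f τ)
    relabel x∉ conv done = done
    relabel {τ = τ} x∉ conv (event {v} {vs} pre ins outs post refl i o q R) =
      event (concatMap f pre) ins (concatMap f outs) (concatMap f post)
        (trans (concatMap-++₃ f pre ins post) (cong (λ l → concatMap f pre ++ l ++ concatMap f post)
          (concatMap-id ins λ e∈ → f-id λ e → x∉ (here (trans (sym e) (all-∈ i e∈))))))
        i (from-all o) (conv (here refl) there q)
        (subst (λ s → Run Q′ ρ′ s vs (concatMap f τ)) (concatMap-++₃ f pre outs post)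
          (relabel (x∉ ∘ there) (λ v∈ us⊆ → conv (there v∈) (there ∘ us⊆)) R))

  module Strands (x y : Fin n) (c : Fin n → List Bool) where

    vert : Bool → Fin n
    vert true  = x
    vert false = y

    inS outS : Bool × Fin n → Strand n
    inS  (b , w) = w , vert b
    outS (b , w) = vert b , w

    to-vert : ∀ {b} {W : Letters n} → Colour b W → All (To (vert b)) (map inS W)
    to-vert p = Allₚ.map⁺ (All.map (cong vert) p)

    from-vert : ∀ {b} {W : Letters n} → Colour b W → All (From (vert b)) (map outS W)
    from-vert p = Allₚ.map⁺ (All.map (cong vert) p)

    colour-reverse : ∀ {b} {W : Letters n} → Colour b W → Colour b (reverse W)
    colour-reverse {W = W} p = ∈-all (reverse W) λ e∈ → all-∈ p (Anyₚ.reverse⁻ e∈)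

    exp-words : ∀ outs → Exp outs (map outS (concatMap (word c) (map proj₂ outs)))
    exp-words [] = []
    exp-words ((a , w) ∷ outs) = subst (Exp _) (sym (Listₚ.map-++ outS (word c w) _)) (to-w (c w) ∷ exp-words outs)
      where
      to-w : ∀ bs → All (To w) (map outS (map (_, w) bs))
      to-w []       = []
      to-w (_ ∷ bs) = refl ∷ to-w bs

    not-in : ∀ {b} {w : Fin n} {W : Letters n} → Colour (not b) W → (b , w) ∉ˡ W
    not-in {true}  p e∈ = case all-∈ p e∈ of λ ()
    not-in {false} p e∈ = case all-∈ p e∈ of λ ()

  module Split {H : Graph n} {x y : Fin n} {vs : List (Fin n)} (uniq : Unique vs) (x∈ : x ∈ˡ vs)
    (N : Run (Exact (merge H x y)) [] [] vs [])
    (Λ : Labelling (Adj H x) (Adj H y) (Rotation (At.ins (locate x∈ N)) (At.outs (locate x∈ N)))) where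

    open At (locate x∈ N) renaming (before to α; after to β)
    open Labelling Λ
    open Strands x y c

    private
      G′ : Graph n
      G′ = merge H x y

      uniq′ = uniq-mid α (subst Unique split-vs uniq)
      x∉α = proj₁ uniq′
      x∉β = proj₁ (proj₂ uniq′)

      lift : ∀ {v w} → Adj H v w → Adj G′ v w
      lift a = (λ { refl → adj-irrefl H refl a }) , inj₁ a

      lift-x : ∀ {v b} → v ≢ x → Adj H v (vert b) → Adj G′ v x
      lift-x {b = true}  ne a = ne , inj₁ a
      lift-x {b = false} ne a = ne , inj₂ (inj₂ (refl , a))

      x-lift : ∀ {w} b → w ≢ x → Adj H (vert b) w → Adj G′ x w
      x-lift true  ne a = ne ∘ sym , inj₁ a
      x-lift false ne a = ne ∘ sym , inj₂ (inj₁ (refl , a))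

      cover : ∀ {w} b → Adj H (vert b) w → b ∈ˡ c w
      cover true  = coverA
      cover false = coverB

      both-verts : ∀ {z : Fin n} b → z ≡ vert b ⊎ z ≡ vert (not b) → z ≡ x ⊎ z ≡ y
      both-verts true  p = p
      both-verts false (inj₁ p) = inj₂ p
      both-verts false (inj₂ p) = inj₁ p

      f : Strand n → State n
      f (w , v) with v ≟ᶠ x
      -- Reversed because a state is read downwards, whereas the rotation lists incoming strands
      -- upwards.
      ... | yes _ = map (λ b → (w , vert b)) (reverse (c w))
      ... | no _  = (w , v) ∷ []

      f-id : ∀ {e} → proj₂ e ≢ x → f e ≡ e ∷ []
      f-id {w , v} ne with v ≟ᶠ x
      ... | yes e = ⊥-elim (ne e)
      ... | no _  = refl

      f-x : ∀ w → f (w , x) ≡ map (λ b → (w , vert b)) (reverse (c w))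
      f-x w with x ≟ᶠ x
      ... | yes _ = refl
      ... | no ne = ⊥-elim (ne refl)

      f-from : ∀ e → All (From (proj₁ e)) (f e)
      f-from (w , v) with v ≟ᶠ x
      ... | yes _ = go (reverse (c w))
        where
        go : ∀ bs → All (From w) (map (λ b → (w , vert b)) bs)
        go [] = []
        go (_ ∷ bs) = refl ∷ go bs
      ... | no _ = refl ∷ []

      WI WO : Letters n
      WI = concatMap (word c) (reverse (map proj₁ ins))
      WO = concatMap (word c) (map proj₂ outs)

      arcs′ : WO ++ WI ≡ W₁ ++ W₂ ++ W₃
      arcs′ = trans (sym (Listₚ.concatMap-++ (word c) (map proj₂ outs) (reverse (map proj₁ ins)))) arcs

      f-ins : ∀ is → All (To x) is → concatMap f is ≡ map inS (reverse (concatMap (word c) (reverse (map proj₁ is))))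
      f-ins [] [] = refl
      f-ins ((w , .x) ∷ is) (refl ∷ p) = begin
        f (w , x) ++ concatMap f is
          ≡⟨ cong₂ _++_ (trans (f-x w) (lemma (c w))) (f-ins is p) ⟩
        map inS (reverse (word c w)) ++ map inS (reverse (cw (reverse (map proj₁ is))))
          ≡⟨ sym (Listₚ.map-++ inS (reverse (word c w)) _) ⟩
        map inS (reverse (word c w) ++ reverse (cw (reverse (map proj₁ is))))
          ≡⟨ cong (map inS) (sym (Listₚ.reverse-++ (cw (reverse (map proj₁ is))) (word c w))) ⟩
        map inS (reverse (cw (reverse (map proj₁ is)) ++ word c w))
          ≡⟨ cong (λ l → map inS (reverse (cw (reverse (map proj₁ is)) ++ l))) (sym (Listₚ.++-identityʳ (word c w))) ⟩
        map inS (reverse (cw (reverse (map proj₁ is)) ++ cw (w ∷ [])))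
          ≡⟨ cong (map inS ∘ reverse) (sym (Listₚ.concatMap-++ (word c) (reverse (map proj₁ is)) (w ∷ []))) ⟩
        map inS (reverse (cw (reverse (map proj₁ is) ++ w ∷ [])))
          ≡⟨ cong (map inS ∘ reverse ∘ cw) (sym (Listₚ.unfold-reverse w (map proj₁ is))) ⟩
        map inS (reverse (cw (reverse (w ∷ map proj₁ is)))) ∎
        where
        open ≡-Reasoning
        cw = concatMap (word c)
        lemma : ∀ bs → map (λ b → (w , vert b)) (reverse bs) ≡ map inS (reverse (map (_, w) bs))
        lemma bs = trans (Listₚ.map-∘ (reverse bs)) (cong (map inS) (Listₚ.reverse-map (_, w) bs))

      no-x : ∀ {e} → e ∈ˡ pre ⊎ e ∈ˡ post → proj₂ e ≢ x
      no-x p e = no-target pre outs post x∉β suffix e p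

      f-state : concatMap f (pre ++ ins ++ post) ≡ pre ++ map inS (reverse WI) ++ post
      f-state = trans (concatMap-++₃ f pre ins post) (cong₂ (λ k l → k ++ l)
        (concatMap-id pre λ e∈ → f-id (no-x (inj₁ e∈)))
        (cong₂ _++_ (f-ins ins ins-to) (concatMap-id post λ e∈ → f-id (no-x (inj₂ e∈)))))

      module Prefix (u u′ : Fin n) (uu : ∀ {z} → z ≡ u ⊎ z ≡ u′ → z ≡ x ⊎ z ≡ y) where
        conv : ∀ {v us outs} → v ∈ˡ α → (∀ {w} → w ∈ˡ us → w ∈ˡ α) → Exact G′ v (us ++ x ∷ β ++ []) outs →
               Complete H v (us ++ u ∷ u′ ∷ β ++ []) (concatMap f outs)
        conv {v} {us} {outs} v∈ us⊆ (_ , _ , compl) {w} w∈ a = go (∈-++⁻ us w∈)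
          where
          v≢x : v ≢ x
          v≢x refl = x∉α v∈
          keep : w ≢ x → w ∈ˡ us ++ x ∷ β ++ [] → (v , w) ∈ˡ concatMap f outs
          keep ne p = ∈-concatMap (compl p (lift a)) (subst ((v , w) ∈ˡ_) (sym (f-id ne)) (here refl))
          at-x : ∀ b → Adj H v (vert b) → (v , vert b) ∈ˡ concatMap f outs
          at-x b a = ∈-concatMap (compl (∈-++⁺ʳ us (here refl)) (lift-x {b = b} v≢x a))
            (subst ((v , vert b) ∈ˡ_) (sym (f-x v)) (∈ₚ.∈-map⁺ _ (Anyₚ.reverse⁺ (cover b (adj-sym H a)))))
          special : w ≡ x ⊎ w ≡ y → (v , w) ∈ˡ concatMap f outs
          special (inj₁ refl) = at-x true a
          special (inj₂ refl) = at-x false a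
          go : w ∈ˡ us ⊎ w ∈ˡ u ∷ u′ ∷ β ++ [] → (v , w) ∈ˡ concatMap f outs
          go (inj₁ p) = keep (λ { refl → x∉α (us⊆ p) }) (∈-++⁺ˡ p)
          go (inj₂ (here e)) = special (uu (inj₁ e))
          go (inj₂ (there (here e))) = special (uu (inj₂ e))
          go (inj₂ (there (there p))) = keep (λ { refl → x∉β ([ id , (λ ()) ]′ (∈-++⁻ β p)) }) (∈-++⁺ʳ us (there p))

        run : Run (Complete H) (u ∷ u′ ∷ β ++ []) [] α (pre ++ map inS (reverse WI) ++ post)
        run = subst (Run (Complete H) (u ∷ u′ ∷ β ++ []) [] α) f-state
          (relabel {Q = Exact G′} {Q′ = Complete H} f-id f-from x∉α conv prefix)

      tail-run : Run (Complete H) [] (pre ++ map outS WO ++ post) β []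
      tail-run = reroute {Q = Exact G′} {Q′ = Complete H}
        (λ {v} {us} {os} v∈ us⊆ o q → os , exp-refl os , o , λ w∈ a → proj₂ (proj₂ q) w∈ (lift a))
        suffix (exp-++ (exp-refl pre) (exp-++ (exp-words outs) (exp-refl post)))

      out-∈ : ∀ {w} b → w ∈ˡ β ++ [] → Adj H (vert b) w → (b , w) ∈ˡ WO
      out-∈ {w} b w∈ a = ∈-concatMap {f = word c}
        (∈ₚ.∈-map⁺ proj₂ (proj₂ (proj₂ rule) w∈ (x-lift b (λ { refl → x∉β ([ id , (λ ()) ]′ (∈-++⁻ β w∈)) }) a)))
        (∈ₚ.∈-map⁺ (_, w) (cover b a))

      u u′ : Fin n
      u  = vert b
      u′ = vert (not b)

      colour′ : ∀ {W : Letters n} → Colour b W → Colour (not (not b)) W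
      colour′ {W} = subst (λ b → Colour b W) (sym (not-not b))
        where
        not-not : ∀ b → not (not b) ≡ b
        not-not true  = refl
        not-not false = refl

      map-rev-++ : ∀ V W → map inS (reverse (V ++ W)) ≡ map inS (reverse W) ++ map inS (reverse V)
      map-rev-++ V W = trans (cong (map inS) (Listₚ.reverse-++ V W)) (Listₚ.map-++ inS (reverse W) (reverse V))

      to′ : ∀ {b} {W : Letters n} → Colour b W → All (To (vert b)) (map inS (reverse W))
      to′ p = to-vert (colour-reverse p)

      tail-as : ∀ {s} → pre ++ map outS WO ++ post ≡ s → Run (Complete H) [] s β []
      tail-as e = subst (λ s → Run (Complete H) [] s β []) e tail-run

      start-as : ∀ {m v vs} → map inS (reverse WI) ≡ m → Run (Complete H) [] (pre ++ m ++ post) (v ∷ vs) [] →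
                 Run (Complete H) [] (pre ++ map inS (reverse WI) ++ post) (v ∷ vs) []
      start-as {v = v} {vs} e = subst (λ m → Run (Complete H) [] (pre ++ m ++ post) (v ∷ vs) []) (sym e)

    Result : Set
    Result = ∃ λ vs′ → Run (Complete H) [] [] vs′ [] × (vs′ ≡ α ++ x ∷ y ∷ β ⊎ vs′ ≡ α ++ y ∷ x ∷ β)

    private
      order₁ : ∀ b → α ++ vert b ∷ vert (not b) ∷ β ≡ α ++ x ∷ y ∷ β ⊎ α ++ vert b ∷ vert (not b) ∷ β ≡ α ++ y ∷ x ∷ β
      order₁ true  = inj₁ refl
      order₁ false = inj₂ refl
      order₂ : ∀ b → α ++ vert (not b) ∷ vert b ∷ β ≡ α ++ x ∷ y ∷ β ⊎ α ++ vert (not b) ∷ vert b ∷ β ≡ α ++ y ∷ x ∷ β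
      order₂ true  = inj₂ refl
      order₂ false = inj₁ refl

      uu₁ : ∀ {z} → z ≡ u ⊎ z ≡ u′ → z ≡ x ⊎ z ≡ y
      uu₁ = both-verts b
      uu₂ : ∀ {z} → z ≡ u′ ⊎ z ≡ u → z ≡ x ⊎ z ≡ y
      uu₂ (inj₁ p) = both-verts b (inj₂ p)
      uu₂ (inj₂ p) = both-verts b (inj₁ p)

      glue₁ : Run (Complete H) [] (pre ++ map inS (reverse WI) ++ post) (u ∷ u′ ∷ β) [] → Result
      glue₁ R = _ , Prefix.run u u′ uu₁ ⊕ R , order₁ b
      glue₂ : Run (Complete H) [] (pre ++ map inS (reverse WI) ++ post) (u′ ∷ u ∷ β) [] → Result
      glue₂ R = _ , Prefix.run u′ u uu₂ ⊕ R , order₂ b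

      out : ∀ {b} {w : Fin n} {W : Letters n} → (b , w) ∈ˡ W → (vert b , w) ∈ˡ map outS W
      out = ∈ₚ.∈-map⁺ outS

      -- The turn from outgoing to incoming strands falls into `W₃`, so `u′` has edges only to the
      -- right. `u` takes in everything and reaches `u′` by a strand between `W₁` and the outgoing
      -- part of `W₃`.
      cut-out : ∀ M → WO ≡ W₁ ++ W₂ ++ M → W₃ ≡ M ++ WI → Result
      cut-out M eO e₃ = glue₁ (event pre (map inS (reverse WI)) (map outS W₁ ++ (u , u′) ∷ map outS M) post refl
          (to′ (proj₂ c₃)) (Allₚ.++⁺ (from-vert col₁) (refl ∷ from-vert (proj₁ c₃))) complete-u
          (event (pre ++ map outS W₁) ((u , u′) ∷ []) (map outS W₂) (map outS M ++ post) (focus pre (map outS W₁) (map outS M) post (u , u′))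
            (refl ∷ []) (from-vert col₂) complete-u′
            (tail-as (trans (cong (λ l → pre ++ l ++ post) (trans (cong (map outS) eO) (trans (Listₚ.map-++ outS W₁ _) (cong (map outS W₁ ++_) (Listₚ.map-++ outS W₂ M)))))
              (focus₂ pre (map outS W₁) (map outS W₂) (map outS M) post)))))
        where
        c₃ : Colour b M × Colour b WI
        c₃ = Allₚ.++⁻ M (subst (Colour b) e₃ col₃)
        complete-u : Complete H u (u′ ∷ β ++ []) (map outS W₁ ++ (u , u′) ∷ map outS M)
        complete-u (here refl) _ = ∈-++⁺ʳ (map outS W₁) (here refl)
        complete-u (there w∈) a with ∈-++⁻ W₁ (subst (_ ∈ˡ_) eO (out-∈ b w∈ a))
        ... | inj₁ p = ∈-++⁺ˡ (out p)
        ... | inj₂ p with ∈-++⁻ W₂ p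
        ... | inj₁ q = ⊥-elim (not-in col₂ q)
        ... | inj₂ q = ∈-++⁺ʳ (map outS W₁) (there (out q))
        complete-u′ : Complete H u′ (β ++ []) (map outS W₂)
        complete-u′ w∈ a with ∈-++⁻ W₁ (subst (_ ∈ˡ_) eO (out-∈ (not b) w∈ a))
        ... | inj₁ p = ⊥-elim (not-in {not b} (colour′ col₁) p)
        ... | inj₂ p with ∈-++⁻ W₂ p
        ... | inj₁ q = out q
        ... | inj₂ q = ⊥-elim (not-in {not b} (colour′ (proj₁ c₃)) q)

      -- The turn falls into `W₂`: `u` handles the upper strands on both sides and `u′` the lower
      -- ones, with the strand between them as the lowest of `u` and the highest of `u′`.
      cut-across : ∀ M M′ → WO ≡ W₁ ++ M → WI ≡ M′ ++ W₃ → W₂ ≡ M ++ M′ → Result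
      cut-across M M′ eO eI e₂ = glue₁ (start-as (trans (cong (map inS ∘ reverse) eI) (map-rev-++ M′ W₃))
          (event pre (map inS (reverse W₃)) (map outS W₁ ++ (u , u′) ∷ []) (map inS (reverse M′) ++ post)
            (cong (pre ++_) (Listₚ.++-assoc (map inS (reverse W₃)) (map inS (reverse M′)) post))
            (to′ col₃) (Allₚ.++⁺ (from-vert col₁) (refl ∷ [])) complete-u
            (event (pre ++ map outS W₁) ((u , u′) ∷ map inS (reverse M′)) (map outS M) post
              (focus pre (map outS W₁) [] (map inS (reverse M′) ++ post) (u , u′)) (refl ∷ to′ (proj₂ c₂)) (from-vert (proj₁ c₂)) complete-u′
              (tail-as (trans (cong (λ l → pre ++ l ++ post) (trans (cong (map outS) eO) (Listₚ.map-++ outS W₁ M)))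
                (trans (cong (pre ++_) (Listₚ.++-assoc (map outS W₁) (map outS M) post)) (sym (Listₚ.++-assoc pre _ _))))))))
        where
        c₂ : Colour (not b) M × Colour (not b) M′
        c₂ = Allₚ.++⁻ M (subst (Colour (not b)) e₂ col₂)
        complete-u : Complete H u (u′ ∷ β ++ []) (map outS W₁ ++ (u , u′) ∷ [])
        complete-u (here refl) _ = ∈-++⁺ʳ (map outS W₁) (here refl)
        complete-u (there w∈) a with ∈-++⁻ W₁ (subst (_ ∈ˡ_) eO (out-∈ b w∈ a))
        ... | inj₁ p = ∈-++⁺ˡ (out p)
        ... | inj₂ q = ⊥-elim (not-in (proj₁ c₂) q)
        complete-u′ : Complete H u′ (β ++ []) (map outS M)
        complete-u′ w∈ a with ∈-++⁻ W₁ (subst (_ ∈ˡ_) eO (out-∈ (not b) w∈ a))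
        ... | inj₁ p = ⊥-elim (not-in {not b} (colour′ col₁) p)
        ... | inj₂ q = out q

      -- The turn falls into `W₁`, so all edges of `u′` come from the left. `u′` is swept before `u`
      -- and emits a single strand, to `u`.
      cut-in : ∀ M → W₁ ≡ WO ++ M → WI ≡ M ++ W₂ ++ W₃ → Result
      cut-in M e₁ eI = glue₂ (start-as (trans (cong (map inS ∘ reverse) eI) (trans (map-rev-++ M (W₂ ++ W₃))
          (trans (cong (_++ map inS (reverse M)) (map-rev-++ W₂ W₃)) (Listₚ.++-assoc (map inS (reverse W₃)) _ _))))
          (event (pre ++ map inS (reverse W₃)) (map inS (reverse W₂)) ((u′ , u) ∷ []) (map inS (reverse M) ++ post)
            (focus₂ pre (map inS (reverse W₃)) (map inS (reverse W₂)) (map inS (reverse M)) post)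
            (to′ col₂) (refl ∷ []) complete-u′
            (event pre (map inS (reverse W₃) ++ (u′ , u) ∷ map inS (reverse M)) (map outS WO) post
              (sym (focus pre (map inS (reverse W₃)) (map inS (reverse M)) post (u′ , u)))
              (Allₚ.++⁺ (to′ col₃) (refl ∷ to′ (proj₂ c₁))) (from-vert (proj₁ c₁)) complete-u tail-run)))
        where
        c₁ : Colour b WO × Colour b M
        c₁ = Allₚ.++⁻ WO (subst (Colour b) e₁ col₁)
        complete-u′ : Complete H u′ (u ∷ β ++ []) ((u′ , u) ∷ [])
        complete-u′ (here refl) _ = here refl
        complete-u′ (there w∈) a = ⊥-elim (not-in {not b} (colour′ (proj₁ c₁)) (out-∈ (not b) w∈ a))
        complete-u : Complete H u (β ++ []) (map outS WO)
        complete-u w∈ a = out (out-∈ b w∈ a)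

    split-run : Result
    split-run with ++-compare WO W₁ arcs′
    ... | inj₂ (M , e₁ , eI) = cut-in M e₁ eI
    ... | inj₁ (M , eO , e₂₃) with ++-compare M W₂ (sym e₂₃)
    ... | inj₁ (M′ , refl , e₃) = cut-out M′ eO e₃
    ... | inj₂ (M′ , e₂ , eI)   = cut-across M M′ eO eI e₂

  -- The first vertex s, when the edge st is drawn on top.
  module SplitFirst {H : Graph n} {s y t : Fin n} (s≢y : s ≢ y) (y≢t : y ≢ t) {β : List (Fin n)} (uniq : Unique (s ∷ β))
    (lt : Last t β) (st : Adj H s t) {outs : State n} (suffix : Run (Exact (merge H s y)) [] outs β [])
    (compl : ∀ {w} → w ∈ˡ β → w ≢ t → Adj (merge H s y) s w → (s , w) ∈ˡ outs)
    (Λ : Labelling (Adj H s) (Adj H y) (t ∷ map proj₂ outs)) where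

    open Labelling Λ
    open Strands s y c

    private
      WO : Letters n
      WO = concatMap (word c) (map proj₂ outs)

      -- Where an edge from `y` to `t` can run: below `s t` if `s` has no strands above those of
      -- `y`, or along the bottom if it has none below them. Being strands to the last vertex, both
      -- are put in by `add-ends`.
      data Ends : Letters n → Letters n → Set where
        inner : ∀ {X X′} → ¬ Adj H y t → Ends X X′
        above : ∀ {X′} → Ends [] X′
        below : ∀ {X} → Ends X []

      record Linear (V : Letters n) : Set where
        field
          X Y X′ : Letters n
          eq     : V ≡ X ++ Y ++ X′
          colX   : Colour true X
          colY   : Colour false Y
          colX′  : Colour true X′
          ends   : Ends X X′

      -- The word of t comes first, and it contains the colour of s.
      linear : ∀ {V} b (W₁ W₂ W₃ : Letters n) → Colour b W₁ → Colour (not b) W₂ → Colour b W₃ →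
               ∀ bs → Shape bs → true ∈ˡ bs → (Adj H y t → false ∈ˡ bs) → map (_, t) bs ++ V ≡ W₁ ++ W₂ ++ W₃ → Linear V
      linear b W₁ W₂ W₃ p q r _ (inj₂ (inj₁ refl)) (here ()) _ e
      linear b W₁ W₂ W₃ p q r _ (inj₂ (inj₁ refl)) (there ()) _ e
      linear true (_ ∷ W₁) W₂ W₃ (_ ∷ p) q r _ (inj₁ refl) _ f e = record
        { X = W₁ ; Y = W₂ ; X′ = W₃ ; eq = Listₚ.∷-injectiveʳ e ; colX = p ; colY = q ; colX′ = r ; ends = inner λ a → case f a of λ { (there ()) } }
      linear true [] (_ ∷ W₂) W₃ p (q ∷ _) r _ (inj₁ refl) _ f refl = case q of λ ()
      linear true [] [] (_ ∷ W₃) p q (_ ∷ r) _ (inj₁ refl) _ f refl = record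
        { X = [] ; Y = [] ; X′ = W₃ ; eq = refl ; colX = [] ; colY = [] ; colX′ = r ; ends = above }
      linear false (_ ∷ W₁) W₂ W₃ (p ∷ _) q r _ (inj₁ refl) _ f refl = case p of λ ()
      linear false [] (_ ∷ W₂) W₃ p (_ ∷ q) r _ (inj₁ refl) _ f refl = record
        { X = W₂ ; Y = W₃ ; X′ = [] ; eq = cong (W₂ ++_) (sym (Listₚ.++-identityʳ W₃)) ; colX = q ; colY = r ; colX′ = [] ; ends = below }
      linear false [] [] (_ ∷ W₃) p q (r ∷ _) _ (inj₁ refl) _ f refl = case r of λ ()
      linear true (_ ∷ _ ∷ W₁) W₂ W₃ (_ ∷ p ∷ _) q r _ (inj₂ (inj₂ (inj₁ refl))) _ f refl = case p of λ ()
      linear true (_ ∷ []) (_ ∷ W₂) W₃ p (_ ∷ q) r _ (inj₂ (inj₂ (inj₁ refl))) _ f refl = record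
        { X = [] ; Y = W₂ ; X′ = W₃ ; eq = refl ; colX = [] ; colY = q ; colX′ = r ; ends = above }
      linear true (_ ∷ []) [] (_ ∷ W₃) p q (r ∷ _) _ (inj₂ (inj₂ (inj₁ refl))) _ f refl = case r of λ ()
      linear true [] (_ ∷ W₂) W₃ p (q ∷ _) r _ (inj₂ (inj₂ (inj₁ refl))) _ f e = case trans (cong proj₁ (Listₚ.∷-injectiveˡ e)) q of λ ()
      linear true [] [] (_ ∷ _ ∷ W₃) p q (_ ∷ r ∷ _) _ (inj₂ (inj₂ (inj₁ refl))) _ f refl = case r of λ ()
      linear false (_ ∷ W₁) W₂ W₃ (p ∷ _) q r _ (inj₂ (inj₂ (inj₁ refl))) _ f e = case trans (cong proj₁ (Listₚ.∷-injectiveˡ e)) p of λ ()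
      linear false [] (_ ∷ _ ∷ W₂) W₃ p (_ ∷ q ∷ _) r _ (inj₂ (inj₂ (inj₁ refl))) _ f refl = case q of λ ()
      linear false [] (_ ∷ []) (_ ∷ W₃) p q (_ ∷ r) _ (inj₂ (inj₂ (inj₁ refl))) _ f refl = record
        { X = [] ; Y = W₃ ; X′ = [] ; eq = sym (Listₚ.++-identityʳ W₃) ; colX = [] ; colY = r ; colX′ = [] ; ends = above }
      linear false [] [] (_ ∷ W₃) p q (r ∷ _) _ (inj₂ (inj₂ (inj₁ refl))) _ f refl = case r of λ ()
      linear false [] (_ ∷ []) [] p q r _ (inj₂ (inj₂ (inj₁ refl))) _ f ()
      linear true (_ ∷ []) [] [] p q r _ (inj₂ (inj₂ (inj₁ refl))) _ f ()
      linear true (_ ∷ W₁) W₂ W₃ (p ∷ _) q r _ (inj₂ (inj₂ (inj₂ refl))) _ f e = case trans (cong proj₁ (Listₚ.∷-injectiveˡ e)) p of λ ()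
      linear true [] (_ ∷ _ ∷ W₂) W₃ p (_ ∷ q ∷ _) r _ (inj₂ (inj₂ (inj₂ refl))) _ f refl = case q of λ ()
      linear true [] (_ ∷ []) (_ ∷ W₃) p q (_ ∷ r) _ (inj₂ (inj₂ (inj₂ refl))) _ f refl = record
        { X = [] ; Y = [] ; X′ = W₃ ; eq = refl ; colX = [] ; colY = [] ; colX′ = r ; ends = above }
      linear true [] [] (_ ∷ W₃) p q (r ∷ _) _ (inj₂ (inj₂ (inj₂ refl))) _ f refl = case r of λ ()
      linear false (_ ∷ _ ∷ W₁) W₂ W₃ (_ ∷ p ∷ _) q r _ (inj₂ (inj₂ (inj₂ refl))) _ f refl = case p of λ ()
      linear false (_ ∷ []) (_ ∷ W₂) W₃ p (_ ∷ q) r _ (inj₂ (inj₂ (inj₂ refl))) _ f refl = record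
        { X = W₂ ; Y = W₃ ; X′ = [] ; eq = cong (W₂ ++_) (sym (Listₚ.++-identityʳ W₃)) ; colX = q ; colY = r ; colX′ = [] ; ends = below }
      linear false (_ ∷ []) [] (_ ∷ W₃) p q (r ∷ _) _ (inj₂ (inj₂ (inj₂ refl))) _ f refl = case r of λ ()
      linear false [] (_ ∷ W₂) W₃ p (q ∷ _) r _ (inj₂ (inj₂ (inj₂ refl))) _ f e = case trans (cong proj₁ (Listₚ.∷-injectiveˡ e)) q of λ ()
      linear false [] [] (_ ∷ _ ∷ W₃) p q (_ ∷ r ∷ _) _ (inj₂ (inj₂ (inj₂ refl))) _ f refl = case r of λ ()

      open Linear (linear {WO} b W₁ W₂ W₃ col₁ col₂ col₃ (c t) (shape t) (coverA st) coverB arcs)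

      s∉β : s ∉ˡ β
      s∉β = case uniq of λ { (p ∷ _) → ∉-all p }

      lift : ∀ {v w} → Adj H v w → Adj (merge H s y) v w
      lift a = (λ { refl → adj-irrefl H refl a }) , inj₁ a

      out-∈ : ∀ {w} b → w ∈ˡ β → w ≢ t → Adj H (vert b) w → (b , w) ∈ˡ WO
      out-∈ {w} b w∈ w≢t a = ∈-concatMap {f = word c} (∈ₚ.∈-map⁺ proj₂ (compl w∈ w≢t (lift-s b a))) (∈ₚ.∈-map⁺ (_, w) (cover b a))
        where
        s≢w : s ≢ w
        s≢w refl = s∉β w∈
        lift-s : ∀ b → Adj H (vert b) w → Adj (merge H s y) s w
        lift-s true  a = s≢w , inj₁ a
        lift-s false a = s≢w , inj₂ (inj₁ (refl , a))
        cover : ∀ b → Adj H (vert b) w → b ∈ˡ c w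
        cover true  = coverA
        cover false = coverB

      tail-run : (top bot : State n) → All (To t) top → All (To t) bot → Run (Complete H) [] (top ++ map outS (X ++ Y ++ X′) ++ bot) β []
      tail-run top bot p q = add-ends top bot p q lt (subst (λ W → Run (Complete H) [] (map outS W) β []) eq
        (reroute {Q = Exact (merge H s y)} {Q′ = Complete H}
          (λ {v} {us} {os} v∈ us⊆ o r → os , exp-refl os , o , λ w∈ a → proj₂ (proj₂ r) w∈ (lift a)) suffix (exp-words outs)))

      build : (T B : State n) → All (To t) T → All (To t) B → All (From y) T → All (From y) B → (Adj H y t → (y , t) ∈ˡ T ++ B) →
              Run (Complete H) [] (((s , t) ∷ map outS X) ++ (T ++ map outS Y ++ B) ++ map outS X′) β [] → Run (Complete H) [] [] (s ∷ y ∷ β) []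
      build T B tT tB fT fB yt R =
        event [] [] ((s , t) ∷ map outS X ++ (s , y) ∷ map outS X′) [] refl [] (refl ∷ Allₚ.++⁺ (from-vert colX) (refl ∷ from-vert colX′)) complete-s
          (event ((s , t) ∷ map outS X) ((s , y) ∷ []) (T ++ map outS Y ++ B) (map outS X′)
            (cong ((s , t) ∷_) (Listₚ.++-identityʳ (map outS X ++ (s , y) ∷ map outS X′)))
            (refl ∷ []) (Allₚ.++⁺ fT (Allₚ.++⁺ (from-vert colY) fB)) complete-y R)
        where
        out : ∀ {b} {w : Fin n} {W : Letters n} → (b , w) ∈ˡ W → (vert b , w) ∈ˡ map outS W
        out = ∈ₚ.∈-map⁺ outS
        β-in : ∀ {w} → w ∈ˡ β ++ [] → w ∈ˡ β
        β-in w∈ = [ id , (λ ()) ]′ (∈-++⁻ β w∈)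
        complete-s : Complete H s (y ∷ β ++ []) ((s , t) ∷ map outS X ++ (s , y) ∷ map outS X′)
        complete-s (here refl) _ = there (∈-++⁺ʳ (map outS X) (here refl))
        complete-s {w} (there w∈) a with w ≟ᶠ t
        ... | yes refl = here refl
        ... | no w≢t with ∈-++⁻ X (subst (_ ∈ˡ_) eq (out-∈ true (β-in w∈) w≢t a))
        ... | inj₁ p = there (∈-++⁺ˡ (out p))
        ... | inj₂ p with ∈-++⁻ Y p
        ... | inj₁ q = ⊥-elim (not-in colY q)
        ... | inj₂ q = there (∈-++⁺ʳ (map outS X) (there (out q)))
        complete-y : Complete H y (β ++ []) (T ++ map outS Y ++ B)
        complete-y {w} w∈ a with w ≟ᶠ t
        ... | yes refl = [ ∈-++⁺ˡ , ∈-++⁺ʳ T ∘ ∈-++⁺ʳ (map outS Y) ]′ (∈-++⁻ T (yt a))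
        ... | no w≢t with ∈-++⁻ X (subst (_ ∈ˡ_) eq (out-∈ false (β-in w∈) w≢t a))
        ... | inj₁ p = ⊥-elim (not-in {false} colX p)
        ... | inj₂ p with ∈-++⁻ Y p
        ... | inj₁ q = ∈-++⁺ʳ T (∈-++⁺ˡ (out q))
        ... | inj₂ q = ⊥-elim (not-in {false} colX′ q)

      finish : ∀ {X X′} → Ends X X′ → (∀ {top bot} → All (To t) top → All (To t) bot → Run (Complete H) [] (top ++ map outS (X ++ Y ++ X′) ++ bot) β []) →
               ∃₂ λ T B → All (To t) T × All (To t) B × All (From y) T × All (From y) B × (Adj H y t → (y , t) ∈ˡ T ++ B) ×
               Run (Complete H) [] (((s , t) ∷ map outS X) ++ (T ++ map outS Y ++ B) ++ map outS X′) β []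
      finish {X} {X′} (inner ¬yt) tail = [] , [] , [] , [] , [] , [] , (⊥-elim ∘ ¬yt) ,
        subst (λ l → Run (Complete H) [] l β []) (cong ((s , t) ∷_) eqn) (tail {(s , t) ∷ []} {[]} (refl ∷ []) [])
        where
        eqn : map outS (X ++ Y ++ X′) ++ [] ≡ map outS X ++ (map outS Y ++ []) ++ map outS X′
        eqn = trans (Listₚ.++-identityʳ _) (trans (Listₚ.map-++ outS X _) (cong (map outS X ++_)
          (trans (Listₚ.map-++ outS Y X′) (cong (_++ map outS X′) (sym (Listₚ.++-identityʳ (map outS Y)))))))
      finish {X′ = X′} above tail = (y , t) ∷ [] , [] , refl ∷ [] , [] , refl ∷ [] , [] , (λ _ → here refl) ,
        subst (λ l → Run (Complete H) [] l β []) (cong (λ l → (s , t) ∷ (y , t) ∷ l) eqn) (tail {(s , t) ∷ (y , t) ∷ []} {[]} (refl ∷ refl ∷ []) [])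
        where
        eqn : map outS (Y ++ X′) ++ [] ≡ (map outS Y ++ []) ++ map outS X′
        eqn = trans (Listₚ.++-identityʳ _) (trans (Listₚ.map-++ outS Y X′) (cong (_++ map outS X′) (sym (Listₚ.++-identityʳ (map outS Y)))))
      finish {X = X} below tail = [] , (y , t) ∷ [] , [] , refl ∷ [] , [] , refl ∷ [] , (λ _ → here refl) ,
        subst (λ l → Run (Complete H) [] l β []) (cong ((s , t) ∷_) eqn) (tail {(s , t) ∷ []} {(y , t) ∷ []} (refl ∷ []) (refl ∷ []))
        where
        eqn : map outS (X ++ Y ++ []) ++ (y , t) ∷ [] ≡ map outS X ++ (map outS Y ++ (y , t) ∷ []) ++ []
        eqn = trans (cong (λ l → map outS (X ++ l) ++ (y , t) ∷ []) (Listₚ.++-identityʳ Y)) (trans (cong (_++ (y , t) ∷ []) (Listₚ.map-++ outS X Y))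
          (trans (Listₚ.++-assoc (map outS X) _ _) (cong (map outS X ++_) (sym (Listₚ.++-identityʳ _)))))

    split-first : Run (Complete H) [] [] (s ∷ y ∷ β) []
    split-first with finish ends (λ {top} {bot} → tail-run top bot)
    ... | T , B , tT , tB , fT , fB , yt , R = build T B tT tB fT fB yt R

-- Piecewise linear curves with integral corners

module Slabs where
  open SegmentParity using (ℚ-ring; 0<*; 0≤*; 0<⊖; 0≤⊖; end₁; end∈; ∈[]-swap; ≤-cases)
  open import Data.Rational.Base using (ℚ; 0ℚ; 1ℚ; _+_; _*_) renaming (_-_ to _⊖_; _<_ to _<ᵣ_; _≤_ to _≤ᵣ_)
  import Data.Rational.Properties as ℚₚ
  import Data.Nat.Base as ℕ
  import Data.Nat.Properties as ℕₚ
  open import Tactic.RingSolver using (solve-∀)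

  abstract
    ι : ℕ → ℚ
    ι zero    = 0ℚ
    ι (suc k) = ι k + 1ℚ

    ι-step : ∀ k → ι (suc k) ≡ ι k + 1ℚ
    ι-step k = refl

  0<1 : 0ℚ <ᵣ 1ℚ
  0<1 = from-yes (0ℚ ℚₚ.<? 1ℚ)

  ι-suc : ∀ k → ι k <ᵣ ι (suc k)
  ι-suc k = subst₂ _<ᵣ_ (ℚₚ.+-identityʳ (ι k)) (sym (ι-step k)) (ℚₚ.+-monoʳ-< (ι k) 0<1)

  ι-≤ : ∀ {k l} → k ≤ l → ι k ≤ᵣ ι l
  ι-≤ {k} {l} p = go (ℕₚ.≤⇒≤′ p)
    where
    go : ∀ {l} → k ℕ.≤′ l → ι k ≤ᵣ ι l
    go ℕ.≤′-refl     = ℚₚ.≤-refl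
    go (ℕ.≤′-step {l} q) = ℚₚ.≤-trans (go q) (ℚₚ.<⇒≤ (ι-suc l))

  ι-< : ∀ {k l} → suc k ≤ l → ι k <ᵣ ι l
  ι-< {k} p = ℚₚ.<-≤-trans (ι-suc k) (ι-≤ p)

  ι-reflect : ∀ {k l} → ι k ≤ᵣ ι l → k ≤ l
  ι-reflect {k} {l} p with k ℕₚ.≤? l
  ... | yes q = q
  ... | no ¬q = ⊥-elim (ℚₚ.<-irrefl refl (ℚₚ.≤-<-trans p (ι-< (ℕₚ.≰⇒> ¬q))))

  ι-injective : ∀ {k l} → ι k ≡ ι l → k ≡ l
  ι-injective e = ℕₚ.≤-antisym (ι-reflect (ℚₚ.≤-reflexive e)) (ι-reflect (ℚₚ.≤-reflexive (sym e)))

  pt : ℕ → ℕ → Point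
  pt k h = ⟨ ι k , ι h ⟩

  abstract
    pt-injective : ∀ {k l h g} → pt k h ≡ pt l g → k ≡ l × h ≡ g
    pt-injective e = ι-injective (cong x-coord e) , ι-injective (cong y-coord e)

  clash : ∀ {k h g z} → h ≢ g → z ≡ pt k h → z ≡ pt k g → ⊥
  clash ne e e′ = ne (proj₂ (pt-injective (trans (sym e) e′)))

  record Seg (k a b : ℕ) (z : Point) : Set where
    constructor seg
    field mem : z ∈[ pt k a , pt (suc k) b ]

  module Slab {k a b : ℕ} {z : Point} (s : Seg k a b z) where
    z∈ : z ∈[ pt k a , pt (suc k) b ]
    z∈ = Seg.mem s

    t : ℚ
    t = proj₁ z∈

    0≤t : 0ℚ ≤ᵣ t
    0≤t = proj₁ (proj₂ z∈)

    t≤1 : t ≤ᵣ 1ℚ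
    t≤1 = proj₁ (proj₂ (proj₂ z∈))

    x-eq : x-coord z ≡ ι k + t
    x-eq = trans (proj₁ (proj₂ (proj₂ (proj₂ z∈)))) (trans (cong (λ u → (1ℚ ⊖ t) * ι k + t * u) (ι-step k)) (r t (ι k)))
      where
      r : ∀ t k → (1ℚ ⊖ t) * k + t * (k + 1ℚ) ≡ k + t
      r = solve-∀ ℚ-ring

    y-eq : y-coord z ≡ (1ℚ ⊖ t) * ι a + t * ι b
    y-eq = proj₂ (proj₂ (proj₂ (proj₂ z∈)))

    x-lower : ι k ≤ᵣ x-coord z
    x-lower = subst₂ _≤ᵣ_ (ℚₚ.+-identityʳ (ι k)) (sym x-eq) (ℚₚ.+-monoʳ-≤ (ι k) 0≤t)

    x-upper : x-coord z ≤ᵣ ι (suc k)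
    x-upper = subst₂ _≤ᵣ_ (sym x-eq) (sym (ι-step k)) (ℚₚ.+-monoʳ-≤ (ι k) t≤1)

    left-end : t ≡ 0ℚ → z ≡ pt k a
    left-end e = cong₂ ⟨_,_⟩ (trans x-eq (trans (cong (ι k +_) e) (ℚₚ.+-identityʳ (ι k))))
      (trans y-eq (trans (cong (λ t → (1ℚ ⊖ t) * ι a + t * ι b) e) (r (ι a) (ι b))))
      where
      r : ∀ a b → (1ℚ ⊖ 0ℚ) * a + 0ℚ * b ≡ a
      r = solve-∀ ℚ-ring

    right-end : t ≡ 1ℚ → z ≡ pt (suc k) b
    right-end e = cong₂ ⟨_,_⟩ (trans x-eq (trans (cong (ι k +_) e) (sym (ι-step k))))
      (trans y-eq (trans (cong (λ t → (1ℚ ⊖ t) * ι a + t * ι b) e) (r (ι a) (ι b))))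
      where
      r : ∀ a b → (1ℚ ⊖ 1ℚ) * a + 1ℚ * b ≡ b
      r = solve-∀ ℚ-ring

    t-eq : t ≡ x-coord z ⊖ ι k
    t-eq = trans (r (ι k) t) (cong (_⊖ ι k) (sym x-eq))
      where
      r : ∀ k t → t ≡ (k + t) ⊖ k
      r = solve-∀ ℚ-ring

    at-left : x-coord z ≤ᵣ ι k → z ≡ pt k a
    at-left p = left-end (trans t-eq (trans (cong (_⊖ ι k) (ℚₚ.≤-antisym p x-lower)) (ℚₚ.+-inverseʳ (ι k))))

    at-right : ι (suc k) ≤ᵣ x-coord z → z ≡ pt (suc k) b
    at-right p = right-end (trans t-eq (trans (cong (_⊖ ι k) (trans (ℚₚ.≤-antisym x-upper p) (ι-step k))) (r (ι k))))
      where
      r : ∀ k → (k + 1ℚ) ⊖ k ≡ 1ℚ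
      r = solve-∀ ℚ-ring

  open Slab

  module _ {k a b a′ b′ : ℕ} {z : Point} (p : Seg k a b z) (q : Seg k a′ b′ z) where

    private
      same-t : t q ≡ t p
      same-t = trans (t-eq q) (sym (t-eq p))

      gap : (1ℚ ⊖ t p) * (ι a′ ⊖ ι a) + t p * (ι b′ ⊖ ι b) ≡ 0ℚ
      gap = trans (r (t p) (ι a) (ι b) (ι a′) (ι b′))
        (trans (cong₂ _⊖_ (sym (trans (y-eq q) (cong (λ t → (1ℚ ⊖ t) * ι a′ + t * ι b′) same-t))) (sym (y-eq p))) (ℚₚ.+-inverseʳ (y-coord z)))
        where
        r : ∀ t a b c d → (1ℚ ⊖ t) * (c ⊖ a) + t * (d ⊖ b) ≡ ((1ℚ ⊖ t) * c + t * d) ⊖ ((1ℚ ⊖ t) * a + t * b)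
        r = solve-∀ ℚ-ring

      pos-sum : ∀ {u v} → 0ℚ <ᵣ u → 0ℚ ≤ᵣ v → u + v ≡ 0ℚ → ⊥
      pos-sum {u} {v} u>0 v≥0 e = ℚₚ.<-irrefl (sym e) (ℚₚ.+-mono-<-≤ u>0 v≥0)

    -- The difference of the two heights is a convex combination of its values at the ends of the
    -- slab. One value is positive and the other nonnegative, so the difference can vanish only at
    -- the right end.
    slab-right : suc a ≤ a′ → b ≤ b′ → z ≡ pt (suc k) b
    slab-right a<a′ b≤b′ = right-end p (sym (trans (sym (ℚₚ.+-identityʳ 1ℚ)) (one (≤-cases (0≤⊖ (t≤1 p))))))
      where
      one : 0ℚ ≡ 1ℚ ⊖ t p ⊎ 0ℚ <ᵣ 1ℚ ⊖ t p → 1ℚ + 0ℚ ≡ t p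
      one (inj₁ e) = trans (cong (1ℚ ⊖_) e) (r (t p))
        where
        r : ∀ t → 1ℚ ⊖ (1ℚ ⊖ t) ≡ t
        r = solve-∀ ℚ-ring
      one (inj₂ l) = ⊥-elim (pos-sum (0<* l (0<⊖ (ι-< a<a′))) (0≤* (0≤t p) (0≤⊖ (ι-≤ b≤b′))) gap)

    slab-left : a ≤ a′ → suc b ≤ b′ → z ≡ pt k a
    slab-left a≤a′ b<b′ = left-end p (zero-t (≤-cases (0≤t p)))
      where
      zero-t : 0ℚ ≡ t p ⊎ 0ℚ <ᵣ t p → t p ≡ 0ℚ
      zero-t (inj₁ e) = sym e
      zero-t (inj₂ l) = ⊥-elim (pos-sum (0<* l (0<⊖ (ι-< b<b′))) (0≤* (0≤⊖ (t≤1 p)) (0≤⊖ (ι-≤ a≤a′)))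
        (trans (ℚₚ.+-comm (t p * (ι b′ ⊖ ι b)) _) gap))

  -- The curve through the heights h ∷ hs at the levels k, k + 1, …
  On : ℕ → ℕ → List ℕ → Point → Set
  On k h []        z = ⊥
  On k h (h′ ∷ hs) z = Seg k h h′ z ⊎ On (suc k) h′ hs z

  endpoint : ℕ → ℕ → List ℕ → Point
  endpoint k h []        = pt k h
  endpoint k h (h′ ∷ hs) = endpoint (suc k) h′ hs

  on-lower : ∀ {k h} hs {z} → On k h hs z → ι k ≤ᵣ x-coord z
  on-lower (_ ∷ hs) (inj₁ p) = x-lower p
  on-lower {k} (_ ∷ hs) (inj₂ p) = ℚₚ.≤-trans (ℚₚ.<⇒≤ (ι-suc k)) (on-lower hs p)

  on-start : ∀ {k h} hs {z} → On k h hs z → x-coord z ≤ᵣ ι k → z ≡ pt k h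
  on-start (_ ∷ hs) (inj₁ p) le = at-left p le
  on-start {k} (_ ∷ hs) (inj₂ p) le = ⊥-elim (ℚₚ.<-irrefl refl (ℚₚ.<-≤-trans (ι-suc k) (ℚₚ.≤-trans (on-lower hs p) le)))

  Mono : ℕ → ℕ → ℕ → ℕ → Set
  Mono h h′ g g′ = (suc h ≤ g × h′ ≤ g′) ⊎ (suc g ≤ h × g′ ≤ h′)

  -- Curves starting at different heights of one level that meet, if at all, at
  -- a common end.
  data Apart : ℕ → List ℕ → ℕ → List ℕ → Set where
    stopˡ : ∀ {h g gs} → Apart h [] g gs
    stopʳ : ∀ {h hs g} → Apart h hs g []
    meet  : ∀ {h g m} → Mono h m g m → Apart h (m ∷ []) g (m ∷ [])
    go    : ∀ {h h′ hs g g′ gs} → Mono h h′ g g′ → h′ ≢ g′ → Apart h′ hs g′ gs → Apart h (h′ ∷ hs) g (g′ ∷ gs)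

  mono-meet : ∀ {k h h′ g g′ z} → Mono h h′ g g′ → Seg k h h′ z → Seg k g g′ z →
              z ≡ pt (suc k) h′ × z ≡ pt (suc k) g′
  mono-meet {k} {h} {h′} {g} {g′} {z} (inj₁ (l , m)) p q = e , at-right q (ℚₚ.≤-reflexive (sym (cong x-coord e)))
    where
    e : z ≡ pt (suc k) h′
    e = slab-right p q l m
  mono-meet {k} {h} {h′} {g} {g′} {z} (inj₂ (l , m)) p q = at-right p (ℚₚ.≤-reflexive (sym (cong x-coord e))) , e
    where
    e : z ≡ pt (suc k) g′
    e = slab-right q p l m

  seg-end : ∀ {k h h′ g′} gs {z} → Seg k h h′ z → On (suc k) g′ gs z → z ≡ pt (suc k) h′
  seg-end gs p q = at-right p (on-lower gs q)

  rest-start : ∀ {k h h′ g′} gs {z} → Seg k h h′ z → On (suc k) g′ gs z → z ≡ pt (suc k) g′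
  rest-start gs p q = on-start gs q (x-upper p)

  apart : ∀ {k h hs g gs z} → Apart h hs g gs → On k h hs z → On k g gs z → z ≡ endpoint k h hs × z ≡ endpoint k g gs
  apart (meet m) (inj₁ p) (inj₁ q) = mono-meet m p q
  apart (go m ne A) (inj₁ p) (inj₁ q) = ⊥-elim (clash ne (proj₁ (mono-meet m p q)) (proj₂ (mono-meet m p q)))
  apart (go {gs = gs} m ne A) (inj₁ p) (inj₂ q) = ⊥-elim (clash ne (seg-end gs p q) (rest-start gs p q))
  apart (go {hs = hs} m ne A) (inj₂ p) (inj₁ q) = ⊥-elim (clash ne (rest-start hs q p) (seg-end hs q p))
  apart (go m ne A) (inj₂ p) (inj₂ q) = apart A p q

  fork : ∀ {k h h′ hs g′ gs z} → h′ ≢ g′ → Apart h′ hs g′ gs → On k h (h′ ∷ hs) z → On k h (g′ ∷ gs) z →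
         (z ≡ pt k h) ⊎ (z ≡ endpoint k h (h′ ∷ hs) × z ≡ endpoint k h (g′ ∷ gs))
  fork {h′ = h′} {g′ = g′} ne A (inj₁ p) (inj₁ q) with ℕₚ.<-cmp h′ g′
  ... | tri< l _ _ = inj₁ (slab-left p q ℕₚ.≤-refl l)
  ... | tri≈ _ e _ = ⊥-elim (ne e)
  ... | tri> _ _ l = inj₁ (slab-left q p ℕₚ.≤-refl l)
  fork {gs = gs} ne A (inj₁ p) (inj₂ q) = ⊥-elim (clash ne (seg-end gs p q) (rest-start gs p q))
  fork {hs = hs} ne A (inj₂ p) (inj₁ q) = ⊥-elim (clash ne (rest-start hs q p) (seg-end hs q p))
  fork ne A (inj₂ p) (inj₂ q) = inj₂ (apart A p q)

  -- The first curve, from level `k`, does not start after the second, from level `l`. It is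
  -- followed by `wait` up to level `l`, where it runs apart from the second curve or ends in its
  -- starting point, unless it has ended already.
  data Rel : ℕ → ℕ → ℕ → List ℕ → ℕ → List ℕ → Set where
    here  : ∀ {k h hs g gs} → h ≢ g → Apart h hs g gs → Rel k k h hs g gs
    chain : ∀ {k h gs} → Rel k k h [] h gs
    wait  : ∀ {k l h h′ hs g gs} → Rel (suc k) l h′ hs g gs → Rel k l h (h′ ∷ hs) g gs
    gone  : ∀ {k l h g gs} → k ≤ l → Rel k l h [] g gs

  rel-≤ : ∀ {k l h hs g gs} → Rel k l h hs g gs → k ≤ l
  rel-≤ (here _ _) = ℕₚ.≤-refl
  rel-≤ chain      = ℕₚ.≤-refl
  rel-≤ (wait r)   = ℕₚ.<⇒≤ (rel-≤ r)
  rel-≤ (gone l)   = l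

  rel : ∀ {k l h hs g gs z} → Rel k l h hs g gs → On k h hs z → On l g gs z →
        z ≡ endpoint k h hs × (z ≡ pt l g ⊎ z ≡ endpoint l g gs)
  rel (here ne A) p q with apart A p q
  ... | e , e′ = e , inj₂ e′
  rel {k} {l} {gs = gs} {z} (wait {h′ = h′} {hs} r) (inj₁ p) q =
    -- A point over the first slab lies on the second curve only if that curve starts at the right
    -- border of the slab.
    cases r (ℕₚ.≤-antisym (rel-≤ r) (ι-reflect (ℚₚ.≤-trans (on-lower gs q) (x-upper p)))) q
    where
    cases : ∀ {l g gs} → Rel (suc k) l h′ hs g gs → suc k ≡ l → On l g gs z → z ≡ endpoint (suc k) h′ hs × (z ≡ pt l g ⊎ z ≡ endpoint l g gs)
    cases {gs = gs} (here ne A) refl q = ⊥-elim (clash ne (seg-end gs p q) (rest-start gs p q))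
    cases {gs = gs} chain refl q = seg-end gs p q , inj₁ (rest-start gs p q)
    cases (wait r) refl q = ⊥-elim (ℕₚ.<-irrefl refl (rel-≤ r))
    cases {gs = gs} (gone _) refl q = seg-end gs p q , inj₁ (rest-start gs p q)
  rel (wait r) (inj₂ p) q = rel r p q

  data HeightAt : ℕ → ℕ → List ℕ → ℕ → ℕ → Set where
    here  : ∀ {k h hs} → HeightAt k h hs k h
    there : ∀ {k h h′ hs l η} → HeightAt (suc k) h′ hs l η → HeightAt k h (h′ ∷ hs) l η

  height-at : ∀ {k h} hs {l η} → On k h hs (pt l η) → HeightAt k h hs l η
  height-at {k} {h} (h′ ∷ hs) {l} {η} (inj₁ p) = decide (l ℕₚ.≤? k)
    where
    at-k : l ≡ k × η ≡ h → HeightAt k h (h′ ∷ hs) l η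
    at-k (refl , refl) = here
    at-suc : l ≡ suc k × η ≡ h′ → HeightAt k h (h′ ∷ hs) l η
    at-suc (refl , refl) = there here
    decide : Dec (l ≤ k) → HeightAt k h (h′ ∷ hs) l η
    decide (yes le) = at-k (pt-injective (at-left p (ι-≤ le)))
    decide (no ¬le) = at-suc (pt-injective (at-right p (ι-≤ (ℕₚ.≰⇒> ¬le))))
  height-at (h′ ∷ hs) (inj₂ p) = there (height-at hs p)

  private variable
    p q r z : Point

  snoc : Polyline p q → ∀ r → Polyline p r
  snoc (segment p q) r = p ∷ᵖ segment q r
  snoc (p ∷ᵖ π)      r = p ∷ᵖ snoc π r

  ∈-snoc⁻ : (π : Polyline p q) → z ∈ᵖ snoc π r → z ∈ᵖ π ⊎ z ∈[ q , r ]
  ∈-snoc⁻ (segment p q) z∈        = z∈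
  ∈-snoc⁻ (p ∷ᵖ π)      (inj₁ z∈) = inj₁ (inj₁ z∈)
  ∈-snoc⁻ (p ∷ᵖ π)      (inj₂ z∈) with ∈-snoc⁻ π z∈
  ... | inj₁ w = inj₁ (inj₂ w)
  ... | inj₂ w = inj₂ w

  simple-snoc : (π : Polyline p q) → Simple π → q ≢ r → (∀ z → z ∈ᵖ π → z ∈[ q , r ] → z ≡ q) → Simple (snoc π r)
  simple-snoc (segment p q) s ne f = s , ne , λ z a b → f z a b
  simple-snoc (_∷ᵖ_ {q′} p π) (s , s′ , g) ne f =
    s , simple-snoc π s′ ne (λ z a b → f z (inj₂ a) b) ,
    λ z a b → [ g z a , (λ c → g z a (subst (_∈ᵖ π) (sym (f z (inj₁ a) c)) (end∈ π))) ]′ (∈-snoc⁻ π b)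

  -- A sweep draws an edge from its earlier to its later vertex; a drawing asks for the arc from the
  -- smaller to the larger one.
  rev : Polyline p q → Polyline q p
  rev (segment p q) = segment q p
  rev (p ∷ᵖ π)      = snoc (rev π) p

  ∈-rev⁻ : (π : Polyline p q) → z ∈ᵖ rev π → z ∈ᵖ π
  ∈-rev⁻ (segment p q) z∈ = ∈[]-swap z∈
  ∈-rev⁻ (p ∷ᵖ π) z∈ with ∈-snoc⁻ (rev π) z∈
  ... | inj₁ w = inj₂ (∈-rev⁻ π w)
  ... | inj₂ w = inj₁ (∈[]-swap w)

  simple-rev : (π : Polyline p q) → Simple π → Simple (rev π)
  simple-rev (segment p q) s = s ∘ sym
  simple-rev (p ∷ᵖ π) (s , s′ , f) = simple-snoc (rev π) (simple-rev π s′) (s ∘ sym)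
    λ z a b → f z (∈[]-swap b) (∈-rev⁻ π a)

  curve : ∀ k h h′ hs → Polyline (pt k h) (endpoint k h (h′ ∷ hs))
  curve k h h′ []        = segment _ _
  curve k h h′ (h″ ∷ hs) = pt k h ∷ᵖ curve (suc k) h′ h″ hs

  curve-on : ∀ {k h h′} hs {z} → z ∈ᵖ curve k h h′ hs → On k h (h′ ∷ hs) z
  curve-on []        z∈        = inj₁ (seg z∈)
  curve-on (h″ ∷ hs) (inj₁ z∈) = inj₁ (seg z∈)
  curve-on (h″ ∷ hs) (inj₂ z∈) = inj₂ (curve-on hs z∈)

  level-≢ : ∀ {k h h′} → pt k h ≢ pt (suc k) h′
  level-≢ e = ℕₚ.1+n≢n (sym (proj₁ (pt-injective e)))

  curve-simple : ∀ k h h′ hs → Simple (curve k h h′ hs)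
  curve-simple k h h′ []        = level-≢
  curve-simple k h h′ (h″ ∷ hs) = level-≢ , curve-simple (suc k) h′ h″ hs , λ z a b → at-right (seg a) (on-lower (h″ ∷ hs) (curve-on hs b))

-- Drawing a sweep

module Realisation where
  open Runs
  open Slabs
  import Data.Nat.Base as ℕ
  import Data.Nat.Properties as ℕₚ
  import Data.List.Membership.DecPropositional as Mem
  import Data.Fin.Base as Fin
  import Data.Fin.Properties as Finₚ

  private variable
    n : ℕ

  idx : Strand n → State n → ℕ
  idx e [] = 0
  idx e (x ∷ σ) with strand-≟ e x
  ... | yes _ = 0
  ... | no _  = suc (idx e σ)

  idx-< : {e : Strand n} {σ : State n} → e ∈ˡ σ → suc (idx e σ) ≤ length σ
  idx-< {e = e} {x ∷ σ} p with strand-≟ e x | p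
  ... | yes _ | _         = s≤s z≤n
  ... | no ne | here refl = ⊥-elim (ne refl)
  ... | no _  | there q   = s≤s (idx-< q)

  idx-++ˡ : {e : Strand n} (σ : State n) {τ : State n} → e ∈ˡ σ → idx e (σ ++ τ) ≡ idx e σ
  idx-++ˡ {e = e} (x ∷ σ) p with strand-≟ e x | p
  ... | yes _ | _         = refl
  ... | no ne | here refl = ⊥-elim (ne refl)
  ... | no _  | there q   = cong suc (idx-++ˡ σ q)

  idx-++ʳ : {e : Strand n} (σ : State n) {τ : State n} → e ∉ˡ σ → idx e (σ ++ τ) ≡ length σ ℕ.+ idx e τ
  idx-++ʳ [] _ = refl
  idx-++ʳ {e = e} (x ∷ σ) e∉ with strand-≟ e x
  ... | yes refl = ⊥-elim (e∉ (here refl))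
  ... | no _     = cong suc (idx-++ʳ σ (e∉ ∘ there))

  idx-injective : {e f : Strand n} {σ : State n} → e ∈ˡ σ → f ∈ˡ σ → idx e σ ≡ idx f σ → e ≡ f
  idx-injective {e = e} {f} {x ∷ σ} p q eq with strand-≟ e x | strand-≟ f x
  ... | yes refl | yes refl = refl
  idx-injective {e = e} {f} {x ∷ σ} p q () | yes _ | no _
  idx-injective {e = e} {f} {x ∷ σ} p q () | no _ | yes _
  idx-injective {e = e} {f} {x ∷ σ} (here refl) q eq | no ne | no _ = ⊥-elim (ne refl)
  idx-injective {e = e} {f} {x ∷ σ} (there p) (here refl) eq | no _ | no ne = ⊥-elim (ne refl)
  idx-injective {e = e} {f} {x ∷ σ} (there p) (there q) eq | no _ | no _ = idx-injective p q (ℕₚ.suc-injective eq)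

  -- The position after the m items from position p on have been merged into one.
  collapse : ℕ → ℕ → ℕ → ℕ
  collapse p m i with i ℕₚ.<? p | i ℕₚ.<? p ℕ.+ m
  ... | yes _ | _     = i
  ... | no _  | yes _ = p
  ... | no _  | no _  = suc (i ℕ.∸ m)

  Mid : ℕ → ℕ → ℕ → Set
  Mid p m i = p ≤ i × suc i ≤ p ℕ.+ m

  module _ {p m : ℕ} where

    high-≤ : ∀ {i} → p ℕ.+ m ≤ i → p ≤ i ℕ.∸ m
    high-≤ {i} le = subst (_≤ i ℕ.∸ m) (ℕₚ.m+n∸n≡m p m) (ℕₚ.∸-monoˡ-≤ m le)

    collapse-low : ∀ {i} → suc i ≤ p → collapse p m i ≡ i
    collapse-low {i} l with i ℕₚ.<? p | i ℕₚ.<? p ℕ.+ m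
    ... | yes _ | _ = refl
    ... | no ¬l | _ = ⊥-elim (¬l l)

    collapse-mid : ∀ {i} → Mid p m i → collapse p m i ≡ p
    collapse-mid {i} (a , b) with i ℕₚ.<? p | i ℕₚ.<? p ℕ.+ m
    ... | yes l | _     = ⊥-elim (ℕₚ.<⇒≱ l a)
    ... | no _  | yes _ = refl
    ... | no _  | no ¬b = ⊥-elim (¬b b)

    collapse-high : ∀ k → collapse p m (p ℕ.+ (m ℕ.+ k)) ≡ suc (p ℕ.+ k)
    collapse-high k with (p ℕ.+ (m ℕ.+ k)) ℕₚ.<? p | (p ℕ.+ (m ℕ.+ k)) ℕₚ.<? p ℕ.+ m
    ... | yes l | _     = ⊥-elim (ℕₚ.<⇒≱ l (ℕₚ.m≤m+n p _))
    ... | no _  | yes l = ⊥-elim (ℕₚ.<⇒≱ l (ℕₚ.+-monoʳ-≤ p (ℕₚ.m≤m+n m k)))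
    ... | no _  | no _  = cong suc (trans (cong (ℕ._∸ m) (trans (cong (p ℕ.+_) (ℕₚ.+-comm m k)) (sym (ℕₚ.+-assoc p k m)))) (ℕₚ.m+n∸n≡m (p ℕ.+ k) m))

    collapse-mono : ∀ {i j} → i ≤ j → collapse p m i ≤ collapse p m j
    collapse-mono {i} {j} i≤j with i ℕₚ.<? p | i ℕₚ.<? p ℕ.+ m | j ℕₚ.<? p | j ℕₚ.<? p ℕ.+ m
    ... | yes _ | _ | yes _ | _ = i≤j
    ... | yes a | _ | no _ | yes _ = ℕₚ.<⇒≤ a
    ... | yes a | _ | no _ | no d = ℕₚ.≤-trans (ℕₚ.<⇒≤ a) (ℕₚ.m≤n⇒m≤1+n (high-≤ (ℕₚ.≮⇒≥ d)))
    ... | no a | _ | yes c | _ = ⊥-elim (a (ℕₚ.≤-<-trans i≤j c))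
    ... | no _ | yes _ | no _ | yes _ = ℕₚ.≤-refl
    ... | no _ | yes _ | no _ | no d = ℕₚ.m≤n⇒m≤1+n (high-≤ (ℕₚ.≮⇒≥ d))
    ... | no _ | no b | no _ | yes d = ⊥-elim (b (ℕₚ.≤-<-trans i≤j d))
    ... | no _ | no _ | no _ | no _ = s≤s (ℕₚ.∸-monoˡ-≤ m i≤j)

    collapse-strict : ∀ {i j} → suc i ≤ j → ¬ (Mid p m i × Mid p m j) → suc (collapse p m i) ≤ collapse p m j
    collapse-strict {i} {j} i<j ¬mid with i ℕₚ.<? p | i ℕₚ.<? p ℕ.+ m | j ℕₚ.<? p | j ℕₚ.<? p ℕ.+ m
    ... | yes _ | _ | yes _ | _ = i<j
    ... | yes a | _ | no _ | yes _ = a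
    ... | yes a | _ | no _ | no d = s≤s (ℕₚ.≤-trans (ℕₚ.<⇒≤ a) (high-≤ (ℕₚ.≮⇒≥ d)))
    ... | no a | _ | yes c | _ = ⊥-elim (a (ℕₚ.<-trans i<j c))
    ... | no a | yes b | no c | yes d = ⊥-elim (¬mid ((ℕₚ.≮⇒≥ a , b) , ℕₚ.≮⇒≥ c , d))
    ... | no _ | yes _ | no _ | no d = s≤s (high-≤ (ℕₚ.≮⇒≥ d))
    ... | no _ | no b | no _ | yes d = ⊥-elim (b (ℕₚ.<-trans i<j d))
    ... | no _ | no b | no _ | no d = s≤s (ℕₚ.∸-monoˡ-< i<j (ℕₚ.≤-trans (ℕₚ.m≤n+m m p) (ℕₚ.≮⇒≥ b)))

    collapse-≢ : ∀ {i j} → i ≢ j → ¬ (Mid p m i × Mid p m j) → collapse p m i ≢ collapse p m j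
    collapse-≢ {i} {j} ne ¬mid e with ℕₚ.<-cmp i j
    ... | tri< l _ _ = ℕₚ.<⇒≢ (collapse-strict l ¬mid) e
    ... | tri≈ _ e′ _ = ne e′
    ... | tri> _ _ g = ℕₚ.<⇒≢ (collapse-strict g λ (a , b) → ¬mid (b , a)) (sym e)

    collapse-miss : ∀ {i} → ¬ Mid p m i → collapse p m i ≢ p
    collapse-miss {i} ¬mid with i ℕₚ.<? p | i ℕₚ.<? p ℕ.+ m
    ... | yes l | _     = ℕₚ.<⇒≢ l
    ... | no ¬l | yes l = λ _ → ¬mid (ℕₚ.≮⇒≥ ¬l , l)
    ... | no _  | no ¬l = λ e → ℕₚ.<⇒≢ (s≤s (high-≤ (ℕₚ.≮⇒≥ ¬l))) (sym e)

    mono-in : ∀ {i j} → i ≢ j → Mono i (collapse p m i) j (collapse p m j)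
    mono-in {i} {j} ne with ℕₚ.<-cmp i j
    ... | tri< l _ _ = inj₁ (l , collapse-mono (ℕₚ.<⇒≤ l))
    ... | tri≈ _ e _ = ⊥-elim (ne e)
    ... | tri> _ _ g = inj₂ (g , collapse-mono (ℕₚ.<⇒≤ g))

    mono-out : ∀ {i j} → i ≢ j → ¬ (Mid p m i × Mid p m j) → Mono (collapse p m i) i (collapse p m j) j
    mono-out {i} {j} ne ¬mid with ℕₚ.<-cmp i j
    ... | tri< l _ _ = inj₁ (collapse-strict l ¬mid , ℕₚ.<⇒≤ l)
    ... | tri≈ _ e _ = ⊥-elim (ne e)
    ... | tri> _ _ g = inj₂ (collapse-strict g (λ (a , b) → ¬mid (b , a)) , ℕₚ.<⇒≤ g)

  module _ {e : Strand n} (pre ins post : State n) where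

    idx-mid⁺ : e ∉ˡ pre → e ∈ˡ ins → Mid (length pre) (length ins) (idx e (pre ++ ins ++ post))
    idx-mid⁺ ∉pre ∈ins rewrite idx-++ʳ pre {ins ++ post} ∉pre | idx-++ˡ ins {post} ∈ins =
      ℕₚ.m≤m+n _ _ , ℕₚ.+-monoʳ-< (length pre) (idx-< ∈ins)

    idx-mid⁻ : Mid (length pre) (length ins) (idx e (pre ++ ins ++ post)) → e ∈ˡ ins
    idx-mid⁻ (a , b) with Mem._∈?_ strand-≟ e pre
    ... | yes ∈pre rewrite idx-++ˡ pre {ins ++ post} ∈pre = ⊥-elim (ℕₚ.<⇒≱ (idx-< ∈pre) a)
    ... | no ∉pre rewrite idx-++ʳ pre {ins ++ post} ∉pre with Mem._∈?_ strand-≟ e ins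
    ... | yes ∈ins = ∈ins
    ... | no ∉ins rewrite idx-++ʳ ins {post} ∉ins =
      ⊥-elim (ℕₚ.<⇒≱ (ℕₚ.+-cancelˡ-< (length pre) _ _ b) (ℕₚ.m≤m+n _ _))

  -- The height of a passing strand at the level of the vertex comes out the same from the state
  -- before and from the state after, so order can be compared in both adjacent slabs.
  collapse-pass : {e : Strand n} (pre ins outs post : State n) → e ∉ˡ ins → e ∉ˡ outs →
    collapse (length pre) (length ins) (idx e (pre ++ ins ++ post)) ≡ collapse (length pre) (length outs) (idx e (pre ++ outs ++ post))
  collapse-pass {e = e} pre ins outs post ∉ins ∉outs with Mem._∈?_ strand-≟ e pre
  ... | yes ∈pre rewrite idx-++ˡ pre {ins ++ post} ∈pre | idx-++ˡ pre {outs ++ post} ∈pre =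
    trans (collapse-low (idx-< ∈pre)) (sym (collapse-low (idx-< ∈pre)))
  ... | no ∉pre rewrite idx-++ʳ pre {ins ++ post} ∉pre | idx-++ʳ pre {outs ++ post} ∉pre | idx-++ʳ ins {post} ∉ins | idx-++ʳ outs {post} ∉outs =
    trans (collapse-high {length pre} {length ins} _) (sym (collapse-high {length pre} {length outs} _))

  module _ {n : ℕ} where

    private variable
      Q : Rule n
      ρ vs : List (Fin n)
      σ τ : State n

    -- Heights of a strand of the first state, after that state: at the vertices
    -- (odd levels) and at the states (even levels) up to its target.
    tail : Run Q ρ σ vs τ → Strand n → List ℕ
    tail done e = []
    tail {σ = σ} (event {v} pre ins outs post _ _ _ _ R) e with proj₂ e ≟ᶠ v
    ... | yes _ = length pre ∷ []
    ... | no _  = collapse (length pre) (length ins) (idx e σ) ∷ idx e (pre ++ outs ++ post) ∷ tail R e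

    level : ℕ → Run Q ρ σ vs τ → Fin n → ℕ
    level k done w = suc k
    level k (event {v} pre ins outs post _ _ _ _ R) w with w ≟ᶠ v
    ... | yes _ = suc k
    ... | no _  = level (suc (suc k)) R w

    height : Run Q ρ σ vs τ → Fin n → ℕ
    height done w = 0
    height (event {v} pre ins outs post _ _ _ _ R) w with w ≟ᶠ v
    ... | yes _ = length pre
    ... | no _  = height R w

    -- Heights of an emitted strand after its source.
    out₀ : Run Q ρ σ vs τ → Strand n → ℕ
    out₀ done f = 0
    out₀ (event {v} pre ins outs post _ _ _ _ R) f with proj₁ f ≟ᶠ v
    ... | yes _ = idx f (pre ++ outs ++ post)
    ... | no _  = out₀ R f

    out₁ : Run Q ρ σ vs τ → Strand n → List ℕ
    out₁ done f = []
    out₁ (event {v} pre ins outs post _ _ _ _ R) f with proj₁ f ≟ᶠ v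
    ... | yes _ = tail R f
    ... | no _  = out₁ R f

    -- The clause `proj₁ f ≢ v` ties a strand to the first event of its source, which is where
    -- `level`, `out₀` and `out₁` look it up.
    Emits : Run Q ρ σ vs τ → Strand n → Set
    Emits done _ = ⊥
    Emits (event {v} _ _ outs _ _ _ _ _ R) f = f ∈ˡ outs ⊎ (proj₁ f ≢ v × Emits R f)

    level-≥ : ∀ k (R : Run Q ρ σ vs τ) w → suc k ≤ level k R w
    level-≥ k done w = ℕₚ.≤-refl
    level-≥ k (event {v} pre ins outs post _ _ _ _ R) w with w ≟ᶠ v
    ... | yes _ = ℕₚ.≤-refl
    ... | no _  = ℕₚ.≤-trans (ℕₚ.n≤1+n _) (ℕₚ.≤-trans (ℕₚ.n≤1+n _) (level-≥ (suc (suc k)) R w))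

    level-injective : ∀ k (R : Run Q ρ σ vs τ) {u w} → u ∈ˡ vs → w ∈ˡ vs → level k R u ≡ level k R w → u ≡ w
    level-injective k (event {v} pre ins outs post _ _ _ _ R) {u} {w} u∈ w∈ e with u ≟ᶠ v | w ≟ᶠ v
    ... | yes refl | yes refl = refl
    ... | yes _    | no _ = ⊥-elim (ℕₚ.<-irrefl e (ℕₚ.≤-trans (ℕₚ.n≤1+n _) (level-≥ (suc (suc k)) R w)))
    ... | no _     | yes _ = ⊥-elim (ℕₚ.<-irrefl (sym e) (ℕₚ.≤-trans (ℕₚ.n≤1+n _) (level-≥ (suc (suc k)) R u)))
    level-injective k (event _ _ _ _ _ _ _ _ R) (here refl) w∈ e | no ne | no _ = ⊥-elim (ne refl)
    level-injective k (event _ _ _ _ _ _ _ _ R) (there _) (here refl) e | no _ | no ne = ⊥-elim (ne refl)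
    level-injective k (event _ _ _ _ _ _ _ _ R) (there u∈) (there w∈) e | no _ | no _ = level-injective (suc (suc k)) R u∈ w∈ e

    height-at-≤ : ∀ {k h hs l η} → HeightAt k h hs l η → k ≤ l
    height-at-≤ here      = ℕₚ.≤-refl
    height-at-≤ (there p) = ℕₚ.<⇒≤ (height-at-≤ p)

    Past : State n → List (Fin n) → Set
    Past σ vs = ∀ {e} → e ∈ˡ σ → proj₁ e ∉ˡ vs

    module Event {v : Fin n} {vs : List (Fin n)} (pre ins outs post : State n)
      (i : All (To v) ins) (o : All (From v) outs) (v∉ : v ∉ˡ vs) (past : Past (pre ++ ins ++ post) (v ∷ vs))
      (R : Run Q ρ (pre ++ outs ++ post) vs []) where

      p = length pre
      σ₀ = pre ++ ins ++ post
      σ₁ = pre ++ outs ++ post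

      past′ : Past σ₁ vs
      past′ e∈ with ∈-++⁻ pre e∈
      ... | inj₁ q = past (∈-++⁺ˡ q) ∘ there
      ... | inj₂ q with ∈-++⁻ outs q
      ... | inj₁ r = λ s → v∉ (subst (_∈ˡ vs) (all-∈ o r) s)
      ... | inj₂ r = past (∈-++⁺ʳ pre (∈-++⁺ʳ ins r)) ∘ there

      not-out : ∀ {e} → e ∈ˡ σ₀ → e ∉ˡ outs
      not-out e∈ r = past e∈ (here (all-∈ o r))

      not-pre : ∀ {e} → proj₂ e ≡ v → e ∈ˡ pre ⊎ e ∈ˡ post → ⊥
      not-pre refl = no-target pre outs post v∉ R refl

      out-not-pre : ∀ {e} → e ∈ˡ outs → e ∉ˡ pre
      out-not-pre r q = past (∈-++⁺ˡ q) (here (all-∈ o r))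

      passes : ∀ {e} → e ∈ˡ σ₀ → proj₂ e ≢ v → e ∈ˡ σ₁
      passes e∈ ne with ∈-++⁻ pre e∈
      ... | inj₁ q = ∈-++⁺ˡ q
      ... | inj₂ q with ∈-++⁻ ins q
      ... | inj₁ r = ⊥-elim (ne (all-∈ i r))
      ... | inj₂ r = ∈-++⁺ʳ pre (∈-++⁺ʳ outs r)

      emitted : ∀ {f} → f ∈ˡ outs → f ∈ˡ σ₁
      emitted r = ∈-++⁺ʳ pre (∈-++⁺ˡ r)

      is-in : ∀ {e} → e ∈ˡ σ₀ → proj₂ e ≡ v → e ∈ˡ ins
      is-in e∈ t with ∈-++⁻ pre e∈
      ... | inj₁ q = ⊥-elim (not-pre t (inj₁ q))
      ... | inj₂ q with ∈-++⁻ ins q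
      ... | inj₁ r = r
      ... | inj₂ r = ⊥-elim (not-pre t (inj₂ r))

      low : Strand n → ℕ
      low e = collapse p (length ins) (idx e σ₀)

      low-hit : ∀ {e} → e ∈ˡ σ₀ → proj₂ e ≡ v → low e ≡ p
      low-hit e∈ t = collapse-mid (idx-mid⁺ pre ins post (λ q → not-pre t (inj₁ q)) (is-in e∈ t))

      not-mid : ∀ {e} → proj₂ e ≢ v → ¬ Mid p (length ins) (idx e σ₀)
      not-mid ne mid = ne (all-∈ i (idx-mid⁻ pre ins post mid))

      low-out : ∀ {e} → e ∈ˡ σ₀ → proj₂ e ≢ v → low e ≡ collapse p (length outs) (idx e σ₁)
      low-out e∈ ne = collapse-pass pre ins outs post (λ r → ne (all-∈ i r)) (not-out e∈)

      not-mid-out : ∀ {e} → e ∈ˡ σ₀ → ¬ Mid p (length outs) (idx e σ₁)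
      not-mid-out e∈ mid = not-out e∈ (idx-mid⁻ pre outs post mid)

      emit-mid : ∀ {f} → f ∈ˡ outs → collapse p (length outs) (idx f σ₁) ≡ p
      emit-mid r = collapse-mid (idx-mid⁺ pre outs post (out-not-pre r) r)

      low-≢ : ∀ {e} → e ∈ˡ σ₀ → proj₂ e ≢ v → low e ≢ p
      low-≢ e∈ ne = collapse-miss (not-mid ne)

    -- Towards a vertex the order of the strands is kept, and only those ending there come together
    -- (`mono-in`); behind it the passing strands keep their strict order (`mono-out`).
    strands-apart : (R : Run Q ρ σ vs []) → Unique vs → Past σ vs → ∀ {e e′} → e ∈ˡ σ → e′ ∈ˡ σ → e ≢ e′ →
                    Apart (idx e σ) (tail R e) (idx e′ σ) (tail R e′)
    strands-apart (event {v} pre ins outs post refl i o q R) (u ∷ us) past {e} {e′} e∈ e′∈ ne with proj₂ e ≟ᶠ v | proj₂ e′ ≟ᶠ v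
    ... | yes t | yes t′ = meet (subst₂ (λ a b → Mono (idx e E.σ₀) a (idx e′ E.σ₀) b) (E.low-hit e∈ t) (E.low-hit e′∈ t′) (mono-in {E.p} {length ins} i≢j))
      where
      module E = Event pre ins outs post i o (∉-all u) past R
      i≢j = ne ∘ idx-injective e∈ e′∈
    ... | yes t | no ¬t′ = go (subst (λ a → Mono (idx e E.σ₀) a (idx e′ E.σ₀) (E.low e′)) (E.low-hit e∈ t) (mono-in {E.p} {length ins} (ne ∘ idx-injective e∈ e′∈)))
        (E.low-≢ e′∈ ¬t′ ∘ sym) stopˡ
      where module E = Event pre ins outs post i o (∉-all u) past R
    ... | no ¬t | yes t′ = go (subst (λ a → Mono (idx e E.σ₀) (E.low e) (idx e′ E.σ₀) a) (E.low-hit e′∈ t′) (mono-in {E.p} {length ins} (ne ∘ idx-injective e∈ e′∈)))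
        (E.low-≢ e∈ ¬t) stopʳ
      where module E = Event pre ins outs post i o (∉-all u) past R
    ... | no ¬t | no ¬t′ = go (mono-in {E.p} {length ins} i≢j) (collapse-≢ i≢j λ (m , _) → E.not-mid ¬t m)
        (go (subst₂ (λ a b → Mono a (idx e E.σ₁) b (idx e′ E.σ₁)) (sym (E.low-out e∈ ¬t)) (sym (E.low-out e′∈ ¬t′)) (mono-out i′≢j′ λ (m , _) → E.not-mid-out e∈ m))
          i′≢j′ (strands-apart R us E.past′ (E.passes e∈ ¬t) (E.passes e′∈ ¬t′) ne))
      where
      module E = Event pre ins outs post i o (∉-all u) past R
      i≢j = ne ∘ idx-injective e∈ e′∈
      i′≢j′ = ne ∘ idx-injective (E.passes e∈ ¬t) (E.passes e′∈ ¬t′)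

    strand-emitted : ∀ k (R : Run Q ρ σ vs []) → Unique vs → Past σ vs → ∀ {e f} → e ∈ˡ σ → Emits R f →
      Rel k (level k R (proj₁ f)) (idx e σ) (tail R e) (height R (proj₁ f)) (out₀ R f ∷ out₁ R f)
    strand-emitted k (event {v} pre ins outs post refl i o q R) (u ∷ us) past {e} {f} e∈ em with proj₂ e ≟ᶠ v | proj₁ f ≟ᶠ v | em
    ... | _ | no ne | inj₁ f∈ = ⊥-elim (ne (all-∈ o f∈))
    ... | _ | yes s | inj₂ (ne , _) = ⊥-elim (ne s)
    ... | yes t | yes s | inj₁ f∈ = wait chain
    ... | no ¬t | yes s | inj₁ f∈ = wait (here (E.low-≢ e∈ ¬t)
          (go (subst₂ (λ a b → Mono a (idx e E.σ₁) b (idx f E.σ₁)) (sym (E.low-out e∈ ¬t)) (E.emit-mid f∈) (mono-out ne λ (m , _) → E.not-mid-out e∈ m))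
            ne (strands-apart R us E.past′ (E.passes e∈ ¬t) (E.emitted f∈) e≢f)))
      where
      module E = Event pre ins outs post i o (∉-all u) past R
      e≢f : e ≢ f
      e≢f refl = E.not-out e∈ f∈
      ne = e≢f ∘ idx-injective (E.passes e∈ ¬t) (E.emitted f∈)
    ... | yes t | no _ | inj₂ (_ , em′) = wait (gone (ℕₚ.≤-trans (ℕₚ.n≤1+n _) (ℕₚ.≤-trans (ℕₚ.n≤1+n _) (level-≥ (suc (suc k)) R (proj₁ f)))))
    ... | no ¬t | no _ | inj₂ (_ , em′) = wait (wait (strand-emitted (suc (suc k)) R us E.past′ (E.passes e∈ ¬t) em′))
      where module E = Event pre ins outs post i o (∉-all u) past R

    data Pair (l : ℕ) (h : ℕ) (hs : List ℕ) (l′ : ℕ) (g : ℕ) (gs : List ℕ) : Set where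
      forked : ∀ {h′ hs′ g′ gs′} → l ≡ l′ → h ≡ g → hs ≡ h′ ∷ hs′ → gs ≡ g′ ∷ gs′ → h′ ≢ g′ → Apart h′ hs′ g′ gs′ → Pair l h hs l′ g gs
      first  : Rel l l′ h hs g gs → Pair l h hs l′ g gs
      second : Rel l′ l g gs h hs → Pair l h hs l′ g gs

    -- Edges with a common source fork there. Otherwise one of them is emitted earlier and is
    -- treated as a strand of the state that follows, so `strand-emitted` applies.
    emitted-pair : ∀ k (R : Run Q ρ σ vs []) → Unique vs → Past σ vs → ∀ {f g} → Emits R f → Emits R g → f ≢ g →
      Pair (level k R (proj₁ f)) (height R (proj₁ f)) (out₀ R f ∷ out₁ R f) (level k R (proj₁ g)) (height R (proj₁ g)) (out₀ R g ∷ out₁ R g)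
    emitted-pair k (event {v} pre ins outs post refl i o q R) (u ∷ us) past {f} {g} em em′ ne with proj₁ f ≟ᶠ v | proj₁ g ≟ᶠ v | em | em′
    ... | no ¬s | _ | inj₁ f∈ | _ = ⊥-elim (¬s (all-∈ o f∈))
    ... | yes s | _ | inj₂ (¬s , _) | _ = ⊥-elim (¬s s)
    ... | _ | no ¬s | _ | inj₁ g∈ = ⊥-elim (¬s (all-∈ o g∈))
    ... | _ | yes s | _ | inj₂ (¬s , _) = ⊥-elim (¬s s)
    ... | yes _ | yes _ | inj₁ f∈ | inj₁ g∈ = forked refl refl refl refl (ne ∘ idx-injective (E.emitted f∈) (E.emitted g∈))
          (strands-apart R us E.past′ (E.emitted f∈) (E.emitted g∈) ne)
      where module E = Event pre ins outs post i o (∉-all u) past R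
    ... | yes _ | no _ | inj₁ f∈ | inj₂ (_ , e′) = first (wait (strand-emitted (suc (suc k)) R us E.past′ (E.emitted f∈) e′))
      where module E = Event pre ins outs post i o (∉-all u) past R
    ... | no _ | yes _ | inj₂ (_ , e) | inj₁ g∈ = second (wait (strand-emitted (suc (suc k)) R us E.past′ (E.emitted g∈) e))
      where module E = Event pre ins outs post i o (∉-all u) past R
    ... | no _ | no _ | inj₂ (_ , e) | inj₂ (_ , e′) = emitted-pair (suc (suc k)) R us E.past′ e e′ ne
      where module E = Event pre ins outs post i o (∉-all u) past R

    too-low : ∀ {k h hs l η} → HeightAt k h hs l η → suc l ≤ k → ⊥
    too-low p lt = ℕₚ.<⇒≱ lt (height-at-≤ p)

    skip : ∀ {k h h′ hs l η} → HeightAt k h (h′ ∷ hs) l η → suc k ≤ l → HeightAt (suc k) h′ hs l η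
    skip here      lt = ⊥-elim (ℕₚ.<-irrefl refl lt)
    skip (there p) _  = p

    at-once : ∀ {k h hs η} → HeightAt k h hs k η → h ≡ η
    at-once here      = refl
    at-once (there p) = ⊥-elim (too-low p ℕₚ.≤-refl)

    ended : ∀ {k h l η} → HeightAt k h [] l η → suc k ≤ l → ⊥
    ended here lt = ℕₚ.<-irrefl refl lt

    strand-vertex : ∀ k (R : Run Q ρ σ vs []) → Unique vs → Past σ vs → ∀ {e w} → e ∈ˡ σ → w ∈ˡ vs →
      HeightAt k (idx e σ) (tail R e) (level k R w) (height R w) → w ≡ proj₂ e
    strand-vertex k (event {v} pre ins outs post refl i o q R) (u ∷ us) past {e} {w} e∈ w∈ p with w ≟ᶠ v | proj₂ e ≟ᶠ v | w∈
    ... | yes refl | yes t | _ = sym t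
    ... | yes refl | no ¬t | _ = ⊥-elim (E.low-≢ e∈ ¬t (at-once (skip p ℕₚ.≤-refl)))
      where module E = Event pre ins outs post i o (∉-all u) past R
    ... | no w≢v | _ | here eq = ⊥-elim (w≢v eq)
    ... | no w≢v | yes t | there _ = ⊥-elim (ended (skip p (ℕₚ.<⇒≤ (ℕₚ.<⇒≤ (level-≥ (suc (suc k)) R w)))) (ℕₚ.<⇒≤ (level-≥ (suc (suc k)) R w)))
    ... | no w≢v | no ¬t | there w∈′ = strand-vertex (suc (suc k)) R us E.past′ (E.passes e∈ ¬t) w∈′
        (skip (skip p (ℕₚ.<⇒≤ (ℕₚ.<⇒≤ (level-≥ (suc (suc k)) R w)))) (ℕₚ.<⇒≤ (level-≥ (suc (suc k)) R w)))
      where module E = Event pre ins outs post i o (∉-all u) past R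

    emitted-vertex : ∀ k (R : Run Q ρ σ vs []) → Unique vs → Past σ vs → ∀ {f w} → Emits R f → w ∈ˡ vs →
      HeightAt (level k R (proj₁ f)) (height R (proj₁ f)) (out₀ R f ∷ out₁ R f) (level k R w) (height R w) → w ≡ proj₁ f ⊎ w ≡ proj₂ f
    emitted-vertex k (event {v} pre ins outs post refl i o q R) (u ∷ us) past {f} {w} em w∈ p with proj₁ f ≟ᶠ v | w ≟ᶠ v | em | w∈
    ... | no ¬s | _ | inj₁ f∈ | _ = ⊥-elim (¬s (all-∈ o f∈))
    ... | yes s | _ | inj₂ (¬s , _) | _ = ⊥-elim (¬s s)
    ... | yes refl | yes refl | inj₁ _ | _ = inj₁ refl
    ... | _ | no w≢v | _ | here eq = ⊥-elim (w≢v eq)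
    ... | yes refl | no w≢v | inj₁ f∈ | there w∈′ = inj₂ (strand-vertex (suc (suc k)) R us E.past′ (E.emitted f∈) w∈′ (skip p (ℕₚ.<⇒≤ (level-≥ (suc (suc k)) R w))))
      where
      module E = Event pre ins outs post i o (∉-all u) past R
    ... | no _ | yes refl | inj₂ (_ , em′) | _ = ⊥-elim (too-low p (ℕₚ.≤-trans (ℕₚ.n≤1+n _) (level-≥ (suc (suc k)) R (proj₁ f))))
    ... | no _ | no _ | inj₂ (_ , em′) | there w∈′ = emitted-vertex (suc (suc k)) R us E.past′ em′ w∈′ p
      where module E = Event pre ins outs post i o (∉-all u) past R

    strand-end : ∀ k (R : Run Q ρ σ vs []) → ∀ {e} → e ∈ˡ σ → Past σ vs → Unique vs →
                 endpoint k (idx e σ) (tail R e) ≡ pt (level k R (proj₂ e)) (height R (proj₂ e))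
    strand-end k (event {v} pre ins outs post refl i o q R) {e} e∈ past (u ∷ us) with proj₂ e ≟ᶠ v
    ... | yes _ = refl
    ... | no ¬t = strand-end (suc (suc k)) R (E.passes e∈ ¬t) E.past′ us
      where module E = Event pre ins outs post i o (∉-all u) past R

    emit-target : (R : Run Q ρ σ vs []) → ∀ {f} → Emits R f → proj₂ f ∈ˡ vs
    emit-target (event pre ins outs post _ _ _ _ R) (inj₁ f∈)     = there (targets R (∈-++⁺ʳ pre (∈-++⁺ˡ f∈)))
    emit-target (event _ _ _ _ _ _ _ _ R)          (inj₂ (_ , em)) = there (emit-target R em)

    emitted-end : ∀ k (R : Run Q ρ σ vs []) → ∀ {f} → Emits R f → Past σ vs → Unique vs → proj₁ f ≢ proj₂ f →
                  endpoint (level k R (proj₁ f)) (height R (proj₁ f)) (out₀ R f ∷ out₁ R f) ≡ pt (level k R (proj₂ f)) (height R (proj₂ f))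
    emitted-end k (event {v} pre ins outs post refl i o q R) {f} em past (u ∷ us) ne with proj₁ f ≟ᶠ v | proj₂ f ≟ᶠ v | em
    ... | no ¬s | _ | inj₁ f∈ = ⊥-elim (¬s (all-∈ o f∈))
    ... | yes s | _ | inj₂ (¬s , _) = ⊥-elim (¬s s)
    ... | yes s | yes t | inj₁ _ = ⊥-elim (ne (trans s (sym t)))
    ... | yes s | no ¬t | inj₁ f∈ = strand-end (suc (suc k)) R (E.emitted f∈) E.past′ us
      where module E = Event pre ins outs post i o (∉-all u) past R
    ... | no ¬s | yes t | inj₂ (_ , em′) = ⊥-elim (∉-all u (subst (_∈ˡ _) t (emit-target R em′)))
    ... | no ¬s | no ¬t | inj₂ (_ , em′) = emitted-end (suc (suc k)) R em′ E.past′ us ne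
      where module E = Event pre ins outs post i o (∉-all u) past R

    emits-edge : {G : Graph n} (R : Run (Complete G) [] σ vs []) → ∀ {u w} → u ∈ˡ vs → w ∈ˡ vs → Adj G u w → Emits R (u , w) ⊎ Emits R (w , u)
    emits-edge {G = G} (event {v} {vs} pre ins outs post _ i o q R) {u} {w} u∈ w∈ a with u ≟ᶠ v | w ≟ᶠ v | u∈ | w∈
    ... | yes refl | yes refl | _ | _ = ⊥-elim (adj-irrefl G refl a)
    ... | yes refl | no ne | _ | here e = ⊥-elim (ne e)
    ... | yes refl | no _ | _ | there w∈′ = inj₁ (inj₁ (q (∈-++⁺ˡ w∈′) a))
    ... | no ne | yes refl | here e | _ = ⊥-elim (ne e)
    ... | no _ | yes refl | there u∈′ | _ = inj₂ (inj₁ (q (∈-++⁺ˡ u∈′) (adj-sym G a)))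
    ... | no ne | no _ | here e | _ = ⊥-elim (ne e)
    ... | no _ | no ne | there _ | here e = ⊥-elim (ne e)
    ... | no u≢ | no w≢ | there u∈′ | there w∈′ with emits-edge {G = G} R u∈′ w∈′ a
    ... | inj₁ e = inj₁ (inj₂ (u≢ , e))
    ... | inj₂ e = inj₂ (inj₂ (w≢ , e))

  subst-∈ : {p q q′ : Point} (e : q ≡ q′) {π : Polyline p q} {z : Point} → z ∈ᵖ subst (Polyline p) e π → z ∈ᵖ π
  subst-∈ refl z∈ = z∈

  subst-simple : {p q q′ : Point} (e : q ≡ q′) {π : Polyline p q} → Simple π → Simple (subst (Polyline p) e π)
  subst-simple refl s = s

  module Realise {G : Graph n} {vs : List (Fin n)} (uniq : Unique vs) (every : ∀ v → v ∈ˡ vs) (R : Run (Complete G) [] [] vs []) where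

    pos : Fin n → Point
    pos v = pt (level 0 R v) (height R v)

    private
      no-past : Past [] vs
      no-past ()

      module Arc {u w : Fin n} (em : Emits R (u , w)) (u≢w : u ≢ w) where
        l = level 0 R u
        h = height R u
        h′ = out₀ R (u , w)
        hs = out₁ R (u , w)
        end : endpoint l h (h′ ∷ hs) ≡ pos w
        end = emitted-end 0 R em no-past uniq u≢w
        arc : Polyline (pos u) (pos w)
        arc = subst (Polyline (pos u)) end (curve l h h′ hs)
        simple : Simple arc
        simple = subst-simple end (curve-simple l h h′ hs)
        on : ∀ {z} → z ∈ᵖ arc → On l h (h′ ∷ hs) z
        on z∈ = curve-on hs (subst-∈ end z∈)
        vertex : ∀ w′ → On l h (h′ ∷ hs) (pos w′) → w′ ≡ u ⊎ w′ ≡ w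
        vertex w′ p = emitted-vertex 0 R uniq no-past em (every w′) (height-at (h′ ∷ hs) p)

      common : ∀ {u w u′ w′} (em : Emits R (u , w)) (em′ : Emits R (u′ , w′)) (ne : u ≢ w) (ne′ : u′ ≢ w′) → (u , w) ≢ (u′ , w′) → ∀ {z} →
               On (Arc.l em ne) (Arc.h em ne) (Arc.h′ em ne ∷ Arc.hs em ne) z →
               On (Arc.l em′ ne′) (Arc.h em′ ne′) (Arc.h′ em′ ne′ ∷ Arc.hs em′ ne′) z → z ≡ pos u ⊎ z ≡ pos w
      common {u} {w} {u′} {w′} em em′ ne ne′ diff {z} p q = cases (emitted-pair 0 R uniq no-past em em′ diff) p q
        where
        at-end : z ≡ endpoint (level 0 R u) (height R u) (out₀ R (u , w) ∷ out₁ R (u , w)) → z ≡ pos u ⊎ z ≡ pos w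
        at-end e = inj₂ (trans e (Arc.end em ne))
        cases : Pair (level 0 R u) (height R u) (out₀ R (u , w) ∷ out₁ R (u , w)) (level 0 R u′) (height R u′) (out₀ R (u′ , w′) ∷ out₁ R (u′ , w′)) →
                On (level 0 R u) (height R u) (out₀ R (u , w) ∷ out₁ R (u , w)) z →
                On (level 0 R u′) (height R u′) (out₀ R (u′ , w′) ∷ out₁ R (u′ , w′)) z → z ≡ pos u ⊎ z ≡ pos w
        cases (forked e e′ refl refl h≢g A) p q = [ inj₁ , at-end ∘ proj₁ ]′ (fork h≢g A p (subst₂ (λ l h → On l h (out₀ R (u′ , w′) ∷ out₁ R (u′ , w′)) z) (sym e) (sym e′) q))
        cases (first r) p q = at-end (proj₁ (rel r p q))
        cases (second r) p q = [ inj₁ , at-end ]′ (proj₂ (rel r q p))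

      Drawn : Fin n → Fin n → Set
      Drawn u w = (Emits R (u , w) ⊎ Emits R (w , u)) × u ≢ w

      drawn : ∀ {u w} → Adj G u w → Drawn u w
      drawn a = emits-edge {G = G} R (every _) (every _) a , λ { refl → adj-irrefl G refl a }

      draw : ∀ {u w} → Drawn u w → Polyline (pos u) (pos w)
      draw (inj₁ em , ne) = Arc.arc em ne
      draw (inj₂ em , ne) = rev (Arc.arc em (ne ∘ sym))

      arc′ : ∀ u w → Polyline (pos u) (pos w)
      arc′ u w with adj? G u w
      ... | yes a = draw (drawn a)
      ... | no _  = segment (pos u) (pos w)

      Adj-arc : ∀ {u w} → Adj G u w → ∃ λ (d : Drawn u w) → arc′ u w ≡ draw d
      Adj-arc {u} {w} a with adj? G u w
      ... | yes a′ = drawn a′ , refl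
      ... | no ¬a  = ⊥-elim (¬a a)

      draw-simple : ∀ {u w} (d : Drawn u w) → Simple (draw d)
      draw-simple (inj₁ em , ne) = Arc.simple em ne
      draw-simple (inj₂ em , ne) = simple-rev (Arc.arc em (ne ∘ sym)) (Arc.simple em (ne ∘ sym))

      draw-vertex : ∀ {u w} (d : Drawn u w) → ∀ v → pos v ∈ᵖ draw d → v ≡ u ⊎ v ≡ w
      draw-vertex (inj₁ em , ne) v p = Arc.vertex em ne v (Arc.on em ne p)
      draw-vertex (inj₂ em , ne) v p with Arc.vertex em (ne ∘ sym) v (Arc.on em (ne ∘ sym) (∈-rev⁻ (Arc.arc em (ne ∘ sym)) p))
      ... | inj₁ e = inj₂ e
      ... | inj₂ e = inj₁ e

      flip : {A B : Set} → A ⊎ B → B ⊎ A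
      flip = [ inj₂ , inj₁ ]′

      draw-common : ∀ {u w u′ w′} → u Fin.< w → u′ Fin.< w′ → (d : Drawn u w) (d′ : Drawn u′ w′) → (u , w) ≢ (u′ , w′) →
                    ∀ z → z ∈ᵖ draw d → z ∈ᵖ draw d′ → z ≡ pos u ⊎ z ≡ pos w
      draw-common l l′ (inj₁ em , ne) (inj₁ em′ , ne′) diff z p q = common em em′ ne ne′ diff (Arc.on em ne p) (Arc.on em′ ne′ q)
      draw-common l l′ (inj₁ em , ne) (inj₂ em′ , ne′) diff z p q =
        common em em′ ne (ne′ ∘ sym) (λ { refl → Finₚ.<-asym l l′ }) (Arc.on em ne p) (Arc.on em′ (ne′ ∘ sym) (∈-rev⁻ (Arc.arc em′ (ne′ ∘ sym)) q))
      draw-common l l′ (inj₂ em , ne) (inj₁ em′ , ne′) diff z p q = flip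
        (common em em′ (ne ∘ sym) ne′ (λ { refl → Finₚ.<-asym l l′ }) (Arc.on em (ne ∘ sym) (∈-rev⁻ (Arc.arc em (ne ∘ sym)) p)) (Arc.on em′ ne′ q))
      draw-common l l′ (inj₂ em , ne) (inj₂ em′ , ne′) diff z p q = flip
        (common em em′ (ne ∘ sym) (ne′ ∘ sym) (λ { refl → diff refl }) (Arc.on em (ne ∘ sym) (∈-rev⁻ (Arc.arc em (ne ∘ sym)) p))
          (Arc.on em′ (ne′ ∘ sym) (∈-rev⁻ (Arc.arc em′ (ne′ ∘ sym)) q)))

    planar : Planar G
    planar = record
      { pos = pos
      ; pos-injective = λ {u} {w} e → level-injective 0 R (every u) (every w) (proj₁ (pt-injective e))
      ; arc = arc′
      ; arc-simple = λ (_ , a) → let (d , e) = Adj-arc a in subst Simple (sym e) (draw-simple d)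
      ; arc-vertex = λ (_ , a) w p → let (d , e) = Adj-arc a in draw-vertex d w (subst (pos w ∈ᵖ_) e p)
      ; arc-arc = λ (l , a) (l′ , a′) diff z p q →
          let (d , e) = Adj-arc a ; (d′ , e′) = Adj-arc a′ in
          draw-common l l′ d d′ diff z (subst (z ∈ᵖ_) e p) (subst (z ∈ᵖ_) e′ q) }

-- Sweeps with prescribed ends

module Diagrams where
  open Models
  open Runs
  open Labellings
  open Splitting
  import Data.List.Properties as Listₚ
  import Data.List.Relation.Unary.All.Properties as Allₚ
  import Data.List.Membership.Propositional.Properties as ∈ₚ
  import Data.List.Relation.Unary.Any.Properties as Anyₚ

  private variable
    n : ℕ

  -- The first and the last vertex of a sweep lie on its outer face. Hence an edge between them can
  -- be added (`top-edge`), and the whole sweep can take the place of a strand between them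
  -- (`Substitute`).
  record Diagram (K : Graph n) (U : Subset n) (s t : Fin n) : Set where
    field
      vs    : List (Fin n)
      first : ∃ λ r → vs ≡ s ∷ r
      last  : Last t vs
      uniq  : Unique vs
      mem⁺  : ∀ {v} → v ∈ˢ U → v ∈ˡ vs
      mem⁻  : ∀ {v} → v ∈ˡ vs → v ∈ˢ U
      run   : Run (Complete K) [] [] vs []

  drop-nil : {A : Set} {x : A} (xs : List A) → x ∈ˡ xs ++ [] → x ∈ˡ xs
  drop-nil xs p = [ id , (λ ()) ]′ (∈-++⁻ xs p)

  last-snoc : {A : Set} {t : A} {vs : List A} → Last t vs → ∃ λ r → vs ≡ r ++ t ∷ []
  last-snoc one = [] , refl
  last-snoc (more {x} l) with last-snoc l
  ... | r , refl = x ∷ r , refl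

  last-tail : {A : Set} {s t : A} {r : List A} → s ≢ t → Last t (s ∷ r) → Last t r
  last-tail ne one      = ⊥-elim (ne refl)
  last-tail ne (more l) = l

  module _ {n : ℕ} where
    private variable
      K K′ : Graph n
      U    : Subset n
      s t  : Fin n

    diagram-mono : (∀ {a b} → a ∈ˢ U → b ∈ˢ U → Adj K′ a b → Adj K a b) → Diagram K U s t → Diagram K′ U s t
    diagram-mono {K′ = K′} {K = K} f D = record
      { vs = vs ; first = first ; last = last ; uniq = uniq ; mem⁺ = mem⁺ ; mem⁻ = mem⁻
      ; run = run-map {Q = Complete K} {Q′ = Complete K′}
          (λ {v} {us} v∈ us⊆ c w∈ a → c w∈ (f (mem⁻ v∈) (mem⁻ (us⊆ (drop-nil us w∈))) a)) run }
      where open Diagram D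

    diagram-reverse : Diagram K U s t → Diagram K U t s
    diagram-reverse {K = K} {s = s} {t = t} D = record
      { vs = reverse vs
      ; first = let (r , e) = last-snoc last in reverse r , trans (cong reverse e) (Listₚ.reverse-++ r (t ∷ []))
      ; last = let (r , e) = first in subst (Last s) (sym (trans (cong reverse e) (Listₚ.unfold-reverse s r))) (last-++ (reverse r) one)
      ; uniq = uniq-reverse uniq ; mem⁺ = Anyₚ.reverse⁺ ∘ mem⁺ ; mem⁻ = mem⁻ ∘ Anyₚ.reverse⁻
      ; run = reverse-run {G = K} [] uniq (λ ()) run }
      where open Diagram D

    first-event : ∀ {Q : Rule n} {ρ r} → Run Q ρ [] (s ∷ r) [] → ∃ λ outs → All (From s) outs × Q s (r ++ ρ) outs × Run Q ρ outs r []
    first-event {Q = Q} {ρ} {r} (event [] [] outs [] refl i o q R) =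
      outs , o , q , subst (λ σ → Run Q ρ σ r []) (Listₚ.++-identityʳ outs) R
    first-event (event [] [] outs (_ ∷ _) () i o q R)
    first-event (event [] (_ ∷ _) outs post () i o q R)
    first-event (event (_ ∷ _) ins outs post () i o q R)

    top-edge : s ≢ t → (∀ {a b} → a ∈ˢ U → b ∈ˢ U → Adj K′ a b → Adj K a b ⊎ SamePair a b s t) → Diagram K U s t → Diagram K′ U s t
    top-edge {s = s} {t = t} {K′ = K′} {K = K} s≢t f D = go vs first last uniq mem⁺ mem⁻ run
      where
      open Diagram D
      go : ∀ vs → (∃ λ r → vs ≡ s ∷ r) → Last t vs → Unique vs → (∀ {v} → v ∈ˢ _ → v ∈ˡ vs) → (∀ {v} → v ∈ˡ vs → v ∈ˢ _) → Run (Complete K) [] [] vs [] → Diagram K′ _ s t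
      go _ (r , refl) l (p ∷ u) m⁺ m⁻ R with first-event R
      ... | outs , o , q , S = record { vs = s ∷ r ; first = r , refl ; last = l ; uniq = p ∷ u ; mem⁺ = m⁺ ; mem⁻ = m⁻
        ; run = event [] [] ((s , t) ∷ outs) [] refl [] (refl ∷ o) compl
            (add-ends ((s , t) ∷ []) [] (refl ∷ []) [] (last-tail s≢t l) (run-map {Q = Complete K} {Q′ = Complete K′} conv S)) }
        where
        s∉ : s ∉ˡ r
        s∉ = ∉-all p
        compl : Complete K′ s (r ++ []) ((s , t) ∷ outs)
        compl w∈ a with f (m⁻ (here refl)) (m⁻ (there (drop-nil r w∈))) a
        ... | inj₁ b = there (q w∈ b)
        ... | inj₂ (inj₁ (_ , refl)) = here refl
        ... | inj₂ (inj₂ (e , _)) = ⊥-elim (s≢t e)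
        conv : ∀ {v us outs} → v ∈ˡ r → (∀ {w} → w ∈ˡ us → w ∈ˡ r) → Complete K v (us ++ []) outs → Complete K′ v (us ++ []) outs
        conv {us = us} v∈ us⊆ c w∈ a with f (m⁻ (there v∈)) (m⁻ (there (us⊆ (drop-nil us w∈)))) a
        ... | inj₁ b = c w∈ b
        ... | inj₂ (inj₁ (refl , _)) = ⊥-elim (s∉ v∈)
        ... | inj₂ (inj₂ (_ , refl)) = ⊥-elim (s∉ (us⊆ (drop-nil us w∈)))

    -- An isolated vertex can be swept after all the others, whichever `w` was last among them.
    append-isolated : t ∈ˢ U → s ≢ t → (∀ {v} → v ∈ˢ U → ¬ Adj K v t) → ∀ {w} → Diagram K (U - t) s w → Diagram K U s t
    append-isolated {t = t} {U = U} {K = K} t∈ s≢t iso D = record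
      { vs = vs ++ t ∷ [] ; first = let (r , e) = first in r ++ t ∷ [] , cong (_++ t ∷ []) e ; last = last-++ vs one
      ; uniq = uniq-++⁺ uniq ([] ∷ []) λ { p (here refl) → ∉-minus (mem⁻ p) refl }
      ; mem⁺ = m⁺ ; mem⁻ = λ p → [ ∈─ ∘ mem⁻ , (λ { (here refl) → t∈ }) ]′ (∈-++⁻ vs p)
      ; run = run-map {Q = Complete K} {Q′ = Complete K} conv run ⊕ event [] [] [] [] refl [] [] (λ ()) done }
      where
      open Diagram D
      m⁺ : ∀ {v} → v ∈ˢ U → v ∈ˡ vs ++ t ∷ []
      m⁺ {v} v∈ with v ≟ᶠ t
      ... | yes refl = ∈-++⁺ʳ vs (here refl)
      ... | no ne    = ∈-++⁺ˡ (mem⁺ (x∈p∧x≢y⇒x∈p-y v∈ ne))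
      conv : ∀ {v us outs} → v ∈ˡ vs → (∀ {w} → w ∈ˡ us → w ∈ˡ vs) → Complete K v (us ++ []) outs → Complete K v (us ++ t ∷ []) outs
      conv {us = us} v∈ us⊆ c w∈ a with ∈-++⁻ us w∈
      ... | inj₁ p = c (∈-++⁺ˡ p) a
      ... | inj₂ (here refl) = ⊥-elim (iso (∈─ (mem⁻ v∈)) a)

    -- A diagram drawn from p to q replaces the strand p q of another diagram.
    module Substitute {K₁ K₂ H : Graph n} {U₁ U₂ C : Subset n} {p q : Fin n} (p≢q : p ≢ q)
      (D₁ : Diagram K₁ U₁ s t) (D₂ : Diagram K₂ U₂ p q) (p∈ : p ∈ˢ U₁) (q∈ : q ∈ˢ U₁) (pq : Adj K₁ p q)
      (C⊆U₂ : ∀ {v} → v ∈ˢ C → v ∈ˢ U₂) (U₂⊆ : ∀ {v} → v ∈ˢ U₂ → v ∈ˢ C ⊎ v ≡ p ⊎ v ≡ q) (C∩U₁ : ∀ {v} → v ∈ˢ C → v ∈ˢ U₁ → ⊥)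
      (adj₁ : ∀ {a b} → a ∈ˢ U₁ → b ∈ˢ U₁ → Adj H a b → Adj K₁ a b) (adj₂ : ∀ {a b} → a ∈ˢ U₂ → b ∈ˢ U₂ → Adj H a b → Adj K₂ a b)
      (closed : ∀ {a b} → a ∈ˢ C → b ∈ˢ U₁ → Adj H a b → b ≡ p ⊎ b ≡ q) where

      open Diagram D₁ renaming (vs to vs₁; first to first₁; last to last₁; uniq to uniq₁; mem⁺ to mem⁺₁; mem⁻ to mem⁻₁; run to run₁)
      open Diagram D₂ using () renaming (vs to vs₂; first to first₂; last to last₂; uniq to uniq₂; mem⁺ to mem⁺₂; mem⁻ to mem⁻₂; run to run₂)
      open At (locate (mem⁺₁ p∈) run₁) renaming (before to α; after to β)

      private
        mid : p ∉ˡ α × p ∉ˡ β × (∀ {w} → w ∈ˡ α → w ∈ˡ β → ⊥)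
        mid = uniq-mid α (subst Unique split-vs uniq₁)
        in-α : ∀ {v} → v ∈ˡ α → v ∈ˢ U₁
        in-α v∈ = mem⁻₁ (subst (_ ∈ˡ_) (sym split-vs) (∈-++⁺ˡ v∈))
        in-β : ∀ {v} → v ∈ˡ β → v ∈ˢ U₁
        in-β v∈ = mem⁻₁ (subst (_ ∈ˡ_) (sym split-vs) (∈-++⁺ʳ α (there v∈)))

        -- The events of `p` and `q` are cut off. As `q` comes last, every strand that is left
        -- before its event leads to it.
        inner-run : ∃₂ λ ws outs → ∃ λ τ → vs₂ ≡ p ∷ ws ++ q ∷ [] × All (From p) outs × Complete K₂ p (ws ++ q ∷ []) outs ×
                    Run (Complete K₂) (q ∷ []) outs ws τ × All (To q) τ
        inner-run = go vs₂ first₂ last₂ uniq₂ run₂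
          where
          go : ∀ vs → (∃ λ r → vs ≡ p ∷ r) → Last q vs → Unique vs → Run (Complete K₂) [] [] vs [] →
               ∃₂ λ ws outs → ∃ λ τ → vs ≡ p ∷ ws ++ q ∷ [] × All (From p) outs × Complete K₂ p (ws ++ q ∷ []) outs ×
               Run (Complete K₂) (q ∷ []) outs ws τ × All (To q) τ
          go _ (r , refl) l (_ ∷ u) R with first-event R
          ... | outs , o , c , S with last-tail p≢q l
          ... | l′ = _ , outs , _ , cong (p ∷_) eq , o , subst (λ k → Complete K₂ p k outs) (trans (Listₚ.++-identityʳ r) eq) c ,
              subst₂ (λ k σ → Run (Complete K₂) k outs A.before σ) rest-eq ends A.prefix , A.ins-to
            where
            module A = At (locate (last-∈ l′) S)
            no-after : A.after ≡ []
            no-after with A.after | A.split-vs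
            ... | [] | _ = refl
            ... | x ∷ a | e = ⊥-elim (proj₁ (proj₂ (uniq-mid A.before (subst Unique e u)))
                (last-∈ (last-tail′ (last-suffix A.before (subst (Last q) e l′)) )))
              where
              last-tail′ : ∀ {x a} → Last q (q ∷ x ∷ a) → Last q (x ∷ a)
              last-tail′ (more l) = l
            rest-eq : q ∷ A.after ++ [] ≡ q ∷ []
            rest-eq = cong (λ a → q ∷ a ++ []) no-after
            eq : r ≡ A.before ++ q ∷ []
            eq = trans A.split-vs (cong (λ a → A.before ++ q ∷ a) no-after)
            ends : A.pre ++ A.ins ++ A.post ≡ A.ins
            ends = let (e₁ , e₃) = nothing A.after no-after A.suffix in trans (cong₂ (λ a b → a ++ A.ins ++ b) e₁ e₃) (Listₚ.++-identityʳ A.ins)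
              where
              nothing : ∀ a → a ≡ [] → Run (Complete K₂) [] (A.pre ++ A.outs ++ A.post) a [] → A.pre ≡ [] × A.post ≡ []
              nothing _ refl T = split A.pre A.outs A.post (end T)
                where
                end : ∀ {σ} → Run (Complete K₂) [] σ [] [] → σ ≡ []
                end done = refl
                split : ∀ (x y z : State n) → x ++ y ++ z ≡ [] → x ≡ [] × z ≡ []
                split [] [] [] _ = refl , refl

      substitute : q ∈ˡ β → ∀ {U} → (∀ {v} → v ∈ˢ U → v ∈ˢ U₁ ⊎ v ∈ˢ C) → (∀ {v} → v ∈ˢ U₁ → v ∈ˢ U) → (∀ {v} → v ∈ˢ C → v ∈ˢ U) → Diagram H U s t
      substitute q∈β {U} U⊆ U₁⊆U C⊆U with inner-run
      -- In place of the strand from `p` to `q`, between `o₁` and `o₃`, the event of `p` emits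
      -- `outs₂`. The inner vertices `ws` are swept at once, and the remaining strands `τ` follow
      -- the course of the replaced strand to `q`, as `exp-q` expresses.
      ... | ws , outs₂ , τ , e₂ , o₂ , c₂ , R₂ , τ-to with ∈ₚ.∈-∃++ (rule (∈-++⁺ˡ q∈β) pq)
      ... | o₁ , o₃ , eo = record
        { vs = α ++ p ∷ ws ++ β ; first = fst ; last = lst ; uniq = uq ; mem⁺ = m⁺ ; mem⁻ = m⁻
        ; run = run-map {Q = Complete K₁} {Q′ = Complete H} conv-α prefix ⊕
            event pre ins (o₁ ++ outs₂ ++ o₃) post refl ins-to from-p compl-p
              (subst (λ σ → Run (Complete H) [] σ (ws ++ β) []) (shift outs₂)
                (frame (pre ++ o₁) (o₃ ++ post) (run-map {Q = Complete K₂} {Q′ = Complete H} conv-ws R₂) ⊕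
                  subst (λ σ → Run (Complete H) [] σ β []) (sym (shift τ)) tail-run)) }
        where
        shift : ∀ m → (pre ++ o₁) ++ m ++ o₃ ++ post ≡ pre ++ (o₁ ++ m ++ o₃) ++ post
        shift m = sym (focus₂ pre o₁ m o₃ post)
        from-p : All (From p) (o₁ ++ outs₂ ++ o₃)
        from-p = let (a , b) = Allₚ.++⁻ o₁ (subst (All (From p)) eo outs-from) in Allₚ.++⁺ a (Allₚ.++⁺ o₂ (case b of λ { (_ ∷ b′) → b′ }))
        exp-q : Exp (pre ++ (o₁ ++ (p , q) ∷ o₃) ++ post) (pre ++ (o₁ ++ τ ++ o₃) ++ post)
        exp-q = exp-++ (exp-refl pre) (exp-++ (exp-++ (exp-refl o₁) (τ-to ∷ exp-refl o₃)) (exp-refl post))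
        tail-run : Run (Complete H) [] (pre ++ (o₁ ++ τ ++ o₃) ++ post) β []
        tail-run = reroute {Q = Complete K₁} {Q′ = Complete H}
          (λ {v} {us} {os} v∈ us⊆ o c → os , exp-refl os , o , λ w∈ a → c w∈ (adj₁ (in-β v∈) (in-β (us⊆ (drop-nil us w∈))) a))
          (subst (λ o → Run (Complete K₁) [] (pre ++ o ++ post) β []) eo suffix) exp-q
        in-ws₂ : ∀ {v} → v ∈ˡ ws → v ∈ˢ U₂
        in-ws₂ v∈ = mem⁻₂ (subst (_ ∈ˡ_) (sym e₂) (there (∈-++⁺ˡ v∈)))
        uniq-pws : Unique (p ∷ ws ++ q ∷ [])
        uniq-pws = subst Unique e₂ uniq₂
        p∉ws : p ∉ˡ ws
        p∉ws v∈ = case uniq-pws of λ { (a ∷ _) → ∉-all a (∈-++⁺ˡ v∈) }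
        q∉ws : q ∉ˡ ws
        q∉ws v∈ = case uniq-pws of λ { (_ ∷ u) → proj₁ (uniq-mid ws u) v∈ }
        in-ws : ∀ {v} → v ∈ˡ ws → v ∈ˢ C
        in-ws v∈ with U₂⊆ (in-ws₂ v∈)
        ... | inj₁ c = c
        ... | inj₂ (inj₁ refl) = ⊥-elim (p∉ws v∈)
        ... | inj₂ (inj₂ refl) = ⊥-elim (q∉ws v∈)
        conv-α : ∀ {v us outs} → v ∈ˡ α → (∀ {w} → w ∈ˡ us → w ∈ˡ α) → Complete K₁ v (us ++ p ∷ β ++ []) outs →
                 Complete H v (us ++ p ∷ (ws ++ β) ++ []) outs
        conv-α {v} {us} v∈ us⊆ c {w} w∈ a with ∈-++⁻ us w∈
        ... | inj₁ r = c (∈-++⁺ˡ r) (adj₁ (in-α v∈) (in-α (us⊆ r)) a)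
        ... | inj₂ (here refl) = c (∈-++⁺ʳ us (here refl)) (adj₁ (in-α v∈) p∈ a)
        ... | inj₂ (there r) with ∈-++⁻ ws (drop-nil (ws ++ β) r)
        ... | inj₂ b = c (∈-++⁺ʳ us (there (∈-++⁺ˡ b))) (adj₁ (in-α v∈) (in-β b) a)
        ... | inj₁ b with closed (in-ws b) (in-α v∈) (adj-sym H a)
        ... | inj₁ refl = ⊥-elim (proj₁ mid v∈)
        ... | inj₂ refl = ⊥-elim (proj₂ (proj₂ mid) v∈ q∈β)
        compl-p : Complete H p ((ws ++ β) ++ []) (o₁ ++ outs₂ ++ o₃)
        compl-p {w} w∈ a with ∈-++⁻ ws (drop-nil (ws ++ β) w∈)
        ... | inj₁ r = ∈-++⁺ʳ o₁ (∈-++⁺ˡ (c₂ (∈-++⁺ˡ r) (adj₂ (mem⁻₂ (subst (p ∈ˡ_) (sym e₂) (here refl))) (in-ws₂ r) a)))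
        ... | inj₂ r with ∈-++⁻ o₁ (subst (_ ∈ˡ_) eo (rule (∈-++⁺ˡ r) (adj₁ p∈ (in-β r) a)))
        ... | inj₁ b = ∈-++⁺ˡ b
        ... | inj₂ (there b) = ∈-++⁺ʳ o₁ (∈-++⁺ʳ outs₂ b)
        ... | inj₂ (here refl) = ∈-++⁺ʳ o₁ (∈-++⁺ˡ (c₂ (∈-++⁺ʳ ws (here refl))
              (adj₂ (mem⁻₂ (subst (p ∈ˡ_) (sym e₂) (here refl))) (mem⁻₂ (subst (q ∈ˡ_) (sym e₂) (there (∈-++⁺ʳ ws (here refl))))) a)))
        conv-ws : ∀ {v us outs} → v ∈ˡ ws → (∀ {w} → w ∈ˡ us → w ∈ˡ ws) → Complete K₂ v (us ++ q ∷ []) outs → Complete H v (us ++ β ++ []) outs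
        conv-ws {v} {us} v∈ us⊆ c {w} w∈ a with ∈-++⁻ us w∈
        ... | inj₁ r = c (∈-++⁺ˡ r) (adj₂ (in-ws₂ v∈) (in-ws₂ (us⊆ r)) a)
        ... | inj₂ r with closed (in-ws v∈) (in-β (drop-nil β r)) a
        ... | inj₁ refl = ⊥-elim (proj₁ (proj₂ mid) (drop-nil β r))
        ... | inj₂ refl = c (∈-++⁺ʳ us (here refl)) (adj₂ (in-ws₂ v∈) (mem⁻₂ (subst (q ∈ˡ_) (sym e₂) (there (∈-++⁺ʳ ws (here refl))))) a)
        fst : ∃ λ r → α ++ p ∷ ws ++ β ≡ s ∷ r
        fst = go α (trans (sym (proj₂ first₁)) split-vs)
          where
          go : ∀ α → s ∷ proj₁ first₁ ≡ α ++ p ∷ β → ∃ λ r → α ++ p ∷ ws ++ β ≡ s ∷ r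
          go [] refl = ws ++ β , refl
          go (_ ∷ α) refl = α ++ p ∷ ws ++ β , refl
        lst : Last t (α ++ p ∷ ws ++ β)
        lst = last-++ α (more (last-++ ws (go β q∈β (last-suffix α (subst (Last t) split-vs last₁)))))
          where
          go : ∀ β → q ∈ˡ β → Last t (p ∷ β) → Last t β
          go (_ ∷ _) _ (more l) = l
        uα : Unique α
        uα = proj₁ (uniq-++⁻ α (subst Unique split-vs uniq₁))
        uβ : Unique β
        uβ = case proj₁ (proj₂ (uniq-++⁻ α (subst Unique split-vs uniq₁))) of λ { (_ ∷ u) → u }
        uw : Unique ws
        uw = case uniq-pws of λ { (_ ∷ u) → proj₁ (uniq-++⁻ ws u) }
        uq : Unique (α ++ p ∷ ws ++ β)
        uq = uniq-++⁺ uα (∈-all _ (λ { r refl → [ p∉ws , proj₁ (proj₂ mid) ]′ (∈-++⁻ ws r) }) ∷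
            uniq-++⁺ uw uβ (λ a b → C∩U₁ (in-ws a) (in-β b)))
          λ { a (here refl) → proj₁ mid a
            ; a (there b) → [ (λ c → C∩U₁ (in-ws c) (in-α a)) , proj₂ (proj₂ mid) a ]′ (∈-++⁻ ws b) }
        m⁺ : ∀ {v} → v ∈ˢ U → v ∈ˡ α ++ p ∷ ws ++ β
        m⁺ {v} v∈ with U⊆ v∈
        ... | inj₁ a = insert (∈-++⁻ α (subst (v ∈ˡ_) split-vs (mem⁺₁ a)))
          where
          insert : v ∈ˡ α ⊎ v ∈ˡ p ∷ β → v ∈ˡ α ++ p ∷ ws ++ β
          insert (inj₁ b) = ∈-++⁺ˡ b
          insert (inj₂ (here e)) = ∈-++⁺ʳ α (here e)
          insert (inj₂ (there b)) = ∈-++⁺ʳ α (there (∈-++⁺ʳ ws b))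
        ... | inj₂ c = ∈-++⁺ʳ α (pick (subst (v ∈ˡ_) e₂ (mem⁺₂ (C⊆U₂ c))))
          where
          pick : v ∈ˡ p ∷ ws ++ q ∷ [] → v ∈ˡ p ∷ ws ++ β
          pick (here e) = here e
          pick (there b) with ∈-++⁻ ws b
          ... | inj₁ d = there (∈-++⁺ˡ d)
          ... | inj₂ (here refl) = ⊥-elim (C∩U₁ c q∈)
        m⁻ : ∀ {v} → v ∈ˡ α ++ p ∷ ws ++ β → v ∈ˢ U
        m⁻ {v} v∈ with ∈-++⁻ α v∈
        ... | inj₁ a = U₁⊆U (in-α a)
        ... | inj₂ (here refl) = U₁⊆U p∈
        ... | inj₂ (there b) with ∈-++⁻ ws b
        ... | inj₁ d = C⊆U (in-ws d)
        ... | inj₂ d = U₁⊆U (in-β d)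

    -- Which of `p` and `q` the host sweeps first is not known beforehand, so the guest is supplied
    -- in both directions.
    substitute : ∀ {K₁ K₂ K₃ H : Graph n} {U₁ U₂ C : Subset n} {p q} → p ≢ q → Diagram K₁ U₁ s t → Diagram K₂ U₂ p q → Diagram K₃ U₂ q p →
      p ∈ˢ U₁ → q ∈ˢ U₁ → Adj K₁ p q → (∀ {v} → v ∈ˢ C → v ∈ˢ U₂) → (∀ {v} → v ∈ˢ U₂ → v ∈ˢ C ⊎ v ≡ p ⊎ v ≡ q) → (∀ {v} → v ∈ˢ C → v ∈ˢ U₁ → ⊥) →
      (∀ {a b} → a ∈ˢ U₁ → b ∈ˢ U₁ → Adj H a b → Adj K₁ a b) → (∀ {a b} → a ∈ˢ U₂ → b ∈ˢ U₂ → Adj H a b → Adj K₂ a b × Adj K₃ a b) →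
      (∀ {a b} → a ∈ˢ C → b ∈ˢ U₁ → Adj H a b → b ≡ p ⊎ b ≡ q) →
      (∀ {v} → v ∈ˢ U → v ∈ˢ U₁ ⊎ v ∈ˢ C) → (∀ {v} → v ∈ˢ U₁ → v ∈ˢ U) → (∀ {v} → v ∈ˢ C → v ∈ˢ U) → Diagram H U s t
    substitute {K₁ = K₁} {p = p} {q} p≢q D₁ D₂ D₃ p∈ q∈ pq C⊆ U₂⊆ C∩ adj₁ adj₂ closed U⊆ U₁⊆ C⊆U = go (∈-++⁻ α (subst (q ∈ˡ_) split-vs (Diagram.mem⁺ D₁ q∈)))
      where
      open At (locate (Diagram.mem⁺ D₁ p∈) (Diagram.run D₁)) using (split-vs) renaming (before to α; after to β)
      module A′ = At (locate (Diagram.mem⁺ D₁ q∈) (Diagram.run D₁))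
      swap⊎ : ∀ {A B : Set} → A ⊎ B → B ⊎ A
      swap⊎ = [ inj₂ , inj₁ ]′
      go : q ∈ˡ α ⊎ q ∈ˡ p ∷ β → Diagram _ _ _ _
      go (inj₂ (here e)) = ⊥-elim (p≢q (sym e))
      go (inj₂ (there q∈β)) = Substitute.substitute p≢q D₁ D₂ p∈ q∈ pq C⊆ U₂⊆ C∩ adj₁ (λ a b e → proj₁ (adj₂ a b e)) closed q∈β U⊆ U₁⊆ C⊆U
      go (inj₁ q∈α) = Substitute.substitute (p≢q ∘ sym) D₁ D₃ q∈ p∈ (adj-sym K₁ pq) C⊆ (λ v∈ → [ inj₁ , inj₂ ∘ swap⊎ ]′ (U₂⊆ v∈)) C∩ adj₁
          (λ a b e → proj₂ (adj₂ a b e)) (λ a b e → swap⊎ (closed a b e)) p-after U⊆ U₁⊆ C⊆U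
        where
        p-after : p ∈ˡ A′.after
        p-after with two-splits α A′.before (trans (sym split-vs) A′.split-vs)
        ... | inj₁ (_ , r) = r
        ... | inj₂ (inj₂ (e , _)) = ⊥-elim (p≢q e)
        ... | inj₂ (inj₁ (_ , q∈β)) = ⊥-elim (proj₂ (proj₂ (uniq-mid α (subst Unique split-vs (Diagram.uniq D₁)))) q∈α q∈β)

-- Undoing a contraction

module Uncontraction where
  open Models
  open EdgeLoss
  open Connectivity
  open Runs
  open Crossings
  open Labellings
  open Splitting
  open Diagrams
  import Data.List.Properties as Listₚ
  import Data.List.Membership.Propositional.Properties as ∈ₚ
  import Data.List.Relation.Unary.Any.Properties as Anyₚ
  open import Data.List.Relation.Binary.Sublist.Propositional using () renaming (_⊆_ to _⊆ˡ_; lookup to ⊆ˡ-lookup)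

  private variable
    n : ℕ

  sources : {Q : Rule n} {ρ : List (Fin n)} {σ τ : State n} {vs : List (Fin n)} → Run Q ρ σ vs τ → ∀ {e} → e ∈ˡ τ → e ∈ˡ σ ⊎ proj₁ e ∈ˡ vs
  sources done e∈ = inj₁ e∈
  sources (event pre ins outs post refl i o q R) e∈ with sources R e∈
  ... | inj₂ p = inj₂ (there p)
  ... | inj₁ p with ∈-++⁻ pre p
  ... | inj₁ r = inj₁ (∈-++⁺ˡ r)
  ... | inj₂ r with ∈-++⁻ outs r
  ... | inj₁ r′ = inj₂ (here (all-∈ o r′))
  ... | inj₂ r′ = inj₁ (∈-++⁺ʳ pre (∈-++⁺ʳ ins r′))

  rotation-in : {Q : Rule n} {vs : List (Fin n)} {z : Fin n} (z∈ : z ∈ˡ vs) (R : Run Q [] [] vs []) →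
                ∀ {w} → w ∈ˡ Rotation (At.ins (locate z∈ R)) (At.outs (locate z∈ R)) → w ∈ˡ vs
  rotation-in {n} {vs = vs} {z} z∈ R {w} w∈ = subst (w ∈ˡ_) (sym split-vs) (go (∈-++⁻ (map proj₂ outs) w∈))
    where
    open At (locate z∈ R)
    go : w ∈ˡ map proj₂ outs ⊎ w ∈ˡ reverse (map proj₁ ins) → w ∈ˡ before ++ z ∷ after
    go (inj₁ p) with ∈ₚ.∈-map⁻ proj₂ p
    ... | e , e∈ , refl = ∈-++⁺ʳ before (there (targets suffix (∈-++⁺ʳ pre (∈-++⁺ˡ e∈))))
    go (inj₂ p) with ∈ₚ.∈-map⁻ proj₁ (Anyₚ.reverse⁻ {xs = map proj₁ ins} p)
    ... | e , e∈ , refl = ∈-++⁺ˡ ([ (λ ()) , id ]′ (sources prefix (∈-++⁺ʳ pre (∈-++⁺ˡ e∈))))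

  Excluding : Graph n → Subset n → Set
  Excluding G U = ¬ Model K₅⁻ G U × ¬ Model K₃,₃⁻ G U

  others? : (U : Subset n) (x y : Fin n) → Decidable (λ v → v ∈ˢ U × v ≢ x × v ≢ y)
  others? U x y v = v ∈? U ×-dec ¬? (v ≟ᶠ x) ×-dec ¬? (v ≟ᶠ y)

  others : Subset n → Fin n → Fin n → Subset n
  others U x y = sub (others? U x y)

  -- The induction hypothesis concerns the contraction of `G`, to which `s t` is added afterwards;
  -- the vertex is split in the contraction of `G + st`. As `y` is not an end of `s t`, the first
  -- graph contains the second.
  merge-addEdge : (G : Graph n) {x y s t a b : Fin n} (s≢t : s ≢ t) → y ≢ s → y ≢ t →
                  Adj (merge (addEdge G s t s≢t) x y) a b → Adj (addEdge (merge G x y) s t s≢t) a b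
  merge-addEdge G _ ys yt (ne , inj₁ (inj₁ e)) = inj₁ (ne , inj₁ e)
  merge-addEdge G _ ys yt (ne , inj₁ (inj₂ p)) = inj₂ p
  merge-addEdge G _ ys yt (ne , inj₂ (inj₁ (e , inj₁ a))) = inj₁ (ne , inj₂ (inj₁ (e , a)))
  merge-addEdge G _ ys yt (ne , inj₂ (inj₁ (e , inj₂ (inj₁ (p , _))))) = ⊥-elim (ys p)
  merge-addEdge G _ ys yt (ne , inj₂ (inj₁ (e , inj₂ (inj₂ (p , _))))) = ⊥-elim (yt p)
  merge-addEdge G _ ys yt (ne , inj₂ (inj₂ (e , inj₁ a))) = inj₁ (ne , inj₂ (inj₂ (e , a)))
  merge-addEdge G _ ys yt (ne , inj₂ (inj₂ (e , inj₂ (inj₁ (_ , p))))) = ⊥-elim (yt p)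
  merge-addEdge G _ ys yt (ne , inj₂ (inj₂ (e , inj₂ (inj₂ (_ , p))))) = ⊥-elim (ys p)

  re-add : {U : Subset n} {y v : Fin n} → v ∈ˢ U → v ≡ y ⊎ v ∈ˢ U - y
  re-add {y = y} {v} v∈ with v ≟ᶠ y
  ... | yes e = inj₁ e
  ... | no ne = inj₂ (x∈p∧x≢y⇒x∈p-y v∈ ne)

  insert-twin : {H : Graph n} {U : Subset n} {s t x y : Fin n} {vs vs′ α β : List (Fin n)} → x ≢ s → x ≢ t → y ∈ˢ U →
    (∃ λ r → vs ≡ s ∷ r) → Last t vs → Unique vs → (∀ {v} → v ∈ˢ U - y → v ∈ˡ vs) → (∀ {v} → v ∈ˡ vs → v ∈ˢ U - y) →
    vs ≡ α ++ x ∷ β → vs′ ≡ α ++ x ∷ y ∷ β ⊎ vs′ ≡ α ++ y ∷ x ∷ β → Run (Complete H) [] [] vs′ [] → Diagram H U s t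
  insert-twin {n} {H} {U} {s} {t} {x} {y} {vs} {vs′} {α} {β} x≢s x≢t y∈ (r , e₀) l u m⁺ m⁻ refl order R = record
    { vs = vs′ ; first = fst order ; last = lst order ; uniq = unq order (uniq-++⁻ α u) ; mem⁺ = λ v∈ → in⁺ order (re-add v∈)
    ; mem⁻ = λ {v} → out order ; run = R }
    where
    Order : Set
    Order = vs′ ≡ α ++ x ∷ y ∷ β ⊎ vs′ ≡ α ++ y ∷ x ∷ β
    starts : ∀ α τ → α ++ x ∷ β ≡ s ∷ r → ∃ λ r → α ++ τ ≡ s ∷ r
    starts [] τ refl = ⊥-elim (x≢s refl)
    starts (_ ∷ α) τ refl = α ++ τ , refl
    fst : Order → ∃ λ r → vs′ ≡ s ∷ r
    fst (inj₁ refl) = starts α (x ∷ y ∷ β) e₀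
    fst (inj₂ refl) = starts α (y ∷ x ∷ β) e₀
    lst : Order → Last t vs′
    lst (inj₁ refl) = last-++ α (more (more (last-tail x≢t (last-suffix α l))))
    lst (inj₂ refl) = last-++ α (more (more (last-tail x≢t (last-suffix α l))))
    y∉ : y ∉ˡ α ++ x ∷ β
    y∉ p = ∉-minus (m⁻ p) refl
    y∉β : All (y ≢_) β
    y∉β = ∈-all β λ { w∈ refl → y∉ (∈-++⁺ʳ α (there w∈)) }
    x≢y : x ≢ y
    x≢y refl = y∉ (∈-++⁺ʳ α (here refl))
    unq : Order → Unique α × Unique (x ∷ β) × (∀ {w} → w ∈ˡ α → w ∈ˡ x ∷ β → ⊥) → Unique vs′
    unq (inj₁ refl) (uα , p ∷ uβ , dj) = uniq-++⁺ uα ((x≢y ∷ p) ∷ y∉β ∷ uβ)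
      λ { a (here e) → dj a (here e) ; a (there (here refl)) → y∉ (∈-++⁺ˡ a) ; a (there (there b)) → dj a (there b) }
    unq (inj₂ refl) (uα , p ∷ uβ , dj) = uniq-++⁺ uα ((x≢y ∘ sym ∷ y∉β) ∷ p ∷ uβ)
      λ { a (there (here e)) → dj a (here e) ; a (here refl) → y∉ (∈-++⁺ˡ a) ; a (there (there b)) → dj a (there b) }
    in⁺ : ∀ {v} → Order → v ≡ y ⊎ v ∈ˢ U - y → v ∈ˡ vs′
    in⁺ (inj₁ refl) (inj₁ refl) = ∈-++⁺ʳ α (there (here refl))
    in⁺ (inj₂ refl) (inj₁ refl) = ∈-++⁺ʳ α (here refl)
    in⁺ (inj₁ refl) (inj₂ v∈) with ∈-++⁻ α (m⁺ v∈)
    ... | inj₁ p         = ∈-++⁺ˡ p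
    ... | inj₂ (here e)  = ∈-++⁺ʳ α (here e)
    ... | inj₂ (there p) = ∈-++⁺ʳ α (there (there p))
    in⁺ (inj₂ refl) (inj₂ v∈) with ∈-++⁻ α (m⁺ v∈)
    ... | inj₁ p         = ∈-++⁺ˡ p
    ... | inj₂ (here e)  = ∈-++⁺ʳ α (there (here e))
    ... | inj₂ (there p) = ∈-++⁺ʳ α (there (there p))
    back : ∀ {v} → v ∈ˡ α ++ x ∷ β → v ∈ˢ U
    back = ∈─ ∘ m⁻
    out : ∀ {v} → Order → v ∈ˡ vs′ → v ∈ˢ U
    out (inj₁ refl) v∈ with ∈-++⁻ α v∈
    ... | inj₁ p                = back (∈-++⁺ˡ p)
    ... | inj₂ (here e)         = back (∈-++⁺ʳ α (here e))
    ... | inj₂ (there (here refl)) = y∈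
    ... | inj₂ (there (there p)) = back (∈-++⁺ʳ α (there p))
    out (inj₂ refl) v∈ with ∈-++⁻ α v∈
    ... | inj₁ p                = back (∈-++⁺ˡ p)
    ... | inj₂ (here refl)      = y∈
    ... | inj₂ (there (here e)) = back (∈-++⁺ʳ α (here e))
    ... | inj₂ (there (there p)) = back (∈-++⁺ʳ α (there p))

  module Uncontract {G : Graph n} {U : Subset n} {s t : Fin n} (s≢t : s ≢ t) (Fr : Excluding G U)
    {x y : Fin n} (x∈ : x ∈ˢ U) (y∈ : y ∈ˢ U) (xy : Adj (addEdge G s t s≢t) x y)
    (conn₂ : Conn₂ (addEdge G s t s≢t) (others U x y)) where

    private
      H : Graph n
      H = addEdge G s t s≢t
      x≢y : x ≢ y
      x≢y refl = adj-irrefl H refl xy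
      W : Subset n
      W = others U x y
      W⊆ : ∀ {v} → v ∈ˢ W → v ∈ˢ U × v ≢ x × v ≢ y
      W⊆ = sub⁻ (others? U x y)

    module _ {vs : List (Fin n)} (uniq : Unique vs) (mem⁺ : ∀ {v} → v ∈ˢ U - y → v ∈ˡ vs) (mem⁻ : ∀ {v} → v ∈ˡ vs → v ∈ˢ U - y)
      (N : Run (Exact (merge H x y)) [] [] vs []) (x∈vs : x ∈ˡ vs) where

      private
        L : List (Fin n)
        L = Rotation (At.ins (locate x∈vs N)) (At.outs (locate x∈vs N))
        E : Enum (merge H x y) (λ w → w ∈ˡ [] ⊎ w ∈ˡ vs) x L
        E = rotation-at no-cut uniq (λ ()) x∈vs N
        in-W : ∀ {v} → v ∈ˡ L → v ∈ˢ W
        in-W {v} v∈ = sub⁺ (others? U x y) (∈─ v∈U , (λ { refl → proj₁ (Enum.sound E v∈) refl }) , ∉-minus v∈U)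
          where
          v∈U : v ∈ˢ U - y
          v∈U = mem⁻ (rotation-in x∈vs N v∈)
        W⊆vs : ∀ {v} → v ∈ˢ W → v ∈ˡ vs
        W⊆vs v∈ = let (a , _ , b) = W⊆ v∈ in mem⁺ (x∈p∧x≢y⇒x∈p-y a b)
        uncrossed : ∀ {a b c d} → (a ∷ b ∷ c ∷ d ∷ []) ⊆ˡ L → Uncrossed conn₂ a b c d
        uncrossed S P⊆ Q⊆ dj π θ = no-crossing {G = merge H x y} uniq x∈vs N (W⊆vs ∘ P⊆) (W⊆vs ∘ Q⊆)
          (λ p → proj₁ (proj₂ (W⊆ (P⊆ p))) refl) (λ q → proj₁ (proj₂ (W⊆ (Q⊆ q))) refl) dj S (walk-⊑ up π) (walk-⊑ up θ)
          where
          up : H ⊑ merge H x y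
          up a = (λ { refl → adj-irrefl H refl a }) , inj₁ a
        x∉W : x ∉ˢ W
        x∉W p = proj₁ (proj₂ (W⊆ p)) refl
        y∉W : y ∉ˢ W
        y∉W p = proj₂ (proj₂ (W⊆ p)) refl

        no-K₃₃ : ¬ Model (completeBipartite 3 3) H U
        no-K₃₃ M = proj₂ Fr (K₃₃-lose {s≢t = s≢t} M)
        no-K₅ : ¬ Model (complete 5) H U
        no-K₅ M = [ proj₁ Fr , proj₂ Fr ]′ (K₅-lose {s≢t = s≢t} M)

        no-obstruction : ¬ Obstruction (Adj H x) (Adj H y) L
        no-obstruction (abab S xa yb xc yd) with sub-unique S (Enum.uniq E)
        ... | (ab ∷ ac ∷ ad ∷ []) ∷ (bc ∷ _ ∷ []) ∷ (cd ∷ []) ∷ _ = no-K₃₃ (interlaced⇒K₃₃ conn₂ (proj₁ ∘ W⊆) x∈ y∈ x∉W y∉W xy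
            (m (here refl)) (m (there (here refl))) (m (there (there (here refl)))) (m (there (there (there (here refl)))))
            ab ac ad bc cd xa yb xc yd (uncrossed S))
          where
          m : ∀ {v} → _ → v ∈ˢ W
          m = in-W ∘ ⊆ˡ-lookup S
        no-obstruction (baba S ya xb yc xd) with sub-unique S (Enum.uniq E)
        ... | (ab ∷ ac ∷ ad ∷ []) ∷ (bc ∷ _ ∷ []) ∷ (cd ∷ []) ∷ _ = no-K₃₃ (interlaced⇒K₃₃ conn₂ (proj₁ ∘ W⊆) y∈ x∈ y∉W x∉W (adj-sym H xy)
            (m (here refl)) (m (there (here refl))) (m (there (there (here refl)))) (m (there (there (there (here refl)))))
            ab ac ad bc cd ya xb yc xd (uncrossed S))
          where
          m : ∀ {v} → _ → v ∈ˢ W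
          m = in-W ∘ ⊆ˡ-lookup S
        no-obstruction (both S xa ya xb yb xc yc) with sub-unique S (Enum.uniq E)
        ... | (ab ∷ ac ∷ []) ∷ (bc ∷ []) ∷ _ = no-K₅ (common⇒K₅ conn₂ (proj₁ ∘ W⊆) x∈ y∈ x∉W y∉W xy
            (m (here refl)) (m (there (here refl))) (m (there (there (here refl)))) ab ac bc xa ya xb yb xc yc)
          where
          m : ∀ {v} → _ → v ∈ˢ W
          m = in-W ∘ ⊆ˡ-lookup S

      labelling : Labelling (Adj H x) (Adj H y) L
      labelling with labelling-or-obstruction (adj? H x) (adj? H y) L (Enum.uniq E) (side ∘ Enum.sound E)
        where
        side : ∀ {w} → Adj (merge H x y) x w → Adj H x w ⊎ Adj H y w
        side (_ , inj₁ a) = inj₁ a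
        side (_ , inj₂ (inj₁ (_ , a))) = inj₂ a
        side (ne , inj₂ (inj₂ (e , _))) = ⊥-elim (ne (sym e))
      ... | inj₁ Λ = Λ
      ... | inj₂ O = ⊥-elim (no-obstruction O)

    module _ (y≢s : y ≢ s) (y≢t : y ≢ t) where

      uncontract-inner : x ≢ s → x ≢ t → Diagram (addEdge (merge G x y) s t s≢t) (U - y) s t → Diagram H U s t
      uncontract-inner x≢s x≢t D = finish split-run
        where
        open Diagram D
        N : Run (Exact (merge H x y)) [] [] vs []
        N = normalise {G = merge H x y} (Diagram.run (diagram-mono {K′ = merge H x y} (λ {a} {b} _ _ e → merge-addEdge G s≢t y≢s y≢t e) D)) []
        x∈vs : x ∈ˡ vs
        x∈vs = mem⁺ (x∈p∧x≢y⇒x∈p-y x∈ x≢y)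
        open Split {H = H} uniq x∈vs N (labelling uniq mem⁺ mem⁻ N x∈vs) using (split-run)
        finish : (∃ λ vs′ → Run (Complete H) [] [] vs′ [] × _) → Diagram H U s t
        finish (vs′ , R , order) = insert-twin {H = H} x≢s x≢t y∈ first last uniq mem⁺ mem⁻ (At.split-vs (locate x∈vs N)) order R

      uncontract-first : x ≡ s → Diagram (addEdge (merge G x y) s t s≢t) (U - y) s t → Diagram H U s t
      uncontract-first refl D = go (Diagram.vs D) (Diagram.first D) (Diagram.last D) (Diagram.uniq D) (Diagram.mem⁺ D) (Diagram.mem⁻ D)
        (normalise {G = K₀} (Diagram.run (diagram-mono {K′ = deleteEdge (merge H s y) s t} (λ {a} {b} _ _ e → merge-addEdge G s≢t y≢s y≢t (proj₁ e)) D)) [])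
        where
        -- The strand `s t` is taken out and then put back on top, so that the rotation at `s`
        -- begins with `t`, as `SplitFirst` requires.
        K₀ : Graph n
        K₀ = deleteEdge (merge H s y) s t
        go : ∀ vs → (∃ λ r → vs ≡ s ∷ r) → Last t vs → Unique vs → (∀ {v} → v ∈ˢ U - y → v ∈ˡ vs) → (∀ {v} → v ∈ˡ vs → v ∈ˢ U - y) →
             Run (Exact K₀) [] [] vs [] → Diagram H U s t
        go _ (r , refl) l u@(p ∷ u′) m⁺ m⁻ R with first-event R
        ... | outs , o , (u₀ , sound , compl) , S = record
          { vs = s ∷ y ∷ r ; first = y ∷ r , refl ; last = more (more lr) ; uniq = ((y≢s ∘ sym) ∷ p) ∷ ∈-all r (λ { w∈ refl → y∉ (there w∈) }) ∷ u′
          ; mem⁺ = λ v∈ → in⁺ (re-add v∈) ; mem⁻ = out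
          ; run = SplitFirst.split-first {H = H} (y≢s ∘ sym) y≢t u lr (inj₂ (inj₁ (refl , refl))) S′ (λ w∈ ne a → compl (∈-++⁺ˡ w∈) (a , off ne))
              (subst (Labelling (Adj H s) (Adj H y)) (Listₚ.++-identityʳ (t ∷ map proj₂ outs)) (labelling u m⁺ m⁻ N (here refl))) }
          where
          lr : Last t r
          lr = last-tail s≢t l
          y∉ : y ∉ˡ s ∷ r
          y∉ q = ∉-minus (m⁻ q) refl
          s∉ : s ∉ˡ r
          s∉ = ∉-all p
          off : ∀ {w} → w ≢ t → ¬ SamePair s w s t
          off ne (inj₁ (_ , e)) = ne e
          off ne (inj₂ (e , _)) = s≢t e
          conv : ∀ {v us os} → v ∈ˡ r → (∀ {w} → w ∈ˡ us → w ∈ˡ r) → Exact K₀ v (us ++ []) os → Exact (merge H s y) v (us ++ []) os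
          conv {v} {us} v∈ us⊆ (u , f , g) = u , (λ e∈ → let (a , b) = f e∈ in a , proj₁ b) , λ w∈ a →
            g w∈ (a , λ { (inj₁ (refl , _)) → s∉ v∈ ; (inj₂ (_ , refl)) → s∉ (us⊆ (drop-nil us w∈)) })
          S′ : Run (Exact (merge H s y)) [] outs r []
          S′ = run-map {Q = Exact K₀} {Q′ = Exact (merge H s y)} conv S
          at-s : Exact (merge H s y) s (r ++ []) ((s , t) ∷ outs)
          at-s = ∈-all outs (λ { e∈ refl → proj₂ (proj₂ (sound e∈)) (inj₁ (refl , refl)) }) ∷ u₀ ,
            (λ { (here refl) → ∈-++⁺ˡ (last-∈ lr) , s≢t , inj₁ (inj₂ (inj₁ (refl , refl))) ; (there e∈) → let (a , b) = sound e∈ in a , proj₁ b }) ,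
            all-out
            where
            all-out : Complete (merge H s y) s (r ++ []) ((s , t) ∷ outs)
            all-out {w} w∈ a with w ≟ᶠ t
            ... | yes refl = here refl
            ... | no ne    = there (compl w∈ (a , off ne))
          N : Run (Exact (merge H s y)) [] [] (s ∷ r) []
          N = event [] [] ((s , t) ∷ outs) [] refl [] (refl ∷ o) at-s (add-ends ((s , t) ∷ []) [] (refl ∷ []) [] lr S′)
          in⁺ : ∀ {v} → v ≡ y ⊎ v ∈ˢ U - y → v ∈ˡ s ∷ y ∷ r
          in⁺ (inj₁ refl) = there (here refl)
          in⁺ (inj₂ v∈) with m⁺ v∈
          ... | here e  = here e
          ... | there q = there (there q)
          out : ∀ {v} → v ∈ˡ s ∷ y ∷ r → v ∈ˢ U
          out (here e) = ∈─ (m⁻ (here e))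
          out (there (here refl)) = y∈
          out (there (there q)) = ∈─ (m⁻ (there q))

-- The induction on the number of vertices

module Induction where
  open Models
  open Connectivity
  open Runs
  open Diagrams
  open Uncontraction
  import Data.Nat.Properties as ℕₚ

  private variable
    n : ℕ

  excluding-mono : {G : Graph n} {U U′ : Subset n} → (∀ {v} → v ∈ˢ U′ → v ∈ˢ U) → Excluding G U → Excluding G U′
  excluding-mono U′⊆U (f , g) = f ∘ model-mono (λ _ _ a → a) U′⊆U , g ∘ model-mono (λ _ _ a → a) U′⊆U

  Drawable : Graph n → Subset n → Set
  Drawable {n} G U = ∀ {s t : Fin n} → s ∈ˢ U → t ∈ˢ U → (s≢t : s ≢ t) → Diagram (addEdge G s t s≢t) U s t

  diagram-flip : (G : Graph n) {U : Subset n} {s t : Fin n} (s≢t : s ≢ t) → Diagram (addEdge G t s (s≢t ∘ sym)) U t s → Diagram (addEdge G s t s≢t) U s t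
  diagram-flip G s≢t D = diagram-mono
    (λ { _ _ (inj₁ e) → inj₁ e ; _ _ (inj₂ (inj₁ p)) → inj₂ (inj₂ p) ; _ _ (inj₂ (inj₂ p)) → inj₂ (inj₁ p) }) (diagram-reverse D)

  two-vertices : {G : Graph n} {U : Subset n} {s t : Fin n} (s≢t : s ≢ t) → s ∈ˢ U → t ∈ˢ U → (∀ {v} → v ∈ˢ U → v ≡ s ⊎ v ≡ t) → Diagram G U s t
  two-vertices {G = G} {U} {s} {t} s≢t s∈ t∈ only = record
    { vs = s ∷ t ∷ [] ; first = _ , refl ; last = more one ; uniq = (s≢t ∷ []) ∷ [] ∷ []
    ; mem⁺ = λ v∈ → [ here , there ∘ here ]′ (only v∈) ; mem⁻ = λ { (here refl) → s∈ ; (there (here refl)) → t∈ }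
    ; run = event [] [] ((s , t) ∷ []) [] refl [] (refl ∷ []) (λ { (here refl) _ → here refl })
        (event [] ((s , t) ∷ []) [] [] refl (refl ∷ []) [] (λ ()) done) }

  module Step {k : ℕ} (IH : ∀ {n} (G : Graph n) (U : Subset n) → ∣ U ∣ ≤ k → Excluding G U → Drawable G U)
    {n : ℕ} (G : Graph n) (U : Subset n) (le : ∣ U ∣ ≤ suc k) (Ex : Excluding G U) where

    smaller : ∀ {V v} → (∀ {w} → w ∈ˢ V → w ∈ˢ U) → v ∈ˢ U → v ∉ˢ V → ∣ V ∣ ≤ k
    smaller V⊆U v∈ v∉ = ℕₚ.≤-pred (ℕₚ.≤-trans (p⊂q⇒∣p∣<∣q∣ (V⊆U , _ , v∈ , v∉)) le)

    -- Without `s t` the vertex `t` is isolated. The rest is drawn from `s` to a third vertex `w`,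
    -- which provides the second end that the induction hypothesis asks for; then `t` is appended
    -- and `s t` returns on top.
    pendant : ∀ {s t w} → s ∈ˢ U → t ∈ˢ U → (s≢t : s ≢ t) → w ∈ˢ U → w ≢ s → w ≢ t →
              (∀ {v} → v ∈ˢ U → v ≢ s → ¬ Adj G v t) → Diagram (addEdge G s t s≢t) U s t
    pendant {s} {t} {w} s∈ t∈ s≢t w∈ w≢s w≢t iso = top-edge s≢t split
      (append-isolated t∈ s≢t alone (diagram-mono {K′ = deleteEdge G s t} (λ _ _ e → inj₁ (proj₁ e))
        (IH G (U - t) (smaller {V = U - t} ∈─ t∈ (λ p → ∉-minus p refl)) (excluding-mono ∈─ Ex)
          (x∈p∧x≢y⇒x∈p-y s∈ s≢t) (x∈p∧x≢y⇒x∈p-y w∈ w≢t) (w≢s ∘ sym))))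
      where
      split : ∀ {a b} → a ∈ˢ U → b ∈ˢ U → Adj (addEdge G s t s≢t) a b → Adj (deleteEdge G s t) a b ⊎ SamePair a b s t
      split {a} {b} _ _ (inj₂ p) = inj₂ p
      split {a} {b} _ _ (inj₁ e) with samePair? a b s t
      ... | yes p = inj₂ p
      ... | no ¬p = inj₁ (e , ¬p)
      alone : ∀ {v} → v ∈ˢ U → ¬ Adj (deleteEdge G s t) v t
      alone {v} v∈ (e , ¬p) with v ≟ᶠ s
      ... | yes refl = ¬p (inj₁ (refl , refl))
      ... | no ne    = iso v∈ ne e

    module _ {s t : Fin n} (s∈ : s ∈ˢ U) (t∈ : t ∈ˢ U) (s≢t : s ≢ t) where

      private
        H : Graph n
        H = addEdge G s t s≢t

      -- The set `C`, attached only at `p` and `q`, is drawn from `p` to `q` and replaces a strand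
      -- `p q` in a sweep of the rest. The vertices `i` and `o` make the two parts smaller than `U`.
      module Cutting {C : Subset n} {p q : Fin n} (p≢q : p ≢ q) (p∈ : p ∈ˢ U) (q∈ : q ∈ˢ U) (p∉ : p ∉ˢ C) (q∉ : q ∉ˢ C)
        (C⊆U : ∀ {v} → v ∈ˢ C → v ∈ˢ U) {i : Fin n} (i∈ : i ∈ˢ C) (s∉ : s ∉ˢ C) (t∉ : t ∉ˢ C)
        {o : Fin n} (o∈ : o ∈ˢ U) (o∉ : o ∉ˢ C) (o≢p : o ≢ p) (o≢q : o ≢ q)
        (closed : ∀ {a b} → a ∈ˢ C → b ∈ˢ U → Adj H a b → b ∈ˢ C ⊎ b ≡ p ⊎ b ≡ q) where

        private
          U₁ U₂ : Subset n
          U₁ = U ─ C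
          U₂? : Decidable (λ v → v ∈ˢ C ⊎ v ≡ p ⊎ v ≡ q)
          U₂? v = v ∈? C ⊎-dec v ≟ᶠ p ⊎-dec v ≟ᶠ q
          U₂ = sub U₂?
          U₂⊆U : ∀ {v} → v ∈ˢ U₂ → v ∈ˢ U
          U₂⊆U v∈ = [ C⊆U , [ (λ { refl → p∈ }) , (λ { refl → q∈ }) ]′ ]′ (sub⁻ U₂? v∈)
          in₁ : ∀ {v} → v ∈ˢ U → v ∉ˢ C → v ∈ˢ U₁
          in₁ = x∈p∧x∉q⇒x∈p─q
          in₂ : ∀ {v} → v ∈ˢ C ⊎ v ≡ p ⊎ v ≡ q → v ∈ˢ U₂
          in₂ = sub⁺ U₂?
          small₁ : ∣ U₁ ∣ ≤ k
          small₁ = smaller {V = U ─ C} ∈─ (C⊆U i∈) (λ r → ∉─ r i∈)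
          draw₂ : Drawable G U₂
          draw₂ = IH G U₂ (smaller U₂⊆U o∈ (λ r → [ o∉ , [ o≢p , o≢q ]′ ]′ (sub⁻ U₂? r))) (excluding-mono U₂⊆U Ex)
          ends : ∀ {v} → v ∉ˢ C → v ∈ˢ U₂ → v ≡ p ⊎ v ≡ q
          ends v∉ v∈ = [ ⊥-elim ∘ v∉ , id ]′ (sub⁻ U₂? v∈)
          both : ∀ {a b} → a ≢ b → a ≡ p ⊎ a ≡ q → b ≡ p ⊎ b ≡ q → SamePair a b p q × SamePair a b q p
          both a≢b (inj₁ refl) (inj₁ refl) = ⊥-elim (a≢b refl)
          both a≢b (inj₁ refl) (inj₂ refl) = inj₁ (refl , refl) , inj₂ (refl , refl)
          both a≢b (inj₂ refl) (inj₁ refl) = inj₂ (refl , refl) , inj₁ (refl , refl)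
          both a≢b (inj₂ refl) (inj₂ refl) = ⊥-elim (a≢b refl)
          adj₂ : ∀ {a b} → a ∈ˢ U₂ → b ∈ˢ U₂ → Adj H a b → Adj (addEdge G p q p≢q) a b × Adj (addEdge G q p (p≢q ∘ sym)) a b
          adj₂ a∈ b∈ (inj₁ e) = inj₁ e , inj₁ e
          -- `s` and `t` lie outside `C`, so both can belong to `U₂` only as `p` and `q`; then `s t`
          -- is the added edge `p q`.
          adj₂ a∈ b∈ (inj₂ (inj₁ (refl , refl))) = let (x , y) = both s≢t (ends s∉ a∈) (ends t∉ b∈) in inj₂ x , inj₂ y
          adj₂ a∈ b∈ (inj₂ (inj₂ (refl , refl))) = let (x , y) = both (s≢t ∘ sym) (ends t∉ a∈) (ends s∉ b∈) in inj₂ x , inj₂ y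

          assemble : ∀ {K₁} → Adj K₁ p q → (∀ {a b} → Adj H a b → Adj K₁ a b) → Diagram K₁ U₁ s t → Diagram H U s t
          assemble pq up D₁ = substitute p≢q D₁ (draw₂ (in₂ (inj₂ (inj₁ refl))) (in₂ (inj₂ (inj₂ refl))) p≢q)
            (draw₂ (in₂ (inj₂ (inj₂ refl))) (in₂ (inj₂ (inj₁ refl))) (p≢q ∘ sym))
            (in₁ p∈ p∉) (in₁ q∈ q∉) pq (in₂ ∘ inj₁) (sub⁻ U₂?) (λ c u → ∉─ u c) (λ _ _ → up) adj₂
            (λ a∈ b∈ e → [ ⊥-elim ∘ ∉─ b∈ , id ]′ (closed a∈ (∈─ b∈) e))
            cover ∈─ C⊆U
            where
            cover : ∀ {v} → v ∈ˢ U → v ∈ˢ U₁ ⊎ v ∈ˢ C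
            cover {v} v∈ with v ∈? C
            ... | yes c = inj₂ c
            ... | no ¬c = inj₁ (in₁ v∈ ¬c)

        adjacent : Adj H p q → Diagram H U s t
        adjacent pq = assemble pq id (IH G U₁ small₁ (excluding-mono ∈─ Ex) (in₁ s∈ s∉) (in₁ t∈ t∉) s≢t)

        -- Contracting `Z` onto `p` turns its edge to `q` into an edge `p q`. So the rest together
        -- with `p q` is a minor of `G` and inherits the exclusion.
        linked : {Z : Subset n} → p ∈ˢ Z → (∀ {v} → v ∈ˢ Z → v ∈ˢ C ⊎ v ≡ p) → (∀ {z} → z ∈ˢ Z → Walk G (_∈ˢ Z) p z) →
                 ∀ {z} → z ∈ˢ Z → Adj G z q → Diagram H U s t
        linked {Z} p∈Z Z⊆ Z-conn {z} z∈ zq = assemble {K₁ = addEdge (addEdge G p q p≢q) s t s≢t} (inj₁ (inj₂ (inj₁ (refl , refl))))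
          [ inj₁ ∘ inj₁ , inj₂ ]′
          (IH (addEdge G p q p≢q) U₁ small₁ (proj₁ Ex ∘ absorb , proj₂ Ex ∘ absorb) (in₁ s∈ s∉) (in₁ t∈ t∉) s≢t)
          where
          absorb : ∀ {m} {K : Graph m} → Model K (addEdge G p q p≢q) U₁ → Model K G U
          absorb = model-absorb ∈─ (λ v∈ → [ C⊆U , (λ { refl → p∈ }) ]′ (Z⊆ v∈)) p∈Z
            (λ a b → [ ⊥-elim ∘ ∉─ b , id ]′ (Z⊆ a)) Z-conn
            λ { (inj₁ e) → inj₁ e ; (inj₂ (inj₁ (refl , refl))) → inj₂ (inj₁ (refl , z , z∈ , zq))
              ; (inj₂ (inj₂ (refl , refl))) → inj₂ (inj₂ (refl , z , z∈ , adj-sym G zq)) }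

      module Separated {s′ t′ : Fin n} (s′∈ : s′ ∈ˢ U) (s′≢t : s′ ≢ t) (ss′ : Adj G s s′)
                       (t′∈ : t′ ∈ˢ U) (t′≢s : t′ ≢ s) (tt′ : Adj G t t′) where

        record Detached (C : Subset n) : Set where
          field
            C⊆U   : ∀ {v} → v ∈ˢ C → v ∈ˢ U
            inner : ∃ λ i → i ∈ˢ C
            s∉    : s ∉ˢ C
            t∉    : t ∉ˢ C

        -- If C is attached to the rest only at p, then s or t would be cut off
        -- unless U has a further vertex.
        attached-at : ∀ {C p q} → Detached C → p ∈ˢ U → p ∉ˢ C → q ∈ˢ U → q ∉ˢ C → Adj H p q →
                      (∀ {a b} → a ∈ˢ C → b ∈ˢ U → Adj H a b → b ∈ˢ C ⊎ b ≡ p) → Diagram H U s t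
        attached-at {C} {p} {q} D p∈ p∉ q∈ q∉ pq closed with any? (λ o → o ∈? U ×-dec ¬? (o ∈? C) ×-dec ¬? (o ≟ᶠ p) ×-dec ¬? (o ≟ᶠ q))
          where open Detached D
        ... | yes (o , o∈ , o∉ , o≢p , o≢q) = Cutting.adjacent (λ { refl → adj-irrefl H refl pq }) p∈ q∈ p∉ q∉ C⊆U (proj₂ inner) s∉ t∉ o∈ o∉ o≢p o≢q
              (λ a∈ b∈ e → [ inj₁ , inj₂ ∘ inj₁ ]′ (closed a∈ b∈ e)) pq
          where open Detached D
        ... | no none = ⊥-elim (clash (rest s∈ s∉) (rest t∈ t∉))
          where
          open Detached D
          rest : ∀ {v} → v ∈ˢ U → v ∉ˢ C → v ≡ p ⊎ v ≡ q
          rest {v} v∈ v∉ with v ≟ᶠ p | v ≟ᶠ q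
          ... | yes e | _ = inj₁ e
          ... | no _ | yes e = inj₂ e
          ... | no a | no b = ⊥-elim (none (v , v∈ , v∉ , a , b))
          beyond : ∀ {v} → v ∈ˢ U → v ≢ p → v ≢ q → v ∈ˢ C
          beyond {v} v∈ a b with v ∈? C
          ... | yes c = c
          ... | no ¬c = ⊥-elim ([ a , b ]′ (rest v∈ ¬c))
          clash : s ≡ p ⊎ s ≡ q → t ≡ p ⊎ t ≡ q → ⊥
          clash (inj₁ refl) (inj₁ e) = s≢t (sym e)
          clash (inj₂ refl) (inj₂ e) = s≢t (sym e)
          clash (inj₁ refl) (inj₂ refl) = [ t∉ , s≢t ∘ sym ]′ (closed (beyond t′∈ t′≢s λ { refl → adj-irrefl G refl tt′ }) t∈ (inj₁ (adj-sym G tt′)))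
          clash (inj₂ refl) (inj₁ refl) = [ s∉ , s≢t ]′ (closed (beyond s′∈ s′≢t λ { refl → adj-irrefl G refl ss′ }) s∈ (inj₁ (adj-sym G ss′)))

        zero-cut : ∀ {C} → Detached C → (∀ {a b} → a ∈ˢ C → b ∈ˢ U → Adj H a b → b ∈ˢ C) → Diagram H U s t
        -- With no attachment at all, `C` may be inserted anywhere; the strand `s t` is always
        -- available.
        zero-cut D closed = attached-at D s∈ (Detached.s∉ D) t∈ (Detached.t∉ D) (inj₂ (inj₁ (refl , refl))) (λ a∈ b∈ e → inj₁ (closed a∈ b∈ e))

        -- An edge from `r` to a vertex outside `C` provides the strand to be replaced. If there is
        -- none, then `r` is neither `s` nor `t`, and `C` together with `r` is detached completely.
        one-cut : ∀ {C r} → Detached C → r ∉ˢ C → (∀ {a b} → a ∈ˢ C → b ∈ˢ U → Adj H a b → b ∈ˢ C ⊎ b ≡ r) → Diagram H U s t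
        one-cut {C} {r} D r∉ closed with r ∈? U
        ... | no r∉U = zero-cut D λ a∈ b∈ e → [ id , (λ { refl → ⊥-elim (r∉U b∈) }) ]′ (closed a∈ b∈ e)
        ... | yes r∈ with any? (λ q → q ∈? U ×-dec ¬? (q ∈? C) ×-dec adj? H r q)
        ... | yes (q , q∈ , q∉ , rq) = attached-at D r∈ r∉ q∈ q∉ rq closed
        ... | no none = zero-cut D′ closed′
          where
          open Detached D
          C′ : Subset n
          C′ = C ∪ ⁅ r ⁆
          cases : ∀ {v} → v ∈ˢ C′ → v ∈ˢ C ⊎ v ≡ r
          cases v∈ = [ inj₁ , inj₂ ∘ x∈⁅y⁆⇒x≡y r ]′ (x∈p∪q⁻ C ⁅ r ⁆ v∈)
          D′ : Detached C′
          D′ = record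
            { C⊆U = λ v∈ → [ C⊆U , (λ { refl → r∈ }) ]′ (cases v∈) ; inner = let (i , i∈) = inner in i , x∈p∪q⁺ (inj₁ i∈)
            ; s∉ = λ v∈ → [ s∉ , (λ { refl → none (t , t∈ , t∉ , inj₂ (inj₁ (refl , refl))) }) ]′ (cases v∈)
            ; t∉ = λ v∈ → [ t∉ , (λ { refl → none (s , s∈ , s∉ , inj₂ (inj₂ (refl , refl))) }) ]′ (cases v∈) }
          closed′ : ∀ {a b} → a ∈ˢ C′ → b ∈ˢ U → Adj H a b → b ∈ˢ C′
          closed′ {a} {b} a∈ b∈ e with cases a∈
          ... | inj₁ a∈C = [ x∈p∪q⁺ ∘ inj₁ , (λ { refl → x∈p∪q⁺ (inj₂ (x∈⁅x⁆ r)) }) ]′ (closed a∈C b∈ e)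
          ... | inj₂ refl with b ∈? C
          ... | yes b∈C = x∈p∪q⁺ (inj₁ b∈C)
          ... | no b∉C  = ⊥-elim (none (b , b∈ , b∉C , e))

        -- Either `p` reaches a neighbour of `q` within `C` and `p`, or the part of `C` that `p`
        -- reaches is attached at `p` alone. If that part is empty, all of `C` is attached at `q`
        -- alone.
        two-cut : ∀ {C p q} → Detached C → p ∉ˢ C → q ∉ˢ C → (∃ λ o → o ∈ˢ U × o ∉ˢ C × o ≢ p × o ≢ q) →
                  (∀ {a b} → a ∈ˢ C → b ∈ˢ U → Adj H a b → b ∈ˢ C ⊎ b ≡ p ⊎ b ≡ q) → Diagram H U s t
        two-cut {C} {p} {q} D p∉ q∉ (o , o∈ , o∉ , o≢p , o≢q) closed with p ∈? U | q ∈? U | p ≟ᶠ q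
        ... | no p∉U | _ | _ = one-cut D q∉ λ a∈ b∈ e → [ inj₁ , [ (λ { refl → ⊥-elim (p∉U b∈) }) , inj₂ ]′ ]′ (closed a∈ b∈ e)
        ... | _ | no q∉U | _ = one-cut D p∉ λ a∈ b∈ e → [ inj₁ , [ inj₂ , (λ { refl → ⊥-elim (q∉U b∈) }) ]′ ]′ (closed a∈ b∈ e)
        ... | _ | _ | yes refl = one-cut D p∉ λ a∈ b∈ e → [ inj₁ , inj₂ ∘ [ id , id ]′ ]′ (closed a∈ b∈ e)
        ... | yes p∈ | yes q∈ | no p≢q with any? (λ z → z ∈? Z ×-dec adj? G z q)
          where open Component (component G (C ∪ ⁅ p ⁆) (x∈p∪q⁺ (inj₂ (x∈⁅x⁆ p))))
        ... | yes (z , z∈ , zq) = Cutting.linked p≢q p∈ q∈ p∉ q∉ C⊆U (proj₂ inner) s∉ t∉ o∈ o∉ o≢p o≢q closed root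
                (λ v∈ → [ inj₁ , inj₂ ∘ x∈⁅y⁆⇒x≡y p ]′ (x∈p∪q⁻ C ⁅ p ⁆ (within v∈))) conn z∈ zq
          where
          open Detached D
          open Component (component G (C ∪ ⁅ p ⁆) (x∈p∪q⁺ (inj₂ (x∈⁅x⁆ p)))) using (root; within; conn)
        ... | no unlinked = go (any? (λ z → z ∈? C ×-dec z ∈? Z))
          where
          open Detached D
          open Component (component G (C ∪ ⁅ p ⁆) (x∈p∪q⁺ (inj₂ (x∈⁅x⁆ p)))) using (Z; root) renaming (closed to Z-closed)
          in-G : ∀ {a b} → a ∈ˢ C → Adj H a b → Adj G a b
          in-G a∈ (inj₁ e) = e
          in-G a∈ (inj₂ (inj₁ (refl , _))) = ⊥-elim (s∉ a∈)
          in-G a∈ (inj₂ (inj₂ (refl , _))) = ⊥-elim (t∉ a∈)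
          both? : Decidable (λ v → v ∈ˢ C × v ∈ˢ Z)
          both? v = v ∈? C ×-dec v ∈? Z
          go : Dec (∃ λ z → z ∈ˢ C × z ∈ˢ Z) → Diagram H U s t
          go (yes (z , z∈C , z∈Z)) = one-cut D′ (p∉ ∘ proj₁ ∘ sub⁻ both?) closed′
            where
            D′ : Detached (sub both?)
            D′ = record { C⊆U = C⊆U ∘ proj₁ ∘ sub⁻ both? ; inner = z , sub⁺ both? (z∈C , z∈Z) ; s∉ = s∉ ∘ proj₁ ∘ sub⁻ both? ; t∉ = t∉ ∘ proj₁ ∘ sub⁻ both? }
            closed′ : ∀ {a b} → a ∈ˢ sub both? → b ∈ˢ U → Adj H a b → b ∈ˢ sub both? ⊎ b ≡ p
            closed′ a∈ b∈ e with sub⁻ both? a∈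
            ... | a∈C , a∈Z with closed a∈C b∈ e
            ... | inj₁ b∈C = inj₁ (sub⁺ both? (b∈C , Z-closed a∈Z (x∈p∪q⁺ (inj₁ b∈C)) (in-G a∈C e)))
            ... | inj₂ (inj₁ b≡p) = inj₂ b≡p
            ... | inj₂ (inj₂ refl) = ⊥-elim (unlinked (_ , a∈Z , in-G a∈C e))
          go (no ¬z) = one-cut D q∉ closed′
            where
            closed′ : ∀ {a b} → a ∈ˢ C → b ∈ˢ U → Adj H a b → b ∈ˢ C ⊎ b ≡ q
            closed′ a∈ b∈ e with closed a∈ b∈ e
            ... | inj₁ b∈C = inj₁ b∈C
            ... | inj₂ (inj₂ b≡q) = inj₂ b≡q
            ... | inj₂ (inj₁ refl) = ⊥-elim (¬z (_ , a∈ , Z-closed root (x∈p∪q⁺ (inj₁ a∈)) (adj-sym G (in-G a∈ e))))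

        separated : ∀ {p q C} → Sep H U (duo p q) C → Diagram H U s t
        separated {p} {q} S₀ with avoiding S₀ s∈ t∈ (inj₂ (inj₁ (refl , refl)))
        ... | C , S , s∉ , t∉ = two-cut (record { C⊆U = λ v∈ → proj₁ (S.C⊆ _ v∈) ; inner = S.inner ; s∉ = s∉ ; t∉ = t∉ })
            (λ v∈ → proj₂ (S.C⊆ _ v∈) (sub⁺ (duo? p q) (inj₁ refl))) (λ v∈ → proj₂ (S.C⊆ _ v∈) (sub⁺ (duo? p q) (inj₂ refl)))
            (let (o , o∈ , o∉ , o∉K) = S.outer in o , o∈ , o∉ , (λ e → o∉K (sub⁺ (duo? p q) (inj₁ e))) , λ e → o∉K (sub⁺ (duo? p q) (inj₂ e)))
            λ a∈ b∈ e → [ inj₁ , inj₂ ∘ sub⁻ (duo? p q) ]′ (S.closed _ _ a∈ b∈ e)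
          where module S = Sep S

      -- An edge other than `s t` belongs to `G`, so the contraction of `G` inherits the exclusion.
      -- If the remaining vertex `x` is `t`, the sweep is mirrored to make it the first one.
      uncontract : ∀ {x y} → x ∈ˢ U → y ∈ˢ U → Adj H x y → ¬ SamePair x y s t → Conn₂ H (others U x y) → y ≢ s → y ≢ t → Diagram H U s t
      uncontract {x} {y} x∈ y∈ xy ¬st conn₂ y≢s y≢t = go (x ≟ᶠ s) (x ≟ᶠ t)
        where
        Gxy : Adj G x y
        Gxy = [ id , ⊥-elim ∘ ¬st ]′ xy
        x≢y : x ≢ y
        x≢y refl = adj-irrefl H refl xy
        draw : Drawable (merge G x y) (U - y)
        draw = IH (merge G x y) (U - y) (smaller {V = U - y} ∈─ y∈ (λ p → ∉-minus p refl)) (proj₁ Ex ∘ model-merge x∈ y∈ Gxy , proj₂ Ex ∘ model-merge x∈ y∈ Gxy)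
        keep : ∀ {v} → v ∈ˢ U → y ≢ v → v ∈ˢ U - y
        keep v∈ ne = x∈p∧x≢y⇒x∈p-y v∈ (ne ∘ sym)
        D : Diagram (addEdge (merge G x y) s t s≢t) (U - y) s t
        D = draw (keep s∈ y≢s) (keep t∈ y≢t) s≢t
        flip : H ⊑ addEdge G t s (s≢t ∘ sym)
        flip (inj₁ e) = inj₁ e
        flip (inj₂ (inj₁ p)) = inj₂ (inj₂ p)
        flip (inj₂ (inj₂ p)) = inj₂ (inj₁ p)
        go : Dec (x ≡ s) → Dec (x ≡ t) → Diagram H U s t
        go (yes e) _ = Uncontract.uncontract-first s≢t Ex x∈ y∈ xy conn₂ y≢s y≢t e D
        go (no x≢s) (no x≢t) = Uncontract.uncontract-inner s≢t Ex x∈ y∈ xy conn₂ y≢s y≢t x≢s x≢t D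
        go (no _) (yes e) = diagram-flip G s≢t (Uncontract.uncontract-first (s≢t ∘ sym) Ex x∈ y∈ (flip xy)
          (λ c u∈ v∈ u≢c v≢c → walk-⊑ flip (conn₂ c u∈ v∈ u≢c v≢c)) y≢t y≢s e (draw (keep t∈ y≢t) (keep s∈ y≢s) (s≢t ∘ sym)))

      three-connected : (∀ p q → ¬ ∃ (Sep H U (duo p q))) → ∀ {w} → w ∈ˢ U → w ≢ s → w ≢ t → Diagram H U s t
      three-connected conn₃ w∈ w≢s w≢t with ContractibleEdge.contractible-edge {G = H} conn₃ s∈ t∈ (inj₂ (inj₁ (refl , refl))) w∈ w≢s w≢t
      ... | x , y , x∈ , y∈ , xy , ¬st , con = go (y ≟ᶠ s) (y ≟ᶠ t)
        where
        off : ∀ {c v} → v ∈ˢ U → v ≢ x → v ≢ y → v ≢ c → v ∉ˢ trio x y c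
        off {c} v∈ a b d v∈K = [ a , [ b , d ]′ ]′ (sub⁻ (trio? x y c) v∈K)
        walk : ∀ c {u v} → u ∈ˢ U × u ≢ x × u ≢ y → v ∈ˢ U × v ≢ x × v ≢ y → u ≢ c → v ≢ c → Walk H (λ w → w ∈ˢ U × w ∉ˢ trio x y c) u v
        walk c (u∈ , ux , uy) (v∈ , vx , vy) uc vc = connected (con c) u∈ v∈ (off u∈ ux uy uc) (off v∈ vx vy vc)
        avoid : ∀ {c w} → w ∉ˢ trio x y c → w ≢ x × w ≢ y × w ≢ c
        avoid {c} w∉ = (λ e → w∉ (sub⁺ (trio? x y c) (inj₁ e))) , (λ e → w∉ (sub⁺ (trio? x y c) (inj₂ (inj₁ e)))) , λ e → w∉ (sub⁺ (trio? x y c) (inj₂ (inj₂ e)))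
        xy-conn : Conn₂ H (others U x y)
        xy-conn c u∈ v∈ uc vc = walk-map (λ (w∈ , w∉) → let (a , b , d) = avoid {c} w∉ in sub⁺ (others? U x y) (w∈ , a , b) , d)
          (walk c (sub⁻ (others? U x y) u∈) (sub⁻ (others? U x y) v∈) uc vc)
        swap× : ∀ {v} → v ∈ˢ U × v ≢ y × v ≢ x → v ∈ˢ U × v ≢ x × v ≢ y
        swap× (a , b , c) = a , c , b
        yx-conn : Conn₂ H (others U y x)
        yx-conn c u∈ v∈ uc vc = walk-map (λ (w∈ , w∉) → let (a , b , d) = avoid {c} w∉ in sub⁺ (others? U y x) (w∈ , b , a) , d)
          (walk c (swap× (sub⁻ (others? U y x) u∈)) (swap× (sub⁻ (others? U y x) v∈)) uc vc)
        x≢y : x ≢ y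
        x≢y refl = adj-irrefl H refl xy
        swapped : x ≢ s → x ≢ t → Diagram H U s t
        swapped = uncontract y∈ x∈ (adj-sym H xy) (¬st ∘ samePair-swap) yx-conn
        -- As the edge is not `s t`, one of its ends is neither `s` nor `t`; this end is the one to
        -- disappear.
        go : Dec (y ≡ s) → Dec (y ≡ t) → Diagram H U s t
        go (no y≢s) (no y≢t) = uncontract x∈ y∈ xy ¬st xy-conn y≢s y≢t
        go (yes refl) _ = swapped x≢y λ e → ¬st (inj₂ (e , refl))
        go (no _) (yes refl) = swapped (λ e → ¬st (inj₁ (e , refl))) x≢y

    drawable : Drawable G U
    drawable {s} {t} s∈ t∈ s≢t with any? (λ w → w ∈? U ×-dec ¬? (w ≟ᶠ s) ×-dec ¬? (w ≟ᶠ t))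
    ... | no none = two-vertices s≢t s∈ t∈ only
      where
      only : ∀ {v} → v ∈ˢ U → v ≡ s ⊎ v ≡ t
      only {v} v∈ with v ≟ᶠ s | v ≟ᶠ t
      ... | yes e | _ = inj₁ e
      ... | no _ | yes e = inj₂ e
      ... | no a | no b = ⊥-elim (none (v , v∈ , a , b))
    ... | yes (w , w∈ , w≢s , w≢t) with any? (λ v → v ∈? U ×-dec ¬? (v ≟ᶠ t) ×-dec adj? G s v) | any? (λ v → v ∈? U ×-dec ¬? (v ≟ᶠ s) ×-dec adj? G t v)
    ... | _ | no iso = pendant s∈ t∈ s≢t w∈ w≢s w≢t (λ v∈ ne e → iso (_ , v∈ , ne , adj-sym G e))
    ... | no iso | _ = diagram-flip G s≢t (pendant t∈ s∈ (s≢t ∘ sym) w∈ w≢t w≢s (λ v∈ ne e → iso (_ , v∈ , ne , adj-sym G e)))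
    -- Past the pendant cases both `s` and `t` have a further neighbour, which is what `attached-at`
    -- needs to rule out a cut with nothing else on the other side.
    ... | yes (s′ , s′∈ , s′≢t , ss′) | yes (t′ , t′∈ , t′≢s , tt′)
        with any? (λ p → any? λ q → sep? (addEdge G s t s≢t) U (duo p q))
    ... | yes (p , q , C , S) = Separated.separated s∈ t∈ s≢t s′∈ s′≢t ss′ t′∈ t′≢s tt′ S
    ... | no ¬S = three-connected s∈ t∈ s≢t (λ p q S → ¬S (p , q , S)) w∈ w≢s w≢t

  excluding⇒drawable : ∀ k {n} (G : Graph n) (U : Subset n) → ∣ U ∣ ≤ k → Excluding G U → Drawable G U
  excluding⇒drawable zero    G U le _ s∈ _ _ = ⊥-elim (ℕₚ.<⇒≱ (∣∣>0 s∈) le)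
  excluding⇒drawable (suc k) G U le Ex = Step.drawable (excluding⇒drawable k) G U le Ex

-- The equivalence

open Minors
open Necessity
open Runs
open Realisation
open Diagrams
open Induction
import Data.Nat.Properties as ℕₚ
open import Function.Construct.Identity using (↔-id; ⇔-id)

≅-refl : ∀ {n} {G : Graph n} → G ≅ G
≅-refl = record { vertices = ↔-id _ ; adjacency = λ _ _ → ⇔-id _ }

diagram⇒planar : ∀ {n} {G : Graph n} {s t : Fin n} → Diagram G ⊤ s t → Planar G
diagram⇒planar D = Realise.planar uniq (λ _ → mem⁺ ∈⊤) run
  where open Diagram D

-- A diagram needs two ends, so graphs with fewer vertices are drawn directly; otherwise any two
-- vertices serve, and the edge added between them is dropped again.
drawable⇒planar : ∀ {n} (G : Graph n) → Drawable G ⊤ → Planar G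
drawable⇒planar {zero} G d = Realise.planar {vs = []} [] (λ ()) done
drawable⇒planar {suc zero} G d = Realise.planar {vs = 0F ∷ []} ([] ∷ []) (λ { 0F → here refl }) (event [] [] [] [] refl [] [] (λ ()) done)
drawable⇒planar {suc (suc n)} G d = diagram⇒planar (diagram-mono (λ _ _ → inj₁) (d {0F} {1F} ∈⊤ ∈⊤ λ ()))

excluded⇒free : ∀ {n} (G : Graph n) → N∘ ｛ K₅⁻ , K₃,₃⁻ ｝ G → Free Planar G
excluded⇒free {n} G N = drawable⇒planar G draw , λ u v u≢v _ → diagram⇒planar (draw ∈⊤ ∈⊤ u≢v)
  where
  draw : Drawable G ⊤
  draw = excluding⇒drawable n G ⊤ (ℕₚ.≤-reflexive (∣⊤∣≡n n)) (N K₅⁻ (inj₁ ≅-refl) ∘ model⇒≺ , N K₃,₃⁻ (inj₂ ≅-refl) ∘ model⇒≺)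

theorem1 : ∀ {n : ℕ} (G : Graph n) → Free Planar G ⇔ N∘ ｛ K₅⁻ , K₃,₃⁻ ｝ G
theorem1 G = mk⇔ (free⇒excluded G) (excluded⇒free G)
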